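{- For each integer $k\ge 2$, the decision version of Fair $k$-Division Under Conflicts is strongly NP-complete when restricted to conflict graphs that are line graphs of bipartite graphs.
   Context: The line graph of a graph $H$ has a vertex for each edge of $H$, two such vertices being adjacent iff the corresponding edges share an endpoint. A partial $k$-coloring of a graph $G=(V,E)$ is a sequence $(X_1,\dots,X_k)$ of $k$ pairwise disjoint independent sets of $G$. Given profit functions $p_1,\dots,p_k:V\to\mathbb{Z}_+$, write $p_j(X)=\sum_{v\in X}p_j(v)$; the satisfaction level of $(X_1,\dots,X_k)$ is $\min_j p_j(X_j)$. The decision version of Fair $k$-Division Under Conflicts: given $G$, $p_1,\dots,p_k$ and $q\in\mathbb{Z}_+$, decide whether $G$ has a partial $k$-coloring with satisfaction level at least $q$. Strong NP-completeness means NP-completeness even when all numbers in the input are bounded by a polynomial in the input size. -}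

module Defs where

open import Data.Bool.Base using (Bool; true; false; T; if_then_else_)
open import Data.Bool.Properties using (T-irrelevant)
open import Data.Fin.Base using (Fin; _<_)
open import Data.Fin.Properties using (_≟_; any?; <-irrelevant)
open import Data.Fin.Subset using (Subset; _∈_; _∩_; Empty)
open import Data.List.Base as List using (List; []; _∷_; [_]; _++_; length; concatMap; allFin; replicate)
open import Data.List.Relation.Unary.All using (All)
open import Data.Maybe.Base using (Maybe; just; nothing)
open import Data.Nat.Base using (ℕ; zero; suc; _+_; _*_; _≤_; _⊓_; NonZero)
open import Data.Nat.Binary.Base using (ℕᵇ; zero; 2[1+_]; 1+[2_]; fromℕ)
open import Data.Product.Base using (Σ; _×_; _,_; proj₁; ∃-syntax)
open import Data.Product.Properties using (≡-dec)
open import Data.Sum.Base using (_⊎_; inj₁; inj₂)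
open import Data.Vec.Base as Vec using (Vec; []; _∷_; tabulate; lookup)
open import Function.Base using (_∘_)
open import Function.Bundles using (_⇔_; _↔_; module Inverse)
open import Level using (0ℓ)
open import Relation.Binary.Core using (Rel)
open import Relation.Binary.Definitions using (Symmetric; Irreflexive; Decidable; DecidableEquality)
open import Relation.Binary.PropositionalEquality using (_≡_; _≢_; sym)
open import Relation.Nullary.Decidable using (yes; ⌊_⌋; toWitness; fromWitness; ¬?; _×-dec_; _⊎-dec_)
open import Relation.Nullary.Negation using (¬_)
open import Relation.Unary using (Pred)

-- Coefficients in increasing order of degree.
Polynomial : Set
Polynomial = List ℕ

eval : Polynomial → ℕ → ℕ
eval []      x = 0
eval (a ∷ p) x = a + x * eval p x

data Move : Set where
  left stay right : Move

record TM : Set where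
  field
    #states #extraTapes #extraSymbols : ℕ

  State : Set
  State = Fin #states

  #tapes : ℕ
  #tapes = suc #extraTapes

  -- `nothing` is the blank; `inj₁` embeds the input/output alphabet.
  Symbol : Set
  Symbol = Maybe (Bool ⊎ Fin #extraSymbols)

  field
    start : State
    -- The machine halts when δ returns `nothing`.
    δ     : State → Vec Symbol #tapes → Maybe (State × Vec (Symbol × Move) #tapes)

-- A two-way infinite tape, blank outside the stored part.
-- `before` lists the cells to the left of the head, nearest first.
record Tape (S : Set) : Set where
  constructor tape
  field
    before : List (Maybe S)
    head   : Maybe S
    after  : List (Maybe S)

open Tape public

module _ {S : Set} where

  move : Move → Tape S → Tape S
  move stay  t                   = t
  move left  (tape []       h rs) = tape [] nothing (h ∷ rs)
  move left  (tape (l ∷ ls) h rs) = tape ls l (h ∷ rs)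
  move right (tape ls h [])       = tape (h ∷ ls) nothing []
  move right (tape ls h (r ∷ rs)) = tape (h ∷ ls) r rs

  writeMove : Maybe S × Move → Tape S → Tape S
  writeMove (s , m) (tape ls _ rs) = move m (tape ls s rs)

  blankTape : Tape S
  blankTape = tape [] nothing []

Word : Set
Word = List Bool

module _ {n : ℕ} where

  writeWord : Word → Tape (Bool ⊎ Fin n)
  writeWord []      = blankTape
  writeWord (b ∷ w) = tape [] (just (inj₁ b)) (List.map (just ∘ inj₁) w)

  leadingBits : List (Maybe (Bool ⊎ Fin n)) → Word
  leadingBits (just (inj₁ b) ∷ ss) = b ∷ leadingBits ss
  leadingBits _                    = []

  -- The maximal word over {0,1} starting at the head.
  readWord : Tape (Bool ⊎ Fin n) → Word
  readWord t = leadingBits (head t ∷ after t)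

module Run (M : TM) where
  open TM M

  record Config : Set where
    constructor config
    field
      state : State
      tapes : Vec (Tape (Bool ⊎ Fin #extraSymbols)) #tapes

  open Config public

  initial : Word → Config
  initial w = config start (writeWord w ∷ Vec.replicate #extraTapes blankTape)

  step : Config → Maybe Config
  step (config q ts) with δ q (Vec.map head ts)
  ... | nothing          = nothing
  ... | just (q′ , acts) = just (config q′ (Vec.zipWith writeMove acts ts))

  Halted : Config → Set
  Halted c = step c ≡ nothing

  -- At most the given number of steps, stopping at a halted configuration.
  run : ℕ → Config → Config
  run zero    c = c
  run (suc n) c with step c
  ... | nothing = c
  ... | just c′ = run n c′

  output : Config → Word
  output c = readWord (Vec.head (tapes c))

  ComputesWithin : ℕ → Word → Word → Set
  ComputesWithin n x y = Halted (run n (initial x)) × output (run n (initial x)) ≡ y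

Language : Set₁
Language = Pred Word 0ℓ

PolyTime : (Word → Word) → Set
PolyTime f = ∃[ M ] ∃[ p ] ∀ x → Run.ComputesWithin M (eval p (length x)) x (f x)

PolyTimeTest : (Word → Bool) → Set
PolyTimeTest t = PolyTime (λ x → [ t x ])

-- Each bit of the first word is preceded by 1; a 0 marks its end.
⟨_,_⟩ : Word → Word → Word
⟨ x , y ⟩ = concatMap (λ b → true ∷ b ∷ []) x ++ false ∷ y

InNP : Language → Set
InNP L = ∃[ verify ] PolyTimeTest verify × ∃[ p ] ∀ x →
  L x ⇔ (∃[ w ] length w ≤ eval p (length x) × T (verify ⟨ x , w ⟩))

infix 4 _≤ₚ_

_≤ₚ_ : Language → Language → Set
L ≤ₚ L′ = ∃[ f ] PolyTime f × (∀ x → L x ⇔ L′ (f x))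

NPHard : Language → Set₁
NPHard L = ∀ (L′ : Language) → InNP L′ → L′ ≤ₚ L

NPComplete : Language → Set₁
NPComplete L = InNP L × NPHard L

record Problem : Set₁ where
  field
    Instance : Set
    encode   : Instance → Word
    numbers  : Instance → List ℕ
    Yes      : Instance → Set

  size : Instance → ℕ
  size = length ∘ encode

  language : Language
  language x = ∃[ I ] encode I ≡ x × Yes I

restrict : (P : Problem) → (Problem.Instance P → Set) → Problem
restrict P C = record
  { Instance = Σ Instance C
  ; encode   = encode ∘ proj₁
  ; numbers  = numbers ∘ proj₁
  ; Yes      = Yes ∘ proj₁
  }
  where open Problem P

NumbersBoundedBy : Polynomial → (P : Problem) → Problem.Instance P → Set
NumbersBoundedBy p P I = All (_≤ eval p (size I)) (numbers I)
  where open Problem P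

-- Garey and Johnson's definition: the problem is in NP, and its restriction
-- to instances with polynomially bounded numbers is NP-complete for some
-- choice of the polynomial.
StronglyNPComplete : Problem → Set₁
StronglyNPComplete P =
  InNP (language P) ×
  ∃[ p ] NPComplete (language (restrict P (NumbersBoundedBy p P)))
  where open Problem using (language)

record Graph (V : Set) : Set where
  field
    adj : V → V → Bool

  Adj : Rel V 0ℓ
  Adj u v = T (adj u v)

  field
    adj-sym    : Symmetric Adj
    adj-irrefl : Irreflexive _≡_ Adj

open Graph public

record _≅_ {V W : Set} (G : Graph V) (H : Graph W) : Set where
  field
    bijection : V ↔ W
  open Inverse bijection using (to)
  field
    adj-iff : ∀ u v → Adj G u v ⇔ Adj H (to u) (to v)

Bipartite : {V : Set} → Graph V → Set
Bipartite {V} G = Σ (V → Bool) λ side → ∀ {u v} → Adj G u v → side u ≢ side v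

module _ {m : ℕ} (H : Graph (Fin m)) where

  -- The endpoints are ordered so that each edge is represented once.
  Edge : Set
  Edge = ∃[ u ] ∃[ v ] u < v × Adj H u v

  _IsEndpointOf_ : Fin m → Edge → Set
  w IsEndpointOf (u , v , _) = w ≡ u ⊎ w ≡ v

  LineAdj : Rel Edge 0ℓ
  LineAdj e f = e ≢ f × ∃[ w ] w IsEndpointOf e × w IsEndpointOf f

  _≟ᴱ_ : DecidableEquality Edge
  _≟ᴱ_ = ≡-dec _≟_ (≡-dec _≟_ (≡-dec (λ p q → yes (<-irrelevant p q))
                                     (λ p q → yes (T-irrelevant p q))))

  isEndpointOf? : Decidable _IsEndpointOf_
  isEndpointOf? w (u , v , _) = (w ≟ u) ⊎-dec (w ≟ v)

  lineAdj? : Decidable LineAdj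
  lineAdj? e f = ¬? (e ≟ᴱ f) ×-dec any? (λ w → isEndpointOf? w e ×-dec isEndpointOf? w f)

  lineGraph : Graph Edge
  lineGraph = record
    { adj        = λ e f → ⌊ lineAdj? e f ⌋
    ; adj-sym    = λ {e} {f} → fromWitness {a? = lineAdj? f e} ∘ swap ∘ toWitness {a? = lineAdj? e f}
    ; adj-irrefl = λ {e} {f} e≡f e~f → proj₁ (toWitness {a? = lineAdj? e f} e~f) e≡f
    }
    where
    swap : ∀ {e f} → LineAdj e f → LineAdj f e
    swap (e≢f , w , w∈e , w∈f) = e≢f ∘ sym , w , w∈f , w∈e

IsLineGraphOfBipartite : {V : Set} → Graph V → Set
IsLineGraphOfBipartite G =
  ∃[ m ] ∃[ H ] Bipartite {Fin m} H × G ≅ lineGraph H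

Independent : ∀ {n} → Graph (Fin n) → Subset n → Set
Independent G X = ∀ {u v} → u ∈ X → v ∈ X → ¬ Adj G u v

record PartialColoring {n} (k : ℕ) (G : Graph (Fin n)) : Set where
  field
    class       : Fin k → Subset n
    independent : ∀ j → Independent G (class j)
    disjoint    : ∀ i j → i ≢ j → Empty (class i ∩ class j)

profit : ∀ {n} → (Fin n → ℕ) → Subset n → ℕ
profit p X = Vec.sum (tabulate (λ v → if lookup X v then p v else 0))

minimum : ∀ {k} .{{_ : NonZero k}} → (Fin k → ℕ) → ℕ
minimum {suc k} f = Vec.foldr₁ _⊓_ (tabulate f)

satisfaction : ∀ {n k} .{{_ : NonZero k}} {G : Graph (Fin n)} →
               (Fin k → Fin n → ℕ) → PartialColoring k G → ℕ
satisfaction p X = minimum (λ j → profit (p j) (PartialColoring.class X j))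

record FairDivisionInstance (k : ℕ) : Set where
  field
    n     : ℕ
    graph : Graph (Fin n)
    p     : Fin k → Fin n → ℕ
    q     : ℕ

-- Bijective base 2, least significant digit first; each digit is preceded
-- by 1, and a 0 marks the end.
encodeℕᵇ : ℕᵇ → Word
encodeℕᵇ zero     = false ∷ []
encodeℕᵇ 2[1+ x ] = true ∷ true ∷ encodeℕᵇ x
encodeℕᵇ 1+[2 x ] = true ∷ false ∷ encodeℕᵇ x

encodeℕ : ℕ → Word
encodeℕ = encodeℕᵇ ∘ fromℕ

module _ {k : ℕ} (I : FairDivisionInstance k) where
  open FairDivisionInstance I

  profits : List ℕ
  profits = concatMap (λ j → List.map (p j) (allFin n)) (allFin k)

  -- The number of vertices in unary, the adjacency matrix, and then all
  -- profits and the threshold in binary.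
  encodeInstance : Word
  encodeInstance =
    replicate n true ++ false ∷
    concatMap (λ u → List.map (adj graph u) (allFin n)) (allFin n) ++
    concatMap encodeℕ profits ++
    encodeℕ q

FairDivision : (k : ℕ) .{{_ : NonZero k}} → Problem
FairDivision k = record
  { Instance = FairDivisionInstance k
  ; encode   = encodeInstance
  ; numbers  = λ I → q I ∷ profits I
  ; Yes      = λ I → ∃[ X ] q I ≤ satisfaction {G = graph I} (p I) X
  }
  where open FairDivisionInstance

OnLineGraphsOfBipartiteGraphs : ∀ {k} → FairDivisionInstance k → Set
OnLineGraphsOfBipartiteGraphs I = IsLineGraphOfBipartite (FairDivisionInstance.graph I)

{-# OPTIONS --safe #-}
-- Hardness holds already for the line graphs of complete bipartite graphs, i.e.
-- for the cells of an R × S board with the attacks of rooks. With profits in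
-- {0,1} and q = R, the problem asks for k injections of the rows into the columns
-- which use allowed cells only and disagree on every row. Two such injections
-- encode the satisfiability of a formula: the first one assigns values to the
-- variables, the second one selects a true literal in every clause. Formulas, in
-- turn, encode the run of a verifier by implications between statements about
-- single tape cells, which force the actual run to be marked as true.
--
-- In order to stay away from programming Turing machines, all polynomial time
-- computations are written as expressions built from bounded sums. Their values
-- are polynomially bounded for syntactic reasons, hence they can be evaluated by
-- nested loops over unary counters.
--
-- A certificate for membership in NP consists of row and column labels of the
-- vertices, their colors, the binary digits of all numbers, the positions of these
-- numbers in the input, and the carries in the additions of the profits; it is
-- checked by a formula with bounded quantifiers.
module Submission where

open import Defs
open import Data.Bool.Base using (Bool; true; false; T; if_then_else_; _∧_; _∨_; not)
open import Data.Bool.Properties as Boolₚ using (T-irrelevant)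
open import Data.Empty using (⊥; ⊥-elim)
open import Data.Fin.Base using (Fin; zero; suc; toℕ; fromℕ<)
open import Data.Fin.Properties as Finₚ using (toℕ<n; toℕ-fromℕ<; fromℕ<-toℕ; toℕ-injective)
open import Data.Fin.Subset using () renaming (_∈_ to _∈ˢ_)
open import Data.Fin.Subset.Properties using (x∈p∩q⁺; x∈p∩q⁻)
open import Data.List.Base as List using (List; []; _∷_; [_]; _++_; length; concatMap; allFin; replicate; map)
open import Data.List.Properties as Listₚ using (++-assoc; ++-identityʳ; length-++; length-map)
open import Data.List.Relation.Unary.All using (All; []; _∷_)
open import Data.List.Relation.Unary.All.Properties as Allₚ using ()
open import Data.Maybe.Base using (Maybe; just; nothing)
open import Data.Nat.Base
open import Data.Nat.Binary.Base as Binary using (fromℕ)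
open import Data.Nat.Binary.Properties using (toℕ-fromℕ; fromℕ-toℕ; fromℕ-injective)
open import Data.Nat.Properties
open import Data.Nat.Tactic.RingSolver using (solve-∀)
open import Data.Product.Base using (Σ; _×_; _,_; proj₁; proj₂; ∃-syntax)
open import Data.Sum.Base using (_⊎_; inj₁; inj₂)
open import Data.Unit.Base using (⊤; tt)
open import Data.Vec.Base as Vec using (Vec; []; _∷_; lookup)
open import Data.Vec.Properties as Vecₚ using ()
open import Function.Base using (_∘_; id; case_of_)
open import Function.Bundles using (_⇔_; mk⇔; mk↔ₛ′; Equivalence; Inverse)
open import Relation.Binary.Definitions using (tri<; tri≈; tri>)
open import Relation.Binary.PropositionalEquality using (_≡_; _≢_; refl; sym; trans; cong; cong₂; subst; subst₂; module ≡-Reasoning)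
open import Relation.Nullary using (¬_; Dec; yes; no)
open import Relation.Nullary.Decidable using (⌊_⌋; toWitness; fromWitness; _×-dec_)
open import Relation.Nullary.Negation using (contradiction)

-- Distinct classes may be adjacent: they interact only by being disjoint. On the board, two
-- injections therefore see each other only within a row, where their columns must differ. Hence the
-- value of a variable has to be present in one row for every clause. Cyclic shifts achieve this: a
-- row that moves on to the next column displaces the next row, so all rows of a variable stay or
-- all of them move. The second injection tests the value by the one column that it needs in such a
-- row. Every further injection has columns of its own, which settles all numbers of classes from 2
-- on.
--
-- The formula for the verifier allows several symbols to be marked in one cell. What actually
-- happens is marked in any case, and the last clauses forbid any verdict but yes to be marked.
--
-- The numbers of an instance may be exponential in its size, so the sums of profits cannot be
-- formed in unary. One column of digits together with its carry, however, involves small numbers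
-- only.

-- Bounded sums, expressions, and generators of words

sumTo : ℕ → (ℕ → ℕ) → ℕ
sumTo zero    f = 0
sumTo (suc n) f = f n + sumTo n f

-- Iteration restricted to subtracting: the result never exceeds the starting value, so no
-- polynomial bound is lost. One round is truncated subtraction; `shifted` uses several rounds to
-- strip binary digits.
descend : ℕ → (ℕ → ℕ) → ℕ → ℕ
descend zero    g r = r
descend (suc n) g r = descend n g (r ∸ g r)

-- The last index is split off, as in `sumTo`, because a compiled loop counts its variable down and
-- the output is written from right to left.
concatTo : ℕ → (ℕ → Word) → Word
concatTo zero    f = []
concatTo (suc n) f = concatTo n f ++ f n

bitAt : Word → ℕ → ℕ
bitAt []          i       = 0
bitAt (true  ∷ y) zero    = 1
bitAt (false ∷ y) zero    = 0
bitAt (b     ∷ y) (suc i) = bitAt y i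

isPositive : ℕ → Bool
isPositive zero    = false
isPositive (suc _) = true

-- Unrestricted iteration would permit repeated doubling and thus exponential values. Here iteration
-- is available only as a sum and as `down`, which makes `valueBound` possible; multiplication,
-- division and all tests are derived from these.
data Expr : ℕ → Set where
  here        : ∀ {Γ} → Expr (suc Γ)
  ↑_          : ∀ {Γ} → Expr Γ → Expr (suc Γ)
  inputLength : ∀ {Γ} → Expr Γ
  one         : ∀ {Γ} → Expr Γ
  _⊕_         : ∀ {Γ} → Expr Γ → Expr Γ → Expr Γ
  ∑           : ∀ {Γ} → Expr Γ → Expr (suc Γ) → Expr Γ
  bit         : ∀ {Γ} → Expr Γ → Expr Γ
  down        : ∀ {Γ} → Expr Γ → Expr Γ → Expr (suc Γ) → Expr Γ

data Gen : ℕ → Set where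
  emit : ∀ {Γ} → Expr Γ → Gen Γ
  _⨾_  : ∀ {Γ} → Gen Γ → Gen Γ → Gen Γ
  for  : ∀ {Γ} → Expr Γ → Gen (suc Γ) → Gen Γ

⟦_⟧ : ∀ {Γ} → Expr Γ → Word → Vec ℕ Γ → ℕ
⟦ here ⟧       y (v ∷ ρ) = v
⟦ ↑ e ⟧        y (v ∷ ρ) = ⟦ e ⟧ y ρ
⟦ inputLength ⟧  y ρ     = length y
⟦ one ⟧        y ρ       = 1
⟦ a ⊕ b ⟧      y ρ       = ⟦ a ⟧ y ρ + ⟦ b ⟧ y ρ
⟦ ∑ n e ⟧      y ρ       = sumTo (⟦ n ⟧ y ρ) (λ i → ⟦ e ⟧ y (i ∷ ρ))
⟦ bit e ⟧      y ρ       = bitAt y (⟦ e ⟧ y ρ)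
⟦ down n a e ⟧ y ρ       = descend (⟦ n ⟧ y ρ) (λ r → ⟦ e ⟧ y (r ∷ ρ)) (⟦ a ⟧ y ρ)

⟦_⟧ᴳ : ∀ {Γ} → Gen Γ → Word → Vec ℕ Γ → Word
⟦ emit e ⟧ᴳ  y ρ = isPositive (⟦ e ⟧ y ρ) ∷ []
⟦ o ⨾ o′ ⟧ᴳ  y ρ = ⟦ o ⟧ᴳ y ρ ++ ⟦ o′ ⟧ᴳ y ρ
⟦ for n o ⟧ᴳ y ρ = concatTo (⟦ n ⟧ y ρ) (λ i → ⟦ o ⟧ᴳ y (i ∷ ρ))

-- Polynomial expressions and their coefficient lists

data Poly : Set where
  X     : Poly
  con   : ℕ → Poly
  _⊞_ _⊠_ : Poly → Poly → Poly

infixl 6 _⊞_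
infixl 7 _⊠_

⟦_⟧ᴾ : Poly → ℕ → ℕ
⟦ X ⟧ᴾ     n = n
⟦ con a ⟧ᴾ n = a
⟦ p ⊞ q ⟧ᴾ n = ⟦ p ⟧ᴾ n + ⟦ q ⟧ᴾ n
⟦ p ⊠ q ⟧ᴾ n = ⟦ p ⟧ᴾ n * ⟦ q ⟧ᴾ n

_⊚_ : Poly → Poly → Poly
X       ⊚ r = r
con a   ⊚ r = con a
(p ⊞ q) ⊚ r = p ⊚ r ⊞ q ⊚ r
(p ⊠ q) ⊚ r = p ⊚ r ⊠ q ⊚ r

⊚-correct : ∀ p r n → ⟦ p ⊚ r ⟧ᴾ n ≡ ⟦ p ⟧ᴾ (⟦ r ⟧ᴾ n)
⊚-correct X       r n = refl
⊚-correct (con a) r n = refl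
⊚-correct (p ⊞ q) r n = cong₂ _+_ (⊚-correct p r n) (⊚-correct q r n)
⊚-correct (p ⊠ q) r n = cong₂ _*_ (⊚-correct p r n) (⊚-correct q r n)

⟦⟧ᴾ-mono : ∀ p {m n} → m ≤ n → ⟦ p ⟧ᴾ m ≤ ⟦ p ⟧ᴾ n
⟦⟧ᴾ-mono X       m≤n = m≤n
⟦⟧ᴾ-mono (con a) m≤n = ≤-refl
⟦⟧ᴾ-mono (p ⊞ q) m≤n = +-mono-≤ (⟦⟧ᴾ-mono p m≤n) (⟦⟧ᴾ-mono q m≤n)
⟦⟧ᴾ-mono (p ⊠ q) m≤n = *-mono-≤ (⟦⟧ᴾ-mono p m≤n) (⟦⟧ᴾ-mono q m≤n)

_+ᶜ_ : Polynomial → Polynomial → Polynomial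
[]       +ᶜ q        = q
p        +ᶜ []       = p
(a ∷ p) +ᶜ (b ∷ q) = a + b ∷ p +ᶜ q

_·ᶜ_ : ℕ → Polynomial → Polynomial
a ·ᶜ p = map (a *_) p

_*ᶜ_ : Polynomial → Polynomial → Polynomial
[]       *ᶜ q = []
(a ∷ p) *ᶜ q = (a ·ᶜ q) +ᶜ (0 ∷ p *ᶜ q)

+ᶜ-eval : ∀ p q x → eval (p +ᶜ q) x ≡ eval p x + eval q x
+ᶜ-eval []      q       x = refl
+ᶜ-eval (a ∷ p) []      x = sym (+-identityʳ _)
+ᶜ-eval (a ∷ p) (b ∷ q) x rewrite +ᶜ-eval p q x = lemma a b x (eval p x) (eval q x)
  where
  lemma : ∀ a b x u v → a + b + x * (u + v) ≡ a + x * u + (b + x * v)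
  lemma = solve-∀

·ᶜ-eval : ∀ a p x → eval (a ·ᶜ p) x ≡ a * eval p x
·ᶜ-eval a []      x = sym (*-zeroʳ a)
·ᶜ-eval a (b ∷ p) x rewrite ·ᶜ-eval a p x = lemma a b x (eval p x)
  where
  lemma : ∀ a b x u → a * b + x * (a * u) ≡ a * (b + x * u)
  lemma = solve-∀

*ᶜ-eval : ∀ p q x → eval (p *ᶜ q) x ≡ eval p x * eval q x
*ᶜ-eval []      q x = refl
*ᶜ-eval (a ∷ p) q x
  rewrite +ᶜ-eval (a ·ᶜ q) (0 ∷ p *ᶜ q) x | ·ᶜ-eval a q x | *ᶜ-eval p q x = lemma a x (eval p x) (eval q x)
  where
  lemma : ∀ a x u v → a * v + x * (u * v) ≡ (a + x * u) * v
  lemma = solve-∀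

coefficients : Poly → Polynomial
coefficients X       = 0 ∷ 1 ∷ []
coefficients (con a) = a ∷ []
coefficients (p ⊞ q) = coefficients p +ᶜ coefficients q
coefficients (p ⊠ q) = coefficients p *ᶜ coefficients q

coefficients-eval : ∀ p x → eval (coefficients p) x ≡ ⟦ p ⟧ᴾ x
coefficients-eval X       x = lemma x
  where
  lemma : ∀ x → x * (1 + x * 0) ≡ x
  lemma = solve-∀
coefficients-eval (con a) x = trans (cong (a +_) (*-zeroʳ x)) (+-identityʳ a)
coefficients-eval (p ⊞ q) x =
  trans (+ᶜ-eval (coefficients p) (coefficients q) x) (cong₂ _+_ (coefficients-eval p x) (coefficients-eval q x))
coefficients-eval (p ⊠ q) x =
  trans (*ᶜ-eval (coefficients p) (coefficients q) x) (cong₂ _*_ (coefficients-eval p x) (coefficients-eval q x))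

horner : Polynomial → Poly
horner []      = con 0
horner (a ∷ p) = con a ⊞ X ⊠ horner p

horner-correct : ∀ p x → ⟦ horner p ⟧ᴾ x ≡ eval p x
horner-correct []      x = refl
horner-correct (a ∷ p) x = cong (λ v → a + x * v) (horner-correct p x)

-- Polynomial bounds on the values of expressions

-- valueBound e and timeBound e are taken at a common bound on the length of
-- the input and on the values of the variables.
valueBound : ∀ {Γ} → Expr Γ → Poly
valueBound here         = X
valueBound (↑ e)        = valueBound e
valueBound inputLength  = X
valueBound one          = con 1
valueBound (a ⊕ b)      = valueBound a ⊞ valueBound b
-- In the body the new variable can approach the value of `n`, so the common bound grows from `X` to
-- `X ⊞ valueBound n`.
valueBound (∑ n e)      = valueBound n ⊠ (valueBound e ⊚ (X ⊞ valueBound n))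
valueBound (bit e)      = con 1
valueBound (down n a e) = valueBound a

_≤*_ : ∀ {Γ} → Vec ℕ Γ → ℕ → Set
[]      ≤* N = ⊤
(v ∷ ρ) ≤* N = v ≤ N × ρ ≤* N

≤*-weaken : ∀ {Γ} {ρ : Vec ℕ Γ} {M N} → M ≤ N → ρ ≤* M → ρ ≤* N
≤*-weaken {ρ = []}    M≤N _       = tt
≤*-weaken {ρ = v ∷ ρ} M≤N (p , q) = ≤-trans p M≤N , ≤*-weaken M≤N q

sumTo-≤ : ∀ n f B → (∀ i → i < n → f i ≤ B) → sumTo n f ≤ n * B
sumTo-≤ zero    f B h = z≤n
sumTo-≤ (suc n) f B h = +-mono-≤ (h n ≤-refl) (sumTo-≤ n f B (λ i i<n → h i (m<n⇒m<1+n i<n)))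

descend-≤ : ∀ n g r → descend n g r ≤ r
descend-≤ zero    g r = ≤-refl
descend-≤ (suc n) g r = ≤-trans (descend-≤ n g (r ∸ g r)) (m∸n≤m r (g r))

bitAt-≤ : ∀ y i → bitAt y i ≤ 1
bitAt-≤ []          i       = z≤n
bitAt-≤ (true  ∷ y) zero    = ≤-refl
bitAt-≤ (false ∷ y) zero    = z≤n
bitAt-≤ (true  ∷ y) (suc i) = bitAt-≤ y i
bitAt-≤ (false ∷ y) (suc i) = bitAt-≤ y i

module _ (y : Word) where

  valueBound-correct : ∀ {Γ} (e : Expr Γ) ρ N → length y ≤ N → ρ ≤* N → ⟦ e ⟧ y ρ ≤ ⟦ valueBound e ⟧ᴾ N
  valueBound-correct here         (v ∷ ρ) N y≤N (v≤N , _)   = v≤N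
  valueBound-correct (↑ e)        (v ∷ ρ) N y≤N (_   , ρ≤N) = valueBound-correct e ρ N y≤N ρ≤N
  valueBound-correct inputLength  ρ       N y≤N ρ≤N         = y≤N
  valueBound-correct one          ρ       N y≤N ρ≤N         = ≤-refl
  valueBound-correct (a ⊕ b)      ρ       N y≤N ρ≤N         =
    +-mono-≤ (valueBound-correct a ρ N y≤N ρ≤N) (valueBound-correct b ρ N y≤N ρ≤N)
  valueBound-correct (∑ n e)      ρ       N y≤N ρ≤N         = ≤-trans
    (sumTo-≤ (⟦ n ⟧ y ρ) _ (⟦ valueBound e ⊚ (X ⊞ valueBound n) ⟧ᴾ N) body)
    (*-monoˡ-≤ _ n≤)
    where
    n≤ = valueBound-correct n ρ N y≤N ρ≤N
    body : ∀ i → i < ⟦ n ⟧ y ρ → ⟦ e ⟧ y (i ∷ ρ) ≤ ⟦ valueBound e ⊚ (X ⊞ valueBound n) ⟧ᴾ N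
    body i i<n rewrite ⊚-correct (valueBound e) (X ⊞ valueBound n) N =
      valueBound-correct e (i ∷ ρ) _ (≤-trans y≤N (m≤m+n N _))
        (≤-trans (<⇒≤ i<n) (≤-trans n≤ (m≤n+m _ N)) , ≤*-weaken (m≤m+n N _) ρ≤N)
  valueBound-correct (bit e)      ρ       N y≤N ρ≤N         = bitAt-≤ y (⟦ e ⟧ y ρ)
  valueBound-correct (down n a e) ρ       N y≤N ρ≤N         =
    ≤-trans (descend-≤ (⟦ n ⟧ y ρ) _ (⟦ a ⟧ y ρ)) (valueBound-correct a ρ N y≤N ρ≤N)

-- The compiler. Tape 0 receives the output, the other tapes are never written
-- after initialisation: tape 1 holds the input, and every further tape is a
-- counter, whose value is the position of the head relative to a marked cell.

Sym : Set
Sym = Maybe (Bool ⊎ Fin 0)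

TapeS : Set
TapeS = Tape (Bool ⊎ Fin 0)

marker : Sym
marker = just (inj₁ true)

isBlank : Sym → Bool
isBlank nothing  = true
isBlank (just _) = false

isTrue : Sym → Bool
isTrue (just (inj₁ b)) = b
isTrue _               = false

nth : {S : Set} → List (Maybe S) → ℕ → Maybe S
nth []       i       = nothing
nth (s ∷ ss) zero    = s
nth (s ∷ ss) (suc i) = nth ss i

symbols : Word → List Sym
symbols = map (just ∘ inj₁)

counter : ℕ → Sym
counter zero    = marker
counter (suc _) = nothing

-- Counter `r` lives on tape `1 + r`. Number 0 is the position on the input tape, treated as a
-- counter whose tape carries letters instead of a marker.
contents : Word → ℕ → ℕ → Sym
contents y zero    = nth (symbols y)
contents y (suc r) = counter

prefixRev : (ℕ → Sym) → ℕ → List Sym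
prefixRev c zero    = []
prefixRev c (suc i) = c i ∷ prefixRev c i

-- The part left of the head is prescribed exactly, the part right of it only cell by cell: a move
-- to the left leaves explicit blanks behind where there were implicit ones.
record At (c : ℕ → Sym) (i : ℕ) (t : TapeS) : Set where
  constructor at
  field
    before-at : before t ≡ prefixRev c i
    head-at   : head t ≡ c i
    after-at  : ∀ j → nth (after t) j ≡ c (suc i + j)

open At

at-right : ∀ {c i} t → At c i t → At c (suc i) (move right t)
at-right {c} {i} (tape ls h [])       (at refl refl a) = at refl (trans (a 0) (cong c (+-identityʳ (suc i))))
  (λ j → trans (a (suc j)) (cong c (+-suc (suc i) j)))
at-right {c} {i} (tape ls h (r ∷ rs)) (at refl refl a) = at refl (trans (a 0) (cong c (+-identityʳ (suc i))))
  (λ j → trans (a (suc j)) (cong c (+-suc (suc i) j)))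

at-left : ∀ {c i} t → At c (suc i) t → At c i (move left t)
at-left {c} {i} (tape (l ∷ ls) h rs) (at refl refl a) = at refl refl λ where
  zero    → cong c (sym (+-identityʳ (suc i)))
  (suc j) → trans (a j) (cong c (sym (+-suc (suc i) j)))

data Instr : Set where
  shift      : ℕ → Move → Instr
  decOr      : ℕ → ℕ → Instr
  decrease   : ℕ → Instr
  jump       : ℕ → Instr
  incIf      : ℕ → Instr
  write      : ℕ → Instr
  initialise : Instr
  copy       : Instr
  finish     : Instr

symAt : ∀ {n} → Vec Sym n → ℕ → Sym
symAt []       r       = nothing
symAt (s ∷ ss) zero    = s
symAt (s ∷ ss) (suc r) = symAt ss r

still : ∀ {n} → Vec Sym n → Vec (Sym × Move) n
still = Vec.map (_, stay)

moveAt : ∀ {n} → Vec Sym n → ℕ → Move → Vec (Sym × Move) n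
moveAt []       r       m = []
moveAt (s ∷ ss) zero    m = (s , m) ∷ still ss
moveAt (s ∷ ss) (suc r) m = (s , stay) ∷ moveAt ss r m

fetch : List Instr → ℕ → Maybe Instr
fetch []       i       = nothing
fetch (c ∷ cs) zero    = just c
fetch (c ∷ cs) (suc i) = fetch cs i

-- The state of the machine is the program counter. The largest state is the address behind the
-- code; there `fetch` fails and the machine halts.
clamp : (n : ℕ) → ℕ → Fin (suc n)
clamp n       zero    = zero
clamp zero    (suc i) = zero
clamp (suc n) (suc i) = suc (clamp n i)

toℕ-clamp : ∀ cs i {c} → fetch cs i ≡ just c → toℕ (clamp (length cs) i) ≡ i
toℕ-clamp (c ∷ cs) zero    eq = refl
toℕ-clamp (c ∷ cs) (suc i) eq = cong suc (toℕ-clamp cs i eq)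

fetch-clamp : ∀ cs i {c} → fetch cs i ≡ just c → fetch cs (toℕ (clamp (length cs) i)) ≡ just c
fetch-clamp (c ∷ cs) zero    eq = eq
fetch-clamp (c ∷ cs) (suc i) eq = fetch-clamp cs i eq

fetch-end : ∀ cs → fetch cs (toℕ (clamp (length cs) (length cs))) ≡ nothing
fetch-end []       = refl
fetch-end (c ∷ cs) = fetch-end cs

-- Stores, relocatable code, and the machine executing it

Store : Set
Store = (ℕ → ℕ) × Word

reg : Store → ℕ → ℕ
reg = proj₁

out : Store → Word
out = proj₂

at_put_ : ℕ → ℕ → ℕ → ℕ
(at d put v) i = if i ≡ᵇ d then v else 0

_[_+=_] : Store → ℕ → ℕ → Store
(σ , o) [ d += v ] = (λ i → σ i + (at d put v) i) , o

infix 4 _≈_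
record _≈_ (s t : Store) : Set where
  constructor _∥_
  field
    same-reg : ∀ i → reg s i ≡ reg t i
    same-out : out s ≡ out t

put-+ : ∀ d a b i → (at d put a) i + (at d put b) i ≡ (at d put (a + b)) i
put-+ d a b i with i ≡ᵇ d
... | true  = refl
... | false = refl

put-0 : ∀ d i → (at d put 0) i ≡ 0
put-0 d i with i ≡ᵇ d
... | true  = refl
... | false = refl

put-same : ∀ d v → (at d put v) d ≡ v
put-same zero    v = refl
put-same (suc d) v = put-same d v

put-other : ∀ {d i} v → i ≢ d → (at d put v) i ≡ 0
put-other {zero}  {zero}  v i≢d = contradiction refl i≢d
put-other {zero}  {suc i} v i≢d = refl
put-other {suc d} {zero}  v i≢d = refl
put-other {suc d} {suc i} v i≢d = put-other v (i≢d ∘ cong suc)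

≈-refl : ∀ {s} → s ≈ s
≈-refl = (λ _ → refl) ∥ refl

≈-sym : ∀ {s t} → s ≈ t → t ≈ s
≈-sym (p ∥ q) = (sym ∘ p) ∥ sym q

≈-trans : ∀ {s t u} → s ≈ t → t ≈ u → s ≈ u
≈-trans (p ∥ q) (p′ ∥ q′) = (λ i → trans (p i) (p′ i)) ∥ trans q q′

+=-cong : ∀ {s t} d v → s ≈ t → s [ d += v ] ≈ t [ d += v ]
+=-cong d v (p ∥ q) = (λ i → cong (_+ _) (p i)) ∥ q

+=-merge : ∀ s d a b → s [ d += a ] [ d += b ] ≈ s [ d += a + b ]
+=-merge (σ , o) d a b = (λ i → trans (+-assoc (σ i) _ _) (cong (σ i +_) (put-+ d a b i))) ∥ refl

+=-swap : ∀ s d a e b → s [ d += a ] [ e += b ] ≈ s [ e += b ] [ d += a ]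
+=-swap (σ , o) d a e b = (λ i → lemma (σ i) ((at d put a) i) ((at e put b) i)) ∥ refl
  where
  lemma : ∀ x u v → x + u + v ≡ x + v + u
  lemma = solve-∀

+=-zero : ∀ s d → s [ d += 0 ] ≈ s
+=-zero (σ , o) d = (λ i → trans (cong (σ i +_) (put-0 d i)) (+-identityʳ (σ i))) ∥ refl

reg-same : ∀ s d {v} → reg s d ≡ 0 → reg (s [ d += v ]) d ≡ v
reg-same s d {v} z rewrite z = put-same d v

reg-other : ∀ s {d i} v → i ≢ d → reg (s [ d += v ]) i ≡ reg s i
reg-other s {d} {i} v i≢d = trans (cong (reg s i +_) (put-other v i≢d)) (+-identityʳ _)

-- Jumps have absolute targets, so a piece of code depends on the address at which it will be
-- placed.
Code : Set
Code = ℕ → List Instr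

_⍮_ : Code → Code → Code
(a ⍮ b) s = a s ++ b (s + length (a s))

infixr 5 _⍮_

instr : Instr → Code
instr i s = i ∷ []

loop : ℕ → Code → Code
loop t body s = decOr t (s + suc (length (body (suc s)) + 1)) ∷ body (suc s) ++ jump s ∷ []

module Execution (c : ℕ) where

  exec : ℕ → Instr → Vec Sym (3 + c) → ℕ × Vec (Sym × Move) (3 + c)
  exec pc (shift r m) (s ∷ ss) = suc pc , (s , stay) ∷ moveAt ss r m
  -- A counter is zero iff its head scans the marker; a blank means that it is positive.
  exec pc (decOr r t) (s ∷ ss) =
    if isBlank (symAt ss r) then (suc pc , (s , stay) ∷ moveAt ss r left) else (t , still (s ∷ ss))
  exec pc (decrease r) (s ∷ ss) =
    if isBlank (symAt ss r) then (suc pc , (s , stay) ∷ moveAt ss r left) else (suc pc , still (s ∷ ss))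
  exec pc (jump t) ss = t , still ss
  exec pc (incIf r) (s ∷ ss) =
    if isTrue (symAt ss 0) then (suc pc , (s , stay) ∷ moveAt ss r right) else (suc pc , still (s ∷ ss))
  -- Moving left after each letter builds the output from its end, over the remains of the input on
  -- tape 0.
  exec pc (write r) (s ∷ ss) = suc pc , (just (inj₁ (isBlank (symAt ss r))) , left) ∷ still ss
  exec pc initialise (s ∷ s₁ ∷ ss) = suc pc , (s , stay) ∷ (s₁ , stay) ∷ Vec.map (λ _ → marker , stay) ss
  exec pc copy (s ∷ s₁ ∷ s₂ ∷ ss) =
    if isBlank s then (suc pc , still (s ∷ s₁ ∷ s₂ ∷ ss))
                 else (pc , (s , right) ∷ (s , right) ∷ (s₂ , right) ∷ still ss)
  exec pc finish (s ∷ ss) = suc pc , (s , right) ∷ still ss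

  compiled : List Instr → TM
  compiled code = record
    { #states       = suc (length code)
    ; #extraTapes   = 2 + c
    ; #extraSymbols = 0
    ; start         = zero
    ; δ             = λ q ss → act q ss (fetch code (toℕ q))
    }
    where
    act : Fin (suc (length code)) → Vec Sym (3 + c) → Maybe Instr →
          Maybe (Fin (suc (length code)) × Vec (Sym × Move) (3 + c))
    act q ss nothing  = nothing
    act q ss (just i) = just (clamp (length code) (proj₁ (exec (toℕ q) i ss)) , proj₂ (exec (toℕ q) i ss))

iterateDown : {A : Set} → (ℕ → A → A) → ℕ → A → A
iterateDown g zero    a = a
iterateDown g (suc m) a = iterateDown g m (g m a)

-- Reasoning about executions

module Logic (c : ℕ) (code : List Instr) (y : Word) where
  open Execution c public
  open Run (compiled code)

  Tapes : Set
  Tapes = Vec TapeS (3 + c)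

  conf : ℕ → Tapes → Config
  conf pc ts = config (clamp (length code) pc) ts

  -- On tape 0 only the cells right of the head are controlled: they hold the output, followed by
  -- cells where reading stops at once. Nothing is claimed about the head and the cells left of it.
  record Rep (st : Store) (ts : Tapes) : Set where
    constructor rep
    field
      junk      : List Sym
      no-junk   : leadingBits junk ≡ []
      output-at : after (Vec.head ts) ≡ symbols (out st) ++ junk
      input-at  : ∀ i → At (contents y (toℕ i)) (reg st (toℕ i)) (lookup (Vec.tail ts) i)

  rep-cong : ∀ {s s′ ts} → s ≈ s′ → Rep s ts → Rep s′ ts
  rep-cong (p ∥ refl) (rep j nj o-at i-at) =
    rep j nj o-at (λ i → subst (λ v → At (contents y (toℕ i)) v _) (p (toℕ i)) (i-at i))

  data Steps : ℕ → Config → Config → Set where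
    done : ∀ {c} → Steps 0 c c
    more : ∀ {n c c′ c″} → step c ≡ just c′ → Steps n c′ c″ → Steps (suc n) c c″

  Steps-++ : ∀ {m n c c′ c″} → Steps m c c′ → Steps n c′ c″ → Steps (m + n) c c″
  Steps-++ done       t = t
  Steps-++ (more e s) t = more e (Steps-++ s t)

  Steps-run : ∀ {m n c c′} → Steps m c c′ → m ≤ n → Halted c′ → run n c ≡ c′
  Steps-run {n = zero}  done       z≤n     h = refl
  Steps-run {n = suc n} {c} done   z≤n     h with step c
  ... | nothing = refl
  Steps-run {n = suc n} {c} (more e s) (s≤s m≤n) h rewrite e = Steps-run s m≤n h

  Reaches : ℕ → Config → Config → Set
  Reaches B c c′ = ∃[ n ] n ≤ B × Steps n c c′

  record Exec (pc : ℕ) (s : Store) (B pc′ : ℕ) (s′ : Store) : Set where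
    constructor executes
    field
      exec-on : ∀ ts → Rep s ts → ∃[ ts′ ] Rep s′ ts′ × Reaches B (conf pc ts) (conf pc′ ts′)

  open Exec public

  Exec-trans : ∀ {p q r s t u A B} → Exec p s A q t → Exec q t B r u → Exec p s (A + B) r u
  Exec-trans (executes e) (executes f) = executes λ ts r → case e ts r of λ where
    (ts′ , r′ , m , m≤A , st) → case f ts′ r′ of λ where
      (ts″ , r″ , n , n≤B , st′) → ts″ , r″ , m + n , +-mono-≤ m≤A n≤B , Steps-++ st st′

  Exec-cong : ∀ {p q q′ s s′ t t′ A B} → s′ ≈ s → t ≈ t′ → A ≤ B → q ≡ q′ → Exec p s A q t → Exec p s′ B q′ t′
  Exec-cong s≈ t≈ A≤B refl (executes e) = executes λ ts r → case e ts (rep-cong s≈ r) of λ where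
    (ts′ , r′ , m , m≤A , st) → ts′ , rep-cong t≈ r′ , m , ≤-trans m≤A A≤B , st

  Placed : ℕ → List Instr → Set
  Placed s []       = ⊤
  Placed s (i ∷ is) = fetch code s ≡ just i × Placed (suc s) is

  Placed-++ : ∀ s is js → Placed s (is ++ js) → Placed s is × Placed (s + length is) js
  Placed-++ s []       js p       = tt , subst (λ s → Placed s js) (sym (+-identityʳ s)) p
  Placed-++ s (i ∷ is) js (e , p) with Placed-++ (suc s) is js p
  ... | p₁ , p₂ = (e , p₁) , subst (λ s → Placed s js) (sym (+-suc s (length is))) p₂

  record Runs (a : Code) (s : Store) (B : ℕ) (s′ : Store) : Set where
    constructor runs
    field
      runs-at : ∀ pc → Placed pc (a pc) → Exec pc s B (pc + length (a pc)) s′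

  open Runs public

  runs-⍮ : ∀ {a b s t u A B} → Runs a s A t → Runs b t B u → Runs (a ⍮ b) s (A + B) u
  runs-⍮ {a} {b} (runs ra) (runs rb) = runs λ pc p → case Placed-++ pc (a pc) (b (pc + length (a pc))) p of λ where
    (pa , pb) → Exec-cong ≈-refl ≈-refl ≤-refl
      (trans (+-assoc pc _ _) (cong (pc +_) (sym (length-++ (a pc)))))
      (Exec-trans (ra pc pa) (rb _ pb))

  runs-cong : ∀ {a s s′ t t′ A B} → s′ ≈ s → t ≈ t′ → A ≤ B → Runs a s A t → Runs a s′ B t′
  runs-cong s≈ t≈ A≤B (runs r) = runs λ pc p → Exec-cong s≈ t≈ A≤B refl (r pc p)

  step-instr : ∀ pc {i} ts → fetch code pc ≡ just i →
    step (conf pc ts) ≡ just (conf (proj₁ (exec pc i (Vec.map head ts)))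
                                   (Vec.zipWith writeMove (proj₂ (exec pc i (Vec.map head ts))) ts))
  step-instr pc ts e rewrite fetch-clamp code pc e | toℕ-clamp code pc e = refl

  exec-instr : ∀ pc {i s s′ q} → fetch code pc ≡ just i →
    (∀ ts → Rep s ts → proj₁ (exec pc i (Vec.map head ts)) ≡ q
                     × Rep s′ (Vec.zipWith writeMove (proj₂ (exec pc i (Vec.map head ts))) ts)) →
    Exec pc s 1 q s′
  exec-instr pc e h = executes λ ts r → case h ts r of λ where
    (refl , r′) → _ , r′ , 1 , ≤-refl , more (step-instr pc ts e) done

  still-id : ∀ {n} (ts : Vec TapeS n) → Vec.zipWith writeMove (still (Vec.map head ts)) ts ≡ ts
  still-id []       = refl
  still-id (t ∷ ts) = cong (t ∷_) (still-id ts)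

  lookup-moveAt : ∀ {n} (ts : Vec TapeS n) r m i →
    lookup (Vec.zipWith writeMove (moveAt (Vec.map head ts) r m) ts) i ≡
    (if toℕ i ≡ᵇ r then move m (lookup ts i) else lookup ts i)
  lookup-moveAt (t ∷ ts) zero    m zero    = refl
  lookup-moveAt (t ∷ ts) zero    m (suc i) = cong (λ ts → lookup ts i) (still-id ts)
  lookup-moveAt (t ∷ ts) (suc r) m zero    = refl
  lookup-moveAt (t ∷ ts) (suc r) m (suc i) = lookup-moveAt ts r m i

  symAt-lookup : ∀ {n} (ts : Vec TapeS n) r (r<n : r < n) →
    symAt (Vec.map head ts) r ≡ head (lookup ts (fromℕ< r<n))
  symAt-lookup (t ∷ ts) zero    r<n       = refl
  symAt-lookup (t ∷ ts) (suc r) (s≤s r<n) = symAt-lookup ts r r<n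

  rep-still : ∀ {s} ts → Rep s ts → Rep s (Vec.zipWith writeMove (still (Vec.map head ts)) ts)
  rep-still ts r rewrite still-id ts = r

  rep-right : ∀ {s} t ts r → Rep s (t ∷ ts) →
    Rep (s [ r += 1 ]) (t ∷ Vec.zipWith writeMove (moveAt (Vec.map head ts) r right) ts)
  rep-right {s} t ts r (rep j nj o-at i-at) = rep j nj o-at moved
    where
    moved : ∀ i → At (contents y (toℕ i)) (reg (s [ r += 1 ]) (toℕ i))
                     (lookup (Vec.zipWith writeMove (moveAt (Vec.map head ts) r right) ts) i)
    moved i rewrite lookup-moveAt ts r right i with toℕ i ≡ᵇ r
    ... | true  rewrite +-comm (reg s (toℕ i)) 1 = at-right _ (i-at i)
    ... | false rewrite +-identityʳ (reg s (toℕ i)) = i-at i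

  rep-left : ∀ {s} t ts r m → Rep (s [ r += suc m ]) (t ∷ ts) →
    Rep (s [ r += m ]) (t ∷ Vec.zipWith writeMove (moveAt (Vec.map head ts) r left) ts)
  rep-left {s} t ts r m (rep j nj o-at i-at) = rep j nj o-at moved
    where
    moved : ∀ i → At (contents y (toℕ i)) (reg (s [ r += m ]) (toℕ i))
                     (lookup (Vec.zipWith writeMove (moveAt (Vec.map head ts) r left) ts) i)
    moved i rewrite lookup-moveAt ts r left i with toℕ i ≡ᵇ r | i-at i
    ... | true  | a rewrite +-suc (reg s (toℕ i)) m = at-left _ a
    ... | false | a = a

  symAt-rep : ∀ {s} t ts {r} → r < 2 + c → Rep s (t ∷ ts) → symAt (Vec.map head ts) r ≡ contents y r (reg s r)
  symAt-rep {s} t ts {r} r<n (rep _ _ _ i-at) = trans (symAt-lookup ts r r<n)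
    (subst (λ q → head (lookup ts (fromℕ< r<n)) ≡ contents y q (reg s q)) (toℕ-fromℕ< r<n)
      (head-at (i-at (fromℕ< r<n))))

  symAt-counter : ∀ {s} t ts {r v} → 1 ≤ r → r < 2 + c → reg s r ≡ v → Rep s (t ∷ ts) →
    symAt (Vec.map head ts) r ≡ counter v
  symAt-counter t ts {suc r} (s≤s _) r<n e R = trans (symAt-rep t ts r<n R) (cong counter e)

  runs-instr : ∀ {i s s′ B} → (∀ pc → fetch code pc ≡ just i → Exec pc s B (suc pc) s′) → Runs (instr i) s B s′
  runs-instr f = runs λ where
    pc (e , _) → Exec-cong ≈-refl ≈-refl ≤-refl (+-comm 1 pc) (f pc e)

  runs-inc : ∀ {s} r → Runs (instr (shift r right)) s 1 (s [ r += 1 ])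
  runs-inc r = runs-instr λ pc e → exec-instr pc e λ where
    (t ∷ ts) R → refl , rep-right t ts r R

  runs-dec : ∀ {s} r m → Runs (instr (shift r left)) (s [ r += suc m ]) 1 (s [ r += m ])
  runs-dec r m = runs-instr λ pc e → exec-instr pc e λ where
    (t ∷ ts) R → refl , rep-left t ts r m R

  runs-decrease : ∀ {s} r m → 1 ≤ r → r < 2 + c → reg s r ≡ 0 →
    Runs (instr (decrease r)) (s [ r += m ]) 1 (s [ r += m ∸ 1 ])
  runs-decrease {s} r m 1≤r r<c z = runs-instr λ pc e → exec-instr pc e (effect pc m)
    where
    effect : ∀ pc m ts → Rep (s [ r += m ]) ts →
      proj₁ (exec pc (decrease r) (Vec.map head ts)) ≡ suc pc ×
      Rep (s [ r += m ∸ 1 ]) (Vec.zipWith writeMove (proj₂ (exec pc (decrease r) (Vec.map head ts))) ts)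
    effect pc zero    (t ∷ ts) R rewrite symAt-counter t ts 1≤r r<c (reg-same s r {0} z) R = refl , rep-still (t ∷ ts) R
    effect pc (suc m) (t ∷ ts) R rewrite symAt-counter t ts 1≤r r<c (reg-same s r {suc m} z) R = refl , rep-left t ts r m R

  exec-decOr-suc : ∀ {s pc r target} m → 1 ≤ r → r < 2 + c → reg s r ≡ 0 → fetch code pc ≡ just (decOr r target) →
    Exec pc (s [ r += suc m ]) 1 (suc pc) (s [ r += m ])
  exec-decOr-suc {s} {pc} {r} {target} m 1≤r r<c z e = exec-instr pc e effect
    where
    effect : ∀ ts → Rep (s [ r += suc m ]) ts →
      proj₁ (exec pc (decOr r target) (Vec.map head ts)) ≡ suc pc ×
      Rep (s [ r += m ]) (Vec.zipWith writeMove (proj₂ (exec pc (decOr r target) (Vec.map head ts))) ts)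
    effect (t ∷ ts) R rewrite symAt-counter t ts 1≤r r<c (reg-same s r {suc m} z) R = refl , rep-left t ts r m R

  exec-decOr-zero : ∀ {s pc r target} → 1 ≤ r → r < 2 + c → reg s r ≡ 0 → fetch code pc ≡ just (decOr r target) →
    Exec pc s 1 target s
  exec-decOr-zero {s} {pc} {r} {target} 1≤r r<c z e = exec-instr pc e effect
    where
    effect : ∀ ts → Rep s ts →
      proj₁ (exec pc (decOr r target) (Vec.map head ts)) ≡ target ×
      Rep s (Vec.zipWith writeMove (proj₂ (exec pc (decOr r target) (Vec.map head ts))) ts)
    effect (t ∷ ts) R rewrite symAt-counter t ts 1≤r r<c z R = refl , rep-still (t ∷ ts) R

  exec-jump : ∀ {s pc target} → fetch code pc ≡ just (jump target) → Exec pc s 1 target s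
  exec-jump {s} {pc} e = exec-instr pc e λ where
    (t ∷ ts) R → refl , rep-still (t ∷ ts) R

  bit-contents : ∀ y i → isTrue (contents y 0 i) ≡ isPositive (bitAt y i)
  bit-contents []          i       = refl
  bit-contents (true  ∷ y) zero    = refl
  bit-contents (false ∷ y) zero    = refl
  bit-contents (true  ∷ y) (suc i) = bit-contents y i
  bit-contents (false ∷ y) (suc i) = bit-contents y i

  runs-incIf : ∀ {s} r {p} → reg s 0 ≡ p → Runs (instr (incIf r)) s 1 (s [ r += bitAt y p ])
  runs-incIf {s} r {p} refl = runs-instr λ pc e → exec-instr pc e (effect pc)
    where
    effect : ∀ pc ts → Rep s ts →
      proj₁ (exec pc (incIf r) (Vec.map head ts)) ≡ suc pc ×
      Rep (s [ r += bitAt y p ]) (Vec.zipWith writeMove (proj₂ (exec pc (incIf r) (Vec.map head ts))) ts)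
    effect pc (t ∷ ts) R
      rewrite symAt-rep t ts {0} (s≤s z≤n) R | bit-contents y p
      with bitAt y p | bitAt-≤ y p
    ... | zero  | _       = refl , rep-cong (≈-sym (+=-zero s r)) (rep-still (t ∷ ts) R)
    ... | suc _ | s≤s z≤n = refl , rep-right t ts r R

  runs-write : ∀ {s} r {v} → 1 ≤ r → r < 2 + c → reg s r ≡ v →
    Runs (instr (write r)) s 1 (reg s , isPositive v ∷ out s)
  runs-write {s} r {v} 1≤r r<c e′ = runs-instr λ pc e → exec-instr pc e (effect pc)
    where
    blank-positive : ∀ v → isBlank (counter v) ≡ isPositive v
    blank-positive zero    = refl
    blank-positive (suc v) = refl
    after-left : ∀ (t : TapeS) b → after (writeMove (just (inj₁ b) , left) t) ≡ just (inj₁ b) ∷ after t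
    after-left (tape []       h rs) b = refl
    after-left (tape (l ∷ ls) h rs) b = refl
    effect : ∀ pc ts → Rep s ts →
      proj₁ (exec pc (write r) (Vec.map head ts)) ≡ suc pc ×
      Rep (reg s , isPositive v ∷ out s) (Vec.zipWith writeMove (proj₂ (exec pc (write r) (Vec.map head ts))) ts)
    effect pc (t ∷ ts) R@(rep j nj o-at i-at)
      rewrite symAt-counter t ts 1≤r r<c e′ R | blank-positive v | still-id ts =
      refl , rep j nj (trans (after-left t (isPositive v)) (cong (just (inj₁ (isPositive v)) ∷_) o-at)) i-at

  module _ {A : Set} (St : A → Store) (Inv : ℕ → A → Set) (g : ℕ → A → A) where

    -- `St` describes the store apart from the loop counter, which is zero in it. The counter is
    -- decreased before the body is entered, so the body meets the values from `n - 1` down to 0 in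
    -- it and can use it as the bound variable.
    runs-loop : ∀ {t body n} K → 1 ≤ t → t < 2 + c → (∀ a → reg (St a) t ≡ 0) →
      (∀ m a → m < n → Inv (suc m) a → Inv m (g m a) × Runs body (St a [ t += m ]) K (St (g m a) [ t += m ])) →
      ∀ N → n ≤ N → ∀ a → Inv n a → Runs (loop t body) (St a [ t += n ]) (suc (N * (2 + K))) (St (iterateDown g n a))
    runs-loop {t} {body} {n} K 1≤t t<c z h N n≤N a inv = runs λ pc p → enter pc p
      where
      exit : ℕ → ℕ
      exit pc = pc + suc (length (body (suc pc)) + 1)
      lemma : ∀ K R → 1 + (K + (1 + suc R)) ≡ suc (2 + K + R)
      lemma = solve-∀
      go : ∀ pc → fetch code pc ≡ just (decOr t (exit pc)) → Placed (suc pc) (body (suc pc)) →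
        fetch code (suc pc + length (body (suc pc))) ≡ just (jump pc) →
        ∀ m a → m ≤ n → Inv m a → Exec pc (St a [ t += m ]) (suc (m * (2 + K))) (exit pc) (St (iterateDown g m a))
      go pc e pb ej zero a m≤n i = Exec-cong (+=-zero (St a) t) ≈-refl ≤-refl refl (exec-decOr-zero 1≤t t<c (z a) e)
      go pc e pb ej (suc m) a m<n i with h m a m<n i
      ... | i′ , rb = Exec-cong ≈-refl ≈-refl (≤-reflexive (lemma K (m * (2 + K)))) refl
        (Exec-trans (exec-decOr-suc m 1≤t t<c (z a) e)
        (Exec-trans (runs-at rb (suc pc) pb)
        (Exec-trans (exec-jump ej) (go pc e pb ej m (g m a) (≤-trans (n≤1+n m) m<n) i′))))
      enter : ∀ pc → Placed pc (loop t body pc) →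
        Exec pc (St a [ t += n ]) (suc (N * (2 + K))) (pc + length (loop t body pc)) (St (iterateDown g n a))
      enter pc (e , p) with Placed-++ (suc pc) (body (suc pc)) (jump pc ∷ []) p
      ... | pb , ej , _ = Exec-cong ≈-refl ≈-refl (s≤s (*-monoˡ-≤ (2 + K) n≤N))
        (cong (λ l → pc + suc l) (sym (length-++ (body (suc pc)))))
        (go pc e pb ej n a ≤-refl inv)

-- Compilation of expressions

-- Reading a counter empties it; the second copy in `t` serves to restore it.
copyCounter : ℕ → ℕ → ℕ → Code
copyCounter r d t = loop r (instr (shift d right) ⍮ instr (shift t right)) ⍮ loop t (instr (shift r right))

-- Adds the value of the expression to counter d. The counters from f on are vacant:
-- they are zero before and after.
compile : ∀ {Γ} → Expr Γ → Vec ℕ Γ → ℕ → ℕ → Code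
compile here         (r ∷ env) d f = copyCounter r d f
compile (↑ e)        (r ∷ env) d f = compile e env d f
compile inputLength  env       d f = copyCounter 1 d f
compile one          env       d f = instr (shift d right)
compile (a ⊕ b)      env       d f = compile a env d f ⍮ compile b env d f
compile (∑ n e)      env       d f = compile n env f (1 + f) ⍮ loop f (compile e (f ∷ env) d (1 + f))
-- The cursor walks out by the value in `f`; the duplicate in `1 + f` leads it back after the bit
-- has been read.
compile (bit e)      env       d f =
  compile e env f (2 + f) ⍮ loop f (instr (shift (1 + f) right) ⍮ instr (shift 0 right)) ⍮
  instr (incIf d) ⍮ loop (1 + f) (instr (shift 0 left))
-- `f` holds the decreasing value, which is also the bound variable of `e`; `1 + f` counts the
-- rounds, and `2 + f` receives the amount to subtract.
compile (down n a e) env       d f =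
  compile a env f (3 + f) ⍮ compile n env (1 + f) (3 + f) ⍮
  loop (1 + f) (compile e (f ∷ env) (2 + f) (3 + f) ⍮ loop (2 + f) (instr (decrease f))) ⍮
  loop f (instr (shift d right))

scratch : ∀ {Γ} → Expr Γ → ℕ
scratch here         = 1
scratch (↑ e)        = scratch e
scratch inputLength  = 1
scratch one          = 0
scratch (a ⊕ b)      = scratch a + scratch b
scratch (∑ n e)      = 1 + (scratch n + scratch e)
scratch (bit e)      = 2 + scratch e
scratch (down n a e) = 3 + (scratch a + (scratch n + scratch e))

loopBound : Poly → Poly → Poly
loopBound n K = con 1 ⊞ n ⊠ (con 2 ⊞ K)

timeBound : ∀ {Γ} → Expr Γ → Poly
timeBound here         = loopBound X (con 2) ⊞ loopBound X (con 1)
timeBound (↑ e)        = timeBound e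
timeBound inputLength  = loopBound X (con 2) ⊞ loopBound X (con 1)
timeBound one          = con 1
timeBound (a ⊕ b)      = timeBound a ⊞ timeBound b
timeBound (∑ n e)      = timeBound n ⊞ loopBound (valueBound n) (timeBound e ⊚ (X ⊞ valueBound n))
timeBound (bit e)      =
  timeBound e ⊞ (loopBound (valueBound e) (con 2) ⊞ (con 1 ⊞ loopBound (valueBound e) (con 1)))
timeBound (down n a e) =
  timeBound a ⊞ (timeBound n ⊞
  (loopBound (valueBound n) (timeBound e ⊚ inner ⊞ loopBound (valueBound e ⊚ inner) (con 1)) ⊞
   loopBound (valueBound a) (con 1)))
  where
  inner = X ⊞ valueBound a

Each : ∀ {Γ} → (ℕ → ℕ → Set) → Vec ℕ Γ → Vec ℕ Γ → Set
Each P []        []      = ⊤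
Each P (r ∷ env) (v ∷ ρ) = P r v × Each P env ρ

Each-map : ∀ {Γ} {P Q : ℕ → ℕ → Set} → (∀ r v → P r v → Q r v) →
  ∀ (env ρ : Vec ℕ Γ) → Each P env ρ → Each Q env ρ
Each-map f []        []      _       = tt
Each-map f (r ∷ env) (v ∷ ρ) (p , q) = f r v p , Each-map f env ρ q

-- `d` differs from the counters of all variables, because the result accumulates in it while they
-- are still being read. By `2 ≤ d` it also differs from the cursor and from the length.
record Ready {Γ} (y : Word) (env ρ : Vec ℕ Γ) (d f : ℕ) (s : Store) : Set where
  field
    vacant   : ∀ i → f ≤ i → reg s i ≡ 0
    cursor : reg s 0 ≡ 0
    size   : reg s 1 ≡ length y
    vars   : Each (λ r v → 1 ≤ r × r < f × r ≢ d × reg s r ≡ v) env ρ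
    2≤d    : 2 ≤ d
    d<f    : d < f

open Ready

iterateDown-suc : ∀ n a → iterateDown (λ _ → suc) n a ≡ n + a
iterateDown-suc zero    a = refl
iterateDown-suc (suc n) a = trans (iterateDown-suc n (suc a)) (+-suc n a)

iterateDown-sum : ∀ f n a → iterateDown (λ m a → a + f m) n a ≡ a + sumTo n f
iterateDown-sum f zero    a = sym (+-identityʳ a)
iterateDown-sum f (suc n) a = trans (iterateDown-sum f n (a + f n)) (+-assoc a (f n) _)

iterateDown-pred : ∀ n a → iterateDown (λ _ a → a ∸ 1) n a ≡ a ∸ n
iterateDown-pred zero    a = refl
iterateDown-pred (suc n) a = trans (iterateDown-pred n (a ∸ 1)) (∸-+-assoc a 1 n)

iterateDown-descend : ∀ h n a → iterateDown (λ _ a → a ∸ h a) n a ≡ descend n h a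
iterateDown-descend h zero    a = refl
iterateDown-descend h (suc n) a = iterateDown-descend h n (a ∸ h a)

without : Store → ℕ → Store
without (σ , o) r = (λ i → if i ≡ᵇ r then 0 else σ i) , o

-- The loop rule speaks of a store in which the counter is zero, increased by the value of the
-- counter; this brings an arbitrary store into that form.
without-+= : ∀ s r {v} → reg s r ≡ v → s ≈ without s r [ r += v ]
without-+= s r {v} e = pointwise ∥ refl
  where
  pointwise : ∀ i → reg s i ≡ reg (without s r [ r += v ]) i
  pointwise i with i ≡ᵇ r in eq
  ... | true  = trans (cong (reg s) (≡ᵇ⇒≡ i r (subst T (sym eq) tt))) e
  ... | false = sym (+-identityʳ _)

reg-without-same : ∀ s r → reg (without s r) r ≡ 0
reg-without-same s r with r ≡ᵇ r in eq
... | true  = refl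
... | false = ⊥-elim (subst T eq (≡⇒≡ᵇ r r refl))

reg-without-other : ∀ s {r i} → i ≢ r → reg (without s r) i ≡ reg s i
reg-without-other s {r} {i} i≢r with i ≡ᵇ r in eq
... | true  = contradiction (≡ᵇ⇒≡ i r (subst T (sym eq) tt)) i≢r
... | false = refl

module _ {Γ : ℕ} {y : Word} {env ρ : Vec ℕ Γ} where

  ready-+= : ∀ {d f s} v → Ready y env ρ d f s → Ready y env ρ d f (s [ d += v ])
  ready-+= {d} {f} {s} v R = record
    { vacant   = λ i f≤i → trans (reg-other s {d} v (λ { refl → <⇒≱ (d<f R) f≤i })) (vacant R i f≤i)
    ; cursor = trans (reg-other s {d} v (λ { refl → case 2≤d R of λ () })) (cursor R)
    ; size   = trans (reg-other s {d} v (λ { refl → case 2≤d R of λ { (s≤s ()) } })) (size R)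
    ; vars   = Each-map (λ { r w (a , b , c , e) → a , b , c , trans (reg-other s {d} v c) e }) env ρ (vars R)
    ; 2≤d    = 2≤d R
    ; d<f    = d<f R
    }

  ready-out : ∀ {d f s o} → Ready y env ρ d f s → Ready y env ρ d f (reg s , o)
  ready-out R = record
    { vacant = vacant R ; cursor = cursor R ; size = size R ; vars = vars R ; 2≤d = 2≤d R ; d<f = d<f R }

  ready-scratch : ∀ {d f s} j k → j < k → Ready y env ρ d f s → Ready y env ρ (j + f) (k + f) s
  ready-scratch {d} {f} {s} j k j<k R = record
    { vacant   = λ i kf≤i → vacant R i (≤-trans (m≤n+m f k) kf≤i)
    ; cursor = cursor R
    ; size   = size R
    ; vars   = Each-map (λ { r w (a , b , c , e) →
                 a , ≤-trans b (m≤n+m f k) , (λ { refl → <⇒≱ b (m≤n+m f j) }) , e }) env ρ (vars R)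
    ; 2≤d    = ≤-trans (≤-trans (2≤d R) (<⇒≤ (d<f R))) (m≤n+m f j)
    ; d<f    = +-monoˡ-< f j<k
    }

  ready-bind : ∀ {d f s} v → Ready y env ρ d f s → Ready y (f ∷ env) (v ∷ ρ) d (1 + f) (s [ f += v ])
  ready-bind {d} {f} {s} v R = record
    { vacant   = λ i f<i → trans (reg-other s {f} v (λ { refl → <-irrefl refl f<i })) (vacant R i (<⇒≤ f<i))
    ; cursor = trans (reg-other s {f} v (λ { refl → case 2≤f of λ () })) (cursor R)
    ; size   = trans (reg-other s {f} v (λ { refl → case 2≤f of λ { (s≤s ()) } })) (size R)
    ; vars   = (≤-trans (s≤s z≤n) 2≤f , ≤-refl , (λ { refl → <-irrefl refl (d<f R) }) , reg-same s f (vacant R f ≤-refl))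
             , Each-map (λ { r w (a , b , c , e) → a , m<n⇒m<1+n b , c
                 , trans (reg-other s {f} v (λ { refl → <-irrefl refl b })) e }) env ρ (vars R)
    ; 2≤d    = 2≤d R
    ; d<f    = m<n⇒m<1+n (d<f R)
    }
    where
    2≤f : 2 ≤ f
    2≤f = ≤-trans (2≤d R) (<⇒≤ (d<f R))

  ready-drop : ∀ {r v d f s} → Ready y (r ∷ env) (v ∷ ρ) d f s → Ready y env ρ d f s
  ready-drop R = record
    { vacant = vacant R ; cursor = cursor R ; size = size R ; vars = proj₂ (vars R) ; 2≤d = 2≤d R ; d<f = d<f R }

  2≤-vacant : ∀ {d f s} → Ready y env ρ d f s → 2 ≤ f
  2≤-vacant R = ≤-trans (2≤d R) (<⇒≤ (d<f R))

+=-both : ∀ s d e a t m → s [ d += a ] [ e += a ] [ t += m ] [ d += 1 ] [ e += 1 ] ≈ s [ d += suc a ] [ e += suc a ] [ t += m ]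
+=-both s d e a t m = (λ i → trans
  (lemma (reg s i) ((at d put a) i) ((at e put a) i) ((at t put m) i) ((at d put 1) i) ((at e put 1) i))
  (cong₂ (λ p q → reg s i + p + q + (at t put m) i) (put-+ d 1 a i) (put-+ e 1 a i))) ∥ refl
  where
  lemma : ∀ x p q w u v → x + p + q + w + u + v ≡ x + (u + p) + (v + q) + w
  lemma = solve-∀

module Compiled (c : ℕ) (code : List Instr) (y : Word) where
  open Logic c code y public

  runs-move : ∀ s {t r n N} → 1 ≤ t → t < 2 + c → t ≢ r → reg s t ≡ 0 → n ≤ N →
    Runs (loop t (instr (shift r right))) (s [ t += n ]) (suc (N * 3)) (s [ r += n ])
  runs-move s {t} {r} {n} {N} 1≤t t<c t≢r z n≤N =
    runs-cong (+=-cong t n (≈-sym (+=-zero s r)))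
              (subst (λ v → s [ r += v ] ≈ s [ r += n ]) (sym (trans (iterateDown-suc n 0) (+-identityʳ n))) ≈-refl) ≤-refl
      (runs-loop (λ a → s [ r += a ]) (λ _ _ → ⊤) (λ _ → suc) 1 1≤t t<c
        (λ a → trans (reg-other s a t≢r) z)
        (λ m a _ _ → tt , runs-cong ≈-refl (body m a) ≤-refl (runs-inc r))
        N n≤N 0 tt)
    where
    body : ∀ m a → s [ r += a ] [ t += m ] [ r += 1 ] ≈ s [ r += suc a ] [ t += m ]
    body m a = ≈-trans (+=-swap (s [ r += a ]) t m r 1) (+=-cong t m
      (subst (λ v → s [ r += a ] [ r += 1 ] ≈ s [ r += v ]) (+-comm a 1) (+=-merge s r a 1)))

  runs-drain : ∀ s {t r n v N} → 1 ≤ t → t < 2 + c → 1 ≤ r → r < 2 + c → t ≢ r →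
    reg s t ≡ 0 → reg s r ≡ 0 → n ≤ N →
    Runs (loop t (instr (decrease r))) (s [ r += v ] [ t += n ]) (suc (N * 3)) (s [ r += v ∸ n ])
  runs-drain s {t} {r} {n} {v} {N} 1≤t t<c 1≤r r<c t≢r zt zr n≤N =
    runs-cong ≈-refl (subst (λ w → s [ r += w ] ≈ s [ r += v ∸ n ]) (sym (iterateDown-pred n v)) ≈-refl) ≤-refl
      (runs-loop (λ a → s [ r += a ]) (λ _ _ → ⊤) (λ _ a → a ∸ 1) 1 1≤t t<c
        (λ a → trans (reg-other s a t≢r) zt)
        (λ m a _ _ → tt , runs-cong (+=-swap s r a t m) (+=-swap s t m r (a ∸ 1)) ≤-refl
          (runs-decrease r a 1≤r r<c (trans (reg-other s m (t≢r ∘ sym)) zr)))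
        N n≤N v tt)

  runs-copy : ∀ s {r d t v N} → 1 ≤ r → r < 2 + c → 1 ≤ t → t < 2 + c → r ≢ d → r ≢ t → d ≢ t →
    reg s t ≡ 0 → reg s r ≡ v → v ≤ N →
    Runs (copyCounter r d t) s (suc (N * 4) + suc (N * 3)) (s [ d += v ])
  runs-copy s {r} {d} {t} {v} {N} 1≤r r<c 1≤t t<c r≢d r≢t d≢t z e v≤N = runs-⍮
    (runs-cong (≈-trans (without-+= s r e) (+=-cong r v (≈-sym (≈-trans (+=-zero _ t) (+=-zero s′ d)))))
               (subst (λ w → s′ [ d += w ] [ t += w ] ≈ s′ [ d += v ] [ t += v ])
                      (sym (trans (iterateDown-suc v 0) (+-identityʳ v))) ≈-refl) ≤-refl
      (runs-loop (λ a → s′ [ d += a ] [ t += a ]) (λ _ _ → ⊤) (λ _ → suc) 2 1≤r r<c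
        (λ a → trans (reg-other (s′ [ d += a ]) a r≢t) (trans (reg-other s′ a r≢d) (reg-without-same s r)))
        (λ m a _ _ → tt , runs-cong ≈-refl (+=-both s′ d t a r m) ≤-refl (runs-⍮ (runs-inc d) (runs-inc t)))
        N v≤N 0 tt))
    (runs-cong ≈-refl (≈-trans (+=-swap s′ d v r v) (+=-cong d v (≈-sym (without-+= s r e)))) ≤-refl
      (runs-move (s′ [ d += v ]) 1≤t t<c (r≢t ∘ sym)
        (trans (reg-other s′ v (d≢t ∘ sym)) (trans (reg-without-other s (r≢t ∘ sym)) z)) v≤N))
    where
    s′ = without s r

  runs-advance : ∀ s {t u n N} → 1 ≤ t → t < 2 + c → t ≢ u → t ≢ 0 → reg s t ≡ 0 → n ≤ N →
    Runs (loop t (instr (shift u right) ⍮ instr (shift 0 right))) (s [ t += n ]) (suc (N * 4)) (s [ u += n ] [ 0 += n ])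
  runs-advance s {t} {u} {n} {N} 1≤t t<c t≢u t≢0 z n≤N =
    runs-cong (+=-cong t n (≈-sym (≈-trans (+=-zero _ 0) (+=-zero s u))))
              (subst (λ w → s [ u += w ] [ 0 += w ] ≈ s [ u += n ] [ 0 += n ])
                     (sym (trans (iterateDown-suc n 0) (+-identityʳ n))) ≈-refl) ≤-refl
      (runs-loop (λ a → s [ u += a ] [ 0 += a ]) (λ _ _ → ⊤) (λ _ → suc) 2 1≤t t<c
        (λ a → trans (reg-other (s [ u += a ]) a t≢0) (trans (reg-other s a t≢u) z))
        (λ m a _ _ → tt , runs-cong ≈-refl (+=-both s u 0 a t m) ≤-refl (runs-⍮ (runs-inc u) (runs-inc 0)))
        N n≤N 0 tt)

  runs-retreat : ∀ s {t n N} → 1 ≤ t → t < 2 + c → t ≢ 0 → reg s t ≡ 0 → n ≤ N →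
    Runs (loop t (instr (shift 0 left))) (s [ 0 += n ] [ t += n ]) (suc (N * 3)) s
  runs-retreat s {t} {n} {N} 1≤t t<c t≢0 z n≤N =
    runs-cong ≈-refl (subst (λ w → s [ 0 += w ] ≈ s) (sym (vanishes n)) (+=-zero s 0)) ≤-refl
      (runs-loop (λ a → s [ 0 += a ]) (λ m a → a ≡ m) (λ m _ → m) 1 1≤t t<c
        (λ a → trans (reg-other s a t≢0) z)
        (λ { m .(suc m) _ refl → refl ,
             runs-cong (+=-swap s 0 (suc m) t m) (+=-swap s t m 0 m) ≤-refl (runs-dec 0 m) })
        N n≤N n refl)
    where
    vanishes : ∀ n → iterateDown (λ m _ → m) n n ≡ 0
    vanishes zero    = refl
    vanishes (suc n) = vanishes n

  fits : ∀ f a b {n} → f + (a + b) ≤ n → f + a ≤ n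
  fits f a b h = ≤-trans (+-monoʳ-≤ f (m≤m+n a b)) h

  fits′ : ∀ f a b {n} → f + (a + b) ≤ n → f + b ≤ n
  fits′ f a b h = ≤-trans (+-monoʳ-≤ f (m≤n+m b a)) h

  fits-suc : ∀ f k a {n} → f + (k + a) ≤ n → k + f + a ≤ n
  fits-suc f k a h = ≤-trans (≤-reflexive (lemma f k a)) h
    where
    lemma : ∀ f k a → k + f + a ≡ f + (k + a)
    lemma = solve-∀

  below : ∀ k f a {n} → suc k + f + a ≤ n → k + f < n
  below k f a h = ≤-trans (m≤m+n _ a) h

  compile-correct : ∀ {Γ} (e : Expr Γ) {env ρ d f s N} → Ready y env ρ d f s → f + scratch e ≤ 2 + c →
    length y ≤ N → ρ ≤* N → Runs (compile e env d f) s (⟦ timeBound e ⟧ᴾ N) (s [ d += ⟦ e ⟧ y ρ ])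
  compile-correct here {r ∷ env} {v ∷ ρ} {d} {f} {s} {N} R h y≤N (v≤N , _) with vars R
  ... | (1≤r , r<f , r≢d , e) , _ =
    runs-copy s 1≤r (≤-trans r<f (≤-trans (m≤m+n f 1) h)) (≤-trans (s≤s z≤n) (2≤-vacant R))
      (≤-trans (≤-reflexive (+-comm 1 f)) h) r≢d (λ { refl → <-irrefl refl r<f }) (λ { refl → <-irrefl refl (d<f R) })
      (vacant R f ≤-refl) e v≤N
  compile-correct (↑ e) {r ∷ env} {v ∷ ρ} R h y≤N (_ , ρ≤N) = compile-correct e (ready-drop R) h y≤N ρ≤N
  compile-correct inputLength {d = d} {f} {s} R h y≤N ρ≤N =
    runs-copy s (s≤s z≤n) (s≤s (s≤s z≤n)) (≤-trans (s≤s z≤n) (2≤-vacant R))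
      (≤-trans (≤-reflexive (+-comm 1 f)) h) (λ { refl → case 2≤d R of λ { (s≤s ()) } })
      (λ { refl → case 2≤-vacant R of λ { (s≤s ()) } }) (λ { refl → <-irrefl refl (d<f R) })
      (vacant R f ≤-refl) (size R) y≤N
  compile-correct one R h y≤N ρ≤N = runs-inc _
  compile-correct (a ⊕ b) {ρ = ρ} {d} {f} {s} R h y≤N ρ≤N = runs-cong ≈-refl (+=-merge s d _ _) ≤-refl (runs-⍮
    (compile-correct a R (fits f (scratch a) (scratch b) h) y≤N ρ≤N)
    (compile-correct b (ready-+= _ R) (fits′ f (scratch a) (scratch b) h) y≤N ρ≤N))
  compile-correct (∑ n e) {env} {ρ} {d} {f} {s} {N} R h y≤N ρ≤N = runs-⍮
    (compile-correct n (ready-scratch 0 1 (s≤s z≤n) R) (fits (1 + f) (scratch n) (scratch e) h′) y≤N ρ≤N)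
    (runs-cong (+=-cong f _ (≈-sym (+=-zero s d)))
               (subst (λ w → s [ d += w ] ≈ s [ d += ⟦ ∑ n e ⟧ y ρ ]) (sym (iterateDown-sum g (⟦ n ⟧ y ρ) 0)) ≈-refl)
               (s≤s ≤-refl)
      (runs-loop (λ a → s [ d += a ]) (λ _ _ → ⊤) (λ m a → a + g m) (⟦ timeBound e ⊚ (X ⊞ valueBound n) ⟧ᴾ N)
        (≤-trans (s≤s z≤n) (2≤-vacant R)) (below 0 f _ h′)
        (λ a → trans (reg-other s a (λ { refl → <-irrefl refl (d<f R) })) (vacant R f ≤-refl))
        (λ m a m<n _ → tt , body m a m<n)
        _ n≤ 0 tt))
    where
    g = λ i → ⟦ e ⟧ y (i ∷ ρ)
    h′ = fits-suc f 1 (scratch n + scratch e) h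
    n≤ = valueBound-correct y n ρ N y≤N ρ≤N
    body : ∀ m a → m < ⟦ n ⟧ y ρ → Runs (compile e (f ∷ env) d (1 + f)) (s [ d += a ] [ f += m ])
      (⟦ timeBound e ⊚ (X ⊞ valueBound n) ⟧ᴾ N) (s [ d += a + g m ] [ f += m ])
    body m a m<n rewrite ⊚-correct (timeBound e) (X ⊞ valueBound n) N =
      runs-cong ≈-refl (≈-trans (+=-swap (s [ d += a ]) f m d (g m)) (+=-cong f m (+=-merge s d a (g m)))) ≤-refl
        (compile-correct e (ready-bind m (ready-+= a R)) (fits′ (1 + f) (scratch n) (scratch e) h′)
          (≤-trans y≤N (m≤m+n N _))
          (≤-trans (<⇒≤ m<n) (≤-trans n≤ (m≤n+m _ N)) , ≤*-weaken (m≤m+n N _) ρ≤N))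
  compile-correct (bit e) {env} {ρ} {d} {f} {s} {N} R h y≤N ρ≤N = runs-⍮
    (compile-correct e (ready-scratch 0 2 (s≤s z≤n) R) h′ y≤N ρ≤N)
    (runs-⍮ (runs-advance s 1≤f (≤-trans (n≤1+n _) f<c) (m≢1+n+m f) (λ { refl → case 2≤-vacant R of λ () }) (vacant R f ≤-refl) e≤)
    (runs-⍮ (runs-incIf d (trans (reg-same (s [ 1 + f += v ]) 0 (trans (reg-other s {1 + f} v (λ ())) (cursor R))) refl))
    (runs-cong (≈-trans (+=-swap _ 0 v d b) (≈-trans (+=-cong 0 v (+=-swap s (1 + f) v d b)) (+=-swap _ (1 + f) v 0 v))) ≈-refl ≤-refl
      (runs-retreat (s [ d += b ]) (s≤s z≤n) f<c (λ ())
        (trans (reg-other s {d} b (λ { refl → <⇒≱ (d<f R) (n≤1+n _) })) (vacant R (1 + f) (n≤1+n f))) e≤))))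
    where
    v = ⟦ e ⟧ y ρ
    b = bitAt y v
    h′ = fits-suc f 2 (scratch e) h
    e≤ = valueBound-correct y e ρ N y≤N ρ≤N
    1≤f = ≤-trans (s≤s z≤n) (2≤-vacant R)
    f<c = below 1 f _ h′
  compile-correct (down n a e) {env} {ρ} {d} {f} {s} {N} R h y≤N ρ≤N = runs-⍮
    (compile-correct a (ready-scratch 0 3 (s≤s z≤n) R) (fits (3 + f) (scratch a) _ h′) y≤N ρ≤N)
    (runs-⍮ (compile-correct n (ready-scratch 0 2 (s≤s z≤n) (ready-drop (ready-bind A R))) hₙ y≤N ρ≤N)
    (runs-⍮ (subst (λ w → Runs _ (s [ f += A ] [ 1 + f += B ]) (⟦ loopBound (valueBound n) (timeBound e ⊚ inner ⊞ loopBound (valueBound e ⊚ inner) (con 1)) ⟧ᴾ N) (s [ f += w ])) (iterateDown-descend g B A)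
      (runs-loop (λ r → s [ f += r ]) (λ _ r → r ≤ A) (λ _ r → r ∸ g r) _
        (s≤s z≤n) (≤-trans (n≤1+n _) f<c)
        (λ r → trans (reg-other s r (m≢1+n+m f ∘ sym)) (vacant R (1 + f) (n≤1+n f)))
        (λ m r _ r≤A → ≤-trans (m∸n≤m r (g r)) r≤A , body m r r≤A)
        _ n≤ A ≤-refl))
    (runs-move s 1≤f (≤-trans (m≤n+m _ 2) f<c) (λ { refl → <-irrefl refl (d<f R) }) (vacant R f ≤-refl)
      (≤-trans (descend-≤ B g A) a≤))))
    where
    A = ⟦ a ⟧ y ρ
    B = ⟦ n ⟧ y ρ
    g = λ r → ⟦ e ⟧ y (r ∷ ρ)
    h′ = fits-suc f 3 (scratch a + (scratch n + scratch e)) h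
    h″ = fits′ (3 + f) (scratch a) _ h′
    hₙ = fits (3 + f) (scratch n) (scratch e) h″
    f<c = below 2 f _ h′
    1≤f = ≤-trans (s≤s z≤n) (2≤-vacant R)
    n≤ = valueBound-correct y n ρ N y≤N ρ≤N
    a≤ = valueBound-correct y a ρ N y≤N ρ≤N
    inner = X ⊞ valueBound a
    body : ∀ m r → r ≤ A →
      Runs (compile e (f ∷ env) (2 + f) (3 + f) ⍮ loop (2 + f) (instr (decrease f))) (s [ f += r ] [ 1 + f += m ])
        (⟦ timeBound e ⊚ inner ⊞ loopBound (valueBound e ⊚ inner) (con 1) ⟧ᴾ N) (s [ f += r ∸ g r ] [ 1 + f += m ])
    body m r r≤A rewrite ⊚-correct (timeBound e) inner N | ⊚-correct (valueBound e) inner N = runs-⍮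
      (compile-correct e (ready-scratch 0 1 (s≤s z≤n) (ready-drop (ready-bind m (ready-bind r R))))
        (fits′ (3 + f) (scratch n) (scratch e) h″) y≤ r≤)
      (runs-cong (+=-cong (2 + f) (g r) (+=-swap s f r (1 + f) m)) (+=-swap s (1 + f) m f (r ∸ g r)) ≤-refl
        (runs-drain (s [ 1 + f += m ]) (s≤s z≤n) f<c 1≤f (≤-trans (m≤n+m _ 2) f<c) (m≢1+n+m f ∘ sym)
          (trans (reg-other s m (m≢1+n+m (suc f) {0} ∘ sym)) (vacant R (2 + f) (m≤n+m f 2)))
          (trans (reg-other s m (m≢1+n+m f)) (vacant R f ≤-refl))
          (valueBound-correct y e (r ∷ ρ) _ y≤ r≤)))
      where
      y≤ = ≤-trans y≤N (m≤m+n N _)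
      r≤ : (r ∷ ρ) ≤* (N + ⟦ valueBound a ⟧ᴾ N)
      r≤ = ≤-trans r≤A (≤-trans a≤ (m≤n+m _ N)) , ≤*-weaken (m≤m+n N _) ρ≤N

-- Compilation of generators, and the complete machine

-- The output grows to the left, so the second part of a sequence has to run first. In the clause
-- for `emit`, the loop with empty body resets `f` to zero.
compileᴳ : ∀ {Γ} → Gen Γ → Vec ℕ Γ → ℕ → Code
compileᴳ (emit e)  env f = compile e env f (1 + f) ⍮ instr (write f) ⍮ loop f (λ _ → [])
compileᴳ (o ⨾ o′)  env f = compileᴳ o′ env f ⍮ compileᴳ o env f
compileᴳ (for n o) env f = compile n env f (1 + f) ⍮ loop f (compileᴳ o (f ∷ env) (1 + f))

scratchᴳ : ∀ {Γ} → Gen Γ → ℕ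
scratchᴳ (emit e)  = 1 + scratch e
scratchᴳ (o ⨾ o′)  = scratchᴳ o + scratchᴳ o′
scratchᴳ (for n o) = 1 + (scratch n + scratchᴳ o)

timeBoundᴳ : ∀ {Γ} → Gen Γ → Poly
timeBoundᴳ (emit e)  = timeBound e ⊞ (con 1 ⊞ loopBound (valueBound e) (con 0))
timeBoundᴳ (o ⨾ o′)  = timeBoundᴳ o′ ⊞ timeBoundᴳ o
timeBoundᴳ (for n o) = timeBound n ⊞ loopBound (valueBound n) (timeBoundᴳ o ⊚ (X ⊞ valueBound n))

iterateDown-concat : ∀ h n o → iterateDown (λ m o → h m ++ o) n o ≡ concatTo n h ++ o
iterateDown-concat h zero    o = refl
iterateDown-concat h (suc n) o = trans (iterateDown-concat h n (h n ++ o)) (sym (++-assoc (concatTo n h) (h n) o))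

-- After copying, the cursor stands behind the input. It is rewound by as many cells as counter 1
-- tells, with counter 2 as an intermediate copy that is zero again afterwards.
main : Gen 0 → Code
main g = copyCounter 1 2 3 ⍮ loop 2 (instr (shift 0 left)) ⍮ compileᴳ g [] 3

mainBound : Gen 0 → Poly
mainBound g = (loopBound X (con 2) ⊞ loopBound X (con 1)) ⊞ (loopBound X (con 1) ⊞ timeBoundᴳ g)

framed : Code → List Instr
framed body = (instr initialise ⍮ instr copy ⍮ body ⍮ instr finish) 0

leadingBits-symbols : ∀ o junk → leadingBits junk ≡ [] → leadingBits (symbols o ++ junk) ≡ o
leadingBits-symbols []      junk nj = nj
leadingBits-symbols (b ∷ o) junk nj = cong (b ∷_) (leadingBits-symbols o junk nj)

nth-inside : ∀ y i → i < length y → ∃[ b ] nth (symbols y) i ≡ just (inj₁ b)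
nth-inside (b ∷ y) zero    _       = b , refl
nth-inside (b ∷ y) (suc i) (s≤s p) = nth-inside y i p

nth-outside : ∀ y i → length y ≤ i → nth (symbols y) i ≡ nothing
nth-outside []      i       _       = refl
nth-outside (b ∷ y) (suc i) (s≤s p) = nth-outside y i p

leadingBits-blank : ∀ (ss : List Sym) → nth ss 0 ≡ nothing → leadingBits ss ≡ []
leadingBits-blank []             _ = refl
leadingBits-blank (nothing ∷ ss) _ = refl

module CompiledGen (c : ℕ) (code : List Instr) (y : Word) where
  open Compiled c code y public
  open Run (compiled code)

  compileᴳ-correct : ∀ {Γ} (o : Gen Γ) {env ρ f s N} → Ready y env ρ 2 f s → f + scratchᴳ o ≤ 2 + c →
    length y ≤ N → ρ ≤* N → Runs (compileᴳ o env f) s (⟦ timeBoundᴳ o ⟧ᴾ N) (reg s , ⟦ o ⟧ᴳ y ρ ++ out s)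
  compileᴳ-correct (emit e) {ρ = ρ} {f} {s} R h y≤N ρ≤N = runs-⍮
    (compile-correct e (ready-scratch 0 1 (s≤s z≤n) R) h′ y≤N ρ≤N)
    (runs-⍮ (runs-write f 1≤f f<c (reg-same s f (vacant R f ≤-refl)))
      (runs-loop {A = ⊤} (λ _ → s′) (λ _ _ → ⊤) (λ _ _ → tt) {body = λ _ → []} 0 1≤f f<c
        (λ _ → vacant R f ≤-refl)
        (λ m _ _ _ → tt , runs λ pc _ → executes λ ts r →
          ts , r , 0 , z≤n , subst (λ q → Steps 0 (conf pc ts) (conf q ts)) (sym (+-identityʳ pc)) done)
        _ (valueBound-correct y e ρ _ y≤N ρ≤N) tt tt))
    where
    s′ = reg s , isPositive (⟦ e ⟧ y ρ) ∷ out s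
    h′ = fits-suc f 1 (scratch e) h
    f<c = below 0 f (scratch e) h′
    1≤f = ≤-trans (s≤s z≤n) (2≤-vacant R)
  compileᴳ-correct (o ⨾ o′) {ρ = ρ} {f} {s} R h y≤N ρ≤N =
    runs-cong ≈-refl ((λ _ → refl) ∥ sym (++-assoc (⟦ o ⟧ᴳ y ρ) _ (out s))) ≤-refl (runs-⍮
      (compileᴳ-correct o′ R (fits′ f (scratchᴳ o) (scratchᴳ o′) h) y≤N ρ≤N)
      (compileᴳ-correct o (ready-out R) (fits f (scratchᴳ o) (scratchᴳ o′) h) y≤N ρ≤N))
  compileᴳ-correct (for n o) {env} {ρ} {f} {s} {N} R h y≤N ρ≤N = runs-⍮
    (compile-correct n (ready-scratch 0 1 (s≤s z≤n) R) (fits (1 + f) (scratch n) _ h′) y≤N ρ≤N)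
    (runs-cong ≈-refl ((λ _ → refl) ∥ iterateDown-concat g (⟦ n ⟧ y ρ) (out s)) ≤-refl
      (runs-loop (λ o → reg s , o) (λ _ _ → ⊤) (λ m o → g m ++ o) _
        (≤-trans (s≤s z≤n) (2≤-vacant R)) (below 0 f _ h′)
        (λ _ → vacant R f ≤-refl)
        (λ m a m<n _ → tt , body m a m<n)
        _ n≤ (out s) tt))
    where
    g = λ i → ⟦ o ⟧ᴳ y (i ∷ ρ)
    h′ = fits-suc f 1 (scratch n + scratchᴳ o) h
    n≤ = valueBound-correct y n ρ N y≤N ρ≤N
    body : ∀ m a → m < ⟦ n ⟧ y ρ → Runs (compileᴳ o (f ∷ env) (1 + f)) ((reg s , a) [ f += m ])
      (⟦ timeBoundᴳ o ⊚ (X ⊞ valueBound n) ⟧ᴾ N) ((reg s , g m ++ a) [ f += m ])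
    body m a m<n rewrite ⊚-correct (timeBoundᴳ o) (X ⊞ valueBound n) N =
      compileᴳ-correct o (ready-bind m (ready-out R)) (fits′ (1 + f) (scratch n) (scratchᴳ o) h′)
        (≤-trans y≤N (m≤m+n N _))
        (≤-trans (<⇒≤ m<n) (≤-trans n≤ (m≤n+m _ N)) , ≤*-weaken (m≤m+n N _) ρ≤N)

  -- Tape 2 moves along with the head on the input, so that counter 1 ends up holding the length of
  -- the input.
  Copying : ℕ → Tapes → Set
  Copying i (t₀ ∷ t₁ ∷ t₂ ∷ ts) =
    At (contents y 0) i t₀ × t₁ ≡ tape (prefixRev (contents y 0) i) nothing [] ×
    At counter i t₂ × (∀ j → At counter 0 (lookup ts j))

  copied : Store
  copied = ((λ _ → 0) , []) [ 0 += length y ] [ 1 += length y ]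

  Copying-step : ∀ {pc i} → fetch code pc ≡ just copy → i < length y → ∀ ts → Copying i ts →
    ∃[ ts′ ] Copying (suc i) ts′ × Steps 1 (conf pc ts) (conf pc ts′)
  Copying-step {pc} {i} e i<y (t₀ ∷ .(tape _ _ _) ∷ t₂ ∷ ts) (a , refl , a₂ , as) with nth-inside y i i<y
  ... | b , eq = _ , (at-right t₀ a , cong (λ s → tape (s ∷ prefixRev (contents y 0) i) nothing []) (head-at a)
                     , at-right t₂ a₂ , as) , more step≡ done
    where
    ts₀ = t₀ ∷ tape (prefixRev (contents y 0) i) nothing [] ∷ t₂ ∷ ts
    step≡ : step (conf pc ts₀) ≡ just (conf pc (move right t₀ ∷ tape (head t₀ ∷ prefixRev (contents y 0) i) nothing [] ∷
                                               move right t₂ ∷ ts))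
    not-blank : isBlank (head t₀) ≡ false
    not-blank = cong isBlank (trans (head-at a) eq)
    step≡ rewrite step-instr pc ts₀ e | not-blank | still-id ts = refl

  Copying-end : ∀ {pc} → fetch code pc ≡ just copy → ∀ ts → Copying (length y) ts →
    Rep copied ts × Steps 1 (conf pc ts) (conf (suc pc) ts)
  Copying-end {pc} e (t₀ ∷ .(tape _ _ _) ∷ t₂ ∷ ts) (a , refl , a₂ , as) = rep (after t₀)
    (leadingBits-blank (after t₀) (trans (after-at a 0) (nth-outside y _ (m≤n⇒m≤1+n (m≤m+n _ 0))))) refl
    (λ where
      zero          → subst (λ v → At (contents y 0) v (tape (prefixRev (contents y 0) (length y)) nothing [])) (sym (+-identityʳ (length y)))
                        (at refl (sym (nth-outside y _ ≤-refl)) (λ j → sym (nth-outside y _ (m≤n⇒m≤1+n (m≤m+n _ j)))))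
      (suc zero)    → a₂
      (suc (suc j)) → as j) , more step≡ done
    where
    ts₀ = t₀ ∷ tape (prefixRev (contents y 0) (length y)) nothing [] ∷ t₂ ∷ ts
    step≡ : step (conf pc ts₀) ≡ just (conf (suc pc) ts₀)
    is-blank : isBlank (head t₀) ≡ true
    is-blank = cong isBlank (trans (head-at a) (nth-outside y _ ≤-refl))
    step≡ rewrite step-instr pc ts₀ e | is-blank | still-id ts = refl

  Copying-run : ∀ {pc} → fetch code pc ≡ just copy → ∀ k i → i + k ≡ length y → ∀ ts → Copying i ts →
    ∃[ ts′ ] Rep copied ts′ × Steps (k + 1) (conf pc ts) (conf (suc pc) ts′)
  Copying-run e zero i i+k ts C rewrite trans (sym (+-identityʳ i)) i+k with Copying-end e ts C
  ... | R , st = ts , R , st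
  Copying-run e (suc k) i i+k ts C
    with Copying-step e (≤-trans (≤-trans (m≤m+n (suc i) k) (≤-reflexive (sym (+-suc i k)))) (≤-reflexive i+k)) ts C
  ... | ts′ , C′ , st with Copying-run e k (suc i) (trans (sym (+-suc i k)) i+k) ts′ C′
  ... | ts″ , R , st′ = ts″ , R , Steps-++ st st′

  start-input : ∀ y → At (contents y 0) 0 (writeWord y)
  start-input []      = at refl refl (λ j → refl)
  start-input (b ∷ y) = at refl refl (λ j → refl)

  blanks : Tapes
  blanks = writeWord y ∷ Vec.replicate (2 + c) blankTape

  initialised : Tapes
  initialised = Vec.zipWith writeMove (proj₂ (exec 0 initialise (Vec.map head blanks))) blanks

  Copying-start : Copying 0 initialised
  Copying-start = start-input y , refl , at refl refl (λ _ → refl) , marked c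
    where
    marked : ∀ n (j : Fin n) → At counter 0
      (lookup (Vec.zipWith writeMove (Vec.map (λ _ → marker , stay) (Vec.map head (Vec.replicate n blankTape)))
        (Vec.replicate n blankTape)) j)
    marked (suc n) zero    = at refl refl (λ _ → refl)
    marked (suc n) (suc j) = marked n j

  -- The head waits on the cell for the next letter, one to the left of the output; a single move to
  -- the right takes it to the place where reading begins.
  finish-output : ∀ {pc s ts} → Rep s ts →
    output (conf pc (Vec.zipWith writeMove (proj₂ (exec pc finish (Vec.map head ts))) ts)) ≡ out s
  finish-output {s = s} {t ∷ ts} (rep junk nj o-at _) =
    trans (read t) (trans (cong leadingBits o-at) (leadingBits-symbols (out s) junk nj))
    where
    read : ∀ (t : TapeS) → readWord (move right t) ≡ leadingBits (after t)
    read (tape ls h [])       = refl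
    read (tape ls h (r ∷ rs)) = refl

  placed-self : ∀ (pre is : List Instr) → pre ++ is ≡ code → Placed (length pre) is
  placed-self pre []       eq = tt
  placed-self pre (i ∷ is) eq = trans (cong (λ c → fetch c (length pre)) (sym eq)) (fetch-here pre)
    , subst (λ n → Placed n is) (trans (length-++ pre) (+-comm (length pre) 1))
        (placed-self (pre ++ i ∷ []) is (trans (++-assoc pre (i ∷ []) is) eq))
    where
    fetch-here : ∀ pre → fetch (pre ++ i ∷ is) (length pre) ≡ just i
    fetch-here []        = refl
    fetch-here (_ ∷ pre) = fetch-here pre

  framed-computes : ∀ body {B s} → framed body ≡ code → Runs body copied B s →
    ComputesWithin (1 + ((length y + 1) + (B + 1))) y (out s)
  framed-computes body {B} {s} code≡ runs-body with placed-self [] (framed body) code≡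
  ... | e₀ , e₁ , p with Placed-++ 2 (body 2) (finish ∷ []) p
  ... | pm , ef , _ with Copying-run e₁ (length y) 0 refl initialised Copying-start
  ... | ts₁ , R₁ , st₁ with exec-on (runs-at runs-body 2 pm) ts₁ R₁
  ... | ts₂ , R₂ , n , n≤ , st₂ =
    subst (λ c → Halted c × output c ≡ out s) (sym final) (halts , finish-output {pc = end} R₂)
    where
    end : ℕ
    end = 2 + length (body 2)
    length-code : length code ≡ suc end
    length-code = trans (cong length (sym code≡)) (cong (2 +_) (trans (length-++ (body 2)) (+-comm _ 1)))
    ts₃ : Tapes
    ts₃ = Vec.zipWith writeMove (proj₂ (exec end finish (Vec.map head ts₂))) ts₂
    goes : ∀ ts → step (conf end ts) ≡
      just (conf (suc end) (Vec.zipWith writeMove (proj₂ (exec end finish (Vec.map head ts))) ts))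
    goes (t ∷ ts) = step-instr end (t ∷ ts) ef
    halts : Halted (conf (suc end) ts₃)
    halts rewrite sym length-code | fetch-end code = refl
    final : run (1 + ((length y + 1) + (B + 1))) (initial y) ≡ conf (suc end) ts₃
    final = Steps-run
      (Steps-++ (more (step-instr 0 blanks e₀) done) (Steps-++ st₁ (Steps-++ st₂ (more (goes ts₂) done))))
      (s≤s (+-monoʳ-≤ (length y + 1) (+-monoˡ-≤ 1 n≤))) halts

  initial-ready : Ready y [] [] 2 3 (((λ _ → 0) , []) [ 1 += length y ])
  initial-ready = record
    { vacant   = λ { (suc zero) (s≤s ()) ; (suc (suc i)) _ → refl }
    ; cursor = refl
    ; size   = refl
    ; vars   = tt
    ; 2≤d    = ≤-refl
    ; d<f    = ≤-refl
    }

  runs-main : ∀ g → 3 + scratchᴳ g ≤ 2 + c → 4 ≤ 2 + c → Runs (main g) copied (⟦ mainBound g ⟧ᴾ (length y))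
    (reg (((λ _ → 0) , []) [ 1 += length y ]) , ⟦ g ⟧ᴳ y [] ++ [])
  runs-main g fits 4≤ = runs-⍮
    (runs-copy copied (s≤s z≤n) (s≤s (s≤s z≤n)) (s≤s z≤n) 4≤ (λ ()) (λ ()) (λ ()) refl refl ≤-refl)
    (runs-⍮
      (runs-cong (+=-cong 2 (length y) (+=-swap ((λ _ → 0) , []) 0 (length y) 1 (length y))) ≈-refl ≤-refl
        (runs-retreat (((λ _ → 0) , []) [ 1 += length y ]) (s≤s z≤n) (≤-trans (n≤1+n 3) 4≤) (λ ()) refl ≤-refl))
      (compileᴳ-correct g initial-ready fits ≤-refl tt))

runtime : Gen 0 → Poly
runtime g = con 1 ⊞ ((X ⊞ con 1) ⊞ (mainBound g ⊞ con 1))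

Gen-polyTime : (g : Gen 0) → PolyTime (λ y → ⟦ g ⟧ᴳ y [])
Gen-polyTime g = Execution.compiled c (framed (main g)) , coefficients (runtime g) , λ y →
  subst₂ (λ n o → Run.ComputesWithin (Execution.compiled c (framed (main g))) n y o)
    (sym (coefficients-eval (runtime g) (length y))) (++-identityʳ _) (computes y)
  where
  -- This gives `4 + scratchᴳ g` counters: cursor, length and counter 2 are reserved, and counter 3
  -- is used for rewinding the cursor even if `g` itself asks for no scratch.
  c = 2 + scratchᴳ g
  computes : ∀ y → _
  computes y = framed-computes (main g) refl (runs-main g (n≤1+n _) (s≤s (s≤s (s≤s (s≤s z≤n)))))
    where open CompiledGen c (framed (main g)) y

-- Division with remainder, and finite tables

toBit : Bool → ℕ
toBit false = 0
toBit true  = 1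

sumTo-cong : ∀ n {f g} → (∀ i → i < n → f i ≡ g i) → sumTo n f ≡ sumTo n g
sumTo-cong zero    h = refl
sumTo-cong (suc n) h = cong₂ _+_ (h n ≤-refl) (sumTo-cong n (λ i i<n → h i (m<n⇒m<1+n i<n)))

concatTo-cong : ∀ n {f g} → (∀ i → i < n → f i ≡ g i) → concatTo n f ≡ concatTo n g
concatTo-cong zero    h = refl
concatTo-cong (suc n) h = cong₂ _++_ (concatTo-cong n (λ i i<n → h i (m<n⇒m<1+n i<n))) (h n ≤-refl)

descend-cong : ∀ n {g h} → (∀ r → g r ≡ h r) → ∀ r → descend n g r ≡ descend n h r
descend-cong zero    e r = refl
descend-cong (suc n) {g} {h} e r rewrite e r = descend-cong n e (r ∸ h r)

sumTo-const : ∀ n v → sumTo n (λ _ → v) ≡ n * v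
sumTo-const zero    v = refl
sumTo-const (suc n) v = cong (v +_) (sumTo-const n v)

allTo : ℕ → (ℕ → Bool) → Bool
allTo zero    f = true
allTo (suc n) f = f n ∧ allTo n f

opaque
  -- For positive `b`, this counts the positive multiples of `b` up to `a`, a sum being what
  -- expressions offer. It is opaque so that the large terms to come are compared without unfolding
  -- it.
  quot : ℕ → ℕ → ℕ
  quot a b = sumTo a (λ i → toBit (suc i * b ≤ᵇ a))

  rem : ℕ → ℕ → ℕ
  rem a b = a ∸ quot a b * b

  quot-def : ∀ a b → sumTo a (λ i → toBit (suc i * b ≤ᵇ a)) ≡ quot a b
  quot-def a b = refl

  rem-def : ∀ a b → a ∸ quot a b * b ≡ rem a b
  rem-def a b = refl

T-≡ : ∀ {b} → T b → b ≡ true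
T-≡ {true} _ = refl

≡-T : ∀ {b} → b ≡ true → T b
≡-T refl = tt

bool-ext : ∀ {a b} → (T a → T b) → (T b → T a) → a ≡ b
bool-ext {false} {false} f g = refl
bool-ext {false} {true}  f g = ⊥-elim (g tt)
bool-ext {true}  {false} f g = ⊥-elim (f tt)
bool-ext {true}  {true}  f g = refl

sumTo-below : ∀ n {q} → q ≤ n → sumTo n (λ i → toBit (i <ᵇ q)) ≡ q
sumTo-below zero    z≤n = refl
sumTo-below (suc n) {q} q≤n with n <ᵇ q in eq
... | true  = trans (cong suc (trans (sumTo-cong n (λ i i<n → cong toBit
                (trans (T-≡ (<⇒<ᵇ (<-trans i<n n<q))) (sym (T-≡ (<⇒<ᵇ i<n)))))) (sumTo-below n ≤-refl)))
                (≤-antisym n<q q≤n)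
  where n<q = <ᵇ⇒< n q (≡-T eq)
... | false = sumTo-below n (≮⇒≥ (λ n<q → subst T eq (<⇒<ᵇ n<q)))

sumTo-count : ∀ n {q} {f : ℕ → Bool} → q ≤ n → (∀ i → i < n → f i ≡ (i <ᵇ q)) → sumTo n (toBit ∘ f) ≡ q
sumTo-count n q≤n h = trans (sumTo-cong n (λ i i<n → cong toBit (h i i<n))) (sumTo-below n q≤n)

quot-+ : ∀ q {r b} → r < b → quot (q * b + r) b ≡ q
quot-+ q {r} {b} r<b = trans (sym (quot-def (q * b + r) b)) (sumTo-count (q * b + r) q≤ (λ i _ → bool-ext (to i) (from i)))
  where
  1≤b = ≤-trans (s≤s z≤n) r<b
  q≤ : q ≤ q * b + r
  q≤ = ≤-trans (≤-trans (≤-reflexive (sym (*-identityʳ q))) (*-monoʳ-≤ q 1≤b)) (m≤m+n _ r)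
  to : ∀ i → T (suc i * b ≤ᵇ q * b + r) → T (i <ᵇ q)
  to i h = <⇒<ᵇ (*-cancelʳ-< b i q (+-cancelˡ-< b _ _ (≤-<-trans (≤ᵇ⇒≤ _ _ h)
    (≤-trans (+-monoʳ-< (q * b) r<b) (≤-reflexive (+-comm (q * b) b))))))
  from : ∀ i → T (i <ᵇ q) → T (suc i * b ≤ᵇ q * b + r)
  from i h = ≤⇒≤ᵇ (≤-trans (*-monoˡ-≤ b (<ᵇ⇒< i q h)) (m≤m+n _ r))

rem-+ : ∀ q {r b} → r < b → rem (q * b + r) b ≡ r
rem-+ q {r} {b} r<b = trans (sym (rem-def (q * b + r) b))
  (trans (cong (λ p → q * b + r ∸ p * b) (quot-+ q r<b)) (m+n∸m≡n (q * b) r))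

split< : ∀ a b {n} → n < a * b → ∃[ q ] ∃[ r ] q < a × r < b × n ≡ q * b + r
split< (suc a) b {n} n< with n <? b
... | yes n<b = 0 , n , s≤s z≤n , n<b , refl
... | no  n≮b with split< a b {n ∸ b} (+-cancelˡ-< b _ _ (≤-<-trans (≤-reflexive (m+[n∸m]≡n (≮⇒≥ n≮b))) n<))
... | q , r , q<a , r<b , e = suc q , r , s≤s q<a , r<b ,
  trans (sym (m+[n∸m]≡n (≮⇒≥ n≮b))) (trans (cong (b +_) e) (sym (+-assoc b (q * b) r)))

quot< : ∀ a b {n} → n < a * b → quot n b < a
quot< a b n< with split< a b n<
... | q , r , q<a , r<b , refl rewrite quot-+ q r<b = q<a

rem< : ∀ a b {n} → n < a * b → rem n b < b
rem< a b n< with split< a b n<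
... | q , r , q<a , r<b , refl rewrite rem-+ q r<b = r<b

quot-rem : ∀ a b {n} → n < a * b → n ≡ quot n b * b + rem n b
quot-rem a b n< with split< a b n<
... | q , r , q<a , r<b , refl rewrite rem-+ q r<b | quot-+ q r<b = refl

combine< : ∀ {a b q r} → q < a → r < b → q * b + r < a * b
combine< {a} {b} {q} {r} q<a r<b = ≤-trans (+-monoʳ-< (q * b) r<b)
  (≤-trans (≤-reflexive (+-comm (q * b) b)) (*-monoˡ-≤ b q<a))

-- Makes an arbitrary function on a fixed finite range expressible, as a case distinction of
-- constant size; the transition table of a machine will be such a function.
tabled : ℕ → (ℕ → ℕ) → ℕ → ℕ
tabled zero    f v = 0
tabled (suc n) f v = if v ≡ᵇ n then f n else tabled n f v

tabled-val : ∀ n f {v} → v < n → tabled n f v ≡ f v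
tabled-val (suc n) f {v} v<n with v ≡ᵇ n in eq
... | true  = cong f (sym (≡ᵇ⇒≡ v n (≡-T eq)))
... | false = tabled-val n f (≤∧≢⇒< (s≤s⁻¹ v<n) (λ v≡n → subst T eq (≡⇒≡ᵇ v n v≡n)))

lookup₂ : ℕ → ℕ → (ℕ → ℕ → ℕ) → ℕ → ℕ → ℕ
lookup₂ a b f i j = tabled (a * b) (λ z → f (quot z b) (rem z b)) (i * b + j)

lookup₂-val : ∀ {a b} f {i j} → i < a → j < b → lookup₂ a b f i j ≡ f i j
lookup₂-val {a} {b} f {i} i<a j<b =
  trans (tabled-val (a * b) _ (combine< i<a j<b)) (cong₂ f (quot-+ i j<b) (rem-+ i j<b))

lookup₂-≤ : ∀ a b f B → (∀ i j → f i j ≤ B) → ∀ i j → lookup₂ a b f i j ≤ B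
lookup₂-≤ a b f B h i j = go (a * b)
  where
  go : ∀ n → tabled n (λ z → f (quot z b) (rem z b)) (i * b + j) ≤ B
  go zero    = z≤n
  go (suc n) with i * b + j ≡ᵇ n
  ... | true  = h _ _
  ... | false = go n

-- Terms, tests and writers with a prescribed meaning

module Terms {A : Set} (input : A → Word) where

  -- The function is stored along with the expression computing it, so that it can
  -- be chosen to be definitionally the one needed.
  record Term (Γ : ℕ) : Set where
    constructor term
    field
      expr    : Expr Γ
      val     : A → Vec ℕ Γ → ℕ
      correct : ∀ a ρ → ⟦ expr ⟧ (input a) ρ ≡ val a ρ

  record Test (Γ : ℕ) : Set where
    constructor test
    field
      exprᵇ    : Expr Γ
      valᵇ     : A → Vec ℕ Γ → Bool
      correctᵇ : ∀ a ρ → ⟦ exprᵇ ⟧ (input a) ρ ≡ toBit (valᵇ a ρ)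

  record Writer (Γ : ℕ) : Set where
    constructor writer
    field
      gen      : Gen Γ
      valʷ     : A → Vec ℕ Γ → Word
      correctʷ : ∀ a ρ → ⟦ gen ⟧ᴳ (input a) ρ ≡ valʷ a ρ

  open Term public
  open Test public
  open Writer public

  infixl 6 _+ᴱ_ _∸ᴱ_
  infixl 7 _*ᴱ_
  infix  4 _≤ᴱ_ _<ᴱ_ _≡ᴱ_
  infixr 3 _∧ᴱ_
  infixr 2 _∨ᴱ_
  infixr 1 _⨾ᴱ_

  variable
    Γ : ℕ

  varExpr : Fin Γ → Expr Γ
  varExpr zero    = here
  varExpr (suc i) = ↑ varExpr i

  varᴱ : Fin Γ → Term Γ
  varᴱ i = term (varExpr i) (λ _ ρ → lookup ρ i) (λ a → go i)
    where
    go : ∀ {Γ a} (i : Fin Γ) ρ → ⟦ varExpr i ⟧ (input a) ρ ≡ lookup ρ i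
    go zero    (v ∷ ρ) = refl
    go (suc i) (v ∷ ρ) = go i ρ

  wkᴱ : Term Γ → Term (suc Γ)
  wkᴱ t = term (↑ expr t) (λ a ρ → val t a (Vec.tail ρ)) λ { a (v ∷ ρ) → correct t a ρ }

  lenᴱ : Term Γ
  lenᴱ = term inputLength (λ a _ → length (input a)) (λ _ _ → refl)

  _+ᴱ_ _∸ᴱ_ _*ᴱ_ : Term Γ → Term Γ → Term Γ
  s +ᴱ t = term (expr s ⊕ expr t) (λ a ρ → val s a ρ + val t a ρ) (λ a ρ → cong₂ _+_ (correct s a ρ) (correct t a ρ))
  -- A single round of descent, with a decrement independent of the current value.
  s ∸ᴱ t = term (down one (expr s) (↑ expr t)) (λ a ρ → val s a ρ ∸ val t a ρ)
    (λ a ρ → cong₂ _∸_ (correct s a ρ) (correct t a ρ))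
  s *ᴱ t = term (∑ (expr s) (↑ expr t)) (λ a ρ → val s a ρ * val t a ρ)
    (λ a ρ → trans (sumTo-const (⟦ expr s ⟧ (input a) ρ) (⟦ expr t ⟧ (input a) ρ)) (cong₂ _*_ (correct s a ρ) (correct t a ρ)))

  litExpr : ℕ → Expr Γ
  litExpr zero    = down one one one
  litExpr (suc n) = one ⊕ litExpr n

  litᴱ : ℕ → Term Γ
  litᴱ n = term (litExpr n) (λ _ _ → n) (go n)
    where
    go : ∀ {Γ} n a (ρ : Vec ℕ Γ) → ⟦ litExpr n ⟧ (input a) ρ ≡ n
    go zero    a ρ = refl
    go (suc n) a ρ = cong suc (go n a ρ)

  ∑ᴱ : Term Γ → Term (suc Γ) → Term Γ
  ∑ᴱ n t = term (∑ (expr n) (expr t)) (λ a ρ → sumTo (val n a ρ) (λ i → val t a (i ∷ ρ)))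
    (λ a ρ → trans (cong (λ n → sumTo n _) (correct n a ρ)) (sumTo-cong (val n a ρ) (λ i _ → correct t a (i ∷ ρ))))

  descendᴱ : Term Γ → Term Γ → Term (suc Γ) → Term Γ
  descendᴱ n s t = term (down (expr n) (expr s) (expr t))
    (λ a ρ → descend (val n a ρ) (λ r → val t a (r ∷ ρ)) (val s a ρ))
    (λ a ρ → trans (cong₂ (λ n s → descend n _ s) (correct n a ρ) (correct s a ρ))
                   (descend-cong (val n a ρ) (λ r → correct t a (r ∷ ρ)) (val s a ρ)))

  bitᴱ : Term Γ → Test Γ
  bitᴱ t = test (bit (expr t)) (λ a ρ → isPositive (bitAt (input a) (val t a ρ)))
    (λ a ρ → trans (cong (bitAt (input a)) (correct t a ρ)) (lemma (input a) (val t a ρ)))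
    where
    lemma : ∀ y i → bitAt y i ≡ toBit (isPositive (bitAt y i))
    lemma y i with bitAt y i | bitAt-≤ y i
    ... | zero  | _       = refl
    ... | suc _ | s≤s z≤n = refl

  bitValueᴱ : Term Γ → Term Γ
  bitValueᴱ t = term (bit (expr t)) (λ a ρ → bitAt (input a) (val t a ρ)) (λ a ρ → cong (bitAt (input a)) (correct t a ρ))

  indᴱ : Test Γ → Term Γ
  indᴱ b = term (exprᵇ b) (λ a ρ → toBit (valᵇ b a ρ)) (correctᵇ b)

  asTest : (t : Term Γ) (f : A → Vec ℕ Γ → Bool) → (∀ a ρ → val t a ρ ≡ toBit (f a ρ)) → Test Γ
  asTest t f h = test (expr t) f (λ a ρ → trans (correct t a ρ) (h a ρ))

  asTerm : (t : Term Γ) (f : A → Vec ℕ Γ → ℕ) → (∀ a ρ → val t a ρ ≡ f a ρ) → Term Γ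
  asTerm t f h = term (expr t) f (λ a ρ → trans (correct t a ρ) (h a ρ))

  _≤ᴱ_ _<ᴱ_ _≡ᴱ_ : Term Γ → Term Γ → Test Γ
  s ≤ᴱ t = asTest (litᴱ 1 ∸ᴱ (s ∸ᴱ t)) (λ a ρ → val s a ρ ≤ᵇ val t a ρ) (λ a ρ → lemma (val s a ρ) (val t a ρ))
    where
    lemma : ∀ m n → 1 ∸ (m ∸ n) ≡ toBit (m ≤ᵇ n)
    lemma zero    n       = cong (1 ∸_) (0∸n≡0 n)
    lemma (suc m) zero    = 0∸n≡0 m
    lemma (suc m) (suc n) = trans (lemma m n) (cong toBit (bool-ext (λ h → ≤⇒≤ᵇ (s≤s (≤ᵇ⇒≤ m n h)))
      (λ h → ≤⇒≤ᵇ (s≤s⁻¹ (≤ᵇ⇒≤ (suc m) (suc n) h)))))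
  s <ᴱ t = asTest (litᴱ 1 ∸ᴱ (litᴱ 1 +ᴱ s ∸ᴱ t)) (λ a ρ → val s a ρ <ᵇ val t a ρ) (λ a ρ → lemma (val s a ρ) (val t a ρ))
    where
    lemma : ∀ m n → 1 ∸ (suc m ∸ n) ≡ toBit (m <ᵇ n)
    lemma m       zero    = 0∸n≡0 m
    lemma zero    (suc n) = cong (1 ∸_) (0∸n≡0 n)
    lemma (suc m) (suc n) = lemma m n
  s ≡ᴱ t = asTest (litᴱ 1 ∸ᴱ ((s ∸ᴱ t) +ᴱ (t ∸ᴱ s))) (λ a ρ → val s a ρ ≡ᵇ val t a ρ) (λ a ρ → lemma (val s a ρ) (val t a ρ))
    where
    lemma : ∀ m n → 1 ∸ ((m ∸ n) + (n ∸ m)) ≡ toBit (m ≡ᵇ n)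
    lemma zero    zero    = refl
    lemma zero    (suc n) = 0∸n≡0 n
    lemma (suc m) zero    = 0∸n≡0 (m + 0)
    lemma (suc m) (suc n) = lemma m n

  notᴱ : Test Γ → Test Γ
  notᴱ b = asTest (litᴱ 1 ∸ᴱ indᴱ b) (λ a ρ → not (valᵇ b a ρ)) (λ a ρ → lemma (valᵇ b a ρ))
    where
    lemma : ∀ b → 1 ∸ toBit b ≡ toBit (not b)
    lemma false = refl
    lemma true  = refl

  _∧ᴱ_ _∨ᴱ_ : Test Γ → Test Γ → Test Γ
  b ∧ᴱ c = asTest (indᴱ b *ᴱ indᴱ c) (λ a ρ → valᵇ b a ρ ∧ valᵇ c a ρ) (λ a ρ → lemma (valᵇ b a ρ) (valᵇ c a ρ))
    where
    lemma : ∀ b c → toBit b * toBit c ≡ toBit (b ∧ c)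
    lemma false c = refl
    lemma true  c = *-identityˡ (toBit c)
  b ∨ᴱ c = asTest (litᴱ 1 ∸ᴱ (litᴱ 1 ∸ᴱ (indᴱ b +ᴱ indᴱ c))) (λ a ρ → valᵇ b a ρ ∨ valᵇ c a ρ)
    (λ a ρ → lemma (valᵇ b a ρ) (valᵇ c a ρ))
    where
    lemma : ∀ b c → 1 ∸ (1 ∸ (toBit b + toBit c)) ≡ toBit (b ∨ c)
    lemma false false = refl
    lemma false true  = refl
    lemma true  c     = cong (1 ∸_) (0∸n≡0 (toBit c))

  ifᴱ : Test Γ → Term Γ → Term Γ → Term Γ
  ifᴱ b s t = asTerm (indᴱ b *ᴱ s +ᴱ indᴱ (notᴱ b) *ᴱ t) (λ a ρ → if valᵇ b a ρ then val s a ρ else val t a ρ)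
    (λ a ρ → lemma (valᵇ b a ρ) (val s a ρ) (val t a ρ))
    where
    lemma : ∀ b s t → toBit b * s + toBit (not b) * t ≡ (if b then s else t)
    lemma false s t = *-identityˡ t
    lemma true  s t = trans (+-identityʳ _) (*-identityˡ s)

  ∀ᴱ : Term Γ → Test (suc Γ) → Test Γ
  ∀ᴱ n b = asTest (litᴱ 1 ∸ᴱ ∑ᴱ n (indᴱ (notᴱ b))) (λ a ρ → allTo (val n a ρ) (λ i → valᵇ b a (i ∷ ρ)))
    (λ a ρ → lemma (val n a ρ) (λ i → valᵇ b a (i ∷ ρ)))
    where
    lemma : ∀ n f → 1 ∸ sumTo n (λ i → toBit (not (f i))) ≡ toBit (allTo n f)
    lemma zero    f = refl
    lemma (suc n) f with f n
    ... | true  = lemma n f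
    ... | false = 0∸n≡0 (sumTo n (λ i → toBit (not (f i))))

  quotᴱ remᴱ : Term Γ → Term Γ → Term Γ
  quotᴱ s t = asTerm (∑ᴱ s (indᴱ ((litᴱ 1 +ᴱ varᴱ zero) *ᴱ wkᴱ t ≤ᴱ wkᴱ s)))
    (λ a ρ → quot (val s a ρ) (val t a ρ)) (λ a ρ → quot-def (val s a ρ) (val t a ρ))
  remᴱ s t = asTerm (s ∸ᴱ quotᴱ s t *ᴱ t)
    (λ a ρ → rem (val s a ρ) (val t a ρ)) (λ a ρ → rem-def (val s a ρ) (val t a ρ))

  polyᴱ : Poly → Term Γ → Term Γ
  polyᴱ X       t = t
  polyᴱ (con a) t = litᴱ a
  polyᴱ (p ⊞ q) t = polyᴱ p t +ᴱ polyᴱ q t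
  polyᴱ (p ⊠ q) t = polyᴱ p t *ᴱ polyᴱ q t

  polyᴱ-val : ∀ p (t : Term Γ) a ρ → val (polyᴱ p t) a ρ ≡ ⟦ p ⟧ᴾ (val t a ρ)
  polyᴱ-val X       t a ρ = refl
  polyᴱ-val (con n) t a ρ = refl
  polyᴱ-val (p ⊞ q) t a ρ = cong₂ _+_ (polyᴱ-val p t a ρ) (polyᴱ-val q t a ρ)
  polyᴱ-val (p ⊠ q) t a ρ = cong₂ _*_ (polyᴱ-val p t a ρ) (polyᴱ-val q t a ρ)

  evalᴱ : Poly → Term Γ → Term Γ
  evalᴱ p t = asTerm (polyᴱ p t) (λ a ρ → ⟦ p ⟧ᴾ (val t a ρ)) (polyᴱ-val p t)

  tableᴱ : ℕ → (ℕ → ℕ) → Term Γ → Term Γ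
  tableᴱ n f t = asTerm (go n) (λ a ρ → tabled n f (val t a ρ)) (go-val n)
    where
    go : ℕ → Term _
    go zero    = litᴱ 0
    go (suc n) = ifᴱ (t ≡ᴱ litᴱ n) (litᴱ (f n)) (go n)
    go-val : ∀ n a ρ → val (go n) a ρ ≡ tabled n f (val t a ρ)
    go-val zero    a ρ = refl
    go-val (suc n) a ρ = cong (if val t a ρ ≡ᵇ n then f n else_) (go-val n a ρ)

  table₂ᴱ : ℕ → ℕ → (ℕ → ℕ → ℕ) → Term Γ → Term Γ → Term Γ
  table₂ᴱ a b f s t = tableᴱ (a * b) (λ z → f (quot z b) (rem z b)) (s *ᴱ litᴱ b +ᴱ t)

  emitᴱ : Test Γ → Writer Γ
  emitᴱ b = writer (emit (exprᵇ b)) (λ a ρ → valᵇ b a ρ ∷ [])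
    (λ a ρ → cong (_∷ []) (trans (cong isPositive (correctᵇ b a ρ)) (lemma (valᵇ b a ρ))))
    where
    lemma : ∀ b → isPositive (toBit b) ≡ b
    lemma false = refl
    lemma true  = refl

  _⨾ᴱ_ : Writer Γ → Writer Γ → Writer Γ
  o ⨾ᴱ o′ = writer (gen o ⨾ gen o′) (λ a ρ → valʷ o a ρ ++ valʷ o′ a ρ)
    (λ a ρ → cong₂ _++_ (correctʷ o a ρ) (correctʷ o′ a ρ))

  forᴱ : Term Γ → Writer (suc Γ) → Writer Γ
  forᴱ n o = writer (for (expr n) (gen o)) (λ a ρ → concatTo (val n a ρ) (λ i → valʷ o a (i ∷ ρ)))
    (λ a ρ → trans (cong (λ n → concatTo n _) (correct n a ρ)) (concatTo-cong (val n a ρ) (λ i _ → correctʷ o a (i ∷ ρ))))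

-- Counting by finite sums

sumTo-∃ : ∀ n f → 1 ≤ sumTo n f → ∃[ i ] i < n × 1 ≤ f i
sumTo-∃ (suc n) f h with f n in eq
... | suc v = n , ≤-refl , ≤-trans (s≤s z≤n) (≤-reflexive (sym eq))
... | zero with sumTo-∃ n f h
...   | i , i<n , p = i , m<n⇒m<1+n i<n , p

term≤sumTo : ∀ n f {i} → i < n → f i ≤ sumTo n f
term≤sumTo (suc n) f {i} i<n with i ≟ n
... | yes refl = m≤m+n (f n) _
... | no  i≢n  = ≤-trans (term≤sumTo n f (≤∧≢⇒< (s≤s⁻¹ i<n) i≢n)) (m≤n+m _ (f n))

sumTo-mono : ∀ n {f g} → (∀ i → i < n → f i ≤ g i) → sumTo n f ≤ sumTo n g
sumTo-mono zero    h = z≤n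
sumTo-mono (suc n) h = +-mono-≤ (h n ≤-refl) (sumTo-mono n (λ i i<n → h i (m<n⇒m<1+n i<n)))

sumTo-≤1 : ∀ n f → (∀ i → i < n → f i ≤ 1) → (∀ i j → i < n → j < n → 1 ≤ f i → 1 ≤ f j → i ≡ j) → sumTo n f ≤ 1
sumTo-≤1 zero    f small unique = z≤n
sumTo-≤1 (suc n) f small unique with f n in eq
... | zero  = sumTo-≤1 n f (λ i p → small i (m<n⇒m<1+n p)) (λ i j p q → unique i j (m<n⇒m<1+n p) (m<n⇒m<1+n q))
... | suc v = +-mono-≤ {suc v} {1} (≤-trans (≤-reflexive (sym eq)) (small n ≤-refl)) (≮⇒≥ λ h → case sumTo-∃ n f h of λ where
  (i , i<n , p) → <-irrefl (unique i n (m<n⇒m<1+n i<n) ≤-refl p (≤-trans (s≤s z≤n) (≤-reflexive (sym eq)))) i<n)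

-- Each term is at most 1, so a single zero would leave at most `n - 1` for the whole sum.
sumTo-full : ∀ n f → (∀ i → i < n → f i ≤ 1) → n ≤ sumTo n f → ∀ i → i < n → 1 ≤ f i
sumTo-full (suc n) f small h i i<n with i ≟ n
... | yes refl = +-cancelʳ-≤ n 1 (f i) (≤-trans h (+-monoʳ-≤ (f i)
                   (≤-trans (sumTo-≤ n f 1 (λ j p → small j (m<n⇒m<1+n p))) (≤-reflexive (*-identityʳ n)))))
... | no  i≢n  = sumTo-full n f (λ j p → small j (m<n⇒m<1+n p))
                   (+-cancelˡ-≤ 1 n _ (≤-trans h (+-monoˡ-≤ _ (small n ≤-refl)))) i (≤∧≢⇒< (s≤s⁻¹ i<n) i≢n)

sumTo-head : ∀ n f → sumTo (suc n) f ≡ f 0 + sumTo n (f ∘ suc)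
sumTo-head zero    f = refl
sumTo-head (suc n) f = trans (cong (f (suc n) +_) (sumTo-head n f)) (lemma (f (suc n)) (f 0) _)
  where
  lemma : ∀ a b c → a + (b + c) ≡ b + (a + c)
  lemma = solve-∀

sumTo-+ : ∀ m n f → sumTo (m + n) f ≡ sumTo m (λ i → f (i + n)) + sumTo n f
sumTo-+ zero    n f = refl
sumTo-+ (suc m) n f = trans (cong (f (m + n) +_) (sumTo-+ m n f)) (sym (+-assoc (f (m + n)) _ _))

sumTo-* : ∀ m n f → sumTo (m * n) f ≡ sumTo m (λ i → sumTo n (λ j → f (i * n + j)))
sumTo-* zero    n f = refl
sumTo-* (suc m) n f = trans (sumTo-+ n (m * n) f) (cong₂ _+_
  (sumTo-cong n (λ i _ → cong f (+-comm i (m * n)))) (sumTo-* m n f))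

extend : ∀ {n} {A : Set} → A → (Fin n → A) → ℕ → A
extend {zero}  d f i       = d
extend {suc n} d f zero    = f zero
extend {suc n} d f (suc i) = extend d (f ∘ suc) i

extend-toℕ : ∀ {n} {A : Set} (d : A) (f : Fin n → A) i → extend d f (toℕ i) ≡ f i
extend-toℕ d f zero    = refl
extend-toℕ d f (suc i) = extend-toℕ d (f ∘ suc) i

sum-tabulate : ∀ n (f : Fin n → ℕ) g → (∀ i → f i ≡ g (toℕ i)) → Vec.sum (Vec.tabulate f) ≡ sumTo n g
sum-tabulate zero    f g h = refl
sum-tabulate (suc n) f g h = trans (cong₂ _+_ (h zero) (sum-tabulate n (f ∘ suc) (g ∘ suc) (h ∘ suc)))
  (sym (sumTo-head n g))

minimum-greatest : ∀ k .{{_ : NonZero k}} (f : Fin k → ℕ) q → q ≤ minimum f ⇔ (∀ j → q ≤ f j)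
minimum-greatest (suc k) f q = mk⇔ (to k f) (from k f)
  where
  to : ∀ k (f : Fin (suc k) → ℕ) → q ≤ minimum f → ∀ j → q ≤ f j
  to zero    f h zero    = h
  to (suc k) f h zero    = ≤-trans h (m⊓n≤m (f zero) _)
  to (suc k) f h (suc j) = to k (f ∘ suc) (≤-trans h (m⊓n≤n (f zero) _)) j
  from : ∀ k (f : Fin (suc k) → ℕ) → (∀ j → q ≤ f j) → q ≤ minimum f
  from zero    f h = h zero
  from (suc k) f h = ⊓-glb (h zero) (from k (f ∘ suc) (h ∘ suc))

∧-proj₁ : ∀ {a b} → a ∧ b ≡ true → a ≡ true
∧-proj₁ {true} {b} e = refl

∧-proj₂ : ∀ {a b} → a ∧ b ≡ true → b ≡ true
∧-proj₂ {true} {b} e = e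

∧-intro : ∀ {a b} → a ≡ true → b ≡ true → a ∧ b ≡ true
∧-intro refl refl = refl

∨-elim : ∀ {a b} → a ∨ b ≡ true → a ≡ true ⊎ b ≡ true
∨-elim {true}  e = inj₁ refl
∨-elim {false} e = inj₂ e

∨-introˡ : ∀ {a b} → a ≡ true → a ∨ b ≡ true
∨-introˡ refl = refl

∨-introʳ : ∀ {a b} → b ≡ true → a ∨ b ≡ true
∨-introʳ {true}  e = refl
∨-introʳ {false} e = e

not-true : ∀ {a} → not a ≡ true → a ≢ true
not-true {false} _ ()

not-intro : ∀ {a} → a ≢ true → not a ≡ true
not-intro {false} _ = refl
not-intro {true}  h = contradiction refl h

≡ᵇ-sound : ∀ {m n} → (m ≡ᵇ n) ≡ true → m ≡ n
≡ᵇ-sound {m} {n} e = ≡ᵇ⇒≡ m n (≡-T e)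

≡ᵇ-complete : ∀ {m n} → m ≡ n → (m ≡ᵇ n) ≡ true
≡ᵇ-complete {m} {n} e = T-≡ (≡⇒≡ᵇ m n e)

-- Rook's graphs and their colorings as selections

-- A partial rook's graph: vertices are cells with a row and a column label.
module _ (row col : ℕ → ℕ) where

  cellAdj : ℕ → ℕ → Bool
  cellAdj u v = ((row u ≡ᵇ row v) ∨ (col u ≡ᵇ col v)) ∧ not (u ≡ᵇ v)

  cellAdj-sound : ∀ {u v} → T (cellAdj u v) → (row u ≡ row v ⊎ col u ≡ col v) × u ≢ v
  cellAdj-sound {u} {v} t with ∨-elim (∧-proj₁ (T-≡ t)) | not-true (∧-proj₂ {(row u ≡ᵇ row v) ∨ (col u ≡ᵇ col v)} (T-≡ t))
  ... | inj₁ e | u≢v = inj₁ (≡ᵇ-sound e) , u≢v ∘ ≡ᵇ-complete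
  ... | inj₂ e | u≢v = inj₂ (≡ᵇ-sound e) , u≢v ∘ ≡ᵇ-complete

  cellAdj-complete : ∀ {u v} → row u ≡ row v ⊎ col u ≡ col v → u ≢ v → T (cellAdj u v)
  cellAdj-complete {u} {v} (inj₁ e) u≢v = ≡-T (∧-intro (∨-introˡ (≡ᵇ-complete e)) (not-intro (u≢v ∘ ≡ᵇ-sound)))
  cellAdj-complete {u} {v} (inj₂ e) u≢v = ≡-T (∧-intro (∨-introʳ {row u ≡ᵇ row v} (≡ᵇ-complete e)) (not-intro (u≢v ∘ ≡ᵇ-sound)))

  cellGraph : ∀ n → Graph (Fin n)
  cellGraph n = record
    { adj        = λ u v → cellAdj (toℕ u) (toℕ v)
    ; adj-sym    = λ {u} {v} t → case cellAdj-sound {toℕ u} {toℕ v} t of λ where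
        (inj₁ e , u≢v) → cellAdj-complete (inj₁ (sym e)) (u≢v ∘ sym)
        (inj₂ e , u≢v) → cellAdj-complete (inj₂ (sym e)) (u≢v ∘ sym)
    ; adj-irrefl = λ {u} {v} u≡v t → proj₂ (cellAdj-sound {toℕ u} {toℕ v} t) (cong toℕ u≡v)
    }

module _ {n : ℕ} where

  profit-sumTo : ∀ (p : Fin n → ℕ) (Y : Vec Bool n) →
    profit p Y ≡ sumTo n (λ i → if extend false (lookup Y) i then extend 0 p i else 0)
  profit-sumTo p Y = sum-tabulate n _ _ λ i → sym
    (cong₂ (λ b v → if b then v else 0) (extend-toℕ false (lookup Y) i) (extend-toℕ 0 p i))

-- The default 0 outside the range yields a function on all numbers, which can be applied without a
-- proof that its argument is in range.
choose : ∀ n {P : ℕ → ℕ → Set} → (∀ i → i < n → ∃[ v ] P i v) → ∃[ φ ] ∀ i → i < n → P i (φ i)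
choose n {P} h = φ , proof
  where
  pick : ∀ i → Dec (i < n) → ℕ
  pick i (yes p) = proj₁ (h i p)
  pick i (no  _) = 0
  φ : ℕ → ℕ
  φ i = pick i (i <? n)
  proof : ∀ i → i < n → P i (φ i)
  proof i p with i <? n
  ... | yes q = proj₂ (h i q)
  ... | no ¬q = contradiction p ¬q

module Selections (k R S : ℕ) (allowed : ℕ → ℕ → ℕ → Bool) where

  -- `injective` expresses independence along the columns; along the rows it is built into
  -- functions. `distinct` expresses disjointness and compares within one row, as a common cell has
  -- one row; different classes may attack each other.
  record Selection : Set where
    field
      φ         : ℕ → ℕ → ℕ
      range     : ∀ {j r} → j < k → r < R → φ j r < S
      permitted : ∀ {j r} → j < k → r < R → allowed j r (φ j r) ≡ true
      injective : ∀ {j r r′} → j < k → r < R → r′ < R → φ j r ≡ φ j r′ → r ≡ r′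
      distinct  : ∀ {i j r} → i < k → j < k → r < R → φ i r ≡ φ j r → i ≡ j

  rowOf colOf : ℕ → ℕ
  rowOf u = quot u S
  colOf u = rem u S

  selectionInstance : FairDivisionInstance k
  selectionInstance = record
    { n     = R * S
    ; graph = cellGraph rowOf colOf (R * S)
    ; p     = λ j u → toBit (allowed (toℕ j) (rowOf (toℕ u)) (colOf (toℕ u)))
    ; q     = R
    }

  open FairDivisionInstance selectionInstance

  cell-injective : ∀ {u v} → u < R * S → v < R * S → rowOf u ≡ rowOf v → colOf u ≡ colOf v → u ≡ v
  cell-injective u< v< r c = trans (quot-rem R S u<) (trans (cong₂ (λ a b → a * S + b) r c) (sym (quot-rem R S v<)))

  module _ .{{_ : NonZero k}} where

    selection⇒coloring : Selection → ∃[ Y ] q ≤ satisfaction {G = graph} p Y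
    selection⇒coloring σ = coloring , Equivalence.from (minimum-greatest k _ R) λ j →
      ≤-trans (enough j) (≤-reflexive (sym (sum-tabulate (R * S) _ _ (value j))))
      where
      open Selection σ
      chosen : ℕ → ℕ → Bool
      chosen j u = colOf u ≡ᵇ φ j (rowOf u)
      member : ∀ {j u} → u ∈ˢ Vec.tabulate (λ u → chosen j (toℕ u)) → colOf (toℕ u) ≡ φ j (rowOf (toℕ u))
      member {j} {u} u∈ = ≡ᵇ-sound (trans (sym (Vecₚ.lookup∘tabulate (λ u → chosen j (toℕ u)) u)) (Vecₚ.[]=⇒lookup u∈))
      coloring : PartialColoring k graph
      coloring = record
        { class       = λ j → Vec.tabulate (λ u → chosen (toℕ j) (toℕ u))
        ; independent = λ j {u} {v} u∈ v∈ t → case cellAdj-sound rowOf colOf t of λ where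
            (inj₁ e , u≢v) → u≢v (cell-injective (toℕ<n u) (toℕ<n v) e
              (trans (member u∈) (trans (cong (φ (toℕ j)) e) (sym (member v∈)))))
            (inj₂ e , u≢v) → u≢v (cell-injective (toℕ<n u) (toℕ<n v)
              (injective (toℕ<n j) (quot< R S (toℕ<n u)) (quot< R S (toℕ<n v))
                (trans (sym (member u∈)) (trans e (member v∈)))) e)
        ; disjoint    = λ i j i≢j → λ { (u , u∈) → case x∈p∩q⁻ _ _ u∈ of λ where
            (u∈i , u∈j) → i≢j (toℕ-injective (distinct (toℕ<n i) (toℕ<n j) (quot< R S (toℕ<n u))
              (trans (sym (member u∈i)) (member u∈j)))) }
        }
      gain : ℕ → ℕ → ℕ
      gain j u = if chosen j u then toBit (allowed j (rowOf u) (colOf u)) else 0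
      value : ∀ j u → (if lookup (PartialColoring.class coloring j) u then p j u else 0) ≡ gain (toℕ j) (toℕ u)
      value j u rewrite Vecₚ.lookup∘tabulate (λ u → chosen (toℕ j) (toℕ u)) u = refl
      gain-at : ∀ {j u} → colOf u ≡ φ j (rowOf u) → allowed j (rowOf u) (colOf u) ≡ true → 1 ≤ gain j u
      gain-at e al rewrite ≡ᵇ-complete e | al = ≤-refl
      gain-chosen : ∀ {j r} → j < k → r < R → 1 ≤ gain j (r * S + φ j r)
      gain-chosen {j} {r} j<k r<R = gain-at (trans (rem-+ r s<S) (cong (φ j) (sym (quot-+ r s<S))))
        (trans (cong₂ (allowed j) (quot-+ r s<S) (rem-+ r s<S)) (permitted j<k r<R))
        where s<S = range j<k r<R
      enough : ∀ j → R ≤ sumTo (R * S) (gain (toℕ j))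
      enough j = ≤-trans (≤-reflexive (trans (sym (*-identityʳ R)) (sym (sumTo-const R 1))))
        (≤-trans (sumTo-mono R (λ r r<R → ≤-trans (gain-chosen (toℕ<n j) r<R)
          (term≤sumTo S (λ s → gain (toℕ j) (r * S + s)) (range (toℕ<n j) r<R))))
          (≤-reflexive (sym (sumTo-* R S (gain (toℕ j))))))

    -- A row is a clique, so a class owns at most one cell of it and gains at most 1 there. A total
    -- of `R` from `R` rows forces a gain in every row, and only allowed cells yield a gain.
    coloring⇒selection : (Y : PartialColoring k graph) → q ≤ satisfaction {G = graph} p Y → Selection
    coloring⇒selection Y h = record
      { φ         = φ
      ; range     = λ j<k r<R → proj₁ (φ-good _ j<k _ r<R)
      ; permitted = λ j<k r<R → proj₂ (proj₂ (φ-good _ j<k _ r<R))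
      ; injective = λ {j} {r} {r′} j<k r<R r′<R e → injective j<k r<R r′<R (φ-good j j<k r r<R) (φ-good j j<k r′ r′<R) e
      ; distinct  = λ {i} {j} {r} i<k j<k r<R e → distinct i<k j<k r<R (φ-good i i<k r r<R) (φ-good j j<k r r<R) e
      }
      where
      open PartialColoring Y
      In : ℕ → ℕ → Set
      In j u = Σ (j < k) λ j<k → Σ (u < R * S) λ u< → fromℕ< u< ∈ˢ class (fromℕ< j<k)
      Good : ℕ → ℕ → ℕ → Set
      Good j r s = s < S × In j (r * S + s) × allowed j r s ≡ true
      gain : Fin k → ℕ → ℕ
      gain j u = if extend false (lookup (class j)) u then extend 0 (p j) u else 0
      gain-in : ∀ j {u} (u< : u < R * S) → 1 ≤ gain j u → fromℕ< u< ∈ˢ class j × allowed (toℕ j) (rowOf u) (colOf u) ≡ true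
      gain-in j {u} u< g with
          trans (cong (extend false (lookup (class j))) (sym (toℕ-fromℕ< u<))) (extend-toℕ false (lookup (class j)) (fromℕ< u<))
        | trans (cong (extend 0 (p j)) (sym (toℕ-fromℕ< u<))) (extend-toℕ 0 (p j) (fromℕ< u<))
      ... | e₁ | e₂ rewrite e₁ | e₂ | toℕ-fromℕ< u< with lookup (class j) (fromℕ< u<) in eq | allowed (toℕ j) (rowOf u) (colOf u)
      ... | true  | true  = Vecₚ.lookup⇒[]= (fromℕ< u<) (class j) eq , refl
      ... | true  | false = case g of λ ()
      ... | false | _     = case g of λ ()
      independentℕ : ∀ {j u v} → In j u → In j v → rowOf u ≡ rowOf v ⊎ colOf u ≡ colOf v → u ≡ v
      independentℕ {j} {u} {v} (j<k , u< , u∈) (j<k′ , v< , v∈) e with u ≟ v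
      ... | yes u≡v = u≡v
      ... | no  u≢v = ⊥-elim (independent (fromℕ< j<k) u∈ v∈
        (subst₂ (λ a b → T (cellAdj rowOf colOf a b)) (sym (toℕ-fromℕ< u<)) (sym (toℕ-fromℕ< v<)) (cellAdj-complete rowOf colOf e u≢v)))
      row-gain : Fin k → ℕ → ℕ
      row-gain j r = sumTo S (λ s → gain j (r * S + s))
      small : ∀ j r → r < R → row-gain j r ≤ 1
      small j r r<R = sumTo-≤1 S _ bounded unique
        where
        bounded : ∀ s → s < S → gain j (r * S + s) ≤ 1
        bounded s s<S with extend false (lookup (class j)) (r * S + s)
        ... | false = z≤n
        ... | true rewrite trans (cong (extend 0 (p j)) (sym (toℕ-fromℕ< (combine< r<R s<S)))) (extend-toℕ 0 (p j) (fromℕ< (combine< r<R s<S)))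
          with allowed (toℕ j) (rowOf (toℕ (fromℕ< (combine< r<R s<S)))) (colOf (toℕ (fromℕ< (combine< r<R s<S))))
        ... | true  = ≤-refl
        ... | false = z≤n
        into : ∀ {s} → s < S → 1 ≤ gain j (r * S + s) → In (toℕ j) (r * S + s)
        into {s} s<S g = toℕ<n j , combine< r<R s<S
          , subst (λ i → fromℕ< (combine< r<R s<S) ∈ˢ class i) (sym (fromℕ<-toℕ j (toℕ<n j))) (proj₁ (gain-in j (combine< r<R s<S) g))
        unique : ∀ s s′ → s < S → s′ < S → 1 ≤ gain j (r * S + s) → 1 ≤ gain j (r * S + s′) → s ≡ s′
        unique s s′ s<S s′<S g g′ = +-cancelˡ-≡ (r * S) s s′
          (independentℕ (into s<S g) (into s′<S g′) (inj₁ (trans (quot-+ r s<S) (sym (quot-+ r s′<S)))))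
      total : ∀ j → R ≤ sumTo R (row-gain j)
      total j = ≤-trans (Equivalence.to (minimum-greatest k _ R) h j)
        (≤-reflexive (trans (profit-sumTo (p j) (class j)) (sumTo-* R S (gain j))))
      pick : ∀ j → j < k → ∀ r → r < R → ∃[ s ] Good j r s
      pick j j<k r r<R with sumTo-∃ S _ (sumTo-full R (row-gain (fromℕ< j<k)) (small (fromℕ< j<k)) (total (fromℕ< j<k)) r r<R)
      ... | s , s<S , g with gain-in (fromℕ< j<k) (combine< r<R s<S) g
      ... | u∈ , al = s , s<S , (j<k , combine< r<R s<S , u∈) ,
        trans (cong₂ (allowed j) (sym (quot-+ r s<S)) (sym (rem-+ r s<S)))
          (subst (λ j → allowed j (rowOf (r * S + s)) (colOf (r * S + s)) ≡ true) (toℕ-fromℕ< j<k) al)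
      φ-all : ∃[ φ ] ∀ j → j < k → ∀ r → r < R → Good j r (φ j r)
      φ-all = (λ j → proj₁ (table j)) , λ j j<k r r<R → proj₂ (table j) r r<R j<k
        where
        table : ∀ j → ∃[ f ] ∀ r → r < R → (j < k → Good j r (f r))
        table j = choose R λ r r<R → row r r<R (j <? k)
          where
          row : ∀ r → r < R → Dec (j < k) → ∃[ s ] (j < k → Good j r s)
          row r r<R (yes j<k) = proj₁ (pick j j<k r r<R) , λ _ → proj₂ (pick j j<k r r<R)
          row r r<R (no  j≮k) = 0 , λ j<k → contradiction j<k j≮k
      φ = proj₁ φ-all
      φ-good = proj₂ φ-all
      injective : ∀ {j r r′} → j < k → r < R → r′ < R → Good j r (φ j r) → Good j r′ (φ j r′) → φ j r ≡ φ j r′ → r ≡ r′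
      injective {j} {r} {r′} j<k r<R r′<R (s< , in₁ , _) (s′< , in₂ , _) e =
        trans (sym (quot-+ r s<)) (trans (cong rowOf (independentℕ in₁ in₂
          (inj₂ (trans (rem-+ r s<) (trans e (sym (rem-+ r′ s′<))))))) (quot-+ r′ s′<))
      distinct : ∀ {i j r} → i < k → j < k → r < R → Good i r (φ i r) → Good j r (φ j r) → φ i r ≡ φ j r → i ≡ j
      distinct {i} {j} {r} _ _ r<R (s< , (i<k , u< , u∈) , _) (_ , (j<k , v< , v∈) , _) e with i ≟ j
      ... | yes i≡j = i≡j
      ... | no  i≢j = ⊥-elim (disjoint (fromℕ< i<k) (fromℕ< j<k)
        (λ f → i≢j (trans (sym (toℕ-fromℕ< i<k)) (trans (cong toℕ f) (toℕ-fromℕ< j<k))))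
        (fromℕ< u< , x∈p∩q⁺ (u∈ ,
          subst (λ w → w ∈ˢ class (fromℕ< j<k)) (toℕ-injective (trans (toℕ-fromℕ< v<) (trans (cong (r * S +_) (sym e)) (sym (toℕ-fromℕ< u<))))) v∈)))

-- Cells and line graphs of bipartite graphs

edge-≡ : ∀ {m} (H : Graph (Fin m)) {i j i′ j′ p p′ t t′} → i ≡ i′ → j ≡ j′ →
  _≡_ {A = Edge H} (i , j , p , t) (i′ , j′ , p′ , t′)
edge-≡ H {i} {j} {p = p} {p′} {t} {t′} refl refl =
  cong₂ (λ p t → i , j , p , t) (Finₚ.<-irrelevant p p′) (T-irrelevant t t′)

module CellLineGraph (row col : ℕ → ℕ) (n m₁ m₂ : ℕ)
  (row< : ∀ {u} → u < n → row u < m₁) (col< : ∀ {u} → u < n → col u < m₂)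
  (cell-injective : ∀ {u v} → u < n → v < n → row u ≡ row v → col u ≡ col v → u ≡ v) where

  private
    M = m₁ + m₂

    -- Rows are the vertices below `m₁`, columns the others. Thus the row of an edge is its smaller
    -- endpoint, in accordance with the order in which `Edge` lists them.
    Joined : Fin M → Fin M → Set
    Joined i j = ∃[ u ] toℕ i ≡ row (toℕ {n} u) × toℕ j ≡ m₁ + col (toℕ u)

    joined? : ∀ i j → Dec (Joined i j)
    joined? i j = Finₚ.any? (λ u → (toℕ i ≟ row (toℕ u)) ×-dec (toℕ j ≟ m₁ + col (toℕ u)))

    joined-left : ∀ {i j} → Joined i j → toℕ i < m₁
    joined-left (u , e , _) = ≤-trans (≤-reflexive (cong suc e)) (row< (toℕ<n u))

    joined-right : ∀ {i j} → Joined i j → m₁ ≤ toℕ j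
    joined-right (u , _ , e) = ≤-trans (m≤m+n m₁ _) (≤-reflexive (sym e))

    adjacent : Fin M → Fin M → Bool
    adjacent i j = ⌊ joined? i j ⌋ ∨ ⌊ joined? j i ⌋

    adjacent-sound : ∀ {i j} → T (adjacent i j) → Joined i j ⊎ Joined j i
    adjacent-sound {i} {j} t with ∨-elim {⌊ joined? i j ⌋} (T-≡ t)
    ... | inj₁ e = inj₁ (toWitness {a? = joined? i j} (≡-T e))
    ... | inj₂ e = inj₂ (toWitness {a? = joined? j i} (≡-T e))

    adjacent-complete : ∀ {i j} → Joined i j ⊎ Joined j i → T (adjacent i j)
    adjacent-complete {i} {j} (inj₁ w) = ≡-T (∨-introˡ (T-≡ (fromWitness {a? = joined? i j} w)))
    adjacent-complete {i} {j} (inj₂ w) = ≡-T (∨-introʳ {⌊ joined? i j ⌋} (T-≡ (fromWitness {a? = joined? j i} w)))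

    H : Graph (Fin M)
    H = record
      { adj        = adjacent
      ; adj-sym    = λ {i} {j} t → adjacent-complete {j} {i} (case adjacent-sound {i} {j} t of λ where
          (inj₁ w) → inj₂ w
          (inj₂ w) → inj₁ w)
      ; adj-irrefl = irreflexive
      }
      where
      irreflexive : ∀ {i j} → i ≡ j → ¬ T (adjacent i j)
      irreflexive {i} refl t with adjacent-sound {i} {i} t
      ... | inj₁ w = <⇒≱ (joined-left w) (joined-right w)
      ... | inj₂ w = <⇒≱ (joined-left w) (joined-right w)

    bipartite : Bipartite H
    bipartite = (λ i → toℕ i <ᵇ m₁) , λ {i} {j} t e → case adjacent-sound {i} {j} t of λ where
      (inj₁ w) → <⇒≱ (<ᵇ⇒< (toℕ j) m₁ (subst T e (<⇒<ᵇ (joined-left w)))) (joined-right w)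
      (inj₂ w) → <⇒≱ (<ᵇ⇒< (toℕ i) m₁ (subst T (sym e) (<⇒<ᵇ (joined-left w)))) (joined-right w)

    rowVertex colVertex : Fin n → Fin M
    rowVertex u = fromℕ< (≤-trans (row< (toℕ<n u)) (m≤m+n m₁ m₂))
    colVertex u = fromℕ< (+-monoʳ-< m₁ (col< (toℕ<n u)))

    toℕ-rowVertex : ∀ u → toℕ (rowVertex u) ≡ row (toℕ u)
    toℕ-rowVertex u = toℕ-fromℕ< _

    toℕ-colVertex : ∀ u → toℕ (colVertex u) ≡ m₁ + col (toℕ u)
    toℕ-colVertex u = toℕ-fromℕ< _

    joined : ∀ u → Joined (rowVertex u) (colVertex u)
    joined u = u , toℕ-rowVertex u , toℕ-colVertex u

    edge : Fin n → Edge H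
    edge u = rowVertex u , colVertex u , ≤-trans (joined-left (joined u)) (joined-right (joined u))
      , adjacent-complete {rowVertex u} {colVertex u} (inj₁ (joined u))

    edge-joined : (e : Edge H) → Joined (proj₁ e) (proj₁ (proj₂ e))
    edge-joined (i , j , i<j , t) with adjacent-sound {i} {j} t
    ... | inj₁ w = w
    ... | inj₂ w = ⊥-elim (<⇒≱ (<-trans i<j (joined-left w)) (joined-right w))

    cell : Edge H → Fin n
    cell e = proj₁ (edge-joined e)

    same-cell : ∀ {u v} → row (toℕ {n} u) ≡ row (toℕ {n} v) → col (toℕ u) ≡ col (toℕ v) → u ≡ v
    same-cell {u} {v} r c = toℕ-injective (cell-injective (toℕ<n u) (toℕ<n v) r c)

    edge-cell : ∀ e → edge (cell e) ≡ e
    edge-cell e@(i , j , i<j , t) with edge-joined e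
    ... | u , r , c = edge-≡ H (toℕ-injective (trans (toℕ-rowVertex u) (sym r))) (toℕ-injective (trans (toℕ-colVertex u) (sym c)))

    cell-edge : ∀ u → cell (edge u) ≡ u
    cell-edge u with edge-joined (edge u)
    ... | v , r , c = same-cell (trans (sym r) (toℕ-rowVertex u)) (+-cancelˡ-≡ m₁ _ _ (trans (sym c) (toℕ-colVertex u)))

    edge-injective : ∀ {u v} → edge u ≡ edge v → u ≡ v
    edge-injective {u} {v} e = trans (sym (cell-edge u)) (trans (cong cell e) (cell-edge v))

    row≢col : ∀ {u v} → rowVertex u ≢ colVertex v
    row≢col {u} {v} e = <⇒≱ (joined-left (joined u)) (≤-trans (joined-right (joined v)) (≤-reflexive (cong toℕ (sym e))))

    shared⇒ : ∀ u v {w} → _IsEndpointOf_ H w (edge u) → _IsEndpointOf_ H w (edge v) →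
      row (toℕ u) ≡ row (toℕ v) ⊎ col (toℕ u) ≡ col (toℕ v)
    shared⇒ u v (inj₁ refl) (inj₁ e) = inj₁ (trans (sym (toℕ-rowVertex u)) (trans (cong toℕ e) (toℕ-rowVertex v)))
    shared⇒ u v (inj₁ refl) (inj₂ e) = ⊥-elim (row≢col {u} {v} e)
    shared⇒ u v (inj₂ refl) (inj₁ e) = ⊥-elim (row≢col {v} {u} (sym e))
    shared⇒ u v (inj₂ refl) (inj₂ e) = inj₂ (+-cancelˡ-≡ m₁ _ _
      (trans (sym (toℕ-colVertex u)) (trans (cong toℕ e) (toℕ-colVertex v))))

    ⇒shared : ∀ u v → row (toℕ u) ≡ row (toℕ v) ⊎ col (toℕ u) ≡ col (toℕ v) →
      ∃[ w ] _IsEndpointOf_ H w (edge u) × _IsEndpointOf_ H w (edge v)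
    ⇒shared u v (inj₁ e) = rowVertex u , inj₁ refl ,
      inj₁ (toℕ-injective (trans (toℕ-rowVertex u) (trans e (sym (toℕ-rowVertex v)))))
    ⇒shared u v (inj₂ e) = colVertex u , inj₂ refl ,
      inj₂ (toℕ-injective (trans (toℕ-colVertex u) (trans (cong (m₁ +_) e) (sym (toℕ-colVertex v)))))

  isLineGraph : IsLineGraphOfBipartite (cellGraph row col n)
  isLineGraph = M , H , bipartite , record
    { bijection = mk↔ₛ′ edge cell edge-cell cell-edge
    ; adj-iff   = λ u v → mk⇔
        (λ t → case cellAdj-sound row col {toℕ u} {toℕ v} t of λ where
          (e , u≢v) → fromWitness {a? = lineAdj? H (edge u) (edge v)} (u≢v ∘ cong toℕ ∘ edge-injective , ⇒shared u v e))
        (λ t → case toWitness {a? = lineAdj? H (edge u) (edge v)} t of λ where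
          (e≢ , w , w∈u , w∈v) → cellAdj-complete row col (shared⇒ u v w∈u w∈v) (λ e → e≢ (cong edge (toℕ-injective e))))
    }

search : ℕ → (ℕ → Bool) → ℕ
search zero    f = 0
search (suc n) f = if f 0 then 0 else suc (search n (f ∘ suc))

search-found : ∀ n f {i} → i < n → f i ≡ true → f (search n f) ≡ true × search n f < n
search-found (suc n) f {i} i<n e with f 0 in eq
... | true = eq , s≤s z≤n
search-found (suc n) f {zero}  i<n e | false = case trans (sym eq) e of λ ()
search-found (suc n) f {suc i} (s≤s i<n) e | false with search-found n (f ∘ suc) i<n e
... | p , q = p , s≤s q

-- Labels with arbitrary values can be replaced by labels below the number of vertices.
module Relabel (n : ℕ) (label : ℕ → ℕ) where

  relabel : ℕ → ℕ
  relabel u = search n (λ v → label v ≡ᵇ label u)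

  relabel< : ∀ {u} → u < n → relabel u < n
  relabel< {u} u<n = proj₂ (search-found n (λ v → label v ≡ᵇ label u) u<n (≡ᵇ-complete {label u} refl))

  relabel-≡ : ∀ {u v} → label u ≡ label v → relabel u ≡ relabel v
  relabel-≡ e = cong (λ l → search n (λ v → label v ≡ᵇ l)) e

  label-relabel : ∀ {u} → u < n → label (relabel u) ≡ label u
  label-relabel {u} u<n = ≡ᵇ-sound (proj₁ (search-found n (λ v → label v ≡ᵇ label u) u<n (≡ᵇ-complete {label u} refl)))

  relabel-injective : ∀ {u v} → u < n → v < n → relabel u ≡ relabel v → label u ≡ label v
  relabel-injective u<n v<n e = trans (sym (label-relabel u<n)) (trans (cong label e) (label-relabel v<n))

module LineGraphCells {n : ℕ} (G : Graph (Fin n)) where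

  record Cells : Set where
    field
      row col        : ℕ → ℕ
      row<           : ∀ {u} → u < n → row u < n
      col<           : ∀ {u} → u < n → col u < n
      cell-injective : ∀ {u v} → u < n → v < n → row u ≡ row v → col u ≡ col v → u ≡ v
      adj-cell       : ∀ u v → adj G u v ≡ cellAdj row col (toℕ u) (toℕ v)

  -- The side `true` of the bipartition provides the rows, the other side the columns: every edge
  -- has one endpoint on each, and a shared endpoint is a shared label. Relabelling makes the labels
  -- small enough for a certificate.
  cells : IsLineGraphOfBipartite G → Cells
  cells (m , H , (side , opposite) , iso) = record
    { row            = relabel rowLabel
    ; col            = relabel colLabel
    ; row<           = relabel< rowLabel
    ; col<           = relabel< colLabel
    ; cell-injective = λ {u} {v} u<n v<n r c → subst₂ _≡_ (toℕ-fromℕ< u<n) (toℕ-fromℕ< v<n) (cong toℕ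
        (to-injective (ends-injective (edge (fromℕ< u<n)) (edge (fromℕ< v<n))
          (label-≡ rowEnd u<n v<n (relabel-injective rowLabel u<n v<n r))
          (label-≡ colEnd u<n v<n (relabel-injective colLabel u<n v<n c)))))
    ; adj-cell       = λ u v → bool-ext (adj⇒ u v) (⇒adj u v)
    }
    where
    open _≅_ iso
    open Inverse bijection using (from; inverseʳ) renaming (to to edge)
    open Relabel n
    to-injective : ∀ {u v} → edge u ≡ edge v → u ≡ v
    to-injective {u} {v} e = trans (sym (inverseʳ refl)) (trans (cong from e) (inverseʳ refl))
    rowEnd colEnd : Edge H → Fin m
    rowEnd (a , b , _) = if side a then a else b
    colEnd (a , b , _) = if side a then b else a
    side-rowEnd : ∀ e → side (rowEnd e) ≡ true
    side-rowEnd (a , b , _ , t) with side a in eq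
    ... | true  = eq
    ... | false with side b in eq′
    ...   | true  = refl
    ...   | false = contradiction (trans eq (sym eq′)) (opposite t)
    side-colEnd : ∀ e → side (colEnd e) ≡ false
    side-colEnd (a , b , _ , t) with side a in eq
    ... | false = eq
    ... | true with side b in eq′
    ...   | false = refl
    ...   | true  = contradiction (trans eq (sym eq′)) (opposite t)
    ends-injective : ∀ e f → rowEnd e ≡ rowEnd f → colEnd e ≡ colEnd f → e ≡ f
    ends-injective (a , b , a<b , _) (a′ , b′ , a′<b′ , _) r c with side a | side a′
    ... | true  | true  = edge-≡ H r c
    ... | false | false = edge-≡ H c r
    -- Here the edges would have the same endpoints in opposite order, but endpoints are listed
    -- increasingly.
    ... | true  | false = ⊥-elim (<-asym a<b (subst₂ (λ x y → toℕ x < toℕ y) (sym c) (sym r) a′<b′))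
    ... | false | true  = ⊥-elim (<-asym a<b (subst₂ (λ x y → toℕ x < toℕ y) (sym r) (sym c) a′<b′))
    rowEnd-endpoint : ∀ e → _IsEndpointOf_ H (rowEnd e) e
    rowEnd-endpoint (a , b , _) with side a
    ... | true  = inj₁ refl
    ... | false = inj₂ refl
    colEnd-endpoint : ∀ e → _IsEndpointOf_ H (colEnd e) e
    colEnd-endpoint (a , b , _) with side a
    ... | true  = inj₂ refl
    ... | false = inj₁ refl
    endpoint-end : ∀ e {w} → _IsEndpointOf_ H w e → w ≡ rowEnd e ⊎ w ≡ colEnd e
    endpoint-end (a , b , _) w∈ with side a | w∈
    ... | true  | inj₁ e = inj₁ e
    ... | true  | inj₂ e = inj₂ e
    ... | false | inj₁ e = inj₂ e
    ... | false | inj₂ e = inj₁ e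
    row≢col : ∀ e f → rowEnd e ≢ colEnd f
    row≢col e f eq = case trans (sym (side-rowEnd e)) (trans (cong side eq) (side-colEnd f)) of λ ()
    rowLabel colLabel : ℕ → ℕ
    rowLabel = extend 0 (toℕ ∘ rowEnd ∘ edge)
    colLabel = extend 0 (toℕ ∘ colEnd ∘ edge)
    label-≡ : ∀ (end : Edge H → Fin m) {u v} (u<n : u < n) (v<n : v < n) →
      extend 0 (toℕ ∘ end ∘ edge) u ≡ extend 0 (toℕ ∘ end ∘ edge) v → end (edge (fromℕ< u<n)) ≡ end (edge (fromℕ< v<n))
    label-≡ end {u} {v} u<n v<n e = toℕ-injective (trans (sym (at-fromℕ< u<n)) (trans e (at-fromℕ< v<n)))
      where
      at-fromℕ< : ∀ {u} (u<n : u < n) → extend 0 (toℕ ∘ end ∘ edge) u ≡ toℕ (end (edge (fromℕ< u<n)))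
      at-fromℕ< u<n = trans (cong (extend 0 (toℕ ∘ end ∘ edge)) (sym (toℕ-fromℕ< u<n)))
                            (extend-toℕ 0 (toℕ ∘ end ∘ edge) (fromℕ< u<n))
    label-toℕ : ∀ (end : Edge H → Fin m) {u v} → end (edge u) ≡ end (edge v) →
      extend 0 (toℕ ∘ end ∘ edge) (toℕ u) ≡ extend 0 (toℕ ∘ end ∘ edge) (toℕ v)
    label-toℕ end {u} {v} e = trans (extend-toℕ 0 (toℕ ∘ end ∘ edge) u) (trans (cong toℕ e) (sym (extend-toℕ 0 (toℕ ∘ end ∘ edge) v)))
    toℕ-label : ∀ (end : Edge H → Fin m) {u v} →
      extend 0 (toℕ ∘ end ∘ edge) (toℕ u) ≡ extend 0 (toℕ ∘ end ∘ edge) (toℕ v) → end (edge u) ≡ end (edge v)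
    toℕ-label end {u} {v} e = toℕ-injective
      (trans (sym (extend-toℕ 0 (toℕ ∘ end ∘ edge) u)) (trans e (extend-toℕ 0 (toℕ ∘ end ∘ edge) v)))
    adj⇒ : ∀ u v → Adj G u v → T (cellAdj (relabel rowLabel) (relabel colLabel) (toℕ u) (toℕ v))
    adj⇒ u v t with toWitness {a? = lineAdj? H (edge u) (edge v)} (Equivalence.to (adj-iff u v) t)
    ... | e≢ , w , w∈u , w∈v = cellAdj-complete (relabel rowLabel) (relabel colLabel) same (λ e → e≢ (cong edge (toℕ-injective e)))
      where
      same : relabel rowLabel (toℕ u) ≡ relabel rowLabel (toℕ v) ⊎ relabel colLabel (toℕ u) ≡ relabel colLabel (toℕ v)
      same with endpoint-end (edge u) w∈u | endpoint-end (edge v) w∈v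
      ... | inj₁ p | inj₁ q = inj₁ (relabel-≡ rowLabel (label-toℕ rowEnd (trans (sym p) q)))
      ... | inj₂ p | inj₂ q = inj₂ (relabel-≡ colLabel (label-toℕ colEnd (trans (sym p) q)))
      ... | inj₁ p | inj₂ q = ⊥-elim (row≢col (edge u) (edge v) (trans (sym p) q))
      ... | inj₂ p | inj₁ q = ⊥-elim (row≢col (edge v) (edge u) (trans (sym q) p))
    ⇒adj : ∀ u v → T (cellAdj (relabel rowLabel) (relabel colLabel) (toℕ u) (toℕ v)) → Adj G u v
    ⇒adj u v t with cellAdj-sound (relabel rowLabel) (relabel colLabel) {toℕ u} {toℕ v} t
    ... | s , u≢v = Equivalence.from (adj-iff u v) (fromWitness {a? = lineAdj? H (edge u) (edge v)}
      (u≢v ∘ cong toℕ ∘ to-injective , shared s))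
      where
      shared : _ → ∃[ w ] _IsEndpointOf_ H w (edge u) × _IsEndpointOf_ H w (edge v)
      shared (inj₁ e) = rowEnd (edge u) , rowEnd-endpoint (edge u) ,
        subst (λ w → _IsEndpointOf_ H w (edge v)) (sym (toℕ-label rowEnd (relabel-injective rowLabel (toℕ<n u) (toℕ<n v) e))) (rowEnd-endpoint (edge v))
      shared (inj₂ e) = colEnd (edge u) , colEnd-endpoint (edge u) ,
        subst (λ w → _IsEndpointOf_ H w (edge v)) (sym (toℕ-label colEnd (relabel-injective colLabel (toℕ<n u) (toℕ<n v) e))) (colEnd-endpoint (edge v))

-- Satisfiability expressed by two selections

record Satisfiable (V C : ℕ) (pos neg : ℕ → ℕ → Bool) : Set where
  field
    α         : ℕ → Bool
    satisfied : ∀ c → c < C → ∃[ v ] v < V × (pos c v ≡ true × α v ≡ true ⊎ neg c v ≡ true × α v ≡ false)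

-- Row (v , c) with v < V carries the occurrence of variable v in clause c, row
-- (V , c) the clause itself. The first selection has to choose, for each v,
-- between staying at all the columns (0 , v , c) and shifting all of them
-- cyclically, which encodes the value of v. In the second selection, row (V , c)
-- takes the column (1 , v , c) of a literal, and then row (v , c) is forced to a
-- column (0 , v , _) that is left by the first selection iff the literal is true.
module Clauses (k V C : ℕ) (pos neg : ℕ → ℕ → Bool) where

  -- The columns form a block of size `R` for every tag `t`: block 0 is where the first two
  -- selections meet, block 1 serves the second one alone, and block `j` serves the further
  -- selection `j`.
  R S : ℕ
  R = suc V * C
  S = (2 + k) * R

  next : ℕ → ℕ
  next c = if suc c ≡ᵇ C then 0 else suc c

  fits : (j v c t v′ c′ : ℕ) → Bool
  fits j v c t v′ c′ =
      ((j ≡ᵇ 0) ∧ (t ≡ᵇ 0) ∧ (v′ ≡ᵇ v) ∧ ((c′ ≡ᵇ c) ∨ (c′ ≡ᵇ next c)))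
    ∨ (((j ≡ᵇ 1) ∧ (v <ᵇ V) ∧ (v′ ≡ᵇ v) ∧
          (((t ≡ᵇ 1) ∧ (c′ ≡ᵇ c)) ∨ ((t ≡ᵇ 0) ∧ (((c′ ≡ᵇ c) ∧ pos c v) ∨ ((c′ ≡ᵇ next c) ∧ neg c v)))))
    ∨ (((j ≡ᵇ 1) ∧ not (v <ᵇ V) ∧ (t ≡ᵇ 1) ∧ (v′ <ᵇ V) ∧ (c′ ≡ᵇ c) ∧ (pos c v′ ∨ neg c v′))
    ∨ ((2 ≤ᵇ j) ∧ (t ≡ᵇ j) ∧ (v′ ≡ᵇ v) ∧ (c′ ≡ᵇ c))))

  allowed : ℕ → ℕ → ℕ → Bool
  allowed j r s = fits j (quot r C) (rem r C) (quot s R) (quot (rem s R) C) (rem (rem s R) C)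

  -- On row `(v , c)`, `holds` wants the column that the first selection occupies when it stays,
  -- `fails` the one that it occupies when it shifts. Shifting thus means that `v` is true.
  data Fits : (j v c t v′ c′ : ℕ) → Set where
    stays   : ∀ {v c} → Fits 0 v c 0 v c
    shifts  : ∀ {v c} → Fits 0 v c 0 v (next c)
    idle    : ∀ {v c} → v < V → Fits 1 v c 1 v c
    holds   : ∀ {v c} → v < V → pos c v ≡ true → Fits 1 v c 0 v c
    fails   : ∀ {v c} → v < V → neg c v ≡ true → Fits 1 v c 0 v (next c)
    clause  : ∀ {v c v′} → ¬ v < V → v′ < V → pos c v′ ≡ true ⊎ neg c v′ ≡ true → Fits 1 v c 1 v′ c
    further : ∀ {j v c} → Fits (2 + j) v c (2 + j) v c

  <ᵇ-sound : ∀ {m n} → (m <ᵇ n) ≡ true → m < n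
  <ᵇ-sound {m} {n} e = <ᵇ⇒< m n (≡-T e)

  <ᵇ-complete : ∀ {m n} → m < n → (m <ᵇ n) ≡ true
  <ᵇ-complete m<n = T-≡ (<⇒<ᵇ m<n)

  fits-complete : ∀ {j v c t v′ c′} → Fits j v c t v′ c′ → fits j v c t v′ c′ ≡ true
  fits-complete (stays {v} {c}) rewrite ≡ᵇ-complete {v} refl | ≡ᵇ-complete {c} refl = refl
  fits-complete (shifts {v} {c}) rewrite ≡ᵇ-complete {v} refl | ≡ᵇ-complete {next c} refl | Boolₚ.∨-zeroʳ (next c ≡ᵇ c) = refl
  fits-complete (idle {v} {c} v<V) rewrite <ᵇ-complete v<V | ≡ᵇ-complete {v} refl | ≡ᵇ-complete {c} refl = refl
  fits-complete (holds {v} {c} v<V p) rewrite <ᵇ-complete v<V | ≡ᵇ-complete {v} refl | ≡ᵇ-complete {c} refl | p = refl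
  fits-complete (fails {v} {c} v<V p)
    rewrite <ᵇ-complete v<V | ≡ᵇ-complete {v} refl | ≡ᵇ-complete {next c} refl | p
          | Boolₚ.∨-zeroʳ ((next c ≡ᵇ c) ∧ pos c v) = refl
  fits-complete (clause {v} {c} {v′} v≮V v′<V l)
    rewrite not-intro {v <ᵇ V} (v≮V ∘ <ᵇ-sound) | <ᵇ-complete v′<V | ≡ᵇ-complete {c} refl
    with l
  ... | inj₁ p rewrite p = ∨-introʳ {(v <ᵇ V) ∧ (v′ ≡ᵇ v) ∧ true} refl
  ... | inj₂ p rewrite p | Boolₚ.∨-zeroʳ (pos c v′) = ∨-introʳ {(v <ᵇ V) ∧ (v′ ≡ᵇ v) ∧ true} refl
  fits-complete (further {j} {v} {c}) rewrite ≡ᵇ-complete {j} refl | ≡ᵇ-complete {v} refl | ≡ᵇ-complete {c} refl = refl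

  fits-sound : ∀ j {v c t v′ c′} → fits j v c t v′ c′ ≡ true → Fits j v c t v′ c′
  fits-sound 0 {v} {c} {t} {v′} {c′} e with ∨-elim {(t ≡ᵇ 0) ∧ (v′ ≡ᵇ v) ∧ ((c′ ≡ᵇ c) ∨ (c′ ≡ᵇ next c))} e
  ... | inj₁ p with ≡ᵇ-sound {t} {0} (∧-proj₁ p) | ∧-proj₂ {t ≡ᵇ 0} p
  ...   | refl | p₂ with ≡ᵇ-sound {v′} {v} (∧-proj₁ p₂) | ∨-elim (∧-proj₂ {v′ ≡ᵇ v} p₂)
  ...     | refl | inj₁ q with refl ← ≡ᵇ-sound {c′} {c} q = stays
  ...     | refl | inj₂ q with refl ← ≡ᵇ-sound {c′} {next c} q = shifts
  fits-sound 1 {v} {c} {t} {v′} {c′} e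
    with ∨-elim {(v <ᵇ V) ∧ (v′ ≡ᵇ v) ∧
          (((t ≡ᵇ 1) ∧ (c′ ≡ᵇ c)) ∨ ((t ≡ᵇ 0) ∧ (((c′ ≡ᵇ c) ∧ pos c v) ∨ ((c′ ≡ᵇ next c) ∧ neg c v))))} e
  ... | inj₁ p with <ᵇ-sound {v} {V} (∧-proj₁ p) | ∧-proj₂ {v <ᵇ V} p
  ...   | v<V | p₂ with ≡ᵇ-sound {v′} {v} (∧-proj₁ p₂) | ∨-elim (∧-proj₂ {v′ ≡ᵇ v} p₂)
  ...     | refl | inj₁ q with refl ← ≡ᵇ-sound {t} {1} (∧-proj₁ q) | refl ← ≡ᵇ-sound {c′} {c} (∧-proj₂ {t ≡ᵇ 1} q) = idle v<V
  ...     | refl | inj₂ q with refl ← ≡ᵇ-sound {t} {0} (∧-proj₁ q) | ∨-elim (∧-proj₂ {t ≡ᵇ 0} q)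
  ...       | inj₁ w with refl ← ≡ᵇ-sound {c′} {c} (∧-proj₁ w) = holds v<V (∧-proj₂ {c′ ≡ᵇ c} w)
  ...       | inj₂ w with refl ← ≡ᵇ-sound {c′} {next c} (∧-proj₁ w) = fails v<V (∧-proj₂ {c′ ≡ᵇ next c} w)
  fits-sound 1 {v} {c} {t} {v′} {c′} e | inj₂ p′
    with ∨-elim {not (v <ᵇ V) ∧ (t ≡ᵇ 1) ∧ (v′ <ᵇ V) ∧ (c′ ≡ᵇ c) ∧ (pos c v′ ∨ neg c v′)} p′
  ... | inj₁ p with not-true {v <ᵇ V} (∧-proj₁ p) ∘ <ᵇ-complete {v} {V} | ∧-proj₂ {not (v <ᵇ V)} p
  ...   | v≮V | p₂ with refl ← ≡ᵇ-sound {t} {1} (∧-proj₁ p₂) | p₃ ← ∧-proj₂ {t ≡ᵇ 1} p₂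
    with <ᵇ-sound {v′} {V} (∧-proj₁ p₃) | ∧-proj₂ {v′ <ᵇ V} p₃
  ...     | v′<V | p₄ with refl ← ≡ᵇ-sound {c′} {c} (∧-proj₁ p₄) = clause v≮V v′<V (∨-elim (∧-proj₂ {c′ ≡ᵇ c} p₄))
  fits-sound (suc (suc j)) {v} {c} {t} {v′} {c′} e
    with refl ← ≡ᵇ-sound {t} {2 + j} (∧-proj₁ e) | p ← ∧-proj₂ {t ≡ᵇ 2 + j} e
    with refl ← ≡ᵇ-sound {v′} {v} (∧-proj₁ p) | refl ← ≡ᵇ-sound {c′} {c} (∧-proj₂ {v′ ≡ᵇ v} p) = further

  next< : ∀ {c} → c < C → next c < C
  next< {c} c<C with suc c ≡ᵇ C in eq
  ... | true  = ≤-trans (s≤s z≤n) c<C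
  ... | false = ≤∧≢⇒< c<C (λ e → case trans (sym eq) (≡ᵇ-complete e) of λ ())

  next-suc : ∀ {c} → suc c < C → next c ≡ suc c
  next-suc {c} c<C with suc c ≡ᵇ C in eq
  ... | true  = contradiction c<C (<-irrefl (≡ᵇ-sound {suc c} eq))
  ... | false = refl

  next-last : ∀ {c} → suc c ≡ C → next c ≡ 0
  next-last {c} e with suc c ≡ᵇ C in eq
  ... | true  = refl
  ... | false = case trans (sym eq) (≡ᵇ-complete e) of λ ()

  next-injective : ∀ {c c′} → next c ≡ next c′ → c ≡ c′
  next-injective {c} {c′} e with suc c ≡ᵇ C in eq | suc c′ ≡ᵇ C in eq′
  ... | true  | true  = suc-injective (trans (≡ᵇ-sound {suc c} {C} eq) (sym (≡ᵇ-sound {suc c′} {C} eq′)))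
  ... | false | false = suc-injective e

  -- With a single clause, staying and shifting would be the same, and no value could be told from
  -- them.
  next≢ : 2 ≤ C → ∀ c → next c ≢ c
  next≢ 2≤C c e with suc c ≡ᵇ C in eq
  ... | false = 1+n≢n e
  next≢ 2≤C zero e | true = <-irrefl (≡ᵇ-sound {1} eq) 2≤C

  open Selections (2 + k) R S allowed public

  module _ (sat : Satisfiable V C pos neg) (2≤C : 2 ≤ C) where
    open Satisfiable sat

    private
      choice : ∃[ ch ] ∀ c → c < C → ch c < V × (pos c (ch c) ≡ true × α (ch c) ≡ true ⊎ neg c (ch c) ≡ true × α (ch c) ≡ false)
      choice = choose C satisfied

      ch = proj₁ choice
      ch-good = proj₂ choice

      data Kind : Set where
        positive negative resting clausal : Kind

      data Describes (v c : ℕ) : Kind → Set where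
        positive : v < V → ch c ≡ v → α v ≡ true → Describes v c positive
        negative : v < V → ch c ≡ v → α v ≡ false → Describes v c negative
        resting  : v < V → ch c ≢ v → Describes v c resting
        clausal  : ¬ v < V → Describes v c clausal

      kind : ∀ v c → ∃[ κ ] Describes v c κ
      kind v c with v <? V
      ... | no  v≮V = clausal , clausal v≮V
      ... | yes v<V with ch c ≟ v
      ...   | no  c≢v = resting , resting v<V c≢v
      ...   | yes c≡v with α v in eq
      ...     | true  = positive , positive v<V c≡v eq
      ...     | false = negative , negative v<V c≡v eq

      Place : Set
      Place = ℕ × ℕ × ℕ

      second : ℕ → ℕ → Kind → Place
      second v c positive = 0 , v , c
      second v c negative = 0 , v , next c
      second v c resting  = 1 , v , c
      second v c clausal  = 1 , ch c , c

      place : ℕ → ℕ → ℕ → Place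
      place 0             v c = 0 , v , (if α v then next c else c)
      place 1             v c = second v c (proj₁ (kind v c))
      place (suc (suc j)) v c = 2 + j , v , c

      FitsAt : ℕ → ℕ → ℕ → Place → Set
      FitsAt j v c (t , v′ , c′) = Fits j v c t v′ c′

      Bounded : ℕ → Place → Set
      Bounded j (t , v′ , c′) = t < 2 ⊔ suc j × v′ < suc V × c′ < C

      place-fits : ∀ j {v c} → v < suc V → c < C → FitsAt j v c (place j v c)
      place-fits 0 {v} {c} _ _ with α v
      ... | true  = shifts
      ... | false = stays
      place-fits 1 {v} {c} _ c<C with kind v c
      ... | positive , positive v<V refl a with proj₂ (ch-good c c<C)
      ...   | inj₁ (p , _)  = holds v<V p
      ...   | inj₂ (_ , a′) = case trans (sym a) a′ of λ ()
      place-fits 1 {v} {c} _ c<C | negative , negative v<V refl a with proj₂ (ch-good c c<C)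
      ...   | inj₂ (p , _)  = fails v<V p
      ...   | inj₁ (_ , a′) = case trans (sym a) a′ of λ ()
      place-fits 1 {v} {c} _ c<C | resting , resting v<V _ = idle v<V
      place-fits 1 {v} {c} _ c<C | clausal , clausal v≮V with ch-good c c<C
      ...   | c<V , inj₁ (p , _) = clause v≮V c<V (inj₁ p)
      ...   | c<V , inj₂ (p , _) = clause v≮V c<V (inj₂ p)
      place-fits (suc (suc j)) _ _ = further

      fits-bounded : ∀ {j v c t v′ c′} → v < suc V → c < C → Fits j v c t v′ c′ → t < 2 ⊔ suc j × v′ < suc V × c′ < C
      fits-bounded v< c< stays   = s≤s z≤n , v< , c<
      fits-bounded v< c< shifts  = s≤s z≤n , v< , next< c<
      fits-bounded v< c< (idle _) = ≤-refl , v< , c<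
      fits-bounded v< c< (holds _ _) = s≤s z≤n , v< , c<
      fits-bounded v< c< (fails _ _) = s≤s z≤n , v< , next< c<
      fits-bounded v< c< (clause _ v′<V _) = ≤-refl , m<n⇒m<1+n v′<V , c<
      fits-bounded v< c< further = ≤-refl , v< , c<

      -- Two collisions in the second selection need an argument. In block 0, a positive row meeting
      -- a negative one would belong to the same variable, with two values. In block 1, a clause
      -- takes the column vacated by the row of its chosen literal.
      place-injective : ∀ j {v c v′ c′} → v < suc V → v′ < suc V → c < C → c′ < C →
        place j v c ≡ place j v′ c′ → v ≡ v′ × c ≡ c′
      place-injective 0 {v} {c} {v′} {c′} _ _ _ _ e with cong (proj₁ ∘ proj₂) e | cong (proj₂ ∘ proj₂) e
      ... | refl | q with α v
      ...   | true  = refl , next-injective q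
      ...   | false = refl , q
      place-injective 1 {v} {c} {v′} {c′} v< v′< _ _ e with kind v c | kind v′ c′
      ... | positive , _ | positive , _ = cong (proj₁ ∘ proj₂) e , cong (proj₂ ∘ proj₂) e
      ... | negative , _ | negative , _ = cong (proj₁ ∘ proj₂) e , next-injective (cong (proj₂ ∘ proj₂) e)
      ... | resting  , _ | resting  , _ = cong (proj₁ ∘ proj₂) e , cong (proj₂ ∘ proj₂) e
      ... | clausal , clausal v≮V | clausal , clausal v′≮V =
        trans (≤-antisym (s≤s⁻¹ v<) (≮⇒≥ v≮V)) (sym (≤-antisym (s≤s⁻¹ v′<) (≮⇒≥ v′≮V))) , cong (proj₂ ∘ proj₂) e
      ... | positive , positive _ _ a | negative , negative _ _ a′ = case trans (sym a) (trans (cong α (cong (proj₁ ∘ proj₂) e)) a′) of λ ()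
      ... | negative , negative _ _ a | positive , positive _ _ a′ = case trans (sym a) (trans (cong α (cong (proj₁ ∘ proj₂) e)) a′) of λ ()
      ... | resting , resting _ h | clausal , _ = ⊥-elim (h (trans (cong ch (cong (proj₂ ∘ proj₂) e)) (sym (cong (proj₁ ∘ proj₂) e))))
      ... | clausal , _ | resting , resting _ h = ⊥-elim (h (trans (cong ch (sym (cong (proj₂ ∘ proj₂) e))) (cong (proj₁ ∘ proj₂) e)))
      ... | positive , _ | resting , _ = case e of λ ()
      ... | positive , _ | clausal , _ = case e of λ ()
      ... | negative , _ | resting , _ = case e of λ ()
      ... | negative , _ | clausal , _ = case e of λ ()
      ... | resting , _ | positive , _ = case e of λ ()
      ... | resting , _ | negative , _ = case e of λ ()
      ... | clausal , _ | positive , _ = case e of λ ()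
      ... | clausal , _ | negative , _ = case e of λ ()
      place-injective (suc (suc j)) _ _ _ _ e = cong (proj₁ ∘ proj₂) e , cong (proj₂ ∘ proj₂) e

      place-distinct : ∀ i j {v c} → i < j → place i v c ≢ place j v c
      place-distinct 0 1 {v} {c} _ e with kind v c
      ... | positive , positive _ _ a rewrite a = next≢ 2≤C c (cong (proj₂ ∘ proj₂) e)
      ... | negative , negative _ _ a rewrite a = next≢ 2≤C c (sym (cong (proj₂ ∘ proj₂) e))
      ... | resting , _ = case e of λ ()
      ... | clausal , _ = case e of λ ()
      place-distinct 0 (suc (suc j)) _ e = case e of λ ()
      place-distinct 1 (suc (suc j)) {v} {c} _ e with kind v c
      ... | positive , _ = case e of λ ()
      ... | negative , _ = case e of λ ()
      ... | resting , _  = case e of λ ()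
      ... | clausal , _  = case e of λ ()
      place-distinct (suc (suc i)) (suc (suc j)) i<j e = <-irrefl (cong proj₁ e) i<j
      place-distinct 1 1 (s≤s ()) e
      place-distinct (suc (suc i)) 1 (s≤s ()) e

      column : Place → ℕ
      column (t , v , c) = t * R + (v * C + c)

      φ : ℕ → ℕ → ℕ
      φ j r = column (place j (quot r C) (rem r C))

      bounded : ∀ j {r} → r < R → Bounded j (place j (quot r C) (rem r C))
      bounded j {r} r<R = fits-bounded (quot< (suc V) C r<R) (rem< (suc V) C r<R) (place-fits j (quot< (suc V) C r<R) (rem< (suc V) C r<R))

      tag< : ∀ {j t} → j < 2 + k → t < 2 ⊔ suc j → t < 2 + k
      tag< j<k t< = ≤-trans t< (⊔-lub (s≤s (s≤s z≤n)) j<k)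

      column-quot : ∀ {t v c} → v < suc V → c < C → quot (column (t , v , c)) R ≡ t
      column-quot {t} v< c< = quot-+ t (combine< v< c<)

      column-rem : ∀ {t v c} → v < suc V → c < C → rem (column (t , v , c)) R ≡ v * C + c
      column-rem {t} v< c< = rem-+ t (combine< v< c<)

      column-injective : ∀ {t v c t′ v′ c′} → v < suc V → c < C → v′ < suc V → c′ < C →
        column (t , v , c) ≡ column (t′ , v′ , c′) → (t , v , c) ≡ (t′ , v′ , c′)
      column-injective {t} {v} {c} {t′} {v′} {c′} v< c< v′< c′< e = cong₂ _,_
        (trans (sym (column-quot v< c<)) (trans (cong (λ s → quot s R) e) (column-quot v′< c′<)))
        (cong₂ _,_ (trans (sym (quot-+ v c<)) (trans (cong (λ r → quot r C) e′) (quot-+ v′ c′<)))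
                   (trans (sym (rem-+ v c<)) (trans (cong (λ r → rem r C) e′) (rem-+ v′ c′<))))
        where
        e′ : v * C + c ≡ v′ * C + c′
        e′ = trans (sym (column-rem {t} v< c<)) (trans (cong (λ s → rem s R) e) (column-rem {t′} v′< c′<))

      column-place : ∀ i j {r r′} → r < R → r′ < R → φ i r ≡ φ j r′ →
        place i (quot r C) (rem r C) ≡ place j (quot r′ C) (rem r′ C)
      column-place i j r<R r′<R e with bounded i r<R | bounded j r′<R
      ... | _ , p , q | _ , p′ , q′ = column-injective p q p′ q′ e

    satisfiable⇒selection : Selection
    satisfiable⇒selection = record
      { φ         = φ
      ; range     = λ {j} j<k r<R → case bounded j r<R of λ { (t< , v< , c<) → combine< (tag< {j} j<k t<) (combine< v< c<) }
      ; permitted = λ {j} {r} j<k r<R → permitted j r<R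
      ; injective = λ {j} {r} {r′} j<k r<R r′<R e → case place-injective j (quot< (suc V) C r<R) (quot< (suc V) C r′<R)
          (rem< (suc V) C r<R) (rem< (suc V) C r′<R) (column-place j j r<R r′<R e) of λ where
            (p , q) → trans (quot-rem (suc V) C r<R) (trans (cong₂ (λ a b → a * C + b) p q) (sym (quot-rem (suc V) C r′<R)))
      ; distinct  = λ {i} {j} i<k j<k r<R e → case <-cmp i j of λ where
          (tri< i<j _ _) → ⊥-elim (place-distinct i j i<j (column-place i j r<R r<R e))
          (tri≈ _ i≡j _) → i≡j
          (tri> _ _ j<i) → ⊥-elim (place-distinct j i j<i (sym (column-place i j r<R r<R e)))
      }
      where
      permitted : ∀ j {r} → r < R → allowed j r (φ j r) ≡ true
      permitted j {r} r<R with place j (quot r C) (rem r C) | bounded j r<R | place-fits j (quot< (suc V) C r<R) (rem< (suc V) C r<R)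
      ... | t , v′ , c′ | _ , v< , c< | F
        rewrite column-quot {t} v< c< | column-rem {t} v< c< | quot-+ v′ c< | rem-+ v′ c< = fits-complete F

  module _ (σ : Selection) where
    open Selection σ

    private
      row< : ∀ {v c} → v < suc V → c < C → v * C + c < R
      row< = combine<

      Chosen : ℕ → ℕ → ℕ → ℕ → ℕ → ℕ → Set
      Chosen j v c t v′ c′ = φ j (v * C + c) ≡ t * R + (v′ * C + c′)

      chosen : ∀ j {v c} → j < 2 + k → v < suc V → c < C →
        ∃[ t ] ∃[ v′ ] ∃[ c′ ] Chosen j v c t v′ c′ × Fits j v c t v′ c′
      chosen j {v} {c} j<k v< c< with range j<k (row< v< c<) | permitted j<k (row< v< c<)
      ... | s< | ok with split< (2 + k) R s<
      ... | t , r′ , _ , r′< , e with split< (suc V) C r′<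
      ... | v′ , c′ , _ , c′< , refl = t , v′ , c′ , e , fits-sound j (decoded e ok)
        where
        decoded : ∀ {s} → s ≡ t * R + (v′ * C + c′) → allowed j (v * C + c) s ≡ true → fits j v c t v′ c′ ≡ true
        decoded refl ok rewrite quot-+ t r′< | rem-+ t r′< | quot-+ v c< | rem-+ v c< | quot-+ v′ c′< | rem-+ v′ c′< = ok

      0<k : 0 < 2 + k
      0<k = s≤s z≤n

      1<k : 1 < 2 + k
      1<k = s≤s (s≤s z≤n)

      Shifted : ℕ → ℕ → Set
      Shifted v c = φ 0 (v * C + c) ≡ v * C + next c

      -- The column `next c` is taken by row `c`, so row `next c` cannot stay there, unless the two
      -- rows coincide.
      shifted-next : ∀ {v c} → v < suc V → c < C → Shifted v c → Shifted v (next c)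
      shifted-next {v} {c} v< c< s with chosen 0 {v} {next c} 0<k v< (next< c<)
      ... | _ , _ , _ , e , shifts = e
      ... | _ , _ , _ , e , stays = subst (λ w → φ 0 (v * C + w) ≡ v * C + next w) c≡ s
        where
        c≡ : c ≡ next c
        c≡ = +-cancelˡ-≡ (v * C) c (next c) (injective 0<k (row< v< c<) (row< v< (next< c<)) (trans s (sym e)))

      shifted-from-0 : ∀ {v} → v < suc V → Shifted v 0 → ∀ c → c < C → Shifted v c
      shifted-from-0 v< s zero    c< = s
      shifted-from-0 {v} v< s (suc c) c< = subst (Shifted v) (next-suc c<)
        (shifted-next {v} v< (<-trans ≤-refl c<) (shifted-from-0 v< s c (<-trans ≤-refl c<)))

      -- `value` is read at clause 0. From clause `c` the shift is handed on through the remaining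
      -- `d` clauses and then around the end of the cycle.
      shifted-to-0 : ∀ {v} → v < suc V → ∀ d {c} → suc (d + c) ≡ C → Shifted v c → Shifted v 0
      shifted-to-0 {v} v< zero {c} e s = subst (Shifted v) (next-last e) (shifted-next {v} v< (≤-reflexive e) s)
      shifted-to-0 {v} v< (suc d) {c} e s = shifted-to-0 v< d (trans (cong suc (+-suc d c)) e)
        (subst (Shifted v) (next-suc sc<) (shifted-next {v} v< (<-trans ≤-refl sc<) s))
        where
        sc< : suc c < C
        sc< = ≤-trans (s≤s (s≤s (m≤n+m c d))) (≤-reflexive e)

      value : ℕ → Bool
      value v = φ 0 (v * C + 0) ≡ᵇ v * C + next 0

      value-true : ∀ {v c} → v < suc V → c < C → Shifted v c → value v ≡ true
      value-true {v} {c} v< c< s =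
        ≡ᵇ-complete (shifted-to-0 v< (C ∸ suc c) (trans (sym (+-suc (C ∸ suc c) c)) (m∸n+n≡m c<)) s)

      value-false : ∀ {v c} → v < suc V → c < C → ¬ Shifted v c → value v ≡ false
      value-false {v} {c} v< c< ¬s with value v in eq
      ... | false = refl
      ... | true  = contradiction (shifted-from-0 v< (≡ᵇ-sound {φ 0 (v * C + 0)} eq) c c<) ¬s

    selection⇒satisfiable : Satisfiable V C pos neg
    selection⇒satisfiable = record { α = value ; satisfied = satisfied }
      where
      differ : ∀ {v c} → v < suc V → c < C → φ 0 (v * C + c) ≢ φ 1 (v * C + c)
      differ v< c< e = case distinct 0<k 1<k (row< v< c<) e of λ ()
      satisfied : ∀ c → c < C → ∃[ v ] v < V × (pos c v ≡ true × value v ≡ true ⊎ neg c v ≡ true × value v ≡ false)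
      satisfied c c< with chosen 1 {V} {c} 1<k ≤-refl c<
      ... | _ , _ , _ , e , idle V<V      = ⊥-elim (<-irrefl refl V<V)
      ... | _ , _ , _ , e , holds V<V _   = ⊥-elim (<-irrefl refl V<V)
      ... | _ , _ , _ , e , fails V<V _   = ⊥-elim (<-irrefl refl V<V)
      ... | _ , v , _ , e , clause _ v<V _ with chosen 1 {v} {c} 1<k (m<n⇒m<1+n v<V) c<
      ...   | _ , _ , _ , e′ , clause v≮V _ _ = contradiction v<V v≮V
      -- Idling in block 1 would occupy the very column that the clause row has taken.
      ...   | _ , _ , _ , e′ , idle _ = ⊥-elim (<-irrefl
              (trans (sym (quot-+ v c<)) (trans (cong (λ r → quot r C)
                (injective 1<k (row< {v} (m<n⇒m<1+n v<V) c<) (row< {V} ≤-refl c<) (trans e′ (sym e)))) (quot-+ V c<))) v<V)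
      ...   | _ , _ , _ , e′ , holds _ p = v , v<V , inj₁ (p , value-true {v} v< c< shifted)
        where
        v< = m<n⇒m<1+n v<V
        shifted : Shifted v c
        shifted with chosen 0 {v} {c} 0<k v< c<
        ... | _ , _ , _ , e″ , shifts = e″
        ... | _ , _ , _ , e″ , stays  = ⊥-elim (differ {v} v< c< (trans e″ (sym e′)))
      ...   | _ , _ , _ , e′ , fails _ p = v , v<V , inj₂ (p , value-false {v} v< c< (λ s → differ {v} v< c< (trans s (sym e′))))
        where v< = m<n⇒m<1+n v<V

-- Computations expressed by satisfiability

all? : ∀ n {P : ℕ → Set} → (∀ i → Dec (P i)) → (∀ i → i < n → P i) ⊎ ∃[ i ] i < n × ¬ P i
all? zero    d = inj₁ λ i ()
all? (suc n) {P} d with d n | all? n d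
... | no ¬p | _                    = inj₂ (n , ≤-refl , ¬p)
... | yes p | inj₂ (i , i<n , ¬q)  = inj₂ (i , m<n⇒m<1+n i<n , ¬q)
... | yes p | inj₁ q               = inj₁ λ i i<1+n → case i ≟ n of λ where
  (yes refl) → p
  (no  i≢n)  → q i (≤∧≢⇒< (s≤s⁻¹ i<1+n) i≢n)

-- The computation of K tapes over the symbols below Z for T steps. Contents are
-- relative to the heads: the scanned cell is always at position D. The rules
-- are indexed by the possible combinations σ < N of scanned symbols: tape τ
-- scans dig σ τ, writes wr σ τ, and the cell at position 1 + i is then the one
-- that was at position i + mv σ τ. On tape 0 the initial content of the free
-- positions is to be guessed: 0 is blank, 1 and 2 are the bits, 2 means yes.
module Tableau (K Z T D I N : ℕ) (dig wr mv fixed : ℕ → ℕ → ℕ) (free : ℕ → Bool) where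

  updated : ℕ → ℕ → ℕ → ℕ → ℕ
  updated σ τ i s = if i + mv σ τ ≡ᵇ D then wr σ τ else s

  cell : (t′ τ′ i′ s′ t τ i s : ℕ) → Bool
  cell t′ τ′ i′ s′ t τ i s = (t′ ≡ᵇ t) ∧ (τ′ ≡ᵇ τ) ∧ (i′ ≡ᵇ i) ∧ (s′ ≡ᵇ s)

  -- Kind 0: if `σ` is scanned at time `t` and the cell `i + mv σ τ` holds `s`, then the new content
  -- of cell `1 + i` is marked. Kind 1: initial contents. Kind 2: a blank is followed by a blank, so
  -- that the guessed cells spell a word. Kind 3: no verdict but 2. With common parameters for all
  -- kinds, the number of a clause is a mixed radix number.
  posᶜ negᶜ : (κ t σ τ i s t′ τ′ i′ s′ : ℕ) → Bool
  posᶜ κ t σ τ i s t′ τ′ i′ s′ =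
      ((κ ≡ᵇ 0) ∧ cell t′ τ′ i′ s′ (suc t) τ (suc i) (updated σ τ i s))
    ∨ (((κ ≡ᵇ 1) ∧ not ((τ ≡ᵇ 0) ∧ free i) ∧ cell t′ τ′ i′ s′ 0 τ i (fixed τ i))
    ∨ (((κ ≡ᵇ 1) ∧ ((τ ≡ᵇ 0) ∧ free i) ∧ (s′ ≤ᵇ 2) ∧ cell t′ τ′ i′ s′ 0 τ i s′)
    ∨ (((κ ≡ᵇ 2) ∧ cell t′ τ′ i′ s′ 0 0 (suc i) 0)
    -- Left of the head this turns the clause into a tautology: the last blank before the input is
    -- followed by a letter.
    ∨ (((κ ≡ᵇ 2) ∧ (i <ᵇ D) ∧ cell t′ τ′ i′ s′ 0 0 i 0)
    -- Again a tautology, for the one symbol that is permitted as verdict.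
    ∨ ((κ ≡ᵇ 3) ∧ (s ≡ᵇ 2) ∧ cell t′ τ′ i′ s′ T 0 D 2)))))
  negᶜ κ t σ τ i s t′ τ′ i′ s′ =
      ((κ ≡ᵇ 0) ∧ cell t′ τ′ i′ s′ t τ′ D (dig σ τ′))
    ∨ (((κ ≡ᵇ 0) ∧ cell t′ τ′ i′ s′ t τ (i + mv σ τ) s)
    ∨ (((κ ≡ᵇ 2) ∧ cell t′ τ′ i′ s′ 0 0 i 0)
    ∨ ((κ ≡ᵇ 3) ∧ cell t′ τ′ i′ s′ T 0 D s)))

  data Pos : (κ t σ τ i s t′ τ′ i′ s′ : ℕ) → Set where
    result : ∀ {t σ τ i s} → Pos 0 t σ τ i s (suc t) τ (suc i) (updated σ τ i s)
    given  : ∀ {t σ τ i s} → (τ ≡ᵇ 0) ∧ free i ≢ true → Pos 1 t σ τ i s 0 τ i (fixed τ i)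
    guess  : ∀ {t σ i s s′} → free i ≡ true → s′ ≤ 2 → Pos 1 t σ 0 i s 0 0 i s′
    tail   : ∀ {t σ τ i s} → Pos 2 t σ τ i s 0 0 (suc i) 0
    leftOf : ∀ {t σ τ i s} → i < D → Pos 2 t σ τ i s 0 0 i 0
    isYes : ∀ {t σ τ i} → Pos 3 t σ τ i 2 T 0 D 2

  data Neg : (κ t σ τ i s t′ τ′ i′ s′ : ℕ) → Set where
    scans  : ∀ {t σ τ i s τ′} → Neg 0 t σ τ i s t τ′ D (dig σ τ′)
    source : ∀ {t σ τ i s} → Neg 0 t σ τ i s t τ (i + mv σ τ) s
    tail   : ∀ {t σ τ i s} → Neg 2 t σ τ i s 0 0 i 0
    reject : ∀ {t σ τ i s} → Neg 3 t σ τ i s T 0 D s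

  cell-sound : ∀ {t′ τ′ i′ s′ t τ i s} → cell t′ τ′ i′ s′ t τ i s ≡ true → t′ ≡ t × τ′ ≡ τ × i′ ≡ i × s′ ≡ s
  cell-sound {t′} {τ′} {i′} {s′} {t} {τ} {i} {s} e with ∧-proj₁ {t′ ≡ᵇ t} e | ∧-proj₂ {t′ ≡ᵇ t} e
  ... | p | e₁ with ∧-proj₁ {τ′ ≡ᵇ τ} e₁ | ∧-proj₂ {τ′ ≡ᵇ τ} e₁
  ...   | q | e₂ = ≡ᵇ-sound {t′} p , ≡ᵇ-sound {τ′} q , ≡ᵇ-sound {i′} (∧-proj₁ {i′ ≡ᵇ i} e₂) , ≡ᵇ-sound {s′} (∧-proj₂ {i′ ≡ᵇ i} e₂)

  cell-refl : ∀ t τ i s → cell t τ i s t τ i s ≡ true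
  cell-refl t τ i s = ∧-intro (≡ᵇ-complete {t} refl) (∧-intro (≡ᵇ-complete {τ} refl)
    (∧-intro (≡ᵇ-complete {i} refl) (≡ᵇ-complete {s} refl)))

  pos-complete : ∀ {κ t σ τ i s t′ τ′ i′ s′} → Pos κ t σ τ i s t′ τ′ i′ s′ → posᶜ κ t σ τ i s t′ τ′ i′ s′ ≡ true
  pos-complete (result {t} {σ} {τ} {i} {s}) = ∨-introˡ (cell-refl (suc t) τ (suc i) (updated σ τ i s))
  pos-complete (given {τ = τ} {i} h) = ∨-introˡ (∧-intro (not-intro h) (cell-refl 0 τ i (fixed τ i)))
  pos-complete (guess {i = i} {s′ = s′} f h) = ∨-introʳ {not (free i) ∧ cell 0 0 i s′ 0 0 i (fixed 0 i)}
    (∨-introˡ (∧-intro f (∧-intro (T-≡ (≤⇒≤ᵇ h)) (cell-refl 0 0 i s′))))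
  pos-complete (tail {i = i}) = ∨-introˡ (cell-refl 0 0 (suc i) 0)
  pos-complete (leftOf {i = i} h) = ∨-introʳ {cell 0 0 i 0 0 0 (suc i) 0} (∨-introˡ (∧-intro (T-≡ (<⇒<ᵇ h)) (cell-refl 0 0 i 0)))
  pos-complete isYes = cell-refl T 0 D 2

  neg-complete : ∀ {κ t σ τ i s t′ τ′ i′ s′} → Neg κ t σ τ i s t′ τ′ i′ s′ → negᶜ κ t σ τ i s t′ τ′ i′ s′ ≡ true
  neg-complete (scans {t} {σ} {τ′ = τ′}) = ∨-introˡ (cell-refl t τ′ D (dig σ τ′))
  neg-complete (source {t} {σ} {τ} {i} {s}) =
    ∨-introʳ {cell t τ (i + mv σ τ) s t τ D (dig σ τ)} (∨-introˡ (cell-refl t τ (i + mv σ τ) s))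
  neg-complete (tail {i = i}) = ∨-introˡ (cell-refl 0 0 i 0)
  neg-complete (reject {s = s}) = cell-refl T 0 D s

  pos-sound : ∀ κ {t σ τ i s t′ τ′ i′ s′} → posᶜ κ t σ τ i s t′ τ′ i′ s′ ≡ true → Pos κ t σ τ i s t′ τ′ i′ s′
  pos-sound 0 {t} {σ} {τ} {i} {s} {t′} {τ′} {i′} {s′} e with ∨-elim {cell t′ τ′ i′ s′ (suc t) τ (suc i) (updated σ τ i s)} e
  ... | inj₁ p with refl , refl , refl , refl ← cell-sound {t′} {τ′} {i′} {s′} p = result
  pos-sound 1 {t} {σ} {τ} {i} {s} {t′} {τ′} {i′} {s′} e
    with ∨-elim {not ((τ ≡ᵇ 0) ∧ free i) ∧ cell t′ τ′ i′ s′ 0 τ i (fixed τ i)} e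
  ... | inj₁ p with refl , refl , refl , refl ← cell-sound {t′} {τ′} {i′} {s′} (∧-proj₂ {not ((τ ≡ᵇ 0) ∧ free i)} p) =
    given (not-true (∧-proj₁ p))
  ... | inj₂ p′ with ∨-elim {((τ ≡ᵇ 0) ∧ free i) ∧ (s′ ≤ᵇ 2) ∧ cell t′ τ′ i′ s′ 0 τ i s′} p′
  ...   | inj₁ p with ∧-proj₁ {(τ ≡ᵇ 0) ∧ free i} p | ∧-proj₂ {(τ ≡ᵇ 0) ∧ free i} p
  ...     | f | q with refl ← ≡ᵇ-sound {τ} {0} (∧-proj₁ f)
                     | refl , refl , refl , _ ← cell-sound {t′} {τ′} {i′} {s′} (∧-proj₂ {s′ ≤ᵇ 2} q) =
    guess f (≤ᵇ⇒≤ s′ 2 (≡-T (∧-proj₁ q)))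
  pos-sound 2 {t} {σ} {τ} {i} {s} {t′} {τ′} {i′} {s′} e with ∨-elim {cell t′ τ′ i′ s′ 0 0 (suc i) 0} e
  ... | inj₁ p with refl , refl , refl , refl ← cell-sound {t′} {τ′} {i′} {s′} p = tail
  ... | inj₂ p′ with ∨-elim {(i <ᵇ D) ∧ cell t′ τ′ i′ s′ 0 0 i 0} p′
  ...   | inj₁ p with refl , refl , refl , refl ← cell-sound {t′} {τ′} {i′} {s′} (∧-proj₂ {i <ᵇ D} p) =
    leftOf (<ᵇ⇒< i D (≡-T (∧-proj₁ p)))
  pos-sound 3 {t} {σ} {τ} {i} {s} {t′} {τ′} {i′} {s′} e
    with refl ← ≡ᵇ-sound {s} {2} (∧-proj₁ e)
       | refl , refl , refl , refl ← cell-sound {t′} {τ′} {i′} {s′} (∧-proj₂ {s ≡ᵇ 2} e) = isYes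

  neg-sound : ∀ κ {t σ τ i s t′ τ′ i′ s′} → negᶜ κ t σ τ i s t′ τ′ i′ s′ ≡ true → Neg κ t σ τ i s t′ τ′ i′ s′
  neg-sound 0 {t} {σ} {τ} {i} {s} {t′} {τ′} {i′} {s′} e with ∨-elim {cell t′ τ′ i′ s′ t τ′ D (dig σ τ′)} e
  ... | inj₁ p with refl , _ , refl , refl ← cell-sound {t′} {τ′} {i′} {s′} p = scans
  ... | inj₂ p′ with ∨-elim {cell t′ τ′ i′ s′ t τ (i + mv σ τ) s} p′
  ...   | inj₁ p with refl , refl , refl , refl ← cell-sound {t′} {τ′} {i′} {s′} p = source
  neg-sound 2 {t} {σ} {τ} {i} {s} {t′} {τ′} {i′} {s′} e with ∨-elim {cell t′ τ′ i′ s′ 0 0 i 0} e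
  ... | inj₁ p with refl , refl , refl , refl ← cell-sound {t′} {τ′} {i′} {s′} p = tail
  neg-sound 3 {t} {σ} {τ} {i} {s} {t′} {τ′} {i′} {s′} e
    with refl , refl , refl , refl ← cell-sound {t′} {τ′} {i′} {s′} e = reject

  -- `mv` is at most 2, so the clauses for positions below `I` mention cells at positions below
  -- `2 + I`.
  V C : ℕ
  V = suc T * K * (2 + I) * Z
  C = 4 * T * N * K * I * Z

  onVar : (ℕ → ℕ → ℕ → ℕ → Bool) → ℕ → Bool
  onVar f v = f (quot (quot (quot v Z) (2 + I)) K) (rem (quot (quot v Z) (2 + I)) K) (rem (quot v Z) (2 + I)) (rem v Z)

  onClause : (ℕ → ℕ → ℕ → ℕ → ℕ → ℕ → Bool) → ℕ → Bool
  onClause f c = f (quot (quot (quot (quot (quot c Z) I) K) N) T) (rem (quot (quot (quot (quot c Z) I) K) N) T)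
    (rem (quot (quot (quot c Z) I) K) N) (rem (quot (quot c Z) I) K) (rem (quot c Z) I) (rem c Z)

  pos neg : ℕ → ℕ → Bool
  pos c v = onClause (λ κ t σ τ i s → onVar (posᶜ κ t σ τ i s) v) c
  neg c v = onClause (λ κ t σ τ i s → onVar (negᶜ κ t σ τ i s) v) c

  var : ℕ → ℕ → ℕ → ℕ → ℕ
  var t τ i s = ((t * K + τ) * (2 + I) + i) * Z + s

  ClauseBound : (κ t σ τ i s : ℕ) → Set
  ClauseBound κ t σ τ i s = κ < 4 × t < T × σ < N × τ < K × i < I × s < Z

  VarBound : (t τ i s : ℕ) → Set
  VarBound t τ i s = t < suc T × τ < K × i < 2 + I × s < Z

  clauseIndex : (κ t σ τ i s : ℕ) → ℕ
  clauseIndex κ t σ τ i s = ((((κ * T + t) * N + σ) * K + τ) * I + i) * Z + s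

  onVar-var : ∀ {t τ i s} f → VarBound t τ i s → onVar f (var t τ i s) ≡ f t τ i s
  onVar-var {t} {τ} {i} {s} f (t< , τ< , i< , s<)
    rewrite quot-+ ((t * K + τ) * (2 + I) + i) s< | rem-+ ((t * K + τ) * (2 + I) + i) s<
          | quot-+ (t * K + τ) i< | rem-+ (t * K + τ) i< | quot-+ t τ< | rem-+ t τ< = refl

  onClause-index : ∀ {κ t σ τ i s} f → ClauseBound κ t σ τ i s → onClause f (clauseIndex κ t σ τ i s) ≡ f κ t σ τ i s
  onClause-index {κ} {t} {σ} {τ} {i} {s} f (κ< , t< , σ< , τ< , i< , s<)
    rewrite quot-+ ((((κ * T + t) * N + σ) * K + τ) * I + i) s< | rem-+ ((((κ * T + t) * N + σ) * K + τ) * I + i) s<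
          | quot-+ (((κ * T + t) * N + σ) * K + τ) i< | rem-+ (((κ * T + t) * N + σ) * K + τ) i<
          | quot-+ ((κ * T + t) * N + σ) τ< | rem-+ ((κ * T + t) * N + σ) τ<
          | quot-+ (κ * T + t) σ< | rem-+ (κ * T + t) σ< | quot-+ κ t< | rem-+ κ t< = refl

  var-bounded : ∀ {t τ i s} → VarBound t τ i s → var t τ i s < V
  var-bounded (t< , τ< , i< , s<) = combine< (combine< (combine< t< τ<) i<) s<

  clauseIndex-bounded : ∀ {κ t σ τ i s} → ClauseBound κ t σ τ i s → clauseIndex κ t σ τ i s < C
  clauseIndex-bounded (κ< , t< , σ< , τ< , i< , s<) = combine< (combine< (combine< (combine< (combine< κ< t<) σ<) τ<) i<) s<

  var-view : ∀ {v} → v < V → ∃[ t ] ∃[ τ ] ∃[ i ] ∃[ s ] VarBound t τ i s × v ≡ var t τ i s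
  var-view v< with split< (suc T * K * (2 + I)) Z v<
  ... | _ , s , v<₁ , s< , refl with split< (suc T * K) (2 + I) v<₁
  ... | _ , i , v<₂ , i< , refl with split< (suc T) K v<₂
  ... | t , τ , t< , τ< , refl = t , τ , i , s , (t< , τ< , i< , s<) , refl

  clause-view : ∀ {c} → c < C → ∃[ κ ] ∃[ t ] ∃[ σ ] ∃[ τ ] ∃[ i ] ∃[ s ] ClauseBound κ t σ τ i s × c ≡ clauseIndex κ t σ τ i s
  clause-view c< with split< (4 * T * N * K * I) Z c<
  ... | _ , s , c<₁ , s< , refl with split< (4 * T * N * K) I c<₁
  ... | _ , i , c<₂ , i< , refl with split< (4 * T * N) K c<₂
  ... | _ , τ , c<₃ , τ< , refl with split< (4 * T) N c<₃
  ... | _ , σ , c<₄ , σ< , refl with split< 4 T c<₄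
  ... | κ , t , κ< , t< , refl = κ , t , σ , τ , i , s , (κ< , t< , σ< , τ< , i< , s<) , refl

  module _ {κ t σ τ i s t′ τ′ i′ s′} (b : ClauseBound κ t σ τ i s) (b′ : VarBound t′ τ′ i′ s′) where

    pos-at : pos (clauseIndex κ t σ τ i s) (var t′ τ′ i′ s′) ≡ posᶜ κ t σ τ i s t′ τ′ i′ s′
    pos-at = trans (onClause-index (λ κ t σ τ i s → onVar (posᶜ κ t σ τ i s) (var t′ τ′ i′ s′)) b)
      (onVar-var (posᶜ κ t σ τ i s) b′)

    neg-at : neg (clauseIndex κ t σ τ i s) (var t′ τ′ i′ s′) ≡ negᶜ κ t σ τ i s t′ τ′ i′ s′
    neg-at = trans (onClause-index (λ κ t σ τ i s → onVar (negᶜ κ t σ τ i s) (var t′ τ′ i′ s′)) b)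
      (onVar-var (negᶜ κ t σ τ i s) b′)

  record Computation (F : ℕ → ℕ → ℕ → ℕ) : Set where
    field
      symbol< : ∀ t τ i → F t τ i < Z
      combination : ∀ t → ∃[ σ ] σ < N × (∀ τ → τ < K → dig σ τ ≡ F t τ D)
      step : ∀ t {σ} → σ < N → (∀ τ → τ < K → dig σ τ ≡ F t τ D) → ∀ τ → τ < K → ∀ i →
        F (suc t) τ (suc i) ≡ updated σ τ i (F t τ (i + mv σ τ))

  module _ (mv≤2 : ∀ σ τ → mv σ τ ≤ 2) (0<K : 0 < K) (2<Z : 2 < Z) where

    module _ (F : ℕ → ℕ → ℕ → ℕ) (run : Computation F)
      (starts   : ∀ τ i → τ < K → i < I → (τ ≡ᵇ 0) ∧ free i ≢ true → F 0 τ i ≡ fixed τ i)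
      (guesses  : ∀ i → i < I → free i ≡ true → F 0 0 i ≤ 2)
      (blanks   : ∀ i → D ≤ i → F 0 0 i ≡ 0 → F 0 0 (suc i) ≡ 0)
      (leftmost : ∀ i → i < D → F 0 0 i ≡ 0)
      (D<I      : D < I)
      (accepts  : F T 0 D ≡ 2) where
      open Computation run

      private
        Witness : (κ t σ τ i s : ℕ) → Set
        Witness κ t σ τ i s = ∃[ t′ ] ∃[ τ′ ] ∃[ i′ ] ∃[ s′ ] VarBound t′ τ′ i′ s′ ×
          (Pos κ t σ τ i s t′ τ′ i′ s′ × F t′ τ′ i′ ≡ s′ ⊎ Neg κ t σ τ i s t′ τ′ i′ s′ × F t′ τ′ i′ ≢ s′)

        wide : ∀ {i} → i < I → i < 2 + I
        wide i<I = ≤-trans i<I (m≤n+m I 2)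

        source< : ∀ {i} σ τ → i < I → i + mv σ τ < 2 + I
        source< {i} σ τ i<I = ≤-trans (+-mono-≤ i<I (mv≤2 σ τ)) (≤-reflexive (+-comm I 2))

      module _ (dig<Z : ∀ σ τ → dig σ τ < Z) where

        private
          witness : ∀ κ {t σ τ i s} → ClauseBound κ t σ τ i s → Witness κ t σ τ i s
          witness 0 {t} {σ} {τ} {i} {s} (_ , t< , σ< , τ< , i< , s<) with all? K (λ τ → dig σ τ ≟ F t τ D)
          ... | inj₂ (τ′ , τ′< , ≢) = t , τ′ , D , dig σ τ′ , (m<n⇒m<1+n t< , τ′< , wide D<I , dig<Z σ τ′)
            , inj₂ (scans , ≢ ∘ sym)
          ... | inj₁ scanned with F t τ (i + mv σ τ) ≟ s
          ...   | no ≢s = t , τ , i + mv σ τ , s , (m<n⇒m<1+n t< , τ< , source< σ τ i< , s<) , inj₂ (source , ≢s)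
          ...   | yes refl = suc t , τ , suc i , _ , (s≤s t< , τ< , s≤s (m<n⇒m<1+n i<)
              , ≤-trans (≤-reflexive (cong suc (sym F≡))) (symbol< _ _ _)) , inj₁ (result , F≡)
            where F≡ = step t σ< scanned τ τ< i
          witness 1 {t} {σ} {τ} {i} (_ , t< , σ< , τ< , i< , s<) with (τ ≡ᵇ 0) ∧ free i Boolₚ.≟ true
          ... | no h = 0 , τ , i , fixed τ i , (s≤s z≤n , τ< , wide i<
                , ≤-trans (≤-reflexive (cong suc (sym (starts τ i τ< i< h)))) (symbol< 0 τ i))
                , inj₁ (given h , starts τ i τ< i< h)
          ... | yes f with refl ← ≡ᵇ-sound {τ} {0} (∧-proj₁ f) =
            0 , 0 , i , F 0 0 i , (s≤s z≤n , τ< , wide i< , symbol< 0 0 i) , inj₁ (guess f (guesses i i< f) , refl)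
          witness 2 {i = i} (_ , t< , σ< , τ< , i< , s<) with i <? D | F 0 0 i ≟ 0
          ... | yes i<D | _ = 0 , 0 , i , 0 , (s≤s z≤n , 0<K , wide i< , <-trans (s≤s z≤n) 2<Z) , inj₁ (leftOf i<D , leftmost i i<D)
          ... | no _ | no ≢0 = 0 , 0 , i , 0 , (s≤s z≤n , 0<K , wide i< , <-trans (s≤s z≤n) 2<Z) , inj₂ (tail , ≢0)
          ... | no i≮D | yes ≡0 = 0 , 0 , suc i , 0 , (s≤s z≤n , 0<K , s≤s (m<n⇒m<1+n i<) , <-trans (s≤s z≤n) 2<Z)
            , inj₁ (tail , blanks i (≮⇒≥ i≮D) ≡0)
          witness 3 {s = s} (_ , t< , σ< , τ< , i< , s<) with s ≟ 2
          ... | yes refl = T , 0 , D , 2 , (≤-refl , 0<K , wide D<I , 2<Z) , inj₁ (isYes , accepts)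
          ... | no ≢2 = T , 0 , D , s , (≤-refl , 0<K , wide D<I , s<) , inj₂ (reject , λ e → ≢2 (trans (sym e) accepts))
          witness (suc (suc (suc (suc κ)))) (s≤s (s≤s (s≤s (s≤s ()))) , _)

        computation⇒satisfiable : Satisfiable V C pos neg
        computation⇒satisfiable = record { α = α ; satisfied = satisfied }
          where
          holdsᶜ : ℕ → ℕ → ℕ → ℕ → Bool
          holdsᶜ t τ i s = F t τ i ≡ᵇ s
          α : ℕ → Bool
          α = onVar holdsᶜ
          α-true : ∀ {t τ i s} → VarBound t τ i s → F t τ i ≡ s → α (var t τ i s) ≡ true
          α-true b e = trans (onVar-var holdsᶜ b) (≡ᵇ-complete e)
          α-false : ∀ {t τ i s} → VarBound t τ i s → F t τ i ≢ s → α (var t τ i s) ≡ false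
          α-false {t} {τ} {i} {s} b ≢s = trans (onVar-var holdsᶜ b) (Boolₚ.¬-not (≢s ∘ ≡ᵇ-sound {F t τ i}))
          satisfied : ∀ c → c < C → ∃[ v ] v < V × (pos c v ≡ true × α v ≡ true ⊎ neg c v ≡ true × α v ≡ false)
          satisfied c c< with clause-view c<
          ... | κ , t , σ , τ , i , s , b , refl with witness κ b
          ... | t′ , τ′ , i′ , s′ , b′ , inj₁ (p , e) = var t′ τ′ i′ s′ , var-bounded b′ , inj₁
            (trans (pos-at b b′) (pos-complete p) , α-true b′ e)
          ... | t′ , τ′ , i′ , s′ , b′ , inj₂ (p , e) = var t′ τ′ i′ s′ , var-bounded b′ , inj₂
            (trans (neg-at b b′) (neg-complete p) , α-false b′ e)

    module Satisfied (sat : Satisfiable V C pos neg) (0<T : 0 < T) (0<N : 0 < N) (T≤D : T ≤ D) (D+T<I : D + T < I) where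
      open Satisfiable sat

      marked : (t τ i s : ℕ) → Bool
      marked t τ i s = α (var t τ i s)

      private
        literal : ∀ {κ t σ τ i s} → ClauseBound κ t σ τ i s → ∃[ t′ ] ∃[ τ′ ] ∃[ i′ ] ∃[ s′ ] VarBound t′ τ′ i′ s′ ×
          (Pos κ t σ τ i s t′ τ′ i′ s′ × marked t′ τ′ i′ s′ ≡ true ⊎ Neg κ t σ τ i s t′ τ′ i′ s′ × marked t′ τ′ i′ s′ ≡ false)
        literal {κ} b with satisfied _ (clauseIndex-bounded b)
        ... | v , v< , l with var-view v<
        ... | t′ , τ′ , i′ , s′ , b′ , refl with l
        ... | inj₁ (p , a) = t′ , τ′ , i′ , s′ , b′ , inj₁ (pos-sound κ (trans (sym (pos-at b b′)) p) , a)
        ... | inj₂ (p , a) = t′ , τ′ , i′ , s′ , b′ , inj₂ (neg-sound κ (trans (sym (neg-at b b′)) p) , a)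

        clash : {b : Bool} → b ≡ true → b ≡ false → ⊥
        clash refl ()

        D<I : D < I
        D<I = ≤-trans (s≤s (m≤m+n D T)) D+T<I

        0<Z : 0 < Z
        0<Z = <-trans (s≤s z≤n) 2<Z

      marked-next : ∀ {t σ τ i s} → ClauseBound 0 t σ τ i s → (∀ τ → τ < K → marked t τ D (dig σ τ) ≡ true) →
        marked t τ (i + mv σ τ) s ≡ true → marked (suc t) τ (suc i) (updated σ τ i s) ≡ true
      marked-next b scanned m with literal b
      ... | _ , _ , _ , _ , _ , inj₁ (result , a)               = a
      ... | _ , τ′ , _ , _ , (_ , τ′< , _) , inj₂ (scans , a)  = ⊥-elim (clash (scanned τ′ τ′<) a)
      ... | _ , _ , _ , _ , _ , inj₂ (source , a)               = ⊥-elim (clash m a)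

      marked-fixed : ∀ {τ i} → τ < K → i < I → (τ ≡ᵇ 0) ∧ free i ≢ true → marked 0 τ i (fixed τ i) ≡ true
      marked-fixed τ< i< h with literal {1} (s≤s (s≤s z≤n) , 0<T , 0<N , τ< , i< , 0<Z)
      ... | _ , _ , _ , _ , _ , inj₁ (given _ , a)   = a
      ... | _ , _ , _ , _ , _ , inj₁ (guess f _ , a) = contradiction f h

      marked-free : ∀ {i} → i < I → free i ≡ true → ∃[ s ] s ≤ 2 × marked 0 0 i s ≡ true
      marked-free i< f with literal {1} (s≤s (s≤s z≤n) , 0<T , 0<N , 0<K , i< , 0<Z)
      ... | _ , _ , _ , _ , _ , inj₁ (given h , a)   = contradiction f h
      ... | _ , _ , _ , s , _ , inj₁ (guess _ s≤2 , a) = s , s≤2 , a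

      marked-blank : ∀ {i} → i < I → D ≤ i → marked 0 0 i 0 ≡ true → marked 0 0 (suc i) 0 ≡ true
      marked-blank i< D≤i m with literal {2} (s≤s (s≤s (s≤s z≤n)) , 0<T , 0<N , 0<K , i< , 0<Z)
      ... | _ , _ , _ , _ , _ , inj₁ (tail , a)       = a
      ... | _ , _ , _ , _ , _ , inj₁ (leftOf i<D , _) = contradiction i<D (≤⇒≯ D≤i)
      ... | _ , _ , _ , _ , _ , inj₂ (tail , a)       = ⊥-elim (clash m a)

      marked-final : ∀ {s} → s < Z → marked T 0 D s ≡ true → s ≡ 2
      marked-final s< m with literal {3} (≤-refl , 0<T , 0<N , 0<K , D<I , s<)
      ... | _ , _ , _ , _ , _ , inj₁ (isYes , a) = refl
      ... | _ , _ , _ , _ , _ , inj₂ (reject , a) = ⊥-elim (clash m a)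

      module _ (F : ℕ → ℕ → ℕ → ℕ) (run : Computation F)
        (starts : ∀ τ i → τ < K → i < I → marked 0 τ i (F 0 τ i) ≡ true) where
        open Computation run

        private
          -- The border cells of the window lack known predecessors, so the reliable region loses
          -- one cell on either side in every step. The margins `T ≤ D` and `D + T < I` keep the
          -- scanned cell inside it up to time `T`.
          marked-at : ∀ t → t ≤ T → ∀ τ i → τ < K → t ≤ i → i + t < I → marked t τ i (F t τ i) ≡ true
          marked-at zero    _   τ i τ< _ i< = starts τ i τ< (≤-trans (≤-reflexive (cong suc (sym (+-identityʳ i)))) i<)
          marked-at (suc t) t<T τ (suc i) τ< (s≤s t≤i) i+t< with combination t
          ... | σ , σ< , scanned = subst (λ s → marked (suc t) τ (suc i) s ≡ true) (sym (step t σ< scanned τ τ< i))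
            (marked-next (s≤s z≤n , t<T , σ< , τ< , ≤-trans (s≤s (m≤m+n i t)) (≤-trans (s≤s (n≤1+n _)) (≤-trans (n≤1+n _) i+t<′)) , symbol< t τ _)
              (λ τ′ τ′< → subst (λ s → marked t τ′ D s ≡ true) (sym (scanned τ′ τ′<))
                (marked-at t t≤T τ′ D τ′< (≤-trans t≤T T≤D) (≤-trans (s≤s (+-monoʳ-≤ D t≤T)) D+T<I)))
              (marked-at t t≤T τ (i + mv σ τ) τ< (≤-trans t≤i (m≤m+n i _)) (≤-trans (s≤s (≤-trans (+-monoˡ-≤ t (+-monoʳ-≤ i (mv≤2 σ τ)))
                (≤-reflexive (lemma i t)))) i+t<′)))
            where
            t≤T = <⇒≤ t<T
            lemma : ∀ i t → i + 2 + t ≡ suc (suc (i + t))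
            lemma = solve-∀
            i+t<′ : suc (suc (suc (i + t))) ≤ I
            i+t<′ = ≤-trans (≤-reflexive (cong (λ n → suc (suc n)) (sym (+-suc i t)))) i+t<

        computation-accepts : F T 0 D ≡ 2
        computation-accepts = marked-final (symbol< T 0 D) (marked-at T ≤-refl 0 D 0<K T≤D D+T<I)

-- Runs of Turing machines as tableaux

module _ {S : Set} where

  -- The cell at offset a − b from the head.
  look : Tape S → ℕ → ℕ → Maybe S
  look t zero    zero    = head t
  look t (suc a) zero    = nth (after t) a
  look t zero    (suc b) = nth (before t) b
  look t (suc a) (suc b) = look t a b

  look-right : ∀ t a b → look (move right t) a b ≡ look t (suc a) b
  look-right (tape ls h [])       zero    zero          = refl
  look-right (tape ls h (r ∷ rs)) zero    zero          = refl
  look-right (tape ls h [])       (suc a) zero          = refl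
  look-right (tape ls h (r ∷ rs)) (suc a) zero          = refl
  look-right (tape ls h [])       zero    (suc zero)    = refl
  look-right (tape ls h (r ∷ rs)) zero    (suc zero)    = refl
  look-right (tape ls h [])       zero    (suc (suc b)) = refl
  look-right (tape ls h (r ∷ rs)) zero    (suc (suc b)) = refl
  look-right t                    (suc a) (suc b)       = look-right t a b

  look-left : ∀ t a b → look (move left t) a b ≡ look t a (suc b)
  look-left (tape []       h rs) zero          zero    = refl
  look-left (tape (l ∷ ls) h rs) zero          zero    = refl
  look-left (tape []       h rs) (suc zero)    zero    = refl
  look-left (tape (l ∷ ls) h rs) (suc zero)    zero    = refl
  look-left (tape []       h rs) (suc (suc a)) zero    = refl
  look-left (tape (l ∷ ls) h rs) (suc (suc a)) zero    = refl
  look-left (tape []       h rs) zero          (suc b) = refl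
  look-left (tape (l ∷ ls) h rs) zero          (suc b) = refl
  look-left t                    (suc a)       (suc b) = look-left t a b

  look-write : ∀ t s a b → look (tape (before t) s (after t)) a b ≡ (if a ≡ᵇ b then s else look t a b)
  look-write t s zero    zero    = refl
  look-write t s (suc a) zero    = refl
  look-write t s zero    (suc b) = refl
  look-write t s (suc a) (suc b) = look-write t s a b

  look-head : ∀ t a → look t a a ≡ head t
  look-head t zero    = refl
  look-head t (suc a) = look-head t a

  look-from : ∀ t a j → look t (a + j) a ≡ look t j 0
  look-from t zero    j = refl
  look-from t (suc a) j = look-from t a j

  -- The displacement of the head plus 1: the new cell `1 + i` is the old cell `i + moveCode m`,
  -- which avoids negative offsets.
  moveCode : Move → ℕ
  moveCode left  = 0
  moveCode stay  = 1
  moveCode right = 2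

  look-writeMove : ∀ t s m i b → look (writeMove (s , m) t) (suc i) b ≡
    (if i + moveCode m ≡ᵇ b then s else look t (i + moveCode m) b)
  look-writeMove t s left  i b rewrite +-identityʳ i = trans (look-left (tape (before t) s (after t)) (suc i) b) (look-write t s i b)
  look-writeMove t s stay  i b rewrite +-comm i 1 = look-write t s (suc i) b
  look-writeMove t s right i b rewrite +-comm i 2 = trans (look-right (tape (before t) s (after t)) (suc i) b) (look-write t s (2 + i) b)

extend-≥ : ∀ {n} {A : Set} (d : A) (f : Fin n → A) i → n ≤ i → extend d f i ≡ d
extend-≥ {zero}  d f i       _         = refl
extend-≥ {suc n} d f (suc i) (s≤s n≤i) = extend-≥ d (f ∘ suc) i n≤i

rem-< : ∀ a {b} → 0 < b → rem a b < b
rem-< a {b} 0<b = rem< (suc a) b (≤-trans (≤-reflexive (sym (*-identityʳ (suc a)))) (*-monoʳ-≤ (suc a) 0<b))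

digit : ℕ → ℕ → ℕ → ℕ
digit Z σ zero    = rem σ Z
digit Z σ (suc τ) = digit Z (quot σ Z) τ

pack : ℕ → ℕ → (ℕ → ℕ) → ℕ
pack Z zero    d = 0
pack Z (suc K) d = pack Z K (d ∘ suc) * Z + d 0

digit< : ∀ {Z} σ τ → 0 < Z → digit Z σ τ < Z
digit< σ zero    0<Z = rem-< σ 0<Z
digit< {Z} σ (suc τ) 0<Z = digit< (quot σ Z) τ 0<Z

pack< : ∀ Z K d → (∀ τ → d τ < Z) → pack Z K d < Z ^ K
pack< Z zero    d h = s≤s z≤n
pack< Z (suc K) d h = ≤-trans (combine< (pack< Z K (d ∘ suc) (h ∘ suc)) (h 0)) (≤-reflexive (*-comm (Z ^ K) Z))

digit-pack : ∀ Z K d → (∀ τ → d τ < Z) → ∀ τ → τ < K → digit Z (pack Z K d) τ ≡ d τ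
digit-pack Z (suc K) d h zero    _         = rem-+ (pack Z K (d ∘ suc)) (h 0)
digit-pack Z (suc K) d h (suc τ) (s≤s τ<K) =
  trans (cong (λ σ → digit Z σ τ) (quot-+ (pack Z K (d ∘ suc)) (h 0))) (digit-pack Z K (d ∘ suc) (h ∘ suc) τ τ<K)

module Simulation (M : TM) where
  open TM M
  open Run M

  -- The digits of a combination are tape symbols and, for the additional tape, a state; hence one
  -- base that is large enough for both.
  Z : ℕ
  Z = 3 + #extraSymbols + #states

  2<Z : 2 < Z
  2<Z = s≤s (s≤s (s≤s z≤n))

  0<Z : 0 < Z
  0<Z = s≤s z≤n

  encodeSymbol : Symbol → ℕ
  encodeSymbol nothing             = 0
  encodeSymbol (just (inj₁ false)) = 1
  encodeSymbol (just (inj₁ true))  = 2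
  encodeSymbol (just (inj₂ j))     = 3 + toℕ j

  decodeSymbol : ℕ → Symbol
  decodeSymbol 0 = nothing
  decodeSymbol 1 = just (inj₁ false)
  decodeSymbol 2 = just (inj₁ true)
  decodeSymbol (suc (suc (suc j))) = extend nothing (just ∘ inj₂) j

  decode-encode : ∀ s → decodeSymbol (encodeSymbol s) ≡ s
  decode-encode nothing             = refl
  decode-encode (just (inj₁ false)) = refl
  decode-encode (just (inj₁ true))  = refl
  decode-encode (just (inj₂ j))     = extend-toℕ nothing (just ∘ inj₂) j

  encodeSymbol< : ∀ s → encodeSymbol s < Z
  encodeSymbol< nothing             = s≤s z≤n
  encodeSymbol< (just (inj₁ false)) = s≤s (s≤s z≤n)
  encodeSymbol< (just (inj₁ true))  = s≤s (s≤s (s≤s z≤n))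
  encodeSymbol< (just (inj₂ j))     = +-monoʳ-≤ 3 (≤-trans (toℕ<n j) (m≤m+n _ _))

  -- A halted configuration is made to repeat itself, so that a run can be prolonged up to the time
  -- `T`.
  action : State → Vec Symbol #tapes → State × Vec (Symbol × Move) #tapes
  action q ss with δ q ss
  ... | nothing = q , Vec.map (_, stay) ss
  ... | just a  = a

  totalStep : Config → Config
  totalStep (config q ts) =
    config (proj₁ (action q (Vec.map head ts))) (Vec.zipWith writeMove (proj₂ (action q (Vec.map head ts))) ts)

  stay-id : ∀ {n} (ts : Vec (Tape (Bool ⊎ Fin #extraSymbols)) n) →
    Vec.zipWith writeMove (Vec.map (_, stay) (Vec.map head ts)) ts ≡ ts
  stay-id []       = refl
  stay-id (t ∷ ts) = cong (t ∷_) (stay-id ts)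

  totalStep-just : ∀ c {c′} → step c ≡ just c′ → totalStep c ≡ c′
  totalStep-just (config q ts) e with δ q (Vec.map head ts)
  totalStep-just (config q ts) refl | just _ = refl

  totalStep-halted : ∀ c → Halted c → totalStep c ≡ c
  totalStep-halted (config q ts) e with δ q (Vec.map head ts)
  ... | nothing = cong (config q) (stay-id ts)

  stepsFrom : Config → ℕ → Config
  stepsFrom c zero    = c
  stepsFrom c (suc t) = totalStep (stepsFrom c t)

  stepsFrom-suc : ∀ c t → stepsFrom c (suc t) ≡ stepsFrom (totalStep c) t
  stepsFrom-suc c zero    = refl
  stepsFrom-suc c (suc t) = cong totalStep (stepsFrom-suc c t)

  stepsFrom-halted : ∀ c → Halted c → ∀ t → stepsFrom c t ≡ c
  stepsFrom-halted c h zero    = refl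
  stepsFrom-halted c h (suc t) = trans (cong totalStep (stepsFrom-halted c h t)) (totalStep-halted c h)

  stepsFrom-run : ∀ n c → Halted (run n c) → ∀ t → n ≤ t → stepsFrom c t ≡ run n c
  stepsFrom-run zero    c h t n≤t = stepsFrom-halted c h t
  stepsFrom-run (suc n) c h (suc t) (s≤s n≤t) with step c in eq
  ... | nothing = stepsFrom-halted c eq (suc t)
  ... | just c′ = trans (stepsFrom-suc c t) (trans (cong (λ c → stepsFrom c t) (totalStep-just c eq)) (stepsFrom-run n c′ h t n≤t))

  K : ℕ
  K = suc #tapes

  -- The number of combinations is kept symbolic: it enters by packing and unpacking of digits, and
  -- is never to be computed.
  opaque
    N : ℕ
    N = Z ^ K

    packed : (ℕ → ℕ) → ℕ
    packed = pack Z K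

    packed< : ∀ d → (∀ τ → d τ < Z) → packed d < N
    packed< = pack< Z K

    digit-packed : ∀ d → (∀ τ → d τ < Z) → ∀ τ → τ < K → digit Z (packed d) τ ≡ d τ
    digit-packed = digit-pack Z K

  0<N : 0 < N
  0<N = ≤-trans (s≤s z≤n) (packed< (λ _ → 0) (λ _ → 0<Z))

  dig : ℕ → ℕ → ℕ
  dig = lookup₂ N K (digit Z)

  actionOf : ℕ → State × Vec (Symbol × Move) #tapes
  actionOf σ = action (extend start id (digit Z σ #tapes)) (Vec.tabulate (λ τ → decodeSymbol (digit Z σ (toℕ τ))))

  written moved : ℕ → Fin #tapes → ℕ
  written σ τ = encodeSymbol (proj₁ (lookup (proj₂ (actionOf σ)) τ))
  moved σ τ = moveCode {Bool ⊎ Fin #extraSymbols} (proj₂ (lookup (proj₂ (actionOf σ)) τ))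

  writes moves : ℕ → ℕ → ℕ
  writes σ = extend (toℕ (proj₁ (actionOf σ))) (written σ)
  moves σ = extend 1 (moved σ)

  wr mv : ℕ → ℕ → ℕ
  wr = lookup₂ N K writes
  mv = lookup₂ N K moves

  extend-elim : ∀ {n} {A : Set} {Q : A → Set} (d : A) (f : Fin n → A) → Q d → (∀ i → Q (f i)) → ∀ i → Q (extend d f i)
  extend-elim {zero}      d f qd qf i       = qd
  extend-elim {suc n}     d f qd qf zero    = qf zero
  extend-elim {suc n} {Q = Q} d f qd qf (suc i) = extend-elim {Q = Q} d (f ∘ suc) qd (qf ∘ suc) i

  mv≤2 : ∀ σ τ → mv σ τ ≤ 2
  mv≤2 = lookup₂-≤ N K moves 2 λ σ → extend-elim {Q = _≤ 2} 1 (moved σ) (s≤s z≤n) (λ i → moveCode≤2 _)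
    where
    moveCode≤2 : ∀ m → moveCode {Bool ⊎ Fin #extraSymbols} m ≤ 2
    moveCode≤2 left  = z≤n
    moveCode≤2 stay  = s≤s z≤n
    moveCode≤2 right = ≤-refl

  dig<Z : ∀ σ τ → dig σ τ < Z
  dig<Z σ τ = s≤s (lookup₂-≤ N K (digit Z) (2 + #extraSymbols + #states) (λ σ τ → s≤s⁻¹ (digit< σ τ 0<Z)) σ τ)

  module Trace (T D I : ℕ) (fixed : ℕ → ℕ → ℕ) (free : ℕ → Bool) where
    open Tableau K Z T D I N dig wr mv fixed free public

    -- The state is treated as the content of a further tape at position D.
    stateRow : Config → ℕ → ℕ
    stateRow c i = if i ≡ᵇ D then toℕ (state c) else 0

    tapeRow : Config → Fin #tapes → ℕ → ℕ
    tapeRow c τ i = encodeSymbol (look (lookup (tapes c) τ) i D)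

    contentOf : Config → ℕ → ℕ → ℕ
    contentOf c = extend (stateRow c) (tapeRow c)

    content-tape : ∀ c τ i → contentOf c (toℕ τ) i ≡ tapeRow c τ i
    content-tape c τ i = cong (λ f → f i) (extend-toℕ (stateRow c) (tapeRow c) τ)

    content-state : ∀ c i → contentOf c #tapes i ≡ stateRow c i
    content-state c i = cong (λ f → f i) (extend-≥ (stateRow c) (tapeRow c) #tapes ≤-refl)

    content< : ∀ c τ i → contentOf c τ i < Z
    content< c τ i = extend-elim {Q = λ f → f i < Z} (stateRow c) (tapeRow c) state< (λ τ → encodeSymbol< (look (lookup (tapes c) τ) i D)) τ
      where
      state< : (if i ≡ᵇ D then toℕ (state c) else 0) < Z
      state< with i ≡ᵇ D
      ... | true  = ≤-trans (toℕ<n (state c)) (m≤n+m #states _)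
      ... | false = s≤s z≤n

    trace : Config → ℕ → ℕ → ℕ → ℕ
    trace c t = contentOf (stepsFrom c t)

    -- The combination determines the state and the scanned symbols, hence the action. The
    -- additional tape behaves like one that never moves and on which the new state is written.
    updated-step : ∀ c {σ} → σ < N → (∀ τ → τ < K → dig σ τ ≡ contentOf c τ D) → ∀ τ → τ < K → ∀ i →
      contentOf (totalStep c) τ (suc i) ≡ updated σ τ i (contentOf c τ (i + mv σ τ))
    updated-step c@(config q ts) {σ} σ<N scannedᵗ τ τ<K i = subst₂
      (λ m w → contentOf (totalStep c) τ (suc i) ≡ (if i + m ≡ᵇ D then w else contentOf c τ (i + m)))
      (sym (lookup₂-val moves σ<N τ<K)) (sym (lookup₂-val writes σ<N τ<K)) (onRow (τ <? #tapes))
      where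
      scanned : ∀ τ → τ < K → digit Z σ τ ≡ contentOf c τ D
      scanned τ τ<K = trans (sym (lookup₂-val (digit Z) σ<N τ<K)) (scannedᵗ τ τ<K)
      Row : ℕ → Set
      Row τ = contentOf (totalStep c) τ (suc i) ≡ (if i + moves σ τ ≡ᵇ D then writes σ τ else contentOf c τ (i + moves σ τ))
      state≡ : extend start id (digit Z σ #tapes) ≡ q
      state≡ = trans (cong (extend start id) (trans (scanned #tapes ≤-refl)
        (trans (content-state c D) (cong (if_then toℕ q else 0) (≡ᵇ-complete {D} refl))))) (extend-toℕ start id q)
      symbols≡ : Vec.tabulate (λ τ → decodeSymbol (digit Z σ (toℕ τ))) ≡ Vec.map head ts
      symbols≡ = trans (Vecₚ.tabulate-cong λ τ → trans (cong decodeSymbol (trans (scanned (toℕ τ) (m<n⇒m<1+n (toℕ<n τ)))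
          (trans (content-tape c τ D) (cong encodeSymbol (look-head (lookup ts τ) D)))))
        (trans (decode-encode _) (sym (Vecₚ.lookup-map τ head ts)))) (Vecₚ.tabulate∘lookup (Vec.map head ts))
      action≡ : actionOf σ ≡ action q (Vec.map head ts)
      action≡ = cong₂ action state≡ symbols≡
      onTape : ∀ (τ : Fin #tapes) → Row (toℕ τ)
      onTape τ
        rewrite content-tape (totalStep c) τ (suc i) | content-tape c τ (i + moves σ (toℕ τ))
              | extend-toℕ (toℕ (proj₁ (actionOf σ))) (written σ) τ
              | extend-toℕ 1 (moved σ) τ
              | action≡ | Vecₚ.lookup-zipWith writeMove τ (proj₂ (action q (Vec.map head ts))) ts
        = trans (cong encodeSymbol (look-writeMove (lookup ts τ) _ _ i D)) (pull (i + moveCode {Bool ⊎ Fin #extraSymbols} _ ≡ᵇ D))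
        where
        pull : ∀ b {s s′} → encodeSymbol (if b then s else s′) ≡ (if b then encodeSymbol s else encodeSymbol s′)
        pull true  = refl
        pull false = refl
      onState : Row #tapes
      onState
        rewrite extend-≥ (toℕ (proj₁ (actionOf σ))) (written σ) #tapes ≤-refl
              | extend-≥ 1 (moved σ) #tapes ≤-refl
              | content-state (totalStep c) (suc i) | content-state c (i + 1) | +-comm i 1 | action≡
        with suc i ≡ᵇ D
      ... | true  = refl
      ... | false = refl
      onRow : Dec (τ < #tapes) → Row τ
      onRow (yes τ<) = subst Row (toℕ-fromℕ< τ<) (onTape (fromℕ< τ<))
      onRow (no τ≮)  = subst Row (≤-antisym (≮⇒≥ τ≮) (s≤s⁻¹ τ<K)) onState

    trace-computation : ∀ c → Computation (trace c)
    trace-computation c = record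
      { symbol<     = λ t → content< (stepsFrom c t)
      ; combination = λ t → packed (λ τ → trace c t τ D) , packed< _ (λ τ → content< (stepsFrom c t) τ D)
          , λ τ τ<K → trans (lookup₂-val (digit Z) (packed< _ (λ τ → content< (stepsFrom c t) τ D)) τ<K)
              (digit-packed _ (λ τ → content< (stepsFrom c t) τ D) τ τ<K)
      ; step        = λ t → updated-step (stepsFrom c t)
      }

-- The input of the verifier and the theorem of Cook and Levin

letter : Word → ℕ → Maybe Bool
letter []      i       = nothing
letter (b ∷ y) zero    = just b
letter (b ∷ y) (suc i) = letter y i

letterCode : Maybe Bool → ℕ
letterCode nothing      = 0
letterCode (just false) = 1
letterCode (just true)  = 2

letterBit : Maybe Bool → ℕ
letterBit (just true) = 1
letterBit _           = 0

bitAt-letter : ∀ y i → bitAt y i ≡ letterBit (letter y i)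
bitAt-letter []          i       = refl
bitAt-letter (true  ∷ y) zero    = refl
bitAt-letter (false ∷ y) zero    = refl
bitAt-letter (true  ∷ y) (suc i) = bitAt-letter y i
bitAt-letter (false ∷ y) (suc i) = bitAt-letter y i

letter-inside : ∀ y {i} → i < length y → letterCode (letter y i) ≡ suc (bitAt y i)
letter-inside (true  ∷ y) {zero}  _       = refl
letter-inside (false ∷ y) {zero}  _       = refl
letter-inside (true  ∷ y) {suc i} (s≤s p) = letter-inside y p
letter-inside (false ∷ y) {suc i} (s≤s p) = letter-inside y p

letter-outside : ∀ y {i} → length y ≤ i → letter y i ≡ nothing
letter-outside []      _       = refl
letter-outside (b ∷ y) (s≤s p) = letter-outside y p

module _ (w : Word) where

  pair-length : ∀ x → length ⟨ x , w ⟩ ≡ length x * 2 + 1 + length w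
  pair-length []      = refl
  pair-length (b ∷ x) = cong (λ n → suc (suc n)) (pair-length x)

  pair-mark : ∀ x {m} → m < length x → letter ⟨ x , w ⟩ (m * 2) ≡ just true
  pair-mark (b ∷ x) {zero}  _       = refl
  pair-mark (b ∷ x) {suc m} (s≤s p) = pair-mark x p

  pair-left : ∀ x {m} → m < length x → letter ⟨ x , w ⟩ (m * 2 + 1) ≡ letter x m
  pair-left (b ∷ x) {zero}  _       = refl
  pair-left (b ∷ x) {suc m} (s≤s p) = pair-left x p

  pair-separator : ∀ x → letter ⟨ x , w ⟩ (length x * 2) ≡ just false
  pair-separator []      = refl
  pair-separator (b ∷ x) = pair-separator x

  pair-right : ∀ x j → letter ⟨ x , w ⟩ (length x * 2 + 1 + j) ≡ letter w j
  pair-right []      j = refl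
  pair-right (b ∷ x) j = pair-right x j

IsTrue : Bool → Set
IsTrue = T

-- Symbol codes of a pair up to its separator, the part that is known without the certificate: 2 for
-- the marks at even places, the letters of `x` at odd places, and 1 for the final 0.
xCode : Word → ℕ → ℕ
xCode x j = if j <ᵇ length x * 2 then (if rem j 2 ≡ᵇ 0 then 2 else suc (bitAt x (quot j 2)))
            else (if j ≡ᵇ length x * 2 then 1 else 0)

xCode-correct : ∀ x w {j} → j < length x * 2 + 1 → letterCode (letter ⟨ x , w ⟩ j) ≡ xCode x j
xCode-correct x w {j} j< with j <ᵇ length x * 2 in eq
... | true with split< (length x) 2 {j} (<ᵇ⇒< j _ (≡-T eq))
...   | m , 0 , m< , r< , refl rewrite rem-+ m r< =
  cong letterCode (trans (cong (letter ⟨ x , w ⟩) (+-identityʳ (m * 2))) (pair-mark w x m<))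
...   | m , 1 , m< , r< , refl rewrite rem-+ m r< | quot-+ m r< =
  trans (cong letterCode (pair-left w x m<)) (letter-inside x m<)
...   | m , suc (suc r) , m< , s≤s (s≤s ()) , refl
xCode-correct x w {j} j< | false with refl ← ≤-antisym (s≤s⁻¹ (≤-trans j< (≤-reflexive (+-comm _ 1)))) (≮⇒≥ (λ p → subst T eq (<⇒<ᵇ p)))
  rewrite ≡ᵇ-complete {length x * 2} refl = cong letterCode (pair-separator w x)

xCode-beyond : ∀ x {j} → length x * 2 < j → xCode x j ≡ 0
xCode-beyond x {j} j> with j <ᵇ length x * 2 in eq | j ≡ᵇ length x * 2 in eq′
... | true  | _     = contradiction (<ᵇ⇒< j _ (≡-T eq)) (<⇒≯ j>)
... | false | true  = contradiction (≡ᵇ-sound {j} eq′) (<⇒≢ j> ∘ sym)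
... | false | false = refl

module CookLevin (M : TM) (bound : Polynomial) (verify : Word → Bool)
  (computes : ∀ y → Run.ComputesWithin M (eval bound (length y)) y [ verify y ])
  (x : Word) (P T D I : ℕ)
  where
  open TM M using (start; #tapes; #extraSymbols)
  open Run M
  open Simulation M

  -- The certificate starts behind the `length x * 2 + 1` symbols for `x` and the separator; `P`
  -- cells are reserved for it.
  free : ℕ → Bool
  free i = (D + (length x * 2 + 1) ≤ᵇ i) ∧ (i <ᵇ D + (length x * 2 + 1) + P)

  fixed : ℕ → ℕ → ℕ
  fixed τ i = if τ ≡ᵇ 0 then (if i <ᵇ D then 0 else xCode x (i ∸ D))
              else (if τ ≡ᵇ #tapes then (if i ≡ᵇ D then toℕ start else 0) else 0)

  open Trace T D I fixed free public

  origin : ℕ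
  origin = D + (length x * 2 + 1)

  symbol-letter : ∀ y j → encodeSymbol (nth (map (just ∘ inj₁) y) j) ≡ letterCode (letter y j)
  symbol-letter []          j       = refl
  symbol-letter (true  ∷ y) zero    = refl
  symbol-letter (false ∷ y) zero    = refl
  symbol-letter (b     ∷ y) (suc j) = symbol-letter y j

  input-left : ∀ (y : Word) i b → i < b → look {Bool ⊎ Fin #extraSymbols} (writeWord y) i b ≡ nothing
  input-left []      zero    (suc b) _       = refl
  input-left (c ∷ y) zero    (suc b) _       = refl
  input-left y       (suc i) (suc b) (s≤s p) = input-left y i b p

  input-right : ∀ y j → encodeSymbol (look (writeWord y) j 0) ≡ letterCode (letter y j)
  input-right []          zero    = refl
  input-right []          (suc j) = refl
  input-right (true  ∷ y) zero    = refl
  input-right (false ∷ y) zero    = refl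
  input-right (b     ∷ y) (suc j) = symbol-letter y j

  look-blank : ∀ i b → look {Bool ⊎ Fin #extraSymbols} blankTape i b ≡ nothing
  look-blank zero    zero    = refl
  look-blank (suc i) zero    = refl
  look-blank zero    (suc b) = refl
  look-blank (suc i) (suc b) = look-blank i b

  module _ (w : Word) where

    private
      F : ℕ → ℕ → ℕ → ℕ
      F = trace (initial ⟨ x , w ⟩)

    F-left : ∀ {i} → i < D → F 0 0 i ≡ 0
    F-left {i} i<D = cong encodeSymbol (input-left ⟨ x , w ⟩ i D i<D)

    F-input : ∀ j → F 0 0 (D + j) ≡ letterCode (letter ⟨ x , w ⟩ j)
    F-input j = trans (cong encodeSymbol (look-from (writeWord ⟨ x , w ⟩) D j)) (input-right ⟨ x , w ⟩ j)

    F-certificate : ∀ j → F 0 0 (origin + j) ≡ letterCode (letter w j)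
    F-certificate j = trans (cong (F 0 0) (+-assoc D _ j)) (trans (F-input (length x * 2 + 1 + j)) (cong letterCode (pair-right w x j)))

    F-blank : ∀ {i} → origin + length w ≤ i → F 0 0 i ≡ 0
    F-blank {i} h = trans (cong (F 0 0) (sym (m+[n∸m]≡n (≤-trans (m≤m+n origin _) h))))
      (trans (F-certificate (i ∸ origin)) (cong letterCode (letter-outside w
        (+-cancelˡ-≤ origin _ _ (≤-trans h (≤-reflexive (sym (m+[n∸m]≡n (≤-trans (m≤m+n origin _) h)))))))))

    F-other : ∀ τ i → suc τ < K → F 0 (suc τ) i ≡ fixed (suc τ) i
    F-other τ i τ<K with suc τ ≡ᵇ #tapes in eq
    ... | true with refl ← ≡ᵇ-sound {suc τ} {#tapes} eq = content-state (initial ⟨ x , w ⟩) i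
    ... | false = trans (cong (λ τ → F 0 τ i) (sym (toℕ-fromℕ< τ<)))
      (trans (content-tape (initial ⟨ x , w ⟩) (fromℕ< τ<) i) (blank (fromℕ< τ<) (toℕ-fromℕ< τ<)))
      where
      τ< : suc τ < #tapes
      τ< = ≤∧≢⇒< (s≤s⁻¹ τ<K) (λ e → subst IsTrue eq (≡⇒≡ᵇ (suc τ) #tapes e))
      blank : ∀ (j : Fin #tapes) → toℕ j ≡ suc τ → tapeRow (initial ⟨ x , w ⟩) j i ≡ 0
      blank (suc j) _ = cong encodeSymbol (trans (cong (λ t → look t i D) (Vecₚ.lookup-replicate j blankTape)) (look-blank i D))

    F-fixed : ∀ τ i → τ < K → (τ ≡ 0 → i < origin) → F 0 τ i ≡ fixed τ i
    F-fixed (suc τ) i τ<K _ = F-other τ i τ<K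
    F-fixed zero    i τ<K h with i <ᵇ D in eq
    ... | true  = F-left (<ᵇ⇒< i D (≡-T eq))
    ... | false = trans (cong (F 0 0) (sym i≡)) (trans (F-input (i ∸ D))
      (xCode-correct x w (+-cancelˡ-< D _ _ (≤-<-trans (≤-reflexive i≡) (h refl)))))
      where
      i≡ : D + (i ∸ D) ≡ i
      i≡ = m+[n∸m]≡n {D} {i} (≮⇒≥ (λ p → subst IsTrue eq (<⇒<ᵇ p)))

    fixed-beyond : ∀ {i} → origin ≤ i → fixed 0 i ≡ 0
    fixed-beyond {i} h with i <ᵇ D in eq
    ... | true  = refl
    ... | false = xCode-beyond x (+-cancelˡ-≤ D _ _ (≤-trans (≤-reflexive (cong (D +_) (+-comm 1 _)))
      (≤-trans h (≤-reflexive (sym (m+[n∸m]≡n (≤-trans (m≤m+n D _) h)))))))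

    F-blanks : ∀ i → D ≤ i → F 0 0 i ≡ 0 → F 0 0 (suc i) ≡ 0
    F-blanks i D≤i e = trans (cong (F 0 0) (sym (trans (+-suc D _) (cong suc i≡))))
      (trans (F-input (suc (i ∸ D))) (cong letterCode (monotone ⟨ x , w ⟩ (i ∸ D)
        (trans (sym (F-input (i ∸ D))) (trans (cong (F 0 0) i≡) e)))))
      where
      i≡ : D + (i ∸ D) ≡ i
      i≡ = m+[n∸m]≡n D≤i
      monotone : ∀ y j → letterCode (letter y j) ≡ 0 → letter y (suc j) ≡ nothing
      monotone []          j       _ = refl
      monotone (true  ∷ y) zero    ()
      monotone (false ∷ y) zero    ()
      monotone (b     ∷ y) (suc j) e = monotone y j e

    F-guess : ∀ i → D ≤ i → F 0 0 i ≤ 2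
    F-guess i D≤i = ≤-trans (≤-reflexive (trans (cong (F 0 0) (sym (m+[n∸m]≡n D≤i))) (F-input (i ∸ D)))) (letterCode≤2 _)
      where
      letterCode≤2 : ∀ l → letterCode l ≤ 2
      letterCode≤2 nothing      = z≤n
      letterCode≤2 (just false) = s≤s z≤n
      letterCode≤2 (just true)  = ≤-refl

    -- The machine may halt before time `T`; its configuration then persists, with the verdict in
    -- the scanned cell.
    F-verdict : eval bound (length ⟨ x , w ⟩) ≤ T → F T 0 D ≡ suc (toBit (verify ⟨ x , w ⟩))
    F-verdict h = verdict (computes ⟨ x , w ⟩)
      where
      leading : ∀ (s : Maybe (Bool ⊎ Fin #extraSymbols)) ss b → leadingBits (s ∷ ss) ≡ [ b ] → encodeSymbol s ≡ suc (toBit b)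
      leading (just (inj₁ true))  ss b e = cong (suc ∘ toBit) (Listₚ.∷-injectiveˡ e)
      leading (just (inj₁ false)) ss b e = cong (suc ∘ toBit) (Listₚ.∷-injectiveˡ e)
      verdict : ComputesWithin (eval bound (length ⟨ x , w ⟩)) ⟨ x , w ⟩ [ verify ⟨ x , w ⟩ ] → _
      verdict (halted , printed) = trans (cong (λ c → contentOf c 0 D) (stepsFrom-run (eval bound (length ⟨ x , w ⟩)) (initial ⟨ x , w ⟩) halted T h))
        (readHead (tapes (run (eval bound (length ⟨ x , w ⟩)) (initial ⟨ x , w ⟩))) printed)
        where
        readHead : ∀ (ts : Vec (Tape (Bool ⊎ Fin #extraSymbols)) #tapes) → readWord (Vec.head ts) ≡ [ verify ⟨ x , w ⟩ ] →
          encodeSymbol (look (lookup ts zero) D D) ≡ suc (toBit (verify ⟨ x , w ⟩))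
        readHead (t ∷ ts) e = trans (cong encodeSymbol (look-head t D)) (leading (head t) (after t) _ e)

  module _
    (0<T : 0 < T) (T≤D : T ≤ D) (D+T<I : D + T < I) (roomy : origin + P < I)
    (timely : ∀ w → length w ≤ P → eval bound (length ⟨ x , w ⟩) ≤ T) where

    private
      D<I : D < I
      D<I = ≤-trans (s≤s (m≤m+n D T)) D+T<I

      free-sound : ∀ {i} → free i ≡ true → origin ≤ i
      free-sound {i} f = ≤ᵇ⇒≤ origin i (≡-T (∧-proj₁ f))

      free-complete : ∀ {i} → origin ≤ i → i < origin + P → free i ≡ true
      free-complete p q = ∧-intro (T-≡ (≤⇒≤ᵇ p)) (T-≡ (<⇒<ᵇ q))

    certificate⇒satisfiable : ∀ w → length w ≤ P → verify ⟨ x , w ⟩ ≡ true → Satisfiable V C pos neg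
    certificate⇒satisfiable w w≤P ok = computation⇒satisfiable mv≤2 (s≤s z≤n) 2<Z
      (trace (initial ⟨ x , w ⟩)) (trace-computation (initial ⟨ x , w ⟩)) starts
      (λ i _ f → F-guess w i (≤-trans (m≤m+n D _) (free-sound f)))
      (F-blanks w) (λ i → F-left w) D<I (trans (F-verdict w (timely w w≤P)) (cong (suc ∘ toBit) ok)) dig<Z
      where
      starts : ∀ τ i → τ < K → i < I → (τ ≡ᵇ 0) ∧ free i ≢ true → trace (initial ⟨ x , w ⟩) 0 τ i ≡ fixed τ i
      starts (suc τ) i τ<K i<I h = F-fixed w (suc τ) i τ<K λ ()
      starts zero    i τ<K i<I h with i <? origin
      ... | yes i<o = F-fixed w 0 i τ<K (λ _ → i<o)
      ... | no  i≮o = trans (F-blank w (≤-trans (+-monoʳ-≤ origin w≤P) (≮⇒≥ (λ i< → h (free-complete (≮⇒≥ i≮o) i<)))))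
                        (sym (fixed-beyond w (≮⇒≥ i≮o)))

    module _ (sat : Satisfiable V C pos neg) where
      open Satisfied mv≤2 (s≤s z≤n) 2<Z sat 0<T 0<N T≤D D+T<I

      -- A satisfying assignment may mark several symbols in a cell, and any marked one may be
      -- taken. Bits are preferred; in a free cell where no bit is marked the blank is, and the word
      -- ends.
      extracted : ℕ → ℕ → Word
      extracted i zero    = []
      extracted i (suc p) = if marked 0 0 i 2 then true ∷ extracted (suc i) p else
                            (if marked 0 0 i 1 then false ∷ extracted (suc i) p else [])

      extracted-length : ∀ i p → length (extracted i p) ≤ p
      extracted-length i zero    = z≤n
      extracted-length i (suc p) with marked 0 0 i 2 | marked 0 0 i 1
      ... | true  | _     = s≤s (extracted-length (suc i) p)
      ... | false | true  = s≤s (extracted-length (suc i) p)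
      ... | false | false = z≤n

      private
        0<K : 0 < K
        0<K = s≤s z≤n

        blanks-from : ∀ {i} → D ≤ i → marked 0 0 i 0 ≡ true → ∀ j → i + j < I → marked 0 0 (i + j) 0 ≡ true
        blanks-from {i} D≤i m zero    _ = trans (cong (λ i → marked 0 0 i 0) (+-identityʳ i)) m
        blanks-from {i} D≤i m (suc j) h = trans (cong (λ i → marked 0 0 i 0) (+-suc i j))
          (marked-blank (<-trans ≤-refl h′) (≤-trans D≤i (m≤m+n i j)) (blanks-from D≤i m j (<-trans ≤-refl h′)))
          where
          h′ : suc (i + j) < I
          h′ = ≤-trans (≤-reflexive (cong suc (sym (+-suc i j)))) h

        D≤origin : D ≤ origin
        D≤origin = m≤m+n D _

      -- Behind the end of the word, blanks are propagated by the clauses of kind 2; behind the free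
      -- cells they are prescribed. So the assignment marks the actual input built from the
      -- extracted word.
      extracted-marked : ∀ p i → origin ≤ i → i + p ≡ origin + P → ∀ j → i + j < I →
        marked 0 0 (i + j) (letterCode (letter (extracted i p) j)) ≡ true
      extracted-marked zero i o≤i e j h = subst (λ s → marked 0 0 (i + j) s ≡ true) (fixed-beyond [] (≤-trans o≤i (m≤m+n i j)))
        (marked-fixed 0<K h λ f → <⇒≱ (<ᵇ⇒< (i + j) _ (≡-T (∧-proj₂ {origin ≤ᵇ i + j} f)))
          (≤-trans (≤-reflexive (trans (sym e) (+-identityʳ i))) (m≤m+n i j)))
      extracted-marked (suc p) i o≤i e j h with marked 0 0 i 2 in m₂ | marked 0 0 i 1 in m₁
      extracted-marked (suc p) i o≤i e zero h | true | _ = trans (cong (λ i → marked 0 0 i 2) (+-identityʳ i)) m₂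
      extracted-marked (suc p) i o≤i e (suc j) h | true | _ =
        subst (λ k → marked 0 0 k (letterCode (letter (extracted (suc i) p) j)) ≡ true) (sym (+-suc i j))
          (extracted-marked p (suc i) (m≤n⇒m≤1+n o≤i) (trans (sym (+-suc i p)) e) j (subst (_< I) (+-suc i j) h))
      extracted-marked (suc p) i o≤i e zero h | false | true = trans (cong (λ i → marked 0 0 i 1) (+-identityʳ i)) m₁
      extracted-marked (suc p) i o≤i e (suc j) h | false | true =
        subst (λ k → marked 0 0 k (letterCode (letter (extracted (suc i) p) j)) ≡ true) (sym (+-suc i j))
          (extracted-marked p (suc i) (m≤n⇒m≤1+n o≤i) (trans (sym (+-suc i p)) e) j (subst (_< I) (+-suc i j) h))
      extracted-marked (suc p) i o≤i e j h | false | false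
        with marked-free (≤-trans (s≤s (m≤m+n i j)) h) (free-complete o≤i (≤-trans (s≤s (m≤m+n i p)) (≤-reflexive (trans (sym (+-suc i p)) e))))
      ... | 0 , _ , m = blanks-from (≤-trans D≤origin o≤i) m j h
      ... | 1 , _ , m = case trans (sym m) m₁ of λ ()
      ... | 2 , _ , m = case trans (sym m) m₂ of λ ()
      ... | suc (suc (suc _)) , s≤s (s≤s ()) , _

      private
        w : Word
        w = extracted origin P

        starts : ∀ τ i → τ < K → i < I → marked 0 τ i (trace (initial ⟨ x , w ⟩) 0 τ i) ≡ true
        starts (suc τ) i τ<K i<I = subst (λ s → marked 0 (suc τ) i s ≡ true) (sym (F-fixed w (suc τ) i τ<K λ ()))
          (marked-fixed τ<K i<I λ ())
        starts zero i τ<K i<I with i <? origin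
        ... | yes i<o = subst (λ s → marked 0 0 i s ≡ true) (sym (F-fixed w 0 i τ<K (λ _ → i<o)))
          (marked-fixed τ<K i<I λ f → <⇒≱ i<o (free-sound f))
        ... | no i≮o = subst (λ i → marked 0 0 i (trace (initial ⟨ x , w ⟩) 0 0 i) ≡ true) i≡
          (subst (λ s → marked 0 0 (origin + (i ∸ origin)) s ≡ true) (sym (F-certificate w (i ∸ origin)))
            (extracted-marked P origin ≤-refl refl (i ∸ origin) (≤-trans (≤-reflexive (cong suc i≡)) i<I)))
          where
          i≡ : origin + (i ∸ origin) ≡ i
          i≡ = m+[n∸m]≡n (≮⇒≥ i≮o)

      satisfiable⇒certificate : ∃[ w ] length w ≤ P × verify ⟨ x , w ⟩ ≡ true
      satisfiable⇒certificate = w , extracted-length origin P ,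
        accepted _ (trans (sym (F-verdict w (timely w (extracted-length origin P))))
          (computation-accepts (trace (initial ⟨ x , w ⟩)) (trace-computation (initial ⟨ x , w ⟩)) starts))
        where
        accepted : ∀ b → suc (toBit b) ≡ 2 → b ≡ true
        accepted true _ = refl

-- Instances as words

concatTo-head : ∀ n f → concatTo (suc n) f ≡ f 0 ++ concatTo n (f ∘ suc)
concatTo-head zero    f = sym (++-identityʳ (f 0))
concatTo-head (suc n) f = trans (cong (_++ f (suc n)) (concatTo-head n f)) (++-assoc (f 0) _ _)

concatTo-nil : ∀ n f → (∀ i → f i ≡ []) → concatTo n f ≡ []
concatTo-nil zero    f h = refl
concatTo-nil (suc n) f h = cong₂ _++_ (concatTo-nil n f h) (h n)

concatMap-allFin : ∀ n {g : Fin n → Word} {h : ℕ → Word} → (∀ i → g i ≡ h (toℕ i)) → concatMap g (allFin n) ≡ concatTo n h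
concatMap-allFin n {g} e = go n id g e
  where
  go : ∀ n {m} (f : Fin n → Fin m) (g : Fin m → Word) {h : ℕ → Word} → (∀ i → g (f i) ≡ h (toℕ i)) →
    concatMap g (List.tabulate f) ≡ concatTo n h
  go zero    f g     e = refl
  go (suc n) f g {h} e = trans (cong₂ _++_ (e zero) (go n (f ∘ suc) g (e ∘ suc))) (sym (concatTo-head n h))

map-concatMap : {A : Set} (f : A → Bool) (xs : List A) → map f xs ≡ concatMap (λ x → f x ∷ []) xs
map-concatMap f []       = refl
map-concatMap f (x ∷ xs) = cong (f x ∷_) (map-concatMap f xs)

concatMap-map : {A B : Set} (f : A → B) (g : B → Word) (xs : List A) → concatMap g (map f xs) ≡ concatMap (g ∘ f) xs
concatMap-map f g []       = refl
concatMap-map f g (x ∷ xs) = cong (g (f x) ++_) (concatMap-map f g xs)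

concatMap-concatMap : {A B : Set} (f : A → List B) (g : B → Word) (xs : List A) →
  concatMap g (concatMap f xs) ≡ concatMap (concatMap g ∘ f) xs
concatMap-concatMap f g []       = refl
concatMap-concatMap f g (x ∷ xs) = trans (Listₚ.concatMap-++ g (f x) (concatMap f xs))
  (cong (concatMap g (f x) ++_) (concatMap-concatMap f g xs))

replicate-concatTo : ∀ n → replicate n true ≡ concatTo n (λ _ → true ∷ [])
replicate-concatTo zero    = refl
replicate-concatTo (suc n) = trans (cong (true ∷_) (replicate-concatTo n)) (sym (concatTo-head n (λ _ → true ∷ [])))

layout : (k n : ℕ) → (ℕ → ℕ → Bool) → (ℕ → ℕ → Word) → Word → Word
layout k n adjacent number threshold =
  concatTo n (λ _ → true ∷ []) ++ (false ∷ []) ++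
  concatTo n (λ u → concatTo n (λ v → adjacent u v ∷ [])) ++
  concatTo k (λ j → concatTo n (number j)) ++ threshold

encodeInstance-layout : ∀ {k} (I : FairDivisionInstance k) {adjacent number} →
  (∀ u v → adj (FairDivisionInstance.graph I) u v ≡ adjacent (toℕ u) (toℕ v)) →
  (∀ j u → encodeℕ (FairDivisionInstance.p I j u) ≡ number (toℕ j) (toℕ u)) →
  encodeInstance I ≡ layout k (FairDivisionInstance.n I) adjacent number (encodeℕ (FairDivisionInstance.q I))
encodeInstance-layout {k} I {adjacent} {number} a≡ p≡ = cong₂ (λ xs ys → xs ++ false ∷ ys) (replicate-concatTo n)
  (cong₂ _++_ matrix (cong (_++ encodeℕ q) values))
  where
  open FairDivisionInstance I
  matrix : concatMap (λ u → map (adj graph u) (allFin n)) (allFin n) ≡ concatTo n (λ u → concatTo n (λ v → adjacent u v ∷ []))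
  matrix = concatMap-allFin n λ u → trans (map-concatMap (adj graph u) (allFin n))
    (concatMap-allFin n λ v → cong (_∷ []) (a≡ u v))
  values : concatMap encodeℕ (profits I) ≡ concatTo k (λ j → concatTo n (number j))
  values = trans (concatMap-concatMap (λ j → map (p j) (allFin n)) encodeℕ (allFin k))
    (concatMap-allFin k λ j → trans (concatMap-map (p j) encodeℕ (allFin n)) (concatMap-allFin n (p≡ j)))

-- Numbers in bijective base 2

-- Removes the lowest digit in bijective base 2: both `1 + 2 * m` and `2 + 2 * m` become `m`.
decrease-half : ℕ → ℕ
decrease-half r = quot (r ∸ 1) 2

half-even : ∀ m → decrease-half (2 * suc m) ≡ m
half-even m = trans (cong (λ r → quot r 2) (lemma m)) (quot-+ m (s≤s (s≤s z≤n)))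
  where
  lemma : ∀ m → m + suc (m + 0) ≡ m * 2 + 1
  lemma = solve-∀

half-odd : ∀ m → decrease-half (suc (2 * m)) ≡ m
half-odd m = trans (cong (λ r → quot r 2) (lemma m)) (quot-+ m (s≤s z≤n))
  where
  lemma : ∀ m → m + (m + 0) ≡ m * 2 + 0
  lemma = solve-∀

-- The lowest digit with its continuation mark; in bijective base 2 this digit is 2 for even
-- numbers. Zero has no digits.
block : ℕ → Word
block zero    = []
block (suc r) = true ∷ (rem (suc r) 2 ≡ᵇ 0) ∷ []

encodeℕ-block : ∀ r → 0 < r → encodeℕ r ≡ block r ++ encodeℕ (decrease-half r)
encodeℕ-block r 0<r = trans (go (fromℕ r) (subst (0 <_) (sym (toℕ-fromℕ r)) 0<r))
  (cong (λ r → block r ++ encodeℕ (decrease-half r)) (toℕ-fromℕ r))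
  where
  go : ∀ b → 0 < Binary.toℕ b → encodeℕᵇ b ≡ block (Binary.toℕ b) ++ encodeℕ (decrease-half (Binary.toℕ b))
  go Binary.2[1+ b ] _ = cong₂ (λ e w → true ∷ e ∷ w)
    (sym (≡ᵇ-complete (trans (cong (λ r → rem r 2) (lemma (Binary.toℕ b))) (rem-+ (suc (Binary.toℕ b)) (s≤s z≤n)))))
    (cong encodeℕᵇ (sym (trans (cong fromℕ (half-even (Binary.toℕ b))) (fromℕ-toℕ b))))
    where
    lemma : ∀ m → 2 * suc m ≡ suc m * 2 + 0
    lemma = solve-∀
  go Binary.1+[2 b ] _ = cong₂ (λ e w → true ∷ e ∷ w)
    (sym (cong (_≡ᵇ 0) (trans (cong (λ r → rem r 2) (lemma (Binary.toℕ b))) (rem-+ (Binary.toℕ b) (s≤s (s≤s z≤n))))))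
    (cong encodeℕᵇ (sym (trans (cong fromℕ (half-odd (Binary.toℕ b))) (fromℕ-toℕ b))))
    where
    lemma : ∀ m → suc (2 * m) ≡ m * 2 + 1
    lemma = solve-∀

-- Repeated `decrease-half`, phrased with the differences because descent can only subtract.
shifted : ℕ → ℕ → ℕ
shifted b r = descend b (λ r → r ∸ decrease-half r) r

decrease-half≤ : ∀ r → decrease-half r ≤ r ∸ 1
decrease-half≤ r with r ∸ 1
... | zero  = ≤-reflexive (quot-+ 0 {0} {2} (s≤s z≤n))
... | suc m = ≤-trans (s≤s⁻¹ (quot< (suc (suc m)) 2 (≤-trans (s≤s ≤-refl) (m≤m*n (suc (suc m)) 2)))) ≤-refl

shifted-suc : ∀ b r → shifted (suc b) r ≡ shifted b (decrease-half r)
shifted-suc b r = cong (shifted b) (m∸[m∸n]≡n (≤-trans (decrease-half≤ r) (m∸n≤m r 1)))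

-- Any number of rounds from `r` on will do: once the digits are used up, the blocks are empty.
encodeℕ-blocks : ∀ f r → r ≤ f → encodeℕ r ≡ concatTo f (λ b → block (shifted b r)) ++ false ∷ []
encodeℕ-blocks f zero _ = sym (cong (_++ false ∷ []) (concatTo-nil f _ (λ b → cong block (shifted-zero b))))
  where
  shifted-zero : ∀ b → shifted b 0 ≡ 0
  shifted-zero zero    = refl
  shifted-zero (suc b) = trans (shifted-suc b 0) (trans (cong (shifted b) (n≤0⇒n≡0 (decrease-half≤ 0))) (shifted-zero b))
encodeℕ-blocks (suc f) (suc r) (s≤s r≤f) = begin
  encodeℕ (suc r)
    ≡⟨ encodeℕ-block (suc r) (s≤s z≤n) ⟩
  block (suc r) ++ encodeℕ (decrease-half (suc r))
    ≡⟨ cong (block (suc r) ++_) (encodeℕ-blocks f (decrease-half (suc r)) (≤-trans (decrease-half≤ (suc r)) r≤f)) ⟩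
  block (suc r) ++ (concatTo f (λ b → block (shifted b (decrease-half (suc r)))) ++ false ∷ [])
    ≡⟨ ++-assoc (block (suc r)) (concatTo f (λ b → block (shifted b (decrease-half (suc r))))) (false ∷ []) ⟨
  (block (suc r) ++ concatTo f (λ b → block (shifted b (decrease-half (suc r))))) ++ false ∷ []
    ≡⟨ cong (λ w → (block (suc r) ++ w) ++ false ∷ []) (concatTo-cong f (λ b _ → cong block (sym (shifted-suc b (suc r))))) ⟩
  (block (suc r) ++ concatTo f (λ b → block (shifted (suc b) (suc r)))) ++ false ∷ []
    ≡⟨ cong (_++ false ∷ []) (concatTo-head f (λ b → block (shifted b (suc r)))) ⟨
  concatTo (suc f) (λ b → block (shifted b (suc r))) ++ false ∷ [] ∎
  where open ≡-Reasoning

valueOf : ℕ → (ℕ → Bool) → ℕ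
valueOf zero    d = 0
valueOf (suc l) d = suc (toBit (d 0)) + 2 * valueOf l (d ∘ suc)

digitWord : ℕ → (ℕ → Bool) → Word
digitWord l d = concatTo l (λ b → true ∷ d b ∷ []) ++ false ∷ []

digitWord-suc : ∀ l d → digitWord (suc l) d ≡ true ∷ d 0 ∷ digitWord l (d ∘ suc)
digitWord-suc l d = cong (_++ false ∷ []) (concatTo-head l (λ b → true ∷ d b ∷ []))

encodeℕ-valueOf : ∀ l d → encodeℕ (valueOf l d) ≡ digitWord l d
encodeℕ-valueOf l d = trans (cong encodeℕᵇ (trans (cong fromℕ (sym (toℕ-binary l d))) (fromℕ-toℕ (binary l d)))) (encode-binary l d)
  where
  binary : ℕ → (ℕ → Bool) → Binary.ℕᵇ
  binary zero    d = Binary.zero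
  binary (suc l) d = if d 0 then Binary.2[1+ binary l (d ∘ suc) ] else Binary.1+[2 binary l (d ∘ suc) ]
  toℕ-binary : ∀ l d → Binary.toℕ (binary l d) ≡ valueOf l d
  toℕ-binary zero    d = refl
  toℕ-binary (suc l) d with d 0 | toℕ-binary l (d ∘ suc)
  ... | true  | e = trans (cong (λ v → 2 * suc v) e) (lemma (valueOf l (d ∘ suc)))
    where
    lemma : ∀ v → 2 * suc v ≡ 2 + 2 * v
    lemma = solve-∀
  ... | false | e = cong (λ v → suc (2 * v)) e
  encode-binary : ∀ l d → encodeℕᵇ (binary l d) ≡ digitWord l d
  encode-binary zero    d = refl
  encode-binary (suc l) d = trans (first (d 0) refl) (sym (digitWord-suc l d))
    where
    first : ∀ b → d 0 ≡ b → encodeℕᵇ (binary (suc l) d) ≡ true ∷ d 0 ∷ digitWord l (d ∘ suc)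
    first true  e rewrite e = cong (λ w → true ∷ true ∷ w) (encode-binary l (d ∘ suc))
    first false e rewrite e = cong (λ w → true ∷ false ∷ w) (encode-binary l (d ∘ suc))

digitsOf : ∀ m → ∃[ l ] ∃[ d ] valueOf l d ≡ m
digitsOf m with go (fromℕ m)
  where
  go : ∀ b → ∃[ l ] ∃[ d ] valueOf l d ≡ Binary.toℕ b
  go Binary.zero = 0 , (λ _ → false) , refl
  go Binary.2[1+ b ] with go b
  ... | l , d , e = suc l , (λ { zero → true ; (suc i) → d i }) , trans (cong (λ v → 2 + 2 * v) e) (lemma (Binary.toℕ b))
    where
    lemma : ∀ v → 2 + 2 * v ≡ 2 * suc v
    lemma = solve-∀
  go Binary.1+[2 b ] with go b
  ... | l , d , e = suc l , (λ { zero → false ; (suc i) → d i }) , cong (λ v → 1 + 2 * v) e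
... | l , d , e = l , d , trans e (toℕ-fromℕ m)

-- The encoding is injective

-- The continuation marks make the code self-delimiting, which lets consecutive fields be separated.
encodeℕᵇ-prefix : ∀ a b {s t} → encodeℕᵇ a ++ s ≡ encodeℕᵇ b ++ t → a ≡ b × s ≡ t
encodeℕᵇ-prefix Binary.zero     Binary.zero     e = refl , Listₚ.∷-injectiveʳ e
encodeℕᵇ-prefix Binary.zero     Binary.2[1+ b ] e = case Listₚ.∷-injectiveˡ e of λ ()
encodeℕᵇ-prefix Binary.zero     Binary.1+[2 b ] e = case Listₚ.∷-injectiveˡ e of λ ()
encodeℕᵇ-prefix Binary.2[1+ a ] Binary.zero     e = case Listₚ.∷-injectiveˡ e of λ ()
encodeℕᵇ-prefix Binary.1+[2 a ] Binary.zero     e = case Listₚ.∷-injectiveˡ e of λ ()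
encodeℕᵇ-prefix Binary.2[1+ a ] Binary.1+[2 b ] e = case Listₚ.∷-injectiveˡ (Listₚ.∷-injectiveʳ e) of λ ()
encodeℕᵇ-prefix Binary.1+[2 a ] Binary.2[1+ b ] e = case Listₚ.∷-injectiveˡ (Listₚ.∷-injectiveʳ e) of λ ()
encodeℕᵇ-prefix Binary.2[1+ a ] Binary.2[1+ b ] e with encodeℕᵇ-prefix a b (Listₚ.∷-injectiveʳ (Listₚ.∷-injectiveʳ e))
... | refl , s≡t = refl , s≡t
encodeℕᵇ-prefix Binary.1+[2 a ] Binary.1+[2 b ] e with encodeℕᵇ-prefix a b (Listₚ.∷-injectiveʳ (Listₚ.∷-injectiveʳ e))
... | refl , s≡t = refl , s≡t

encodeℕ-prefix : ∀ a b {s t} → encodeℕ a ++ s ≡ encodeℕ b ++ t → a ≡ b × s ≡ t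
encodeℕ-prefix a b e with encodeℕᵇ-prefix (fromℕ a) (fromℕ b) e
... | p , q = fromℕ-injective p , q

numbers-prefix : ∀ (as bs : List ℕ) {s t} → length as ≡ length bs →
  concatMap encodeℕ as ++ s ≡ concatMap encodeℕ bs ++ t → as ≡ bs × s ≡ t
numbers-prefix []       []       _ e = refl , e
numbers-prefix (a ∷ as) (b ∷ bs) l e
  with encodeℕ-prefix a b (trans (sym (++-assoc (encodeℕ a) _ _)) (trans e (++-assoc (encodeℕ b) _ _)))
... | refl , e′ with numbers-prefix as bs (suc-injective l) e′
...   | refl , s≡t = refl , s≡t

unary-prefix : ∀ m n {s t} → replicate m true ++ false ∷ s ≡ replicate n true ++ false ∷ t → m ≡ n × s ≡ t
unary-prefix zero    zero    e = refl , Listₚ.∷-injectiveʳ e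
unary-prefix zero    (suc n) e = case Listₚ.∷-injectiveˡ e of λ ()
unary-prefix (suc m) zero    e = case Listₚ.∷-injectiveˡ e of λ ()
unary-prefix (suc m) (suc n) e with unary-prefix m n (Listₚ.∷-injectiveʳ e)
... | m≡n , s≡t = cong suc m≡n , s≡t

++-split : {A : Set} (as bs : List A) {s t : List A} → length as ≡ length bs → as ++ s ≡ bs ++ t → as ≡ bs × s ≡ t
++-split []       []       _ e = refl , e
++-split (a ∷ as) (b ∷ bs) l e with ++-split as bs (suc-injective l) (Listₚ.∷-injectiveʳ e)
... | p , q = cong₂ _∷_ (Listₚ.∷-injectiveˡ e) p , q

tabulate-injective : ∀ {A : Set} n {f g : Fin n → A} → List.tabulate f ≡ List.tabulate g → ∀ i → f i ≡ g i
tabulate-injective (suc n) e zero    = Listₚ.∷-injectiveˡ e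
tabulate-injective (suc n) e (suc i) = tabulate-injective n (Listₚ.∷-injectiveʳ e) i

module _ {A : Set} where

  tableOf : ∀ {k n} → (Fin k → Fin n → A) → List A
  tableOf {k} {n} f = concatMap (λ i → map (f i) (allFin n)) (allFin k)

  rows-injective : ∀ {B : Set} n (f g : B → Fin n → A) (is : List B) →
    concatMap (λ i → map (f i) (allFin n)) is ≡ concatMap (λ i → map (g i) (allFin n)) is →
    map (λ i → map (f i) (allFin n)) is ≡ map (λ i → map (g i) (allFin n)) is
  rows-injective n f g []       e = refl
  rows-injective n f g (i ∷ is) e with ++-split (map (f i) (allFin n)) (map (g i) (allFin n))
    (trans (length-map (f i) (allFin n)) (sym (length-map (g i) (allFin n)))) e
  ... | p , q = cong₂ _∷_ p (rows-injective n f g is q)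

  tableOf-injective : ∀ {k n} (f g : Fin k → Fin n → A) → tableOf f ≡ tableOf g → ∀ i j → f i j ≡ g i j
  tableOf-injective {k} {n} f g e i j = tabulate-injective n
    (trans (sym (Listₚ.map-tabulate id (f i))) (trans (tabulate-injective k
      (trans (sym (Listₚ.map-tabulate id (λ i → map (f i) (allFin n)))) (trans (rows-injective n f g (allFin k) e)
        (Listₚ.map-tabulate id (λ i → map (g i) (allFin n))))) i) (Listₚ.map-tabulate id (g i)))) j

  tableOf-length : ∀ {k n} (f g : Fin k → Fin n → A) → length (tableOf f) ≡ length (tableOf g)
  tableOf-length {k} {n} f g = go (allFin k)
    where
    go : ∀ is → length (concatMap (λ i → map (f i) (allFin n)) is) ≡ length (concatMap (λ i → map (g i) (allFin n)) is)
    go []       = refl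
    go (i ∷ is) = trans (length-++ (map (f i) (allFin n))) (trans (cong₂ _+_
      (trans (length-map (f i) (allFin n)) (sym (length-map (g i) (allFin n)))) (go is)) (sym (length-++ (map (g i) (allFin n)))))

-- Pointwise agreement, as instances contain functions and proofs; it is enough to transfer
-- solutions.
record Same {k} (I J : FairDivisionInstance k) : Set where
  constructor same
  open FairDivisionInstance
  field
    same-n : n I ≡ n J
    same-adj : ∀ u v → adj (graph I) u v ≡ adj (graph J) (subst Fin same-n u) (subst Fin same-n v)
    same-p : ∀ j u → p I j u ≡ p J j (subst Fin same-n u)
    same-q : q I ≡ q J

-- A word belongs to the language as soon as some instance with this code is solvable. Injectivity
-- carries the answer over to the instance that a reduction has constructed.
encodeInstance-injective : ∀ {k} (I J : FairDivisionInstance k) → encodeInstance I ≡ encodeInstance J → Same I J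
encodeInstance-injective {k} I@(record { n = n }) J e with unary-prefix n (FairDivisionInstance.n J) e
... | refl , e₁ with ++-split (tableOf (adj (FairDivisionInstance.graph I))) (tableOf (adj (FairDivisionInstance.graph J)))
                       (tableOf-length (adj (FairDivisionInstance.graph I)) (adj (FairDivisionInstance.graph J))) e₁
... | a≡ , e₂ with numbers-prefix (profits I) (profits J) (tableOf-length (FairDivisionInstance.p I) (FairDivisionInstance.p J)) e₂
... | p≡ , e₃ = record
  { same-n   = refl
  ; same-adj = tableOf-injective (adj (FairDivisionInstance.graph I)) (adj (FairDivisionInstance.graph J)) a≡
  ; same-p   = tableOf-injective (FairDivisionInstance.p I) (FairDivisionInstance.p J) p≡
  ; same-q   = fromℕ-injective (proj₁ (encodeℕᵇ-prefix _ _ (cong (_++ []) e₃)))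
  }

Solvable : ∀ {k} .{{_ : NonZero k}} → FairDivisionInstance k → Set
Solvable I = ∃[ Y ] q ≤ satisfaction {G = graph} p Y
  where open FairDivisionInstance I

same-solvable : ∀ {k} .{{_ : NonZero k}} {I J : FairDivisionInstance k} → Same I J → Solvable I → Solvable J
same-solvable {k} {I} {J} (same refl a≡ p≡ refl) (Y , h) = record
  { class       = class
  ; independent = λ j {u} {v} u∈ v∈ t → independent j u∈ v∈ (subst T (sym (a≡ u v)) t)
  ; disjoint    = disjoint
  } , Equivalence.from (minimum-greatest k _ _) λ j →
    ≤-trans (Equivalence.to (minimum-greatest k _ _) h j)
      (≤-reflexive (cong Vec.sum (Vecₚ.tabulate-cong λ u → cong (if lookup (class j) u then_else 0) (p≡ j u))))
  where open PartialColoring Y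

module _ {k : ℕ} (I : FairDivisionInstance k) where
  open FairDivisionInstance I

  profits-all⁺ : ∀ {B} → (∀ j u → p j u ≤ B) → All (_≤ B) (profits I)
  profits-all⁺ h = Allₚ.concat⁺ (Allₚ.map⁺ (Allₚ.tabulate⁺ λ j → Allₚ.map⁺ (Allₚ.tabulate⁺ (h j))))

  profits-all⁻ : ∀ {B} → All (_≤ B) (profits I) → ∀ j u → p j u ≤ B
  profits-all⁻ a j u = Allₚ.tabulate⁻ (Allₚ.map⁻ (Allₚ.tabulate⁻ (Allₚ.map⁻ (Allₚ.concat⁻ a)) j)) u

  n≤size : n ≤ length (encodeInstance I)
  n≤size = ≤-trans (≤-trans (≤-reflexive (sym (Listₚ.length-replicate n))) (m≤m+n _ _))
    (≤-reflexive (sym (length-++ (replicate n true))))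

linear : Polynomial
linear = 0 ∷ 1 ∷ []

eval-linear : ∀ x → eval linear x ≡ x
eval-linear x = lemma x
  where
  lemma : ∀ x → x * (1 + x * 0) ≡ x
  lemma = solve-∀

-- The reduction and expressions for it

module LayoutWriter {A : Set} (input : A → Word) where
  open Terms input public

  trueᴱ falseᴱ : ∀ {Γ} → Test Γ
  trueᴱ  = litᴱ 0 ≡ᴱ litᴱ 0
  falseᴱ = litᴱ 0 ≡ᴱ litᴱ 1

  bitNumberᴱ : ∀ {Γ} → Test Γ → Writer Γ
  bitNumberᴱ b = writer (gen w) (λ a ρ → encodeℕ (toBit (valᵇ b a ρ))) λ a ρ → trans (correctʷ w a ρ) (lemma (valᵇ b a ρ))
    where
    w = forᴱ (indᴱ b) (emitᴱ trueᴱ ⨾ᴱ emitᴱ falseᴱ) ⨾ᴱ emitᴱ falseᴱ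
    lemma : ∀ b → concatTo (toBit b) (λ _ → true ∷ false ∷ []) ++ false ∷ [] ≡ encodeℕ (toBit b)
    lemma false = refl
    lemma true  = refl

  blockᴱ : ∀ {Γ} → Term Γ → Writer Γ
  blockᴱ t = writer (gen w) (λ a ρ → block (val t a ρ)) λ a ρ → trans (correctʷ w a ρ) (lemma (val t a ρ))
    where
    w = forᴱ (indᴱ (litᴱ 1 ≤ᴱ t)) (emitᴱ trueᴱ ⨾ᴱ emitᴱ (remᴱ (wkᴱ t) (litᴱ 2) ≡ᴱ litᴱ 0))
    lemma : ∀ r → concatTo (toBit (1 ≤ᵇ r)) (λ _ → true ∷ (rem r 2 ≡ᵇ 0) ∷ []) ≡ block r
    lemma zero    = refl
    lemma (suc r) = refl

  shiftedᴱ : ∀ {Γ} → Term Γ → Term Γ → Term Γ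
  shiftedᴱ b t = descendᴱ b t (varᴱ zero ∸ᴱ quotᴱ (varᴱ zero ∸ᴱ litᴱ 1) (litᴱ 2))

  numberᴱ : ∀ {Γ} → Term Γ → Writer Γ
  numberᴱ t = writer (gen w) (λ a ρ → encodeℕ (val t a ρ))
    λ a ρ → trans (correctʷ w a ρ) (sym (encodeℕ-blocks (val t a ρ) (val t a ρ) ≤-refl))
    where
    w = forᴱ t (blockᴱ (shiftedᴱ (varᴱ zero) (wkᴱ t))) ⨾ᴱ emitᴱ falseᴱ

  layoutᴱ : ∀ {Γ} → ℕ → Term Γ → Test (2 + Γ) → Writer (2 + Γ) → Writer Γ → Writer Γ
  layoutᴱ k n adjacent number threshold = writer
    (gen (forᴱ n (emitᴱ trueᴱ) ⨾ᴱ emitᴱ falseᴱ ⨾ᴱ forᴱ n (forᴱ (wkᴱ n) (emitᴱ adjacent)) ⨾ᴱ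
      forᴱ (litᴱ k) (forᴱ (wkᴱ n) number) ⨾ᴱ threshold))
    (λ a ρ → layout k (val n a ρ) (λ u v → valᵇ adjacent a (v ∷ u ∷ ρ)) (λ j u → valʷ number a (u ∷ j ∷ ρ)) (valʷ threshold a ρ))
    (correctʷ (forᴱ n (emitᴱ trueᴱ) ⨾ᴱ emitᴱ falseᴱ ⨾ᴱ forᴱ n (forᴱ (wkᴱ n) (emitᴱ adjacent)) ⨾ᴱ
      forᴱ (litᴱ k) (forᴱ (wkᴱ n) number) ⨾ᴱ threshold))

  generator : (w : Writer 0) → ∃[ g ] ∀ a → ⟦ g ⟧ᴳ (input a) [] ≡ valʷ w a []
  generator w = gen w , λ a → correctʷ w a []

module Reduction (k : ℕ) (L : Language) (verify : Word → Bool) (M : TM) (bound : Polynomial)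
  (computes : ∀ y → Run.ComputesWithin M (eval bound (length y)) y [ verify y ])
  (certificate : Polynomial)
  (L-verify : ∀ x → L x ⇔ (∃[ w ] length w ≤ eval certificate (length x) × T (verify ⟨ x , w ⟩))) where

  open TM M using (start; #tapes)
  open Simulation M using (K; Z; N; dig; writes; moves; wr; mv; 0<Z; 0<N)

  module Core (x : Word) (P time window : ℕ)
    (0<time : 0 < time) (roomy₁ : time + time < window) (roomy₂ : time + (length x * 2 + 1) + P < window)
    (P≡ : eval certificate (length x) ≡ P) (timely : ∀ w → length w ≤ P → eval bound (length ⟨ x , w ⟩) ≤ time) where

    -- The run takes `time` steps, and the scanned cell is placed at position `time`, so that the
    -- left border of the window cannot affect it.
    open CookLevin M bound verify computes x P time time window public
    open Clauses k V C pos neg public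

    target : FairDivisionInstance (2 + k)
    target = selectionInstance

    4≤C : 4 ≤ C
    4≤C = product 0<time 0<N (s≤s z≤n) (≤-trans (s≤s z≤n) roomy₁) 0<Z
      where
      product : ∀ {a b c d e} → 0 < a → 0 < b → 0 < c → 0 < d → 0 < e → 4 ≤ 4 * a * b * c * d * e
      product {a} {b} {c} {d} {e} a> b> c> d> e> = *-mono-≤ (*-mono-≤ (*-mono-≤ (*-mono-≤ (*-mono-≤ (≤-refl {4}) a>) b>) c>) d>) e>

    0<R : 0 < R
    0<R = positive V C (≤-trans (s≤s z≤n) 4≤C)
      where
      positive : ∀ v c → 0 < c → 0 < suc v * c
      positive v c 0<c = ≤-trans 0<c (m≤m+n c (v * c))

    R≤n : R ≤ R * S
    R≤n = square R 0<R
      where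
      square : ∀ r → 0 < r → r ≤ r * ((2 + k) * r)
      square r 0<r = ≤-trans (≤-reflexive (sym (*-identityʳ r))) (*-monoʳ-≤ r (≤-trans 0<r (m≤m+n r _)))

    target-line : OnLineGraphsOfBipartiteGraphs target
    target-line = CellLineGraph.isLineGraph rowOf colOf (R * S) R S (quot< R S) (rem< R S) cell-injective

    -- The threshold `R` is at most the number of vertices, which the code contains in unary, and
    -- the profits are at most 1; so the size itself is a bound.
    target-bounded : All (_≤ eval linear (length (encodeInstance target))) (FairDivisionInstance.q target ∷ profits target)
    target-bounded = subst (λ B → All (_≤ B) (R ∷ profits target)) (sym (eval-linear (length (encodeInstance target))))
      (≤-trans R≤n (n≤size target) ∷ profits-all⁺ target λ j u →
        ≤-trans (toBit≤1 (allowed (toℕ j) (rowOf (toℕ u)) (colOf (toℕ u)))) (≤-trans 0<R (≤-trans R≤n (n≤size target))))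
      where
      toBit≤1 : ∀ b → toBit b ≤ 1
      toBit≤1 false = z≤n
      toBit≤1 true  = ≤-refl

    solvable⇔ : L x ⇔ Solvable target
    solvable⇔ = mk⇔
      (λ l → case Equivalence.to (L-verify x) l of λ where
        (w , w≤ , ok) → selection⇒coloring (satisfiable⇒selection
          (certificate⇒satisfiable 0<time ≤-refl roomy₁ roomy₂ timely w (≤-trans w≤ (≤-reflexive P≡)) (T-≡ ok))
          (≤-trans (s≤s (s≤s z≤n)) 4≤C)))
      (λ { (Y , h) → case satisfiable⇒certificate 0<time ≤-refl roomy₁ roomy₂ timely
             (selection⇒satisfiable (coloring⇒selection Y h)) of λ where
        (w , w≤ , ok) → Equivalence.from (L-verify x) (w , ≤-trans w≤ (≤-reflexive (sym P≡)) , ≡-T ok) })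

  opaque

    guesses : Word → ℕ
    guesses x = ⟦ horner certificate ⟧ᴾ (length x)

    time : Word → ℕ
    -- The time bound of the verifier at the length of the longest pair; the 1 makes the number of
    -- steps positive, without which there would be no clauses.
    time x = 1 + ⟦ horner bound ⟧ᴾ (length x * 2 + 1 + guesses x)

    window : Word → ℕ
    -- Room for `time x` steps to either side of the head and for the whole pair to the right of it.
    window x = 1 + (time x + time x + (length x * 2 + 1) + guesses x)

    guesses-def : ∀ x → ⟦ horner certificate ⟧ᴾ (length x) ≡ guesses x
    guesses-def x = refl

    time-def : ∀ x → 1 + ⟦ horner bound ⟧ᴾ (length x * 2 + 1 + guesses x) ≡ time x
    time-def x = refl

    window-def : ∀ x → 1 + (time x + time x + (length x * 2 + 1) + guesses x) ≡ window x
    window-def x = refl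

  module Of (x : Word) = Core x (guesses x) (time x) (window x)
    (≤-trans (s≤s z≤n) (≤-reflexive (time-def x)))
    (≤-trans (s≤s (≤-trans (m≤m+n (time x + time x) (length x * 2 + 1)) (m≤m+n _ (guesses x)))) (≤-reflexive (window-def x)))
    (≤-trans (s≤s (+-monoˡ-≤ (guesses x) (+-monoˡ-≤ (length x * 2 + 1) (m≤m+n (time x) (time x))))) (≤-reflexive (window-def x)))
    (trans (sym (horner-correct certificate (length x))) (guesses-def x))
    (λ w w≤ → ≤-trans (≤-reflexive (sym (horner-correct bound _)))
      (≤-trans (≤-trans (⟦⟧ᴾ-mono (horner bound) (≤-trans (≤-reflexive (pair-length w x)) (+-monoʳ-≤ (length x * 2 + 1) w≤))) (n≤1+n _))
        (≤-reflexive (time-def x))))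

  open LayoutWriter {Word} id

  -- Every definition is accompanied by an expression for it. The values of the
  -- expressions are declared to be the defined functions, to be compared one
  -- definition at a time.
  module _ {Γ : ℕ} where

    widthᴱ guessesᴱ timeᴱ windowᴱ Vᴱ Cᴱ Rᴱ Sᴱ : Term Γ
    widthᴱ   = lenᴱ *ᴱ litᴱ 2 +ᴱ litᴱ 1
    guessesᴱ = asTerm (evalᴱ (horner certificate) lenᴱ) (λ x _ → guesses x) (λ x _ → guesses-def x)
    timeᴱ    = asTerm (litᴱ 1 +ᴱ evalᴱ (horner bound) (widthᴱ +ᴱ guessesᴱ)) (λ x _ → time x) (λ x _ → time-def x)
    windowᴱ  = asTerm (litᴱ 1 +ᴱ (timeᴱ +ᴱ timeᴱ +ᴱ widthᴱ +ᴱ guessesᴱ)) (λ x _ → window x) (λ x _ → window-def x)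
    Vᴱ = asTerm ((litᴱ 1 +ᴱ timeᴱ) *ᴱ litᴱ K *ᴱ (litᴱ 2 +ᴱ windowᴱ) *ᴱ litᴱ Z) (λ x _ → Of.V x) (λ x _ → refl)
    Cᴱ = asTerm (litᴱ 4 *ᴱ timeᴱ *ᴱ litᴱ N *ᴱ litᴱ K *ᴱ windowᴱ *ᴱ litᴱ Z) (λ x _ → Of.C x) (λ x _ → refl)
    Rᴱ = asTerm ((litᴱ 1 +ᴱ Vᴱ) *ᴱ Cᴱ) (λ x _ → Of.R x) (λ x _ → refl)
    Sᴱ = asTerm (litᴱ (2 + k) *ᴱ Rᴱ) (λ x _ → Of.S x) (λ x _ → refl)

    xCodeᴱ : Term Γ → Term Γ
    xCodeᴱ j = asTerm (ifᴱ (j <ᴱ lenᴱ *ᴱ litᴱ 2)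
        (ifᴱ (remᴱ j (litᴱ 2) ≡ᴱ litᴱ 0) (litᴱ 2) (litᴱ 1 +ᴱ bitValueᴱ (quotᴱ j (litᴱ 2))))
        (ifᴱ (j ≡ᴱ lenᴱ *ᴱ litᴱ 2) (litᴱ 1) (litᴱ 0)))
      (λ x ρ → xCode x (val j x ρ)) (λ x ρ → refl)

    freeᴱ : Term Γ → Test Γ
    freeᴱ i = asTest (indᴱ ((timeᴱ +ᴱ widthᴱ ≤ᴱ i) ∧ᴱ (i <ᴱ timeᴱ +ᴱ widthᴱ +ᴱ guessesᴱ)))
      (λ x ρ → Of.free x (val i x ρ)) (λ x ρ → refl)

    fixedᴱ : Term Γ → Term Γ → Term Γ
    fixedᴱ τ i = asTerm (ifᴱ (τ ≡ᴱ litᴱ 0) (ifᴱ (i <ᴱ timeᴱ) (litᴱ 0) (xCodeᴱ (i ∸ᴱ timeᴱ)))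
        (ifᴱ (τ ≡ᴱ litᴱ #tapes) (ifᴱ (i ≡ᴱ timeᴱ) (litᴱ (toℕ start)) (litᴱ 0)) (litᴱ 0)))
      (λ x ρ → Of.fixed x (val τ x ρ) (val i x ρ)) (λ x ρ → refl)

    digᴱ wrᴱ mvᴱ : Term Γ → Term Γ → Term Γ
    digᴱ σ τ = asTerm (table₂ᴱ N K (digit Z) σ τ) (λ x ρ → dig (val σ x ρ) (val τ x ρ)) (λ x ρ → refl)
    wrᴱ  σ τ = asTerm (table₂ᴱ N K writes σ τ) (λ x ρ → wr (val σ x ρ) (val τ x ρ)) (λ x ρ → refl)
    mvᴱ  σ τ = asTerm (table₂ᴱ N K moves σ τ) (λ x ρ → mv (val σ x ρ) (val τ x ρ)) (λ x ρ → refl)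

    updatedᴱ : Term Γ → Term Γ → Term Γ → Term Γ → Term Γ
    updatedᴱ σ τ i s = asTerm (ifᴱ (i +ᴱ mvᴱ σ τ ≡ᴱ timeᴱ) (wrᴱ σ τ) s)
      (λ x ρ → Of.updated x (val σ x ρ) (val τ x ρ) (val i x ρ) (val s x ρ)) (λ x ρ → refl)

    cellᴱ : (t′ τ′ i′ s′ t τ i s : Term Γ) → Test Γ
    cellᴱ t′ τ′ i′ s′ t τ i s = asTest (indᴱ ((t′ ≡ᴱ t) ∧ᴱ (τ′ ≡ᴱ τ) ∧ᴱ (i′ ≡ᴱ i) ∧ᴱ (s′ ≡ᴱ s)))
      (λ x ρ → Of.cell x (val t′ x ρ) (val τ′ x ρ) (val i′ x ρ) (val s′ x ρ) (val t x ρ) (val τ x ρ) (val i x ρ) (val s x ρ))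
      (λ x ρ → refl)

    posᶜᴱ negᶜᴱ : (κ t σ τ i s t′ τ′ i′ s′ : Term Γ) → Test Γ
    posᶜᴱ κ t σ τ i s t′ τ′ i′ s′ = asTest (indᴱ (
        ((κ ≡ᴱ litᴱ 0) ∧ᴱ cellᴱ t′ τ′ i′ s′ (litᴱ 1 +ᴱ t) τ (litᴱ 1 +ᴱ i) (updatedᴱ σ τ i s))
      ∨ᴱ (((κ ≡ᴱ litᴱ 1) ∧ᴱ notᴱ ((τ ≡ᴱ litᴱ 0) ∧ᴱ freeᴱ i) ∧ᴱ cellᴱ t′ τ′ i′ s′ (litᴱ 0) τ i (fixedᴱ τ i))
      ∨ᴱ (((κ ≡ᴱ litᴱ 1) ∧ᴱ ((τ ≡ᴱ litᴱ 0) ∧ᴱ freeᴱ i) ∧ᴱ (s′ ≤ᴱ litᴱ 2) ∧ᴱ cellᴱ t′ τ′ i′ s′ (litᴱ 0) τ i s′)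
      ∨ᴱ (((κ ≡ᴱ litᴱ 2) ∧ᴱ cellᴱ t′ τ′ i′ s′ (litᴱ 0) (litᴱ 0) (litᴱ 1 +ᴱ i) (litᴱ 0))
      ∨ᴱ (((κ ≡ᴱ litᴱ 2) ∧ᴱ (i <ᴱ timeᴱ) ∧ᴱ cellᴱ t′ τ′ i′ s′ (litᴱ 0) (litᴱ 0) i (litᴱ 0))
      ∨ᴱ ((κ ≡ᴱ litᴱ 3) ∧ᴱ (s ≡ᴱ litᴱ 2) ∧ᴱ cellᴱ t′ τ′ i′ s′ timeᴱ (litᴱ 0) timeᴱ (litᴱ 2))))))))
      (λ x ρ → Of.posᶜ x (val κ x ρ) (val t x ρ) (val σ x ρ) (val τ x ρ) (val i x ρ) (val s x ρ)
                         (val t′ x ρ) (val τ′ x ρ) (val i′ x ρ) (val s′ x ρ)) (λ x ρ → refl)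
    negᶜᴱ κ t σ τ i s t′ τ′ i′ s′ = asTest (indᴱ (
        ((κ ≡ᴱ litᴱ 0) ∧ᴱ cellᴱ t′ τ′ i′ s′ t τ′ timeᴱ (digᴱ σ τ′))
      ∨ᴱ (((κ ≡ᴱ litᴱ 0) ∧ᴱ cellᴱ t′ τ′ i′ s′ t τ (i +ᴱ mvᴱ σ τ) s)
      ∨ᴱ (((κ ≡ᴱ litᴱ 2) ∧ᴱ cellᴱ t′ τ′ i′ s′ (litᴱ 0) (litᴱ 0) i (litᴱ 0))
      ∨ᴱ ((κ ≡ᴱ litᴱ 3) ∧ᴱ cellᴱ t′ τ′ i′ s′ timeᴱ (litᴱ 0) timeᴱ s)))))
      (λ x ρ → Of.negᶜ x (val κ x ρ) (val t x ρ) (val σ x ρ) (val τ x ρ) (val i x ρ) (val s x ρ)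
                         (val t′ x ρ) (val τ′ x ρ) (val i′ x ρ) (val s′ x ρ)) (λ x ρ → refl)

    onVarᴱ : ((t τ i s : Term Γ) → Test Γ) → Term Γ → Test Γ
    onVarᴱ f v = f (quotᴱ (quotᴱ (quotᴱ v (litᴱ Z)) (litᴱ 2 +ᴱ windowᴱ)) (litᴱ K))
      (remᴱ (quotᴱ (quotᴱ v (litᴱ Z)) (litᴱ 2 +ᴱ windowᴱ)) (litᴱ K))
      (remᴱ (quotᴱ v (litᴱ Z)) (litᴱ 2 +ᴱ windowᴱ)) (remᴱ v (litᴱ Z))

    onClauseᴱ : ((κ t σ τ i s : Term Γ) → Test Γ) → Term Γ → Test Γ
    onClauseᴱ f c = f (quotᴱ κtσ timeᴱ) (remᴱ κtσ timeᴱ) (remᴱ κtστ (litᴱ N)) (remᴱ κtστi (litᴱ K)) (remᴱ c′ windowᴱ) (remᴱ c (litᴱ Z))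
      where
      c′    = quotᴱ c (litᴱ Z)
      κtστi = quotᴱ c′ windowᴱ
      κtστ  = quotᴱ κtστi (litᴱ K)
      κtσ   = quotᴱ κtστ (litᴱ N)

    posᴱ negᴱ : Term Γ → Term Γ → Test Γ
    posᴱ c v = asTest (indᴱ (onClauseᴱ (λ κ t σ τ i s → onVarᴱ (posᶜᴱ κ t σ τ i s) v) c))
      (λ x ρ → Of.pos x (val c x ρ) (val v x ρ)) (λ x ρ → refl)
    negᴱ c v = asTest (indᴱ (onClauseᴱ (λ κ t σ τ i s → onVarᴱ (negᶜᴱ κ t σ τ i s) v) c))
      (λ x ρ → Of.neg x (val c x ρ) (val v x ρ)) (λ x ρ → refl)

    nextᴱ : Term Γ → Term Γ
    nextᴱ c = asTerm (ifᴱ (litᴱ 1 +ᴱ c ≡ᴱ Cᴱ) (litᴱ 0) (litᴱ 1 +ᴱ c)) (λ x ρ → Of.next x (val c x ρ)) (λ x ρ → refl)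

    fitsᴱ : (j v c t v′ c′ : Term Γ) → Test Γ
    fitsᴱ j v c t v′ c′ = asTest (indᴱ (
        ((j ≡ᴱ litᴱ 0) ∧ᴱ (t ≡ᴱ litᴱ 0) ∧ᴱ (v′ ≡ᴱ v) ∧ᴱ ((c′ ≡ᴱ c) ∨ᴱ (c′ ≡ᴱ nextᴱ c)))
      ∨ᴱ (((j ≡ᴱ litᴱ 1) ∧ᴱ (v <ᴱ Vᴱ) ∧ᴱ (v′ ≡ᴱ v) ∧ᴱ
            (((t ≡ᴱ litᴱ 1) ∧ᴱ (c′ ≡ᴱ c)) ∨ᴱ
             ((t ≡ᴱ litᴱ 0) ∧ᴱ (((c′ ≡ᴱ c) ∧ᴱ posᴱ c v) ∨ᴱ ((c′ ≡ᴱ nextᴱ c) ∧ᴱ negᴱ c v)))))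
      ∨ᴱ (((j ≡ᴱ litᴱ 1) ∧ᴱ notᴱ (v <ᴱ Vᴱ) ∧ᴱ (t ≡ᴱ litᴱ 1) ∧ᴱ (v′ <ᴱ Vᴱ) ∧ᴱ (c′ ≡ᴱ c) ∧ᴱ (posᴱ c v′ ∨ᴱ negᴱ c v′))
      ∨ᴱ ((litᴱ 2 ≤ᴱ j) ∧ᴱ (t ≡ᴱ j) ∧ᴱ (v′ ≡ᴱ v) ∧ᴱ (c′ ≡ᴱ c))))))
      (λ x ρ → Of.fits x (val j x ρ) (val v x ρ) (val c x ρ) (val t x ρ) (val v′ x ρ) (val c′ x ρ)) (λ x ρ → refl)

    allowedᴱ : (j r s : Term Γ) → Test Γ
    allowedᴱ j r s = asTest (indᴱ (fitsᴱ j (quotᴱ r Cᴱ) (remᴱ r Cᴱ) (quotᴱ s Rᴱ) (quotᴱ (remᴱ s Rᴱ) Cᴱ) (remᴱ (remᴱ s Rᴱ) Cᴱ)))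
      (λ x ρ → Of.allowed x (val j x ρ) (val r x ρ) (val s x ρ)) (λ x ρ → refl)

    adjacentᴱ : (u v : Term Γ) → Test Γ
    adjacentᴱ u v = asTest (indᴱ (((quotᴱ u Sᴱ ≡ᴱ quotᴱ v Sᴱ) ∨ᴱ (remᴱ u Sᴱ ≡ᴱ remᴱ v Sᴱ)) ∧ᴱ notᴱ (u ≡ᴱ v)))
      (λ x ρ → cellAdj (Of.rowOf x) (Of.colOf x) (val u x ρ) (val v x ρ)) (λ x ρ → refl)

    profitᴱ : (j u : Term Γ) → Test Γ
    profitᴱ j u = asTest (indᴱ (allowedᴱ j (quotᴱ u Sᴱ) (remᴱ u Sᴱ)))
      (λ x ρ → Of.allowed x (val j x ρ) (Of.rowOf x (val u x ρ)) (Of.colOf x (val u x ρ))) (λ x ρ → refl)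

  targetᴱ : Writer 0
  targetᴱ = layoutᴱ (2 + k) (Rᴱ *ᴱ Sᴱ) (adjacentᴱ (varᴱ (suc zero)) (varᴱ zero))
    (bitNumberᴱ (profitᴱ (varᴱ (suc zero)) (varᴱ zero))) (numberᴱ Rᴱ)

  -- The generator is a huge term, which has to be kept from being unfolded.
  opaque
    targetGen : ∃[ g ] ∀ x → ⟦ g ⟧ᴳ (id x) [] ≡ valʷ targetᴱ x []
    targetGen = generator targetᴱ

  targetGen-correct : ∀ x → ⟦ proj₁ targetGen ⟧ᴳ x [] ≡ encodeInstance (Of.target x)
  targetGen-correct x = trans (proj₂ targetGen x) (sym (encodeInstance-layout (Of.target x)
    {λ u v → cellAdj (Of.rowOf x) (Of.colOf x) u v} {λ j u → encodeℕ (toBit (Of.allowed x j (Of.rowOf x u) (Of.colOf x u)))}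
    (λ u v → refl) (λ j u → refl)))

Restricted BoundedRestricted : ℕ → Problem
Restricted k        = restrict (FairDivision (2 + k)) OnLineGraphsOfBipartiteGraphs
BoundedRestricted k = restrict (Restricted k) (NumbersBoundedBy linear (Restricted k))

reduces : ∀ {k} (L : Language) (I : Word → FairDivisionInstance (2 + k)) (f : Word → Word) → PolyTime f →
  (∀ x → f x ≡ encodeInstance (I x)) → (∀ x → OnLineGraphsOfBipartiteGraphs (I x)) →
  (∀ x → All (_≤ eval linear (length (encodeInstance (I x)))) (FairDivisionInstance.q (I x) ∷ profits (I x))) →
  (∀ x → L x ⇔ Solvable (I x)) → L ≤ₚ Problem.language (BoundedRestricted k)
reduces L I f f-polyTime f≡ line bounded L⇔ = f , f-polyTime , λ x → mk⇔
  (λ l → ((I x , line x) , bounded x) , sym (f≡ x) , Equivalence.to (L⇔ x) l)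
  (λ { (((J , _) , _) , e , solvable) → Equivalence.from (L⇔ x)
    (same-solvable (encodeInstance-injective J (I x) (trans e (f≡ x))) solvable) })

Restricted-hard : ∀ k → NPHard (Problem.language (BoundedRestricted k))
Restricted-hard k L (verify , (M , bound , computes) , certificate , L-verify) =
  reduces L Of.target (λ x → ⟦ proj₁ targetGen ⟧ᴳ x []) (Gen-polyTime (proj₁ targetGen)) targetGen-correct
    Of.target-line Of.target-bounded Of.solvable⇔
  where
  open Reduction k L verify M bound computes certificate L-verify

-- Words compared bit by bit

on : Word → ℕ → Bool
on x i = isPositive (bitAt x i)

on-∷ : ∀ b x → on (b ∷ x) 0 ≡ b
on-∷ true  x = refl
on-∷ false x = refl

on-suc : ∀ b x i → on (b ∷ x) (suc i) ≡ on x i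
on-suc true  x i = refl
on-suc false x i = refl

on-++ˡ : ∀ v w {i} → i < length v → on (v ++ w) i ≡ on v i
on-++ˡ (b ∷ v) w {zero}  _       = trans (on-∷ b (v ++ w)) (sym (on-∷ b v))
on-++ˡ (b ∷ v) w {suc i} (s≤s p) = trans (on-suc b (v ++ w) i) (trans (on-++ˡ v w p) (sym (on-suc b v i)))

on-++ʳ : ∀ v w i → on (v ++ w) (length v + i) ≡ on w i
on-++ʳ []      w i = refl
on-++ʳ (b ∷ v) w i = trans (on-suc b (v ++ w) (length v + i)) (on-++ʳ v w i)

on-ext : ∀ x y → length x ≡ length y → (∀ i → i < length y → on x i ≡ on y i) → x ≡ y
on-ext []      []      _ h = refl
on-ext (a ∷ x) (b ∷ y) l h = cong₂ _∷_ (trans (sym (on-∷ a x)) (trans (h 0 (s≤s z≤n)) (on-∷ b y)))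
  (on-ext x y (suc-injective l) λ i p → trans (sym (on-suc a x i)) (trans (h (suc i) (s≤s p)) (on-suc b y i)))

module _ (bx : ℕ → Bool) where

  record Matches (s : ℕ) (v : Word) : Set where
    constructor matching
    field
      bit-at : ∀ i → i < length v → bx (s + i) ≡ on v i

  open Matches public

  matches-at : ∀ {s s′ v} → s ≡ s′ → Matches s v → Matches s′ v
  matches-at refl m = m

  matches-bit : ∀ {s b} → bx s ≡ b → Matches s (b ∷ [])
  matches-bit {s} {b} e = matching λ where
    zero    _        → trans (cong bx (+-identityʳ s)) (trans e (sym (on-∷ b [])))
    (suc i) (s≤s ())

  matches-bit⁻ : ∀ {s b} → Matches s (b ∷ []) → bx s ≡ b
  matches-bit⁻ {s} {b} m = trans (cong bx (sym (+-identityʳ s))) (trans (bit-at m 0 (s≤s z≤n)) (on-∷ b []))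

  matches-++ : ∀ {s} v w → Matches s v → Matches (s + length v) w → Matches s (v ++ w)
  matches-++ {s} v w mv mw = matching go
    where
    go : ∀ i → i < length (v ++ w) → bx (s + i) ≡ on (v ++ w) i
    go i i< with i <? length v
    ... | yes p = trans (bit-at mv i p) (sym (on-++ˡ v w p))
    ... | no ¬p = trans (cong bx (trans (cong (s +_) (sym i≡)) (sym (+-assoc s _ _))))
      (trans (bit-at mw (i ∸ length v) (+-cancelˡ-< (length v) _ _ (≤-trans (≤-reflexive (cong suc i≡)) (≤-trans i< (≤-reflexive (length-++ v))))))
        (trans (sym (on-++ʳ v w (i ∸ length v))) (cong (on (v ++ w)) i≡)))
      where
      i≡ : length v + (i ∸ length v) ≡ i
      i≡ = m+[n∸m]≡n (≮⇒≥ ¬p)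

  matches-++⁻ : ∀ {s} v w → Matches s (v ++ w) → Matches s v × Matches (s + length v) w
  matches-++⁻ {s} v w m =
    matching (λ i p → trans (bit-at m i (≤-trans p (≤-trans (m≤m+n _ _) (≤-reflexive (sym (length-++ v)))))) (on-++ˡ v w p)) ,
    matching (λ i p → trans (cong bx (+-assoc s _ i)) (trans (bit-at m (length v + i) (≤-trans (+-monoʳ-< (length v) p) (≤-reflexive (sym (length-++ v)))))
      (on-++ʳ v w i)))

  module _ (f : ℕ → Word) where

    positions : ∀ n (s : ℕ → ℕ) → (∀ i → i < n → s (suc i) ≡ s i + length (f i)) → s n ≡ s 0 + length (concatTo n f)
    positions zero    s h = sym (+-identityʳ (s 0))
    positions (suc n) s h = trans (h n ≤-refl) (trans (cong (_+ length (f n)) (positions n s (λ i p → h i (m<n⇒m<1+n p))))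
      (trans (+-assoc (s 0) _ _) (cong (s 0 +_) (sym (length-++ (concatTo n f))))))

    matches-concatTo : ∀ n (s : ℕ → ℕ) → (∀ i → i < n → s (suc i) ≡ s i + length (f i)) →
      (∀ i → i < n → Matches (s i) (f i)) → Matches (s 0) (concatTo n f)
    matches-concatTo zero    s h m = matching λ i ()
    matches-concatTo (suc n) s h m = matches-++ (concatTo n f) (f n)
      (matches-concatTo n s (λ i p → h i (m<n⇒m<1+n p)) (λ i p → m i (m<n⇒m<1+n p)))
      (subst (λ t → Matches t (f n)) (positions n s (λ i p → h i (m<n⇒m<1+n p))) (m n ≤-refl))

    matches-concatTo⁻ : ∀ {s} n → Matches s (concatTo n f) → ∀ i → i < n → Matches (s + length (concatTo i f)) (f i)
    matches-concatTo⁻ (suc n) m i i<n with i ≟ n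
    ... | yes refl = proj₂ (matches-++⁻ (concatTo n f) (f n) m)
    ... | no  i≢n  = matches-concatTo⁻ n (proj₁ (matches-++⁻ (concatTo n f) (f n) m)) i (≤∧≢⇒< (s≤s⁻¹ i<n) i≢n)

length-concatTo-const : ∀ n f c → (∀ i → length (f i) ≡ c) → length (concatTo n f) ≡ n * c
length-concatTo-const zero    f c h = refl
length-concatTo-const (suc n) f c h = trans (length-++ (concatTo n f))
  (trans (+-comm _ (length (f n))) (cong₂ _+_ (h n) (length-concatTo-const n f c h)))

length-digitWord : ∀ l d → length (digitWord l d) ≡ suc (2 * l)
length-digitWord l d = trans (length-++ (concatTo l (λ b → true ∷ d b ∷ [])))
  (trans (+-comm _ 1) (cong suc (trans (length-concatTo-const l _ 2 (λ _ → refl)) (*-comm l 2))))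

-- Certificates and their validity

digitValue : (ℕ → Bool) → ℕ → ℕ → ℕ
digitValue d l b = if b <ᵇ l then suc (toBit (d b)) else 0

valueFrom : (ℕ → Bool) → ℕ → ℕ → ℕ
valueFrom d l b = valueOf (l ∸ b) (λ i → d (b + i))

valueOf-cong : ∀ l {d e} → (∀ b → b < l → d b ≡ e b) → valueOf l d ≡ valueOf l e
valueOf-cong zero    h = refl
valueOf-cong (suc l) h = cong₂ (λ b v → suc (toBit b) + 2 * v) (h 0 (s≤s z≤n)) (valueOf-cong l (λ b p → h (suc b) (s≤s p)))

valueFrom-step : ∀ d l b → valueFrom d l b ≡ digitValue d l b + 2 * valueFrom d l (suc b)
valueFrom-step d l b with b <ᵇ l in eq
... | true rewrite +-∸-assoc 1 (<ᵇ⇒< b l (≡-T eq)) = cong₂ (λ x v → suc (toBit x) + 2 * v) (cong d (+-identityʳ b))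
    (valueOf-cong (l ∸ suc b) (λ i _ → cong d (+-suc b i)))
... | false rewrite m≤n⇒m∸n≡0 {l} {b} (≮⇒≥ (λ p → subst T eq (<⇒<ᵇ p)))
                  | m≤n⇒m∸n≡0 {l} {suc b} (m≤n⇒m≤1+n (≮⇒≥ (λ p → subst T eq (<⇒<ᵇ p)))) = refl

valueFrom-end : ∀ d l {b} → l ≤ b → valueFrom d l b ≡ 0
valueFrom-end d l {b} l≤b rewrite m≤n⇒m∸n≡0 {l} {b} l≤b = refl

digitValue≤2 : ∀ d l b → digitValue d l b ≤ 2
digitValue≤2 d l b with b <ᵇ l | d b
... | true  | true  = ≤-refl
... | true  | false = s≤s z≤n
... | false | _     = z≤n

-- Certificates for instances: x has length l and bits bx, class u is 1 + j if u
-- belongs to X_j, and the number p_j(u), or q for j = k and u = 0, has len j u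
-- digits and is encoded at start j u. Profits are added digit by digit, the
-- differences to q being carried, shifted by 2 to keep them nonnegative.
module Validity (k l : ℕ) (bx : ℕ → Bool) (n : ℕ) (row col class : ℕ → ℕ) (len : ℕ → ℕ → ℕ)
  (dig : ℕ → ℕ → ℕ → ℕ) (carry : ℕ → ℕ → ℕ) (rest : ℕ → ℕ → ℕ → ℕ) (start : ℕ → ℕ → ℕ) where

  digit? : ℕ → ℕ → ℕ → Bool
  digit? j u b = 1 ≤ᵇ dig j u b

  value : ℕ → ℕ → ℕ
  value j u = valueOf (len j u) (digit? j u)

  Prefix Matrix Starts Numerals Injective Separated Sums Smalls : Set
  Numeral Small : ℕ → ℕ → Set

  Prefix = (∀ i → i < n → bx i ≡ true) × bx n ≡ false

  Matrix = ∀ u → u < n → ∀ v → v < n → bx (suc n + (u * n + v)) ≡ cellAdj row col u v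

  Starts = start 0 0 ≡ suc n + n * n ×
    (∀ j → j < k → (∀ u → u < n → start j (suc u) ≡ start j u + suc (2 * len j u)) × start (suc j) 0 ≡ start j n) ×
    l ≡ start k 0 + suc (2 * len k 0)

  Numeral j u =
    (∀ b → b < len j u → bx (start j u + 2 * b) ≡ true × bx (start j u + suc (2 * b)) ≡ digit? j u b) ×
    bx (start j u + 2 * len j u) ≡ false

  Numerals = (∀ j → j < k → ∀ u → u < n → Numeral j u) × Numeral k 0

  Injective = ∀ u → u < n → ∀ v → v < n → row u ≡ row v → col u ≡ col v → u ≡ v

  Separated = ∀ u → u < n → ∀ v → v < n → class u ≡ class v → 1 ≤ class u → cellAdj row col u v ≡ false

  -- With `c b` for `carry j b` minus 2, the inequality says that `2 * c (b + 1)` plus a digit of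
  -- `q` is at most `c b` plus the digits of the class; `c` starts at most 0 and ends at least 0.
  -- The shift is 2 because digits are at most 2: from a carry of -2 at least one gets to (-2 - 2) /
  -- 2 = -2 at least.
  Sums = ∀ j → j < k → carry j 0 ≤ 2 ×
    (∀ b → b < l → 2 * carry j (suc b) + digitValue (digit? k 0) (len k 0) b ≤
      carry j b + 2 + sumTo n (λ u → toBit (class u ≡ᵇ suc j) * digitValue (digit? j u) (len j u) b)) ×
    2 ≤ carry j l

  -- `rest j u b` bounds from above what the digits from `b` on stand for, so that the number is
  -- bounded without being computed.
  Small j u = rest j u 0 ≤ l ×
    (∀ b → b < len j u → digitValue (digit? j u) (len j u) b + 2 * rest j u (suc b) ≤ rest j u b)

  Smalls = (∀ j → j < k → ∀ u → u < n → Small j u) × Small k 0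

  Valid : Set
  -- The last condition ensures that the digits of `q` are exhausted at position `l`, where the sums
  -- end.
  Valid = Prefix × Matrix × Starts × Numerals × Injective × Separated × Sums × len k 0 ≤ l

  tail : ℕ → ℕ → ℕ → ℕ
  tail j u b = valueFrom (digit? j u) (len j u) b

  share : ℕ → ℕ → ℕ
  share j b = sumTo n (λ u → toBit (class u ≡ᵇ suc j) * tail j u b)

  share-step : ∀ j b → share j b ≡
    sumTo n (λ u → toBit (class u ≡ᵇ suc j) * digitValue (digit? j u) (len j u) b) + 2 * share j (suc b)
  share-step j b = sumTo-step n (λ u → toBit (class u ≡ᵇ suc j)) _ _ _ (λ u → valueFrom-step (digit? j u) (len j u) b)
    where
    lemma : ∀ t d v s w → t * (d + 2 * v) + (s + 2 * w) ≡ t * d + s + 2 * (t * v + w)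
    lemma = solve-∀
    sumTo-step : ∀ n (t a d v : ℕ → ℕ) → (∀ u → a u ≡ d u + 2 * v u) →
      sumTo n (λ u → t u * a u) ≡ sumTo n (λ u → t u * d u) + 2 * sumTo n (λ u → t u * v u)
    sumTo-step zero    t a d v h = refl
    sumTo-step (suc n) t a d v h = trans (cong₂ _+_ (cong (t n *_) (h n)) (sumTo-step n t a d v h)) (lemma (t n) (d n) (v n) _ _)

  certified : FairDivisionInstance k
  certified = record { n = n ; graph = cellGraph row col n ; p = λ j u → value (toℕ j) (toℕ u) ; q = value k 0 }

  numeral-matches : ∀ {j u} → Numeral j u → Matches bx (start j u) (digitWord (len j u) (digit? j u))
  numeral-matches {j} {u} (h , e) = matches-++ bx (concatTo (len j u) pairs) (false ∷ [])
    (subst (λ s → Matches bx s (concatTo (len j u) pairs)) (+-identityʳ (start j u))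
      (matches-concatTo bx pairs (len j u) (λ b → start j u + 2 * b)
        (λ b _ → trans (cong (start j u +_) (lemma b)) (sym (+-assoc (start j u) _ 2)))
        (λ b b< → matches-++ bx (true ∷ []) (digit? j u b ∷ []) (matches-bit bx (proj₁ (h b b<)))
          (matches-bit bx (trans (cong bx (trans (+-assoc (start j u) _ 1) (cong (start j u +_) (+-comm (2 * b) 1)))) (proj₂ (h b b<)))))))
    (matches-bit bx (trans (cong bx (cong (start j u +_) (trans (length-concatTo-const (len j u) pairs 2 (λ _ → refl)) (*-comm (len j u) 2)))) e))
    where
    pairs : ℕ → Word
    pairs b = true ∷ digit? j u b ∷ []
    lemma : ∀ b → 2 * suc b ≡ 2 * b + 2
    lemma = solve-∀

  module Soundness (valid : Valid) where

    private
      pre = proj₁ valid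
      mat = proj₁ (proj₂ valid)
      sta = proj₁ (proj₂ (proj₂ valid))
      num = proj₁ (proj₂ (proj₂ (proj₂ valid)))
      inj = proj₁ (proj₂ (proj₂ (proj₂ (proj₂ valid))))
      sep = proj₁ (proj₂ (proj₂ (proj₂ (proj₂ (proj₂ valid)))))
      sms = proj₁ (proj₂ (proj₂ (proj₂ (proj₂ (proj₂ (proj₂ valid))))))
      shr = proj₂ (proj₂ (proj₂ (proj₂ (proj₂ (proj₂ (proj₂ valid))))))

      matrixRow : ℕ → ℕ → Word
      matrixRow u v = cellAdj row col u v ∷ []

      number : ℕ → ℕ → Word
      number j u = digitWord (len j u) (digit? j u)

      threshold : Word
      threshold = digitWord (len k 0) (digit? k 0)

      whole : Word
      whole = layout k n (cellAdj row col) number threshold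

      row-length : ∀ u → length (concatTo n (matrixRow u)) ≡ n
      row-length u = trans (length-concatTo-const n _ 1 (λ _ → refl)) (*-identityʳ n)

      start-row : ∀ j → j < k → ∀ u → u < n → start j (suc u) ≡ start j u + length (number j u)
      start-row j j<k u u<n = trans (proj₁ (proj₁ (proj₂ sta) j j<k) u u<n)
        (cong (start j u +_) (sym (length-digitWord (len j u) (digit? j u))))

      start-next : ∀ j → j < k → start (suc j) 0 ≡ start j 0 + length (concatTo n (number j))
      start-next j j<k = trans (proj₂ (proj₁ (proj₂ sta) j j<k)) (positions bx (number j) n (start j) (start-row j j<k))

      unary-length : length (concatTo n (λ _ → true ∷ [])) ≡ n
      unary-length = trans (length-concatTo-const n _ 1 (λ _ → refl)) (*-identityʳ n)

      matrix-length : length (concatTo n (λ u → concatTo n (matrixRow u))) ≡ n * n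
      matrix-length = length-concatTo-const n _ n row-length

      matrix-matches : Matches bx (suc n) (concatTo n (λ u → concatTo n (matrixRow u)))
      matrix-matches = matches-at bx (+-identityʳ (suc n))
        (matches-concatTo bx (λ u → concatTo n (matrixRow u)) n (λ u → suc n + u * n)
          (λ u _ → trans (cong (suc n +_) (+-comm n (u * n))) (trans (sym (+-assoc (suc n) (u * n) n)) (cong (suc n + u * n +_) (sym (row-length u)))))
          (λ u u<n → subst (λ s → Matches bx s (concatTo n (matrixRow u))) (+-identityʳ (suc n + u * n))
            (matches-concatTo bx (matrixRow u) n (λ v → suc n + u * n + v)
              (λ v _ → trans (+-suc (suc n + u * n) v) (+-comm 1 _))
              (λ v v<n → matches-bit bx (trans (cong bx (+-assoc (suc n) (u * n) v)) (mat u u<n v v<n))))))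

      numbers-end : start k 0 ≡ start 0 0 + length (concatTo k (λ j → concatTo n (number j)))
      numbers-end = positions bx (λ j → concatTo n (number j)) k (λ j → start j 0) start-next

      numbers-matches : Matches bx (start 0 0) (concatTo k (λ j → concatTo n (number j)))
      numbers-matches = matches-concatTo bx (λ j → concatTo n (number j)) k (λ j → start j 0) start-next
        λ j j<k → matches-concatTo bx (number j) n (start j) (start-row j j<k)
          λ u u<n → numeral-matches (proj₁ num j j<k u u<n)

      whole-matches : Matches bx 0 whole
      whole-matches = matches-++ bx (concatTo n (λ _ → true ∷ [])) _
        (matches-concatTo bx (λ _ → true ∷ []) n id (λ i _ → +-comm 1 i) (λ i i<n → matches-bit bx (proj₁ pre i i<n)))
        (matches-++ bx (false ∷ []) _ (matches-bit bx (trans (cong bx unary-length) (proj₂ pre)))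
        (matches-at bx (trans (+-comm 1 n) (cong (_+ 1) (sym unary-length)))
        (matches-++ bx (concatTo n (λ u → concatTo n (matrixRow u))) _ matrix-matches
        (matches-at bx (trans (proj₁ sta) (cong (suc n +_) (sym matrix-length)))
        (matches-++ bx (concatTo k (λ j → concatTo n (number j))) threshold numbers-matches
        (subst (λ s → Matches bx s threshold) numbers-end (numeral-matches (proj₂ num))))))))

      whole-length : length whole ≡ l
      whole-length = begin
        length whole
          ≡⟨ length-++ (concatTo n (λ _ → true ∷ [])) ⟩
        length (concatTo n (λ _ → true ∷ [])) + suc (length rest₁)
          ≡⟨ cong₂ (λ a b → a + suc b) unary-length (length-++ (concatTo n (λ u → concatTo n (matrixRow u)))) ⟩
        n + suc (length (concatTo n (λ u → concatTo n (matrixRow u))) + length rest₂)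
          ≡⟨ cong₂ (λ a b → n + suc (a + b)) matrix-length (length-++ (concatTo k (λ j → concatTo n (number j)))) ⟩
        n + suc (n * n + (length (concatTo k (λ j → concatTo n (number j))) + length threshold))
          ≡⟨ lemma n (n * n) _ _ ⟩
        suc n + n * n + length (concatTo k (λ j → concatTo n (number j))) + length threshold
          ≡⟨ cong₂ _+_ (trans (cong (_+ length (concatTo k (λ j → concatTo n (number j)))) (sym (proj₁ sta))) (sym numbers-end)) (length-digitWord (len k 0) (digit? k 0)) ⟩
        start k 0 + suc (2 * len k 0)
          ≡⟨ proj₂ (proj₂ sta) ⟨
        l ∎
        where
        open ≡-Reasoning
        rest₂ = concatTo k (λ j → concatTo n (number j)) ++ threshold
        rest₁ = concatTo n (λ u → concatTo n (matrixRow u)) ++ rest₂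
        lemma : ∀ a b c d → a + suc (b + (c + d)) ≡ suc a + b + c + d
        lemma = solve-∀

    -- The certificate locates the parts of the code in `x`; they follow each other without gaps and
    -- end at `l`, so every bit is accounted for.
    encode-certified : ∀ x → length x ≡ l → (∀ i → on x i ≡ bx i) → encodeInstance certified ≡ x
    encode-certified x x≡l x≡bx = trans (trans (encodeInstance-layout certified (λ u v → refl)
        (λ j u → encodeℕ-valueOf (len (toℕ j) (toℕ u)) (digit? (toℕ j) (toℕ u))))
        (cong (layout k n (cellAdj row col) number) (encodeℕ-valueOf (len k 0) (digit? k 0))))
      (on-ext whole x (trans whole-length (sym x≡l)) λ i i< → trans
        (sym (bit-at whole-matches i (≤-trans i< (≤-reflexive (trans x≡l (sym whole-length)))))) (sym (x≡bx i)))

    certified-line : ∀ B → (∀ u → row u ≤ B) → (∀ u → col u ≤ B) → OnLineGraphsOfBipartiteGraphs certified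
    certified-line B row≤ col≤ = CellLineGraph.isLineGraph row col n (suc B) (suc B)
      (λ _ → s≤s (row≤ _)) (λ _ → s≤s (col≤ _)) (λ {u} {v} u<n v<n → inj u u<n v v<n)

    private
      -- Induction from the last digit down: from `b` on, the class collects what `q` requires, up
      -- to the carry. At `b = 0` the carry is at most 2 and cancels.
      enough-from : ∀ j → j < k → ∀ c b → b + c ≡ l → tail k 0 b + 2 ≤ share j b + carry j b
      enough-from j j<k zero b e rewrite trans (sym (+-identityʳ b)) e | valueFrom-end (digit? k 0) (len k 0) shr =
        ≤-trans (proj₂ (proj₂ (sms j j<k))) (m≤n+m _ _)
      enough-from j j<k (suc c) b e = +-cancelʳ-≤ 2 _ _ (begin
        tail k 0 b + 2 + 2
          ≡⟨ cong (λ t → t + 2 + 2) (valueFrom-step (digit? k 0) (len k 0) b) ⟩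
        d + 2 * tail k 0 (suc b) + 2 + 2
          ≡⟨ lemma₁ d (tail k 0 (suc b)) ⟩
        d + 2 * (tail k 0 (suc b) + 2)
          ≤⟨ +-monoʳ-≤ d (*-monoʳ-≤ 2 (enough-from j j<k c (suc b) (trans (sym (+-suc b c)) e))) ⟩
        d + 2 * (share j (suc b) + carry j (suc b))
          ≡⟨ lemma₂ d (share j (suc b)) (carry j (suc b)) ⟩
        2 * carry j (suc b) + d + 2 * share j (suc b)
          ≤⟨ +-monoˡ-≤ _ (proj₁ (proj₂ (sms j j<k)) b (≤-trans (s≤s (m≤m+n b c)) (≤-reflexive (trans (sym (+-suc b c)) e)))) ⟩
        carry j b + 2 + s + 2 * share j (suc b)
          ≡⟨ lemma₃ (carry j b) s (share j (suc b)) ⟩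
        s + 2 * share j (suc b) + carry j b + 2
          ≡⟨ cong (λ t → t + carry j b + 2) (share-step j b) ⟨
        share j b + carry j b + 2 ∎)
        where
        open ≤-Reasoning
        d = digitValue (digit? k 0) (len k 0) b
        s = sumTo n (λ u → toBit (class u ≡ᵇ suc j) * digitValue (digit? j u) (len j u) b)
        lemma₁ : ∀ d t → d + 2 * t + 2 + 2 ≡ d + 2 * (t + 2)
        lemma₁ = solve-∀
        lemma₂ : ∀ d s c → d + 2 * (s + c) ≡ 2 * c + d + 2 * s
        lemma₂ = solve-∀
        lemma₃ : ∀ c s t → c + 2 + s + 2 * t ≡ s + 2 * t + c + 2
        lemma₃ = solve-∀

      enough : ∀ j → j < k → value k 0 ≤ sumTo n (λ u → toBit (class u ≡ᵇ suc j) * value j u)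
      enough j j<k = +-cancelʳ-≤ 2 _ _ (≤-trans (enough-from j j<k l 0 refl) (+-monoʳ-≤ (share j 0) (proj₁ (sms j j<k))))

    certified-solvable : .{{_ : NonZero k}} → Solvable certified
    certified-solvable = coloring , Equivalence.from (minimum-greatest k _ _) λ j →
      ≤-trans (enough (toℕ j) (toℕ<n j)) (≤-reflexive (sym (sum-tabulate n _ _ λ u →
        trans (cong (if_then value (toℕ j) (toℕ u) else 0) (Vecₚ.lookup∘tabulate (λ u → class (toℕ u) ≡ᵇ suc (toℕ j)) u))
          (if-toBit (class (toℕ u) ≡ᵇ suc (toℕ j))))))
      where
      if-toBit : ∀ b {v} → (if b then v else 0) ≡ toBit b * v
      if-toBit true  = sym (+-identityʳ _)
      if-toBit false = refl
      member : ∀ {j u} → u ∈ˢ Vec.tabulate {n = n} (λ u → class (toℕ u) ≡ᵇ suc j) → class (toℕ u) ≡ suc j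
      member {j} {u} u∈ = ≡ᵇ-sound (trans (sym (Vecₚ.lookup∘tabulate (λ u → class (toℕ u) ≡ᵇ suc j) u)) (Vecₚ.[]=⇒lookup u∈))
      coloring : PartialColoring k (cellGraph row col n)
      coloring = record
        { class       = λ j → Vec.tabulate (λ u → class (toℕ u) ≡ᵇ suc (toℕ j))
        ; independent = λ j {u} {v} u∈ v∈ t → subst T (sep (toℕ u) (toℕ<n u) (toℕ v) (toℕ<n v)
            (trans (member u∈) (sym (member v∈))) (≤-trans (s≤s z≤n) (≤-reflexive (sym (member u∈))))) t
        ; disjoint    = λ i j i≢j → λ { (u , u∈) → case x∈p∩q⁻ _ _ u∈ of λ where
            (u∈i , u∈j) → i≢j (toℕ-injective (suc-injective (trans (sym (member u∈i)) (member u∈j)))) }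
        }

    certified-bounded : Smalls → All (_≤ l) (FairDivisionInstance.q certified ∷ profits certified)
    certified-bounded (small , smallₖ) = below smallₖ ∷ profits-all⁺ certified λ j u → below (small (toℕ j) (toℕ<n j) (toℕ u) (toℕ<n u))
      where
      below : ∀ {j u} → Small j u → value j u ≤ l
      below {j} {u} (r≤ , h) = ≤-trans (go (len j u) 0 (+-identityʳ _)) r≤
        where
        go : ∀ c b → c + b ≡ len j u → tail j u b ≤ rest j u b
        go zero    b refl = ≤-trans (≤-reflexive (valueFrom-end (digit? j u) (len j u) {b} ≤-refl)) z≤n
        go (suc c) b e = ≤-trans (≤-reflexive (valueFrom-step (digit? j u) (len j u) b))
          (≤-trans (+-monoʳ-≤ (digitValue (digit? j u) (len j u) b) (*-monoʳ-≤ 2 (go c (suc b) (trans (+-suc c b) e))))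
            (h b (≤-trans (s≤s (m≤n+m b c)) (≤-reflexive e))))

digitValue-cong : ∀ {d e} l b → (∀ b → b < l → d b ≡ e b) → digitValue d l b ≡ digitValue e l b
digitValue-cong l b h with b <ᵇ l in eq
... | true  = cong (suc ∘ toBit) (h b (<ᵇ⇒< b l (≡-T eq)))
... | false = refl

module ValidityCong (k l : ℕ) (bx : ℕ → Bool) (n : ℕ)
  (row row′ col col′ class class′ : ℕ → ℕ) (len len′ : ℕ → ℕ → ℕ) (dig dig′ : ℕ → ℕ → ℕ → ℕ)
  (carry carry′ : ℕ → ℕ → ℕ) (rest rest′ : ℕ → ℕ → ℕ → ℕ) (start start′ : ℕ → ℕ → ℕ) where

  -- A written certificate is finite: it agrees with the intended functions at the arguments that
  -- matter for validity, while elsewhere the two may differ.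
  Used : ℕ → ℕ → Set
  Used j u = (j < k × u < n) ⊎ (j ≡ k × u ≡ 0)

  private
    module Old = Validity k l bx n row col class len dig carry rest start
    module New = Validity k l bx n row′ col′ class′ len′ dig′ carry′ rest′ start′

  module _
    (row≡   : ∀ {u} → u < n → row′ u ≡ row u)
    (col≡   : ∀ {u} → u < n → col′ u ≡ col u)
    (class≡ : ∀ {u} → u < n → class′ u ≡ class u)
    (len≡   : ∀ {j u} → Used j u → len′ j u ≡ len j u)
    (dig≡   : ∀ {j u b} → Used j u → b < len j u → dig′ j u b ≡ dig j u b)
    (carry≡ : ∀ {j b} → j < k → b ≤ l → carry′ j b ≡ carry j b)
    (start≡ : ∀ {j u} → (j < k × u ≤ n) ⊎ (j ≡ k × u ≡ 0) → start′ j u ≡ start j u) where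

    private
      adj≡ : ∀ {u v} → u < n → v < n → cellAdj row′ col′ u v ≡ cellAdj row col u v
      adj≡ {u} {v} u<n v<n = cong₂ (λ a b → (a ∨ b) ∧ not (u ≡ᵇ v)) (cong₂ _≡ᵇ_ (row≡ u<n) (row≡ v<n)) (cong₂ _≡ᵇ_ (col≡ u<n) (col≡ v<n))

      last : Used k 0
      last = inj₂ (refl , refl)

      start-used : ∀ {j u} → Used j u → start′ j u ≡ start j u
      start-used (inj₁ (j<k , u<n)) = start≡ (inj₁ (j<k , <⇒≤ u<n))
      start-used (inj₂ e)           = start≡ (inj₂ e)

      digit≡ : ∀ {j u b} → Used j u → b < len j u → New.digit? j u b ≡ Old.digit? j u b
      digit≡ used b< = cong (1 ≤ᵇ_) (dig≡ used b<)

      value≡ : ∀ {j u} → Used j u → ∀ b →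
        digitValue (New.digit? j u) (len′ j u) b ≡ digitValue (Old.digit? j u) (len j u) b
      value≡ {j} {u} used b rewrite len≡ used = digitValue-cong (len j u) b (λ b b< → digit≡ used b<)

      numeral : ∀ {j u} → Used j u → Old.Numeral j u → New.Numeral j u
      numeral used (h , e) rewrite len≡ used | start-used used =
        (λ b b< → proj₁ (h b b<) , trans (proj₂ (h b b<)) (sym (digit≡ used b<))) , e

    valid-cong : Old.Valid → New.Valid
    valid-cong (pre , mat , (s₀ , s₁ , s₂) , (nums , numₖ) , inj , sep , sums , short) =
      pre ,
      (λ u u<n v v<n → trans (mat u u<n v v<n) (sym (adj≡ u<n v<n))) ,
      (trans start₀ s₀
        , (λ j j<k → (λ u u<n → trans (start≡ (inj₁ (j<k , u<n))) (trans (proj₁ (s₁ j j<k) u u<n)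
              (sym (cong₂ (λ s l → s + suc (2 * l)) (start≡ (inj₁ (j<k , <⇒≤ u<n))) (len≡ (inj₁ (j<k , u<n)))))))
            , trans (next j<k) (trans (proj₂ (s₁ j j<k)) (sym (start≡ (inj₁ (j<k , ≤-refl))))))
        , trans s₂ (sym (cong₂ (λ s l → s + suc (2 * l)) (start≡ (inj₂ (refl , refl))) (len≡ last)))) ,
      ((λ j j<k u u<n → numeral (inj₁ (j<k , u<n)) (nums j j<k u u<n)) , numeral last numₖ) ,
      (λ u u<n v v<n r c → inj u u<n v v<n (trans (sym (row≡ u<n)) (trans r (row≡ v<n))) (trans (sym (col≡ u<n)) (trans c (col≡ v<n)))) ,
      (λ u u<n v v<n e c → trans (adj≡ u<n v<n) (sep u u<n v v<n (trans (sym (class≡ u<n)) (trans e (class≡ v<n)))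
        (≤-trans c (≤-reflexive (class≡ u<n))))) ,
      (λ j j<k → subst (_≤ 2) (sym (carry≡ j<k z≤n)) (proj₁ (sums j j<k))
        , (λ b b<l → subst₂ _≤_
            (sym (cong₂ (λ c d → 2 * c + d) (carry≡ j<k b<l) (value≡ last b)))
            (sym (cong₂ (λ c s → c + 2 + s) (carry≡ j<k (<⇒≤ b<l)) (sumTo-cong n λ u u<n →
              cong₂ (λ c d → toBit (c ≡ᵇ suc j) * d) (class≡ u<n) (value≡ (inj₁ (j<k , u<n)) b))))
            (proj₁ (proj₂ (sums j j<k)) b b<l))
        , subst (2 ≤_) (sym (carry≡ j<k ≤-refl)) (proj₂ (proj₂ (sums j j<k)))) ,
      ≤-trans (≤-reflexive (len≡ last)) short
      where
      start₀ : start′ 0 0 ≡ start 0 0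
      start₀ with 0 <? k
      ... | yes 0<k = start≡ (inj₁ (0<k , z≤n))
      ... | no  0≮k = start≡ (inj₂ (sym (n≤0⇒n≡0 (≮⇒≥ 0≮k)) , refl))
      next : ∀ {j} → j < k → start′ (suc j) 0 ≡ start (suc j) 0
      next {j} j<k with suc j ≟ k
      ... | yes e = start≡ (inj₂ (e , refl))
      ... | no ≢k = start≡ (inj₁ (≤∧≢⇒< j<k ≢k , z≤n))

    smalls-cong : (∀ {j u b} → Used j u → b ≤ len j u → rest′ j u b ≡ rest j u b) → Old.Smalls → New.Smalls
    smalls-cong rest≡ (smalls , smallₖ) = (λ j j<k u u<n → small (inj₁ (j<k , u<n)) (smalls j j<k u u<n)) , small last smallₖ
      where
      small : ∀ {j u} → Used j u → Old.Small j u → New.Small j u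
      small {j} {u} used (r , h) = ≤-trans (≤-reflexive (rest≡ used z≤n)) r , λ b b< →
        let b<′ = subst (b <_) (len≡ used) b< in
        subst₂ _≤_ (sym (cong₂ (λ d r → d + 2 * r) (value≡ used b) (rest≡ used b<′))) (sym (rest≡ used (<⇒≤ b<′))) (h b b<′)

-- The certificate of a solvable instance

module Completeness (k : ℕ) .{{_ : NonZero k}} (I : FairDivisionInstance k)
  (line : OnLineGraphsOfBipartiteGraphs I) (solution : Solvable I) where
  open FairDivisionInstance I
  open PartialColoring (proj₁ solution) renaming (class to classOf; independent to classes-independent; disjoint to classes-disjoint)
  open LineGraphCells.Cells (LineGraphCells.cells graph line) public

  x : Word
  x = encodeInstance I

  l : ℕ
  l = length x

  amount : ℕ → ℕ → ℕ
  amount j u = if j ≡ᵇ k then q else extend (λ _ → 0) (λ j → extend 0 (p j)) j u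

  len : ℕ → ℕ → ℕ
  len j u = proj₁ (digitsOf (amount j u))

  dig : ℕ → ℕ → ℕ → ℕ
  dig j u b = toBit (proj₁ (proj₂ (digitsOf (amount j u))) b)

  belongs : ℕ → ℕ → Bool
  belongs j u = extend (λ _ → false) (λ j → extend false (lookup (classOf j))) j u

  -- Classes are disjoint, so for a vertex of the graph the largest index found is the only one.
  lastClass : ℕ → ℕ → ℕ
  lastClass zero    u = 0
  lastClass (suc j) u = if belongs j u then suc j else lastClass j u

  class : ℕ → ℕ
  class = lastClass k

  number : ℕ → ℕ → Word
  number j u = digitWord (len j u) (λ b → 1 ≤ᵇ dig j u b)

  start : ℕ → ℕ → ℕ
  start j u = suc n + n * n + length (concatTo j (λ j → concatTo n (number j))) + length (concatTo u (number j))

  digitAt : ℕ → ℕ → ℕ → ℕ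
  digitAt j u = digitValue (λ b → 1 ≤ᵇ dig j u b) (len j u)

  collected : ℕ → ℕ → ℕ
  collected j b = sumTo n (λ u → toBit (class u ≡ᵇ suc j) * digitAt j u b)

  -- The largest carries that `Sums` admits. The subtraction is never truncated, because a digit is
  -- at most 2 and 2 has been added before.
  carry : ℕ → ℕ → ℕ
  carry j zero    = 2
  carry j (suc b) = quot (carry j b + 2 + collected j b ∸ digitAt k 0 b) 2

  rest : ℕ → ℕ → ℕ → ℕ
  rest j u b = valueFrom (λ b → 1 ≤ᵇ dig j u b) (len j u) b

  open Validity k l (on x) n row col class len dig carry rest start public

  value≡ : ∀ j u → value j u ≡ amount j u
  value≡ j u = trans (valueOf-cong (len j u) (λ b _ → one≤ (proj₁ (proj₂ (digitsOf (amount j u))) b))) (proj₂ (proj₂ (digitsOf (amount j u))))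
    where
    one≤ : ∀ b → (1 ≤ᵇ toBit b) ≡ b
    one≤ true  = refl
    one≤ false = refl

  amount-p : ∀ j u → amount (toℕ j) (toℕ u) ≡ p j u
  amount-p j u with toℕ j ≡ᵇ k in eq
  ... | true  = contradiction (≡ᵇ-sound {toℕ j} eq) (<⇒≢ (toℕ<n j))
  ... | false = trans (cong (λ f → f (toℕ u)) (extend-toℕ (λ _ → 0) (λ j → extend 0 (p j)) j)) (extend-toℕ 0 (p j) u)

  amount-q : ∀ u → amount k u ≡ q
  amount-q u rewrite ≡ᵇ-complete {k} refl = refl

  encode-number : ∀ j u → encodeℕ (amount j u) ≡ number j u
  encode-number j u = trans (cong encodeℕ (sym (value≡ j u))) (encodeℕ-valueOf (len j u) (digit? j u))

  x≡layout : x ≡ layout k n (cellAdj row col) number (number k 0)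
  x≡layout = trans (encodeInstance-layout I adj-cell (λ j u → trans (cong encodeℕ (sym (amount-p j u))) (encode-number (toℕ j) (toℕ u))))
    (cong (layout k n (cellAdj row col) number) (trans (cong encodeℕ (sym (amount-q 0))) (encode-number k 0)))

  private
    matrixRow : ℕ → ℕ → Word
    matrixRow u v = cellAdj row col u v ∷ []

    unary matrix numbers : Word
    unary   = concatTo n (λ _ → true ∷ [])
    matrix  = concatTo n (λ u → concatTo n (matrixRow u))
    numbers = concatTo k (λ j → concatTo n (number j))

    unary-length : ∀ i → length (concatTo i (λ _ → true ∷ [])) ≡ i
    unary-length i = trans (length-concatTo-const i _ 1 (λ _ → refl)) (*-identityʳ i)

    row-length : ∀ u → length (concatTo n (matrixRow u)) ≡ n
    row-length u = trans (length-concatTo-const n _ 1 (λ _ → refl)) (*-identityʳ n)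

    matrix-length : ∀ u → length (concatTo u (λ u → concatTo n (matrixRow u))) ≡ u * n
    matrix-length u = length-concatTo-const u _ n row-length

    parts : Matches (on x) 0 unary × Matches (on x) n (false ∷ []) × Matches (on x) (suc n) matrix ×
      Matches (on x) (suc n + n * n) numbers × Matches (on x) (start k 0) (number k 0)
    parts with matches-++⁻ (on x) unary _ (subst (λ y → Matches (on x) 0 y) x≡layout (matching (λ i _ → refl)))
    ... | m₀ , r₀ with matches-++⁻ (on x) (false ∷ []) _ (subst (λ s → Matches (on x) s (false ∷ matrix ++ numbers ++ number k 0)) (unary-length n) r₀)
    ... | m₁ , r₁ with matches-++⁻ (on x) matrix _ (subst (λ s → Matches (on x) s (matrix ++ numbers ++ number k 0)) (+-comm n 1) r₁)
    ... | m₂ , r₂ with matches-++⁻ (on x) numbers _ (subst (λ s → Matches (on x) s (numbers ++ number k 0)) (cong (suc n +_) (matrix-length n)) r₂)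
    ... | m₃ , m₄ = m₀ , m₁ , m₂ , m₃ , subst (λ s → Matches (on x) s (number k 0)) (sym (+-identityʳ _)) m₄

    numeral : ∀ j u → Matches (on x) (start j u) (number j u) → Numeral j u
    numeral j u m with matches-++⁻ (on x) (concatTo (len j u) pairs) (false ∷ []) m
      where
      pairs : ℕ → Word
      pairs b = true ∷ digit? j u b ∷ []
    ... | m₀ , m₁ = (λ b b< → pair b (matches-concatTo⁻ (on x) pairs (len j u) m₀ b b<)) ,
        trans (cong (on x) (cong (start j u +_) (sym (pairs-length (len j u))))) (matches-bit⁻ (on x) m₁)
      where
      pairs : ℕ → Word
      pairs b = true ∷ digit? j u b ∷ []
      pairs-length : ∀ b → length (concatTo b pairs) ≡ 2 * b
      pairs-length b = trans (length-concatTo-const b pairs 2 (λ _ → refl)) (*-comm b 2)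
      pair : ∀ b → Matches (on x) (start j u + length (concatTo b pairs)) (pairs b) →
        on x (start j u + 2 * b) ≡ true × on x (start j u + suc (2 * b)) ≡ digit? j u b
      pair b m rewrite pairs-length b with matches-++⁻ (on x) (true ∷ []) (digit? j u b ∷ []) m
      ... | p₀ , p₁ = matches-bit⁻ (on x) p₀ ,
        trans (cong (on x) (trans (cong (start j u +_) (+-comm 1 (2 * b))) (sym (+-assoc (start j u) _ 1)))) (matches-bit⁻ (on x) p₁)

    number-at : ∀ j → j < k → ∀ u → u < n → Matches (on x) (start j u) (number j u)
    number-at j j<k u u<n = matches-concatTo⁻ (on x) (number j) n
      (matches-concatTo⁻ (on x) (λ j → concatTo n (number j)) k (proj₁ (proj₂ (proj₂ (proj₂ parts)))) j j<k) u u<n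

    prefix : Prefix
    prefix = (λ i i<n → trans (cong (on x) (sym (unary-length i))) (matches-bit⁻ (on x) (matches-concatTo⁻ (on x) _ n (proj₁ parts) i i<n)))
      , matches-bit⁻ (on x) (proj₁ (proj₂ parts))

    matrix-valid : Matrix
    matrix-valid u u<n v v<n = trans
      (cong (on x) (trans (sym (+-assoc (suc n) (u * n) v)) (sym (cong₂ (λ a b → suc n + a + b) (matrix-length u)
        (trans (length-concatTo-const v (matrixRow u) 1 (λ _ → refl)) (*-identityʳ v))))))
      (matches-bit⁻ (on x) (matches-concatTo⁻ (on x) (matrixRow u) n
        (matches-concatTo⁻ (on x) (λ u → concatTo n (matrixRow u)) n (proj₁ (proj₂ (proj₂ parts))) u u<n) v v<n))

    number-length : ∀ j u → length (number j u) ≡ suc (2 * len j u)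
    number-length j u = length-digitWord (len j u) (digit? j u)

    l≡ : l ≡ start k 0 + suc (2 * len k 0)
    l≡ = trans (cong length x≡layout) (begin
      length (layout k n (cellAdj row col) number (number k 0))
        ≡⟨ length-++ unary ⟩
      length unary + suc (length (matrix ++ numbers ++ number k 0))
        ≡⟨ cong₂ (λ a b → a + suc b) (unary-length n) (length-++ matrix) ⟩
      n + suc (length matrix + length (numbers ++ number k 0))
        ≡⟨ cong₂ (λ a b → n + suc (a + b)) (matrix-length n) (length-++ numbers) ⟩
      n + suc (n * n + (length numbers + length (number k 0)))
        ≡⟨ lemma n (n * n) (length numbers) (length (number k 0)) ⟩
      suc n + n * n + length numbers + 0 + length (number k 0)
        ≡⟨ cong (suc n + n * n + length numbers + 0 +_) (number-length k 0) ⟩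
      start k 0 + suc (2 * len k 0) ∎)
      where
      open ≡-Reasoning
      lemma : ∀ a b c d → a + suc (b + (c + d)) ≡ suc a + b + c + 0 + d
      lemma = solve-∀

    starts-valid : Starts
    starts-valid = trans (+-identityʳ _) (+-identityʳ _) , (λ j j<k →
        (λ u u<n → trans (cong (suc n + n * n + length (concatTo j (λ j → concatTo n (number j))) +_)
            (trans (length-++ (concatTo u (number j))) (cong (length (concatTo u (number j)) +_) (number-length j u))))
          (sym (+-assoc (suc n + n * n + length (concatTo j (λ j → concatTo n (number j)))) _ _)))
        , trans (+-identityʳ _) (trans (cong (suc n + n * n +_) (length-++ (concatTo j (λ j → concatTo n (number j)))))
          (sym (+-assoc (suc n + n * n) _ _)))) , l≡

    length-concatTo-mono : ∀ {m n} (f : ℕ → Word) → m ≤ n → length (concatTo m f) ≤ length (concatTo n f)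
    length-concatTo-mono {m} {zero}  f z≤n = z≤n
    length-concatTo-mono {m} {suc n} f m≤n with m ≟ suc n
    ... | yes refl = ≤-refl
    ... | no  m≢n  = ≤-trans (length-concatTo-mono f (s≤s⁻¹ (≤∧≢⇒< m≤n m≢n)))
      (≤-trans (m≤m+n _ _) (≤-reflexive (sym (length-++ (concatTo n f)))))

  start≤ : ∀ {j u} → j < k → u ≤ n → start j u ≤ start k 0
  start≤ {j} {u} j<k u≤n = ≤-trans (≤-reflexive (+-assoc (suc n + n * n) _ _))
    (≤-trans (+-monoʳ-≤ (suc n + n * n) (≤-trans (+-monoʳ-≤ (length (concatTo j (λ j → concatTo n (number j)))) (length-concatTo-mono (number j) u≤n))
      (≤-trans (≤-reflexive (sym (length-++ (concatTo j (λ j → concatTo n (number j)))))) (length-concatTo-mono (λ j → concatTo n (number j)) j<k))))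
      (≤-reflexive (sym (+-identityʳ _))))

  startₖ≤ : start k 0 ≤ l
  startₖ≤ = ≤-trans (m≤m+n _ _) (≤-reflexive (sym l≡))

  lenₖ≤ : len k 0 ≤ l
  lenₖ≤ = ≤-trans (≤-trans (m≤m+n _ _) (n≤1+n _)) (≤-trans (m≤n+m _ (start k 0)) (≤-reflexive (sym l≡)))

  len≤ : ∀ {j u} → j < k → u < n → len j u ≤ l
  len≤ {j} {u} j<k u<n = ≤-trans (≤-trans (m≤m+n _ _) (n≤1+n _)) (≤-trans (m≤n+m _ (start j u))
    (≤-trans (≤-reflexive (sym (proj₁ (proj₁ (proj₂ starts-valid) j j<k) u u<n))) (≤-trans (start≤ j<k u<n) startₖ≤)))

  n≤l : n ≤ l
  n≤l = n≤size I

  class≤ : ∀ u → class u ≤ k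
  class≤ u = go k
    where
    go : ∀ m → lastClass m u ≤ m
    go zero    = z≤n
    go (suc m) with belongs m u
    ... | true  = ≤-refl
    ... | false = m≤n⇒m≤1+n (go m)

  class-belongs : ∀ {u j} → class u ≡ suc j → j < k × belongs j u ≡ true
  class-belongs {u} {j} e = go k e
    where
    go : ∀ m → lastClass m u ≡ suc j → j < m × belongs j u ≡ true
    go (suc m) e with belongs m u in eq
    ... | true with refl ← e = ≤-refl , eq
    ... | false with go m e
    ...   | j<m , b = m<n⇒m<1+n j<m , b

  belongs-∈ : ∀ {j u} (j<k : j < k) (u<n : u < n) → belongs j u ≡ true → fromℕ< u<n ∈ˢ classOf (fromℕ< j<k)
  belongs-∈ {j} {u} j<k u<n e = Vecₚ.lookup⇒[]= (fromℕ< u<n) (classOf (fromℕ< j<k)) (trans (sym (trans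
    (cong₂ belongs (sym (toℕ-fromℕ< j<k)) (sym (toℕ-fromℕ< u<n)))
    (trans (cong (λ f → f (toℕ (fromℕ< u<n))) (extend-toℕ (λ _ → false) (λ j → extend false (lookup (classOf j))) (fromℕ< j<k)))
      (extend-toℕ false (lookup (classOf (fromℕ< j<k))) (fromℕ< u<n))))) e)

  belongs-class : ∀ {j u} → j < k → u < n → belongs j u ≡ true → class u ≡ suc j
  belongs-class {j} {u} j<k u<n b = go k ≤-refl j<k
    where
    go : ∀ m → m ≤ k → j < m → lastClass m u ≡ suc j
    go (suc m) m≤k j<m with belongs m u in eq
    ... | true  = cong suc (case m ≟ j of λ where
      (yes m≡j) → m≡j
      (no  m≢j) → ⊥-elim (classes-disjoint (fromℕ< m≤k) (fromℕ< j<k)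
        (λ f → m≢j (trans (sym (toℕ-fromℕ< m≤k)) (trans (cong toℕ f) (toℕ-fromℕ< j<k))))
        (fromℕ< u<n , x∈p∩q⁺ (belongs-∈ m≤k u<n eq , belongs-∈ j<k u<n b))))
    ... | false = go m (≤-trans (n≤1+n m) m≤k) (≤∧≢⇒< (s≤s⁻¹ j<m) λ { refl → case trans (sym eq) b of λ () })

  private
    separated : Separated
    separated u u<n v v<n e 1≤c with class u in eq
    ... | suc j with class-belongs {u} eq | class-belongs {v} (sym e)
    ...   | j<k , bu | _ , bv with cellAdj row col u v in adj
    ...     | false = refl
    ...     | true  = ⊥-elim (classes-independent (fromℕ< j<k) (belongs-∈ j<k u<n bu) (belongs-∈ j<k v<n bv)
      (subst T (sym (trans (adj-cell (fromℕ< u<n) (fromℕ< v<n)) (cong₂ (cellAdj row col) (toℕ-fromℕ< u<n) (toℕ-fromℕ< v<n)))) (≡-T adj)))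

    enough : ∀ j → j < k → rest k 0 0 ≤ share j 0
    enough j j<k = ≤-trans (≤-reflexive (trans (value≡ k 0) (amount-q 0)))
      (≤-trans (Equivalence.to (minimum-greatest k _ q) (proj₂ solution) (fromℕ< j<k)) (≤-reflexive
        (trans (profit-sumTo (p (fromℕ< j<k)) (classOf (fromℕ< j<k))) (sumTo-cong n gain))))
      where
      gain : ∀ u → u < n → (if extend false (lookup (classOf (fromℕ< j<k))) u then extend 0 (p (fromℕ< j<k)) u else 0) ≡
        toBit (class u ≡ᵇ suc j) * rest j u 0
      gain u u<n = trans (cong₂ (λ b v → if b then v else 0) b≡ v≡) (if-toBit (class u ≡ᵇ suc j))
        where
        if-toBit : ∀ b → (if b then rest j u 0 else 0) ≡ toBit b * rest j u 0
        if-toBit true  = sym (+-identityʳ _)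
        if-toBit false = refl
        belongs≡ : belongs j u ≡ (class u ≡ᵇ suc j)
        belongs≡ = bool-ext (λ t → ≡⇒≡ᵇ _ _ (belongs-class j<k u<n (T-≡ t))) (λ t → ≡-T (proj₂ (class-belongs {u} (≡ᵇ⇒≡ _ _ t))))
        b≡ : extend false (lookup (classOf (fromℕ< j<k))) u ≡ (class u ≡ᵇ suc j)
        b≡ = trans (cong (λ f → f u) (sym (trans (cong (extend (λ _ → false) (λ j → extend false (lookup (classOf j)))) (sym (toℕ-fromℕ< j<k)))
          (extend-toℕ (λ _ → false) (λ j → extend false (lookup (classOf j))) (fromℕ< j<k))))) belongs≡
        v≡ : extend 0 (p (fromℕ< j<k)) u ≡ rest j u 0
        v≡ = trans (trans (cong (extend 0 (p (fromℕ< j<k))) (sym (toℕ-fromℕ< u<n))) (extend-toℕ 0 (p (fromℕ< j<k)) (fromℕ< u<n)))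
          (trans (sym (amount-p (fromℕ< j<k) (fromℕ< u<n)))
            (trans (cong₂ amount (toℕ-fromℕ< j<k) (toℕ-fromℕ< u<n)) (sym (value≡ j u))))

    halves : ∀ m → ∃[ c ] ∃[ r ] r < 2 × m ≡ c * 2 + r × quot m 2 ≡ c
    halves m with split< (suc m) 2 {m} (m≤m*n (suc m) 2)
    ... | c , r , _ , r< , e = c , r , r< , e , trans (cong (λ m → quot m 2) e) (quot-+ c r<)

    half-bound : ∀ a b m → 2 * a ≤ 2 * b + m → a ≤ b + quot m 2
    half-bound a b m h with halves m
    ... | c , r , r< , refl , e rewrite e = ≮⇒≥ λ lt → <-irrefl refl (begin-strict
      2 * a               ≤⟨ h ⟩
      2 * b + (c * 2 + r) ≡⟨ lemma₁ b c r ⟩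
      2 * (b + c) + r     <⟨ +-monoʳ-< (2 * (b + c)) r< ⟩
      2 * (b + c) + 2     ≡⟨ lemma₂ (b + c) ⟩
      2 * suc (b + c)     ≤⟨ *-monoʳ-≤ 2 lt ⟩
      2 * a               ∎)
      where
      open ≤-Reasoning
      lemma₁ : ∀ b c r → 2 * b + (c * 2 + r) ≡ 2 * (b + c) + r
      lemma₁ = solve-∀
      lemma₂ : ∀ m → 2 * m + 2 ≡ 2 * suc m
      lemma₂ = solve-∀

    twice-half : ∀ m → 2 * quot m 2 ≤ m
    twice-half m with halves m
    ... | c , r , _ , refl , e rewrite e = ≤-trans (≤-reflexive (*-comm 2 c)) (m≤m+n (c * 2) r)

    inflow : ℕ → ℕ → ℕ
    inflow j b = carry j b + 2 + collected j b

    digit≤inflow : ∀ j b → digitAt k 0 b ≤ inflow j b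
    digit≤inflow j b = ≤-trans (digitValue≤2 (λ b → 1 ≤ᵇ dig k 0 b) (len k 0) b) (≤-trans (m≤n+m 2 (carry j b)) (m≤m+n _ _))

    -- The start is the solution itself: class `j` collects at least `q`. Going to the next digit
    -- halves both sides; rounding down is harmless, since the quantities compared are integers.
    carry-invariant : ∀ j → j < k → ∀ b → rest k 0 b + 2 ≤ share j b + carry j b
    carry-invariant j j<k zero    = +-monoˡ-≤ 2 (enough j j<k)
    carry-invariant j j<k (suc b) = half-bound (rest k 0 (suc b) + 2) (share j (suc b)) _ (+-cancelˡ-≤ (digitAt k 0 b) _ _ (begin
      digitAt k 0 b + 2 * (rest k 0 (suc b) + 2)
        ≡⟨ lemma₁ (digitAt k 0 b) (rest k 0 (suc b)) ⟩
      digitAt k 0 b + 2 * rest k 0 (suc b) + 2 + 2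
        ≡⟨ cong (λ r → r + 2 + 2) (valueFrom-step (digit? k 0) (len k 0) b) ⟨
      rest k 0 b + 2 + 2
        ≤⟨ +-monoˡ-≤ 2 (carry-invariant j j<k b) ⟩
      share j b + carry j b + 2
        ≡⟨ cong (λ t → t + carry j b + 2) (share-step j b) ⟩
      collected j b + 2 * share j (suc b) + carry j b + 2
        ≡⟨ lemma₂ (collected j b) (share j (suc b)) (carry j b) ⟩
      2 * share j (suc b) + inflow j b
        ≡⟨ cong (2 * share j (suc b) +_) (m+[n∸m]≡n (digit≤inflow j b)) ⟨
      2 * share j (suc b) + (digitAt k 0 b + (inflow j b ∸ digitAt k 0 b))
        ≡⟨ lemma₃ (2 * share j (suc b)) (digitAt k 0 b) _ ⟩
      digitAt k 0 b + (2 * share j (suc b) + (inflow j b ∸ digitAt k 0 b)) ∎))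
      where
      open ≤-Reasoning
      lemma₁ : ∀ d r → d + 2 * (r + 2) ≡ d + 2 * r + 2 + 2
      lemma₁ = solve-∀
      lemma₂ : ∀ s t c → s + 2 * t + c + 2 ≡ 2 * t + (c + 2 + s)
      lemma₂ = solve-∀
      lemma₃ : ∀ a b c → a + (b + c) ≡ b + (a + c)
      lemma₃ = solve-∀

    share-end : ∀ j → j < k → share j l ≡ 0
    share-end j j<k = trans (sumTo-cong n (λ u u<n → trans (cong (toBit (class u ≡ᵇ suc j) *_)
      (valueFrom-end (digit? j u) (len j u) (len≤ j<k u<n))) (*-zeroʳ (toBit (class u ≡ᵇ suc j))))) (trans (sumTo-const n 0) (*-zeroʳ n))

    sums : Sums
    sums j j<k = ≤-refl
      , (λ b _ → ≤-trans (+-monoˡ-≤ _ (twice-half _)) (≤-reflexive (m∸n+n≡m (digit≤inflow j b))))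
      , ≤-trans (≤-trans (m≤n+m 2 (rest k 0 l)) (carry-invariant j j<k l)) (≤-reflexive (cong (_+ carry j l) (share-end j j<k)))

  -- The bound reproduces itself: `2 * n + 2`, the 2 added to it and `n` digits of at most 2 make
  -- `4 * n + 4`, which is then halved.
  carry≤ : ∀ j b → carry j b ≤ 2 * n + 2
  carry≤ j zero    = m≤n+m 2 (2 * n)
  carry≤ j (suc b) = *-cancelˡ-≤ 2 (≤-trans (twice-half _) (≤-trans (m∸n≤m (inflow j b) (digitAt k 0 b))
    (≤-trans (+-mono-≤ (+-monoˡ-≤ 2 (carry≤ j b)) collected≤) (≤-reflexive (lemma n)))))
    where
    lemma : ∀ n → 2 * n + 2 + 2 + n * 2 ≡ 2 * (2 * n + 2)
    lemma = solve-∀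
    collected≤ : collected j b ≤ n * 2
    collected≤ = sumTo-≤ n _ 2 λ u _ → ≤-trans (*-mono-≤ (bit≤1 (class u ≡ᵇ suc j)) (digitValue≤2 (λ b → 1 ≤ᵇ dig j u b) (len j u) b)) ≤-refl
      where
      bit≤1 : ∀ b → toBit b ≤ 1
      bit≤1 true  = ≤-refl
      bit≤1 false = z≤n

  dig≤ : ∀ j u b → dig j u b ≤ 1
  dig≤ j u b with proj₁ (proj₂ (digitsOf (amount j u))) b
  ... | true  = ≤-refl
  ... | false = z≤n

  rest≤ : ∀ j u b → rest j u b ≤ amount j u
  rest≤ j u zero    = ≤-reflexive (value≡ j u)
  rest≤ j u (suc b) = ≤-trans (≤-trans (m≤m+n _ _) (m≤n+m _ (digitAt j u b)))
    (≤-trans (≤-reflexive (sym (valueFrom-step (digit? j u) (len j u) b))) (rest≤ j u b))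

  valid : Valid
  valid = prefix , matrix-valid , starts-valid ,
    ((λ j j<k u u<n → numeral j u (number-at j j<k u u<n)) , numeral k 0 (proj₂ (proj₂ (proj₂ (proj₂ parts))))) ,
    (λ u u<n v v<n → cell-injective u<n v<n) , separated , sums , lenₖ≤

  module _ (bounded : All (_≤ l) (q ∷ profits I)) where

    amount≤ : ∀ {j u} → (j < k × u < n) ⊎ (j ≡ k × u ≡ 0) → amount j u ≤ l
    amount≤ (inj₁ (j<k , u<n)) = subst₂ (λ j u → amount j u ≤ l) (toℕ-fromℕ< j<k) (toℕ-fromℕ< u<n)
      (≤-trans (≤-reflexive (amount-p (fromℕ< j<k) (fromℕ< u<n))) (case bounded of λ { (_ ∷ ps) → profits-all⁻ I ps (fromℕ< j<k) (fromℕ< u<n) }))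
    amount≤ (inj₂ (refl , refl)) = ≤-trans (≤-reflexive (amount-q 0)) (case bounded of λ { (h ∷ _) → h })

    smalls : Smalls
    smalls = (λ j j<k u u<n → small (inj₁ (j<k , u<n))) , small (inj₂ (refl , refl))
      where
      small : ∀ {j u} → (j < k × u < n) ⊎ (j ≡ k × u ≡ 0) → Small j u
      small {j} {u} used = ≤-trans (rest≤ j u 0) (amount≤ used) ,
        λ b _ → ≤-reflexive (sym (valueFrom-step (digit? j u) (len j u) b))

-- The verifier

allTo-sound : ∀ n {f} → allTo n f ≡ true → ∀ i → i < n → f i ≡ true
allTo-sound (suc n) {f} e i i<n with i ≟ n
... | yes refl = ∧-proj₁ e
... | no  i≢n  = allTo-sound n (∧-proj₂ {f n} e) i (≤∧≢⇒< (s≤s⁻¹ i<n) i≢n)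

allTo-complete : ∀ n {f} → (∀ i → i < n → f i ≡ true) → allTo n f ≡ true
allTo-complete zero    h = refl
allTo-complete (suc n) h = ∧-intro (h n ≤-refl) (allTo-complete n (λ i p → h i (m<n⇒m<1+n p)))

all-≤ : ∀ {B C ns} → B ≡ C → All (_≤ B) ns → All (_≤ C) ns
all-≤ refl a = a

on-letter : ∀ y i {b} → letter y i ≡ just b → on y i ≡ b
on-letter y i {true}  e rewrite bitAt-letter y i | e = refl
on-letter y i {false} e rewrite bitAt-letter y i | e = refl

on-same : ∀ y i z j → letter y i ≡ letter z j → on y i ≡ on z j
on-same y i z j e = cong isPositive (trans (bitAt-letter y i) (trans (cong letterBit e) (sym (bitAt-letter z j))))

on-outside : ∀ y {i} → length y ≤ i → on y i ≡ false
on-outside y {i} p = cong isPositive (trans (bitAt-letter y i) (cong letterBit (letter-outside y p)))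

on-applyUpTo : ∀ h N {z} → z < N → on (List.applyUpTo h N) z ≡ h z
on-applyUpTo h (suc N) {zero}  _       = on-∷ (h 0) _
on-applyUpTo h (suc N) {suc z} (s≤s p) = trans (on-suc (h 0) (List.applyUpTo (h ∘ suc) N) z) (on-applyUpTo (h ∘ suc) N p)

pairing : Word × Word → Word
pairing (x , w) = ⟨ x , w ⟩

module Verifier (k : ℕ) .{{_ : NonZero k}} where

  open LayoutWriter pairing

  -- The even places of a pair hold 1 up to the separator, which is 0. So the length of `x` is the
  -- number of those `i` for which all even places up to `2 * i` hold 1.
  xlenᴱ : ∀ {Γ} → Term Γ
  xlenᴱ = asTerm (∑ᴱ lenᴱ (indᴱ (∀ᴱ (litᴱ 1 +ᴱ varᴱ zero) (bitᴱ (varᴱ zero *ᴱ litᴱ 2)))))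
    (λ { (x , w) _ → length x }) λ { (x , w) _ → correctness x w }
    where
    marks : ∀ x w i → allTo (suc i) (λ j → on ⟨ x , w ⟩ (j * 2)) ≡ (i <ᵇ length x)
    marks x w i = bool-ext
      (λ t → <⇒<ᵇ (≰⇒> λ x≤i → case trans (sym (allTo-sound (suc i) (T-≡ t) (length x) (s≤s x≤i)))
        (on-letter ⟨ x , w ⟩ (length x * 2) (pair-separator w x)) of λ ()))
      (λ t → ≡-T (allTo-complete (suc i) λ j j≤i → on-letter ⟨ x , w ⟩ (j * 2) (pair-mark w x (≤-trans j≤i (<ᵇ⇒< i _ t)))))
    correctness : ∀ x w → sumTo (length ⟨ x , w ⟩) (λ i → toBit (allTo (suc i) (λ j → on ⟨ x , w ⟩ (j * 2)))) ≡ length x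
    correctness x w = sumTo-count (length ⟨ x , w ⟩) (≤-trans (≤-trans (m≤m*n (length x) 2) (≤-trans (m≤m+n _ 1) (m≤m+n _ (length w))))
      (≤-reflexive (sym (pair-length w x)))) (λ i _ → marks x w i)

  xbitᴱ : ∀ {Γ} → Term Γ → Test Γ
  xbitᴱ t = test (exprᵇ b) (λ { (x , w) ρ → on x (val t (x , w) ρ) })
    (λ { (x , w) ρ → trans (correctᵇ b (x , w) ρ) (cong toBit (lemma x w (val t (x , w) ρ))) })
    where
    b = (t <ᴱ xlenᴱ) ∧ᴱ bitᴱ (t *ᴱ litᴱ 2 +ᴱ litᴱ 1)
    lemma : ∀ x w i → (i <ᵇ length x) ∧ on ⟨ x , w ⟩ (i * 2 + 1) ≡ on x i
    lemma x w i with i <ᵇ length x in eq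
    ... | true  = on-same ⟨ x , w ⟩ (i * 2 + 1) x i (pair-left w x (<ᵇ⇒< i _ (≡-T eq)))
    ... | false = sym (on-outside x (≮⇒≥ (λ p → subst T eq (<⇒<ᵇ p))))

  wbitᴱ : ∀ {Γ} → Term Γ → Test Γ
  wbitᴱ t = test (exprᵇ b) (λ { (x , w) ρ → on w (val t (x , w) ρ) })
    (λ { (x , w) ρ → trans (correctᵇ b (x , w) ρ) (cong toBit
      (on-same ⟨ x , w ⟩ (length x * 2 + 1 + val t (x , w) ρ) w (val t (x , w) ρ) (pair-right w x (val t (x , w) ρ)))) })
    where b = bitᴱ (xlenᴱ *ᴱ litᴱ 2 +ᴱ litᴱ 1 +ᴱ t)

  -- A certificate is a table of numbers, written in unary in fields of width B.
  width : Word → ℕ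
  width x = length x * 2 + (4 + k)

  address : ℕ → (f a b c : ℕ) → ℕ
  address B f a b c = ((f * B + a) * B + b) * B + c

  -- Counting the ones of a field, wherever they are, turns every word into a table, with entries at
  -- most `width x`.
  entry : Word → Word → (f a b c : ℕ) → ℕ
  entry x w f a b c = sumTo (width x) (λ i → toBit (on w (address (width x) f a b c * width x + i)))

  module _ {Γ : ℕ} where

    widthᴱ : Term Γ
    widthᴱ = xlenᴱ *ᴱ litᴱ 2 +ᴱ litᴱ (4 + k)

    entryᴱ : ℕ → (a b c : Term Γ) → Term Γ
    entryᴱ f a b c = ∑ᴱ widthᴱ (indᴱ (wbitᴱ (wkᴱ (((litᴱ f *ᴱ widthᴱ +ᴱ a) *ᴱ widthᴱ +ᴱ b) *ᴱ widthᴱ +ᴱ c) *ᴱ wkᴱ widthᴱ +ᴱ varᴱ zero)))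

    nᴱ : Term Γ
    nᴱ = entryᴱ 0 (litᴱ 0) (litᴱ 0) (litᴱ 0)

    rowᴱ colᴱ classᴱ : Term Γ → Term Γ
    rowᴱ   u = entryᴱ 1 u (litᴱ 0) (litᴱ 0)
    colᴱ   u = entryᴱ 2 u (litᴱ 0) (litᴱ 0)
    classᴱ u = entryᴱ 3 u (litᴱ 0) (litᴱ 0)

    lengthᴱ carryᴱ startᴱ : Term Γ → Term Γ → Term Γ
    lengthᴱ j u = entryᴱ 4 j u (litᴱ 0)
    carryᴱ  j b = entryᴱ 6 j b (litᴱ 0)
    startᴱ  j u = entryᴱ 8 j u (litᴱ 0)

    digitᴱ : (j u b : Term Γ) → Test Γ
    digitᴱ j u b = litᴱ 1 ≤ᴱ entryᴱ 5 j u b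

    restᴱ digitValueᴱ : (j u b : Term Γ) → Term Γ
    restᴱ = entryᴱ 7
    digitValueᴱ j u b = ifᴱ (b <ᴱ lengthᴱ j u) (litᴱ 1 +ᴱ indᴱ (digitᴱ j u b)) (litᴱ 0)

    cellAdjᴱ : Term Γ → Term Γ → Test Γ
    cellAdjᴱ u v = ((rowᴱ u ≡ᴱ rowᴱ v) ∨ᴱ (colᴱ u ≡ᴱ colᴱ v)) ∧ᴱ notᴱ (u ≡ᴱ v)

  -- A formula carries its meaning as a type. The meaning of `validᶜ` unfolds to `Valid`, so that by
  -- `sound` and `complete` the verifier decides exactly this condition.
  record Check (Γ : ℕ) : Set₁ where
    field
      decision : Test Γ
      Meaning  : Word × Word → Vec ℕ Γ → Set
      sound    : ∀ a ρ → valᵇ decision a ρ ≡ true → Meaning a ρ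
      complete : ∀ a ρ → Meaning a ρ → valᵇ decision a ρ ≡ true

  open Check

  infix  4 _≐_ _≼_ _≗_
  infixr 3 _&_
  infixr 2 _⊃_

  _≐_ _≼_ : ∀ {Γ} → Term Γ → Term Γ → Check Γ
  s ≐ t = record
    { decision = s ≡ᴱ t
    ; Meaning  = λ a ρ → val s a ρ ≡ val t a ρ
    ; sound    = λ a ρ → ≡ᵇ-sound
    ; complete = λ a ρ → ≡ᵇ-complete
    }
  s ≼ t = record
    { decision = s ≤ᴱ t
    ; Meaning  = λ a ρ → val s a ρ ≤ val t a ρ
    ; sound    = λ a ρ e → ≤ᵇ⇒≤ _ _ (≡-T e)
    ; complete = λ a ρ h → T-≡ (≤⇒≤ᵇ h)
    }

  _≗_ : ∀ {Γ} → Test Γ → Test Γ → Check Γ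
  b ≗ c = record
    { decision = (b ∧ᴱ c) ∨ᴱ (notᴱ b ∧ᴱ notᴱ c)
    ; Meaning  = λ a ρ → valᵇ b a ρ ≡ valᵇ c a ρ
    ; sound    = λ a ρ → agree (valᵇ b a ρ) (valᵇ c a ρ)
    ; complete = λ a ρ → agreed (valᵇ b a ρ) (valᵇ c a ρ)
    }
    where
    agree : ∀ b c → (b ∧ c) ∨ (not b ∧ not c) ≡ true → b ≡ c
    agree true  true  _ = refl
    agree false false _ = refl
    agreed : ∀ b c → b ≡ c → (b ∧ c) ∨ (not b ∧ not c) ≡ true
    agreed true  .true  refl = refl
    agreed false .false refl = refl

  _&_ _⊃_ : ∀ {Γ} → Check Γ → Check Γ → Check Γ
  c & d = record
    { decision = decision c ∧ᴱ decision d
    ; Meaning  = λ a ρ → Meaning c a ρ × Meaning d a ρ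
    ; sound    = λ a ρ e → sound c a ρ (∧-proj₁ e) , sound d a ρ (∧-proj₂ {valᵇ (decision c) a ρ} e)
    ; complete = λ { a ρ (p , q) → ∧-intro (complete c a ρ p) (complete d a ρ q) }
    }
  c ⊃ d = record
    { decision = notᴱ (decision c) ∨ᴱ decision d
    ; Meaning  = λ a ρ → Meaning c a ρ → Meaning d a ρ
    -- The premise occurs negatively, so soundness of the implication rests on completeness of the
    -- premise.
    ; sound    = λ a ρ e p → sound d a ρ (modus (complete c a ρ p) e)
    ; complete = λ a ρ f → intro (λ e → complete d a ρ (f (sound c a ρ e)))
    }
    where
    modus : ∀ {b c} → b ≡ true → not b ∨ c ≡ true → c ≡ true
    modus refl e = e
    intro : ∀ {b c} → (b ≡ true → c ≡ true) → not b ∨ c ≡ true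
    intro {true}  f = f refl
    intro {false} f = refl

  all : ∀ {Γ} → Term Γ → Check (suc Γ) → Check Γ
  all n c = record
    { decision = ∀ᴱ n (decision c)
    ; Meaning  = λ a ρ → ∀ i → i < val n a ρ → Meaning c a (i ∷ ρ)
    ; sound    = λ a ρ e i i<n → sound c a (i ∷ ρ) (allTo-sound (val n a ρ) e i i<n)
    ; complete = λ a ρ h → allTo-complete (val n a ρ) (λ i i<n → complete c a (i ∷ ρ) (h i i<n))
    }

  private
    v₀ : ∀ {Γ} → Term (suc Γ)
    v₀ = varᴱ zero

    v₁ : ∀ {Γ} → Term (2 + Γ)
    v₁ = varᴱ (suc zero)

    v₂ : ∀ {Γ} → Term (3 + Γ)
    v₂ = varᴱ (suc (suc zero))

    kᴱ 0ᴱ 1ᴱ 2ᴱ : ∀ {Γ} → Term Γ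
    kᴱ = litᴱ k
    0ᴱ = litᴱ 0
    1ᴱ = litᴱ 1
    2ᴱ = litᴱ 2

  module _ {Γ : ℕ} where

    numeralᶜ smallᶜ : Term Γ → Term Γ → Check Γ
    numeralᶜ j u =
      all (lengthᴱ j u)
        ((xbitᴱ (startᴱ (wkᴱ j) (wkᴱ u) +ᴱ 2ᴱ *ᴱ v₀) ≗ trueᴱ) &
         (xbitᴱ (startᴱ (wkᴱ j) (wkᴱ u) +ᴱ (1ᴱ +ᴱ 2ᴱ *ᴱ v₀)) ≗ digitᴱ (wkᴱ j) (wkᴱ u) v₀)) &
      (xbitᴱ (startᴱ j u +ᴱ 2ᴱ *ᴱ lengthᴱ j u) ≗ falseᴱ)
    smallᶜ j u =
      (restᴱ j u 0ᴱ ≼ xlenᴱ) &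
      all (lengthᴱ j u)
        (digitValueᴱ (wkᴱ j) (wkᴱ u) v₀ +ᴱ 2ᴱ *ᴱ restᴱ (wkᴱ j) (wkᴱ u) (1ᴱ +ᴱ v₀) ≼ restᴱ (wkᴱ j) (wkᴱ u) v₀)

  module _ {Γ : ℕ} where

    prefixᶜ matrixᶜ startsᶜ numeralsᶜ injectiveᶜ separatedᶜ sumsᶜ validᶜ smallsᶜ : Check Γ
    prefixᶜ = all nᴱ (xbitᴱ v₀ ≗ trueᴱ) & (xbitᴱ nᴱ ≗ falseᴱ)
    matrixᶜ = all nᴱ (all nᴱ (xbitᴱ (1ᴱ +ᴱ nᴱ +ᴱ (v₁ *ᴱ nᴱ +ᴱ v₀)) ≗ cellAdjᴱ v₁ v₀))
    startsᶜ =
      (startᴱ 0ᴱ 0ᴱ ≐ 1ᴱ +ᴱ nᴱ +ᴱ nᴱ *ᴱ nᴱ) &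
      all kᴱ
        (all nᴱ (startᴱ v₁ (1ᴱ +ᴱ v₀) ≐ startᴱ v₁ v₀ +ᴱ (1ᴱ +ᴱ 2ᴱ *ᴱ lengthᴱ v₁ v₀)) &
         (startᴱ (1ᴱ +ᴱ v₀) 0ᴱ ≐ startᴱ v₀ nᴱ)) &
      (xlenᴱ ≐ startᴱ kᴱ 0ᴱ +ᴱ (1ᴱ +ᴱ 2ᴱ *ᴱ lengthᴱ kᴱ 0ᴱ))
    numeralsᶜ = all kᴱ (all nᴱ (numeralᶜ v₁ v₀)) & numeralᶜ kᴱ 0ᴱ
    injectiveᶜ = all nᴱ (all nᴱ ((rowᴱ v₁ ≐ rowᴱ v₀) ⊃ (colᴱ v₁ ≐ colᴱ v₀) ⊃ (v₁ ≐ v₀)))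
    separatedᶜ = all nᴱ (all nᴱ ((classᴱ v₁ ≐ classᴱ v₀) ⊃ (1ᴱ ≼ classᴱ v₁) ⊃ (cellAdjᴱ v₁ v₀ ≗ falseᴱ)))
    sumsᶜ = all kᴱ
      ((carryᴱ v₀ 0ᴱ ≼ 2ᴱ) &
       all xlenᴱ (2ᴱ *ᴱ carryᴱ v₁ (1ᴱ +ᴱ v₀) +ᴱ digitValueᴱ kᴱ 0ᴱ v₀ ≼
         carryᴱ v₁ v₀ +ᴱ 2ᴱ +ᴱ ∑ᴱ nᴱ (indᴱ (classᴱ v₀ ≡ᴱ 1ᴱ +ᴱ v₂) *ᴱ digitValueᴱ v₂ v₀ v₁)) &
       (2ᴱ ≼ carryᴱ v₀ xlenᴱ))
    validᶜ = prefixᶜ & matrixᶜ & startsᶜ & numeralsᶜ & injectiveᶜ & separatedᶜ & sumsᶜ & (lengthᴱ kᴱ 0ᴱ ≼ xlenᴱ)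
    smallsᶜ = all kᴱ (all nᴱ (smallᶜ v₁ v₀)) & smallᶜ kᴱ 0ᴱ

  module Entries (x w : Word) where

    n : ℕ
    n = entry x w 0 0 0 0

    row col class : ℕ → ℕ
    row   u = entry x w 1 u 0 0
    col   u = entry x w 2 u 0 0
    class u = entry x w 3 u 0 0

    len carry start : ℕ → ℕ → ℕ
    len   j u = entry x w 4 j u 0
    carry j b = entry x w 6 j b 0
    start j u = entry x w 8 j u 0

    dig rest : ℕ → ℕ → ℕ → ℕ
    dig  = entry x w 5
    rest = entry x w 7

    open Validity k (length x) (on x) n row col class len dig carry rest start public

    entry≤ : ∀ f a b c → entry x w f a b c ≤ width x
    entry≤ f a b c = ≤-trans (sumTo-≤ (width x) _ 1 (λ i _ → bit≤1 (on w _))) (≤-reflexive (*-identityʳ (width x)))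
      where
      bit≤1 : ∀ b → toBit b ≤ 1
      bit≤1 true  = ≤-refl
      bit≤1 false = z≤n

  module Written (x : Word) (G : (f a b c : ℕ) → ℕ) where

    -- Nine tables with three arguments below `B` and fields of width `B`. All arguments are smaller
    -- than `B`, being at most `length x` or at most `k`; the largest values are the carries, which
    -- may reach `2 * n + 2`.
    B N : ℕ
    B = width x
    N = 9 * B * B * B * B

    inCell : ℕ → ℕ → Bool
    inCell z i = i <ᵇ G (quot (quot (quot z B) B) B) (rem (quot (quot z B) B) B) (rem (quot z B) B) (rem z B)

    written : Word
    written = List.applyUpTo (λ z → inCell (quot z B) (rem z B)) N

    entry-written : ∀ {f a b c} → f < 9 → a < B → b < B → c < B → G f a b c ≤ B → entry x written f a b c ≡ G f a b c
    entry-written {f} {a} {b} {c} f< a< b< c< G≤ = sumTo-count B G≤ λ i i<B →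
      trans (on-applyUpTo (λ z → inCell (quot z B) (rem z B)) N (combine< (combine< (combine< (combine< f< a<) b<) c<) i<B))
        (trans (cong₂ inCell (quot-+ (address B f a b c) i<B) (rem-+ (address B f a b c) i<B)) (cell i))
      where
      cell : ∀ i → inCell (address B f a b c) i ≡ (i <ᵇ G f a b c)
      cell i rewrite quot-+ ((f * B + a) * B + b) c< | rem-+ ((f * B + a) * B + b) c<
                   | quot-+ (f * B + a) b< | rem-+ (f * B + a) b< | quot-+ f a< | rem-+ f a< = refl

  module Accepted (I : FairDivisionInstance k) (line : OnLineGraphsOfBipartiteGraphs I) (solution : Solvable I) where
    open Completeness k I line solution using (x; l) public
    private
      module C = Completeness k I line solution

      table : (f a b c : ℕ) → ℕ
      table 0 a b c = FairDivisionInstance.n I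
      table 1 a b c = C.row a
      table 2 a b c = C.col a
      table 3 a b c = C.class a
      table 4 a b c = C.len a b
      table 5 a b c = C.dig a b c
      table 6 a b c = C.carry a b
      table 7 a b c = C.rest a b c
      table f a b c = C.start a b

    open Written x table public

    private
      n = FairDivisionInstance.n I
      module E = Entries x written
      open ValidityCong k l (on x) n C.row E.row C.col E.col C.class E.class C.len E.len C.dig E.dig C.carry E.carry
        C.rest E.rest C.start E.start

      field< : ∀ f → {T (f <ᵇ 9)} → f < 9
      field< f {t} = <ᵇ⇒< f 9 t

      l<B : l < B
      l<B = ≤-trans (s≤s (m≤m*n l 2)) (≤-trans (≤-reflexive (+-comm 1 (l * 2))) (+-monoʳ-≤ (l * 2) (s≤s z≤n)))

      k<B : k < B
      k<B = ≤-trans (m≤n+m (suc k) 3) (m≤n+m (4 + k) (l * 2))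

      0<B : 0 < B
      0<B = ≤-trans (s≤s z≤n) k<B

      u<B : ∀ {u} → u < n → u < B
      u<B u<n = <-trans (≤-trans u<n C.n≤l) l<B

      used< : ∀ {j u} → Used j u → j < B × u < B × C.len j u ≤ l
      used< (inj₁ (j<k , u<n))     = <-trans j<k k<B , u<B u<n , C.len≤ j<k u<n
      used< (inj₂ (refl , refl)) = k<B , 0<B , C.lenₖ≤

      carry-fits : ∀ j b → C.carry j b ≤ B
      carry-fits j b = ≤-trans (C.carry≤ j b) (+-mono-≤ (≤-trans (≤-reflexive (*-comm 2 n)) (*-monoˡ-≤ 2 C.n≤l)) (s≤s (s≤s z≤n)))

      n≡ : E.n ≡ n
      n≡ = entry-written (field< 0) 0<B 0<B 0<B (<⇒≤ (≤-<-trans C.n≤l l<B))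

      start-fits : ∀ {j u} → (j < k × u ≤ n) ⊎ (j ≡ k × u ≡ 0) → E.start j u ≡ C.start j u
      start-fits (inj₁ (j<k , u≤n)) = entry-written (field< 8) (<-trans j<k k<B) (≤-<-trans (≤-trans u≤n C.n≤l) l<B) 0<B
        (<⇒≤ (≤-<-trans (≤-trans (C.start≤ j<k u≤n) C.startₖ≤) l<B))
      start-fits (inj₂ (refl , refl)) = entry-written (field< 8) k<B 0<B 0<B (<⇒≤ (≤-<-trans C.startₖ≤ l<B))

      row≡ : ∀ {u} → u < n → E.row u ≡ C.row u
      row≡ u<n = entry-written (field< 1) (u<B u<n) 0<B 0<B (<⇒≤ (u<B (C.row< u<n)))

      col≡ : ∀ {u} → u < n → E.col u ≡ C.col u
      col≡ u<n = entry-written (field< 2) (u<B u<n) 0<B 0<B (<⇒≤ (u<B (C.col< u<n)))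

      class≡ : ∀ {u} → u < n → E.class u ≡ C.class u
      class≡ u<n = entry-written (field< 3) (u<B u<n) 0<B 0<B (<⇒≤ (≤-<-trans (C.class≤ _) k<B))

      len≡ : ∀ {j u} → Used j u → E.len j u ≡ C.len j u
      len≡ used = case used< used of λ { (j< , u< , len≤) → entry-written (field< 4) j< u< 0<B (<⇒≤ (≤-<-trans len≤ l<B)) }

      dig≡ : ∀ {j u b} → Used j u → b < C.len j u → E.dig j u b ≡ C.dig j u b
      dig≡ {j} {u} {b} used b< = case used< used of λ { (j< , u< , len≤) →
        entry-written (field< 5) j< u< (<-trans (≤-trans b< len≤) l<B) (≤-trans (C.dig≤ j u b) 0<B) }

      carry≡ : ∀ {j b} → j < k → b ≤ l → E.carry j b ≡ C.carry j b
      carry≡ {j} {b} j<k b≤l = entry-written (field< 6) (<-trans j<k k<B) (≤-<-trans b≤l l<B) 0<B (carry-fits j b)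

    written-valid : E.Valid
    written-valid = subst (λ n → Validity.Valid k l (on x) n E.row E.col E.class E.len E.dig E.carry E.rest E.start) (sym n≡)
      (valid-cong row≡ col≡ class≡ len≡ dig≡ carry≡ start-fits C.valid)

    written-small : All (_≤ l) (FairDivisionInstance.q I ∷ profits I) → E.Smalls
    written-small bounded = subst (λ n → Validity.Smalls k l (on x) n E.row E.col E.class E.len E.dig E.carry E.rest E.start) (sym n≡)
      (smalls-cong row≡ col≡ class≡ len≡ dig≡ carry≡ start-fits
        (λ {j} {u} {b} used b≤ → case used< used of λ { (j< , u< , len≤) → entry-written (field< 7) j< u<
          (≤-<-trans (≤-trans b≤ len≤) l<B) (<⇒≤ (≤-<-trans (≤-trans (C.rest≤ j u b) (C.amount≤ bounded used)) l<B)) })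
        (C.smalls bounded))

  certificateBound : Poly
  certificateBound = con 9 ⊠ widthᴾ ⊠ widthᴾ ⊠ widthᴾ ⊠ widthᴾ
    where
    widthᴾ : Poly
    widthᴾ = X ⊠ con 2 ⊞ con (4 + k)

  module _ (c : Check 0) where

    verify : Word → Bool
    verify y = isPositive (⟦ exprᵇ (decision c) ⟧ y [])

    verify-polyTime : PolyTimeTest verify
    verify-polyTime = Gen-polyTime (emit (exprᵇ (decision c)))

    verify-decision : ∀ x w → verify ⟨ x , w ⟩ ≡ valᵇ (decision c) (x , w) []
    verify-decision x w = trans (cong isPositive (correctᵇ (decision c) (x , w) [])) (positive (valᵇ (decision c) (x , w) []))
      where
      positive : ∀ b → isPositive (toBit b) ≡ b
      positive true  = refl
      positive false = refl

    inNP : ∀ (L : Language) → (∀ x w → Meaning c (x , w) [] → L x) →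
      (∀ x → L x → ∃[ w ] length w ≤ ⟦ certificateBound ⟧ᴾ (length x) × Meaning c (x , w) []) → InNP L
    inNP L to from = verify , verify-polyTime , coefficients certificateBound , λ x → mk⇔
      (λ lx → case from x lx of λ { (w , w≤ , m) →
        w , ≤-trans w≤ (≤-reflexive (sym (coefficients-eval certificateBound (length x)))) ,
        ≡-T (trans (verify-decision x w) (complete c (x , w) [] m)) })
      (λ { (w , _ , t) → to x w (sound c (x , w) [] (trans (sym (verify-decision x w)) (T-≡ t))) })

  private
    Lines : Problem
    Lines = restrict (FairDivision k) OnLineGraphsOfBipartiteGraphs

    module _ (x w : Word) (m : Meaning validᶜ (x , w) []) where
      open Entries x w
      open Soundness m

      decoded : Σ (FairDivisionInstance k) OnLineGraphsOfBipartiteGraphs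
      decoded = certified , certified-line (width x) (λ u → entry≤ 1 u 0 0) (λ u → entry≤ 2 u 0 0)

      encode-decoded : encodeInstance certified ≡ x
      encode-decoded = encode-certified x refl (λ _ → refl)

      decoded-solvable : Solvable certified
      decoded-solvable = certified-solvable

  inNP-lines : InNP (Problem.language Lines)
  inNP-lines = inNP validᶜ _
    (λ x w m → decoded x w m , encode-decoded x w m , decoded-solvable x w m)
    (λ { x ((I , line) , refl , solution) → let open Accepted I line solution in
      written , ≤-reflexive (Listₚ.length-applyUpTo _ N) , written-valid })

  inNP-bounded : InNP (Problem.language (restrict Lines (NumbersBoundedBy linear Lines)))
  inNP-bounded = inNP (validᶜ & smallsᶜ) _
    (λ x w (m , s) → (decoded x w m , all-≤
        (trans (cong length (sym (encode-decoded x w m))) (sym (eval-linear (length (encodeInstance (proj₁ (decoded x w m))))))) (Entries.Soundness.certified-bounded x w m s))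
      , encode-decoded x w m , decoded-solvable x w m)
    (λ { x (((I , line) , bounded) , refl , solution) → let open Accepted I line solution in
      written , ≤-reflexive (Listₚ.length-applyUpTo _ N) ,
      written-valid , written-small (all-≤ (eval-linear l) bounded) })

theorem4 : (k : ℕ) .{{_ : NonTrivial k}} →
    StronglyNPComplete (restrict (FairDivision k {{nonTrivial⇒nonZero k}}) OnLineGraphsOfBipartiteGraphs)
theorem4 0             = case nonTrivial⇒n>1 0 of λ ()
theorem4 1             = case nonTrivial⇒n>1 1 of λ { (s≤s ()) }
-- Membership holds for numbers of any size; hardness is attained with numbers below the polynomial
-- `linear`, the size itself.
theorem4 (suc (suc k)) = Verifier.inNP-lines (2 + k) , linear , Verifier.inNP-bounded (2 + k) , Restricted-hard k
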